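{- There is a parallel algorithm which, given a sequence $S$ of length $n$ over the alphabet $\Sigma=\{0,\ldots,\sigma-1\}$ with $\sigma\le n$, constructs the wavelet matrix of $S$ using $O(n\log\sigma)$ work and $O(\log n\log\sigma)$ depth.
   Context: Model: work-depth model with concurrent reads and writes permitted, with unit-cost operations on machine words of $\Theta(\log n)$ bits. The work is the total number of operations and the depth is the number of parallel time steps. $\log$ is base 2, and, as usual in asymptotic bounds, logarithmic factors are read as being at least $1$. The wavelet matrix of $S$ has levels $l=0,\ldots,\lceil\log\sigma\rceil-1$, each storing one bitmap of length $n$. Symbols are viewed as $\lceil\log\sigma\rceil$-bit numbers. The sequence on level $0$ is $S$ itself. For $l\ge1$, the sequence on level $l$ is obtained from the sequence on level $l-1$ by stably reordering it by the $l$'th highest bit of the symbols: all symbols with $l$'th highest bit $0$ are placed on the left and all symbols with $l$'th highest bit $1$ on the right, the relative order within each group being preserved. The bitmap on level $l$ records, position by position, the $(l+1)$'st highest bit of the symbols of the level's sequence. Each level also stores the number of $0$'s on the level, and a succinct rank/select structure (of size sub-linear in the bitmap length) supporting rank and select queries on its bitmap in $O(1)$ work. -}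

module Defs where

open import Data.Bool.Base using (Bool; true; false; if_then_else_; not; _∧_; _∨_; _xor_)
open import Data.Fin.Base using (Fin; toℕ)
open import Data.List.Base
  using (List; []; _∷_; _++_; map; length; take; upTo; filterᵇ; lookup)
open import Data.Nat.Base
open import Data.Nat.DivMod using (_/_; _%_)
open import Data.Nat.ListAction using (sum)
open import Data.Nat.Logarithm using (⌈log₂_⌉)
open import Data.Nat.Properties using (m^n≢0)
open import Data.Product.Base using (∃-syntax; _×_; _,_; proj₂)
open import Data.Vec.Base as Vec using (Vec)
open import Relation.Binary.PropositionalEquality.Core using (_≡_)

-- The logarithm inside O(·): rounded up, and at least 1.  For m ≥ 1 it is
-- within a factor 2 of max(1, log₂ m).
lg : ℕ → ℕ
lg m = 1 ⊔ ⌈log₂ m ⌉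

-- s(n) = o(n), i.e. s(n)/n is eventually below 1/k for every k.
Sublinear : (ℕ → ℕ) → Set
Sublinear s = ∀ k → ∃[ N ] (∀ n → N ≤ n → k * s n ≤ n)

-- Bit k of x, where bit 0 is the least significant one.
bit : ℕ → ℕ → Bool
bit k x = ((x / 2 ^ k) {{m^n≢0 2 k}} % 2) ≡ᵇ 1

------------------------------------------------------------------------
-- The work-depth model
--
-- A program is run by a dynamically changing set of processors on a
-- shared memory.  Processors proceed in lockstep: in one time step every
-- processor that is neither finished nor waiting for unfinished children
-- performs one operation.  All reads of a step see the memory as it was
-- before the step.  If several processors write to one address in the
-- same step, an arbitrary one of them succeeds.

Reg : Set
Reg = ℕ

data Operand : Set where
  reg : Reg → Operand
  lit : ℕ → Operand

data BinOp : Set where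
  add sub mul div mod lt eq and or xor shl shr : BinOp

data Stmt : Set where
  op    : BinOp → Reg → Operand → Operand → Stmt
  load  : Reg → Operand → Stmt                       -- destination, address
  store : Operand → Operand → Stmt                   -- address, value
  cond  : Operand → List Stmt → List Stmt → Stmt     -- nonzero is true
  while : Operand → List Stmt → Stmt
  -- par r k body: start k child processors, each with a copy of the
  -- parent's registers except that the i-th (0 ≤ i < k) has i in
  -- register r; the parent waits until all of them have finished.
  par   : Reg → Operand → List Stmt → Stmt

Prog : Set
Prog = List Stmt

Regs Mem : Set
Regs = Reg → ℕ
Mem  = ℕ → ℕ

Write : Set
Write = ℕ × ℕ

data Thread : Set where
  run  : Prog → Regs → Thread
  -- A processor waiting for its children, with its remaining program.
  join : List Thread → Prog → Regs → Thread

isDone : Thread → Bool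
isDone (run [] _)      = true
isDone (run (_ ∷ _) _) = false
isDone (join _ _ _)    = false

allDone : List Thread → Bool
allDone []       = true
allDone (t ∷ ts) = isDone t ∧ allDone ts

setReg : Reg → ℕ → Regs → Regs
setReg r v ρ r′ = if r ≡ᵇ r′ then v else ρ r′

-- Chooses the successful write among the values v ∷ vs written to
-- an address in a given time step.
Resolver : Set
Resolver = (time address v : ℕ) (vs : List ℕ) → Fin (suc (length vs))

resolve : ((v : ℕ) (vs : List ℕ) → Fin (suc (length vs))) → ℕ → List ℕ → ℕ
resolve choose old []       = old
resolve choose old (v ∷ vs) = lookup (v ∷ vs) (choose v vs)

commit : ((address v : ℕ) (vs : List ℕ) → Fin (suc (length vs))) →
         List Write → Mem → Mem
commit choose ws M a =
  resolve (choose a) (M a)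
    (map proj₂ (filterᵇ (λ (address , _) → address ≡ᵇ a) ws))

record Config : Set where
  constructor config
  field
    thread : Thread
    mem    : Mem
    work   : ℕ

-- The machine with words of w bits.
module Machine (w : ℕ) where

  word : ℕ → ℕ
  word x = (x % 2 ^ w) {{m^n≢0 2 w}}

  bitwise : (Bool → Bool → Bool) → ℕ → ℕ → ℕ
  bitwise f a b =
    sum (map (λ k → if f (bit k a) (bit k b) then 2 ^ k else 0) (upTo w))

  truth : Bool → ℕ
  truth b = if b then 1 else 0

  -- Division and remainder by zero give 0; subtraction is truncated at 0.
  ⟦_⟧ : BinOp → ℕ → ℕ → ℕ
  ⟦ add ⟧ a b       = a + b
  ⟦ sub ⟧ a b       = a ∸ b
  ⟦ mul ⟧ a b       = a * b
  ⟦ div ⟧ a zero    = 0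
  ⟦ div ⟧ a (suc b) = a / suc b
  ⟦ mod ⟧ a zero    = 0
  ⟦ mod ⟧ a (suc b) = a % suc b
  ⟦ lt  ⟧ a b       = truth (a <ᵇ b)
  ⟦ eq  ⟧ a b       = truth (a ≡ᵇ b)
  ⟦ and ⟧ a b       = bitwise _∧_ a b
  ⟦ or  ⟧ a b       = bitwise _∨_ a b
  ⟦ xor ⟧ a b       = bitwise _xor_ a b
  ⟦ shl ⟧ a b       = a * 2 ^ b
  ⟦ shr ⟧ a b       = (a / 2 ^ b) {{m^n≢0 2 b}}

  value : Regs → Operand → ℕ
  value ρ (reg r) = ρ r
  value ρ (lit k) = word k

  -- One time step of a processor and its descendants: the new state, the
  -- attempted writes, and the number of operations performed.
  stepThread  : Mem → Thread → Thread × List Write × ℕ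
  stepThreads : Mem → List Thread → List Thread × List Write × ℕ

  stepThread M (run [] ρ) = run [] ρ , [] , 0
  stepThread M (run (op o r a b ∷ p) ρ) =
    run p (setReg r (word (⟦ o ⟧ (value ρ a) (value ρ b))) ρ) , [] , 1
  stepThread M (run (load r a ∷ p) ρ) =
    run p (setReg r (M (value ρ a)) ρ) , [] , 1
  stepThread M (run (store a b ∷ p) ρ) =
    run p ρ , (value ρ a , value ρ b) ∷ [] , 1
  stepThread M (run (cond a p₁ p₂ ∷ p) ρ) =
    run ((if value ρ a ≡ᵇ 0 then p₂ else p₁) ++ p) ρ , [] , 1
  stepThread M (run (while a body ∷ p) ρ) =
    run (if value ρ a ≡ᵇ 0 then p else body ++ while a body ∷ p) ρ , [] , 1
  stepThread M (run (par r a body ∷ p) ρ) =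
    join (map (λ i → run body (setReg r i ρ)) (upTo (value ρ a))) p ρ
      , [] , 1 + value ρ a
  stepThread M (join ts p ρ) =
    if allDone ts
    then run p ρ , [] , 1
    else let (ts′ , ws , k) = stepThreads M ts in join ts′ p ρ , ws , k

  stepThreads M []       = [] , [] , 0
  stepThreads M (t ∷ ts) =
    let (t′  , ws₁ , k₁) = stepThread M t
        (ts′ , ws₂ , k₂) = stepThreads M ts
    in  t′ ∷ ts′ , ws₁ ++ ws₂ , k₁ + k₂

  -- The configuration after a number of time steps, with the work so far.
  after : Resolver → ℕ → Config → Config
  after choose zero    c = c
  after choose (suc t) c =
    let config th M k  = after choose t c
        (th′ , ws , k′) = stepThread M th
    in  config th′ (commit (choose t) ws M) (k + k′)

  -- Register i initially holds the i-th argument, all others hold 0.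
  args : List ℕ → Regs
  args []       _       = 0
  args (x ∷ xs) zero    = word x
  args (x ∷ xs) (suc i) = args xs i

  start : Prog → List ℕ → Mem → Config
  start p xs M = config (run p (args xs)) M 0

  IsMemory : Mem → Set
  IsMemory M = ∀ a → M a < 2 ^ w

  -- The computation has ended with v in register 0.
  Returns : Config → ℕ → Set
  Returns c v = ∃[ ρ ] (Config.thread c ≡ run [] ρ × ρ 0 ≡ v)

------------------------------------------------------------------------
-- Rank and select

count : Bool → List Bool → ℕ
count true  xs = length (filterᵇ (λ x → x) xs)
count false xs = length (filterᵇ not xs)

rank : Bool → ℕ → List Bool → ℕ
rank b i xs = count b (take i xs)

-- The j-th occurrence of b in xs (j = 1, 2, …) is at position p (from 0).
IsSelect : Bool → ℕ → List Bool → ℕ → Set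
IsSelect b j xs p =
  ∃[ ys ] ∃[ zs ] (xs ≡ ys ++ b ∷ zs × length ys ≡ p × suc (count b ys) ≡ j)

record Queries : Set where
  field
    rankProg selectProg : Bool → Prog

------------------------------------------------------------------------
-- The wavelet matrix of a sequence of L-bit symbols

-- The k-th highest bit of an L-bit number, 1 ≤ k ≤ L.
highBit : (L k : ℕ) → ℕ → Bool
highBit L k = bit (L ∸ k)

levelSeq : (L : ℕ) → List ℕ → (l : ℕ) → List ℕ
levelSeq L xs zero    = xs
levelSeq L xs (suc l) =
  filterᵇ (λ x → not (highBit L (suc l) x)) (levelSeq L xs l) ++
  filterᵇ (highBit L (suc l)) (levelSeq L xs l)

levelBitmap : (L : ℕ) → List ℕ → (l : ℕ) → List Bool
levelBitmap L xs l = map (highBit L (suc l)) (levelSeq L xs l)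

symbols : ∀ {σ n} → Vec (Fin σ) n → List ℕ
symbols S = map toℕ (Vec.toList S)

------------------------------------------------------------------------
-- Representation in memory, with words of w bits

module Layout (w : ℕ) .{{_ : NonZero w}} where
  open Machine w

  HoldsInput : ∀ {σ n} → Mem → Vec (Fin σ) n → Set
  HoldsInput {n = n} M S = ∀ (i : Fin n) → M (toℕ i) ≡ toℕ (Vec.lookup S i)

  -- The n bits packed into the ⌈n/w⌉ words from address B on.
  packedBits : (n : ℕ) → Mem → (B : ℕ) → List Bool
  packedBits n M B = map (λ j → bit (j % w) (M (B + j / w))) (upTo n)

  -- With arguments i, n, w, B and R, the query program p returns v with at
  -- most C operations, leaving the memory unchanged.
  Answers : (C n B R : ℕ) → Mem → (p : Prog) (i v : ℕ) → Set
  Answers C n B R M p i v =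
    ∀ (choose : Resolver) → ∃[ t ]
      let c = after choose t (start p (i ∷ n ∷ w ∷ B ∷ R ∷ []) M) in
      Returns c v × Config.work c ≤ C × (∀ a → Config.mem c a ≡ M a)

  -- The m words from address R on are a rank/select structure for the
  -- bitmap xs of length n packed from address B on: together with the
  -- packed bitmap they suffice, whatever the rest of the memory holds, to
  -- answer the queries.
  IsRankSelect : Queries → (C n : ℕ) → List Bool → Mem → (B R m : ℕ) → Set
  IsRankSelect Q C n xs M B R m =
    ∀ (M′ : Mem) → IsMemory M′ →
    (∀ i → i * w < n → M′ (B + i) ≡ M (B + i)) →
    (∀ i → i < m → M′ (R + i) ≡ M (R + i)) →
    ∀ (b : Bool) →
      (∀ i → i ≤ n →
         Answers C n B R M′ (Queries.rankProg Q b) i (rank b i xs)) ×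
      (∀ j p → IsSelect b j xs p →
         Answers C n B R M′ (Queries.selectProg Q b) j p)

  -- From address D on there are four words for every level: the address of
  -- its bitmap, its number of 0's, and the address and length in words of
  -- its rank/select structure, which occupies at most s bits.
  IsWaveletMatrix : ∀ {σ n} → Queries → (C s : ℕ) → Vec (Fin σ) n →
                    Mem → (D : ℕ) → Set
  IsWaveletMatrix {σ} {n} Q C s S M D =
    ∀ l → l < ⌈log₂ σ ⌉ →
      let xs = levelBitmap ⌈log₂ σ ⌉ (symbols S) l
          B  = M (D + 4 * l)
          Z  = M (D + 4 * l + 1)
          R  = M (D + 4 * l + 2)
          m  = M (D + 4 * l + 3)
      in  packedBits n M B ≡ xs
        × Z ≡ count false xs
        × IsRankSelect Q C n xs M B R m
        × m * w ≤ s

  -- With arbitrary initial contents of the memory outside the input and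
  -- every resolution of concurrent writes, P ends with the address of the
  -- wavelet matrix of S in register 0, within the given work and depth.
  Constructs : ∀ {σ n} → Prog → Queries → (C s work depth : ℕ) →
               Vec (Fin σ) n → Set
  Constructs {σ} {n} P Q C s work depth S =
    ∀ (M : Mem) → IsMemory M → HoldsInput M S →
    ∀ (choose : Resolver) → ∃[ d ] ∃[ D ]
      let c = after choose d (start P (n ∷ σ ∷ w ∷ []) M) in
      Returns c D × Config.work c ≤ work × d ≤ depth
      × IsWaveletMatrix Q C s S (Config.mem c) D

{-# OPTIONS --safe #-}

-- Idea.  A program is a sequence of parallel fills: each reserves fresh cells
-- above a frontier, and its processors read only below the frontier, so races
-- do not matter.  Write u ≈ log log n and b ≈ (log n)/4.  A level counts the
-- ones of its chunks of b symbols by table lookup, adds the counts up by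
-- doubling, and thereby moves every symbol to its place in the next level,
-- in O(n) work and O(log n) depth.  The fills also record F, the inverse of
-- this stable partition, in which the positions of the ones are increased by
-- n + b, so that F increases.  Rank uses a two-level directory and a table.
-- Select evaluates F, sampled in groups at two levels: a group whose values
-- spread over t numbers or more is the only one starting in its range of t
-- numbers, so its values can be stored in a slot given by the quotient of the
-- first value by t; the values of a group that is not sparse at the lower
-- level lie in a window of b bits, which a table searches.  All this takes
-- O(n / (u log n)) words of O(log n) bits, which is o(n) bits.

module Submission where

open import Defs
open import Data.Bool.Base as Bool using (Bool; true; false; if_then_else_; _∧_; not)
open import Data.Empty using (⊥; ⊥-elim)
open import Data.Fin.Base using (Fin; toℕ)
open import Data.List.Base using (List; []; _∷_; _++_; map; length; take; upTo; applyUpTo; filterᵇ; lookup; _∷ʳ_)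
open import Data.List.Membership.Propositional using (_∈_)
open import Data.List.Membership.Propositional.Properties using (∈-++⁻; ∈-++⁺ˡ; ∈-++⁺ʳ; ∈-lookup; ∈-upTo⁻; ∈-upTo⁺; ∈-map⁻; ∈-map⁺)
open import Data.List.Properties using (++-assoc; ++-identityʳ; map-upTo; length-upTo; map-applyUpTo; applyUpTo-∷ʳ; length-++; ∷-injective)
open import Data.List.Relation.Unary.Any using (here; there)
open import Data.Nat.Base
open import Data.Nat.DivMod hiding (result)
open import Data.Nat.Induction using (<-rec)
open import Data.Nat.Logarithm
open import Data.Nat.Properties
open import Data.Nat.Tactic.RingSolver using (solve-∀)
open import Data.Product.Base using (∃-syntax; _×_; _,_; proj₁; proj₂)
open import Data.Sum.Base using (_⊎_; inj₁; inj₂)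
open import Data.Unit.Base using (⊤; tt)
open import Data.Vec.Base as Vec using (Vec)
open import Function.Base using (_∘_)
open import Relation.Binary.Definitions using (tri<; tri≈; tri>)
open import Relation.Binary.PropositionalEquality hiding (J)
open import Relation.Nullary using (¬_; yes; no)

-- Machine words wrap around, so every intermediate value needs a bound. Small quantities are kept
-- below `Bd`, about the eighth root of the range of words. An expression is accepted by a Boolean
-- check of its degree in `Bd`, and only what the syntax cannot show is left to prove. Zeros and
-- ones share one select structure. Since the ones are moved up by n + b and not just by n, `F`
-- jumps by more than b between the two symbols. A group whose values fit a window of b bits
-- therefore holds positions of one symbol only, and a single window of the bitmap decides the
-- query; for zeros the window is complemented. The initial memory is arbitrary, so slots that no
-- sparse group claims and bits past the end of a bitmap stay unknown. Entries are cut to fields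
-- before they are packed, and the window search counts prefixes, which can only grow; so unknown
-- bits never influence an answer. Space is measured as the number of words times u log n, and every
-- component has to be linear in n under this weight. The lower groups decide the choice g = u²: n /
-- u² fields with about (log n) / u of them per word make n / (u log n) words.

T-≡ : ∀ {b} → b ≡ true → Bool.T b
T-≡ refl = tt

≡-T : ∀ {b} → Bool.T b → b ≡ true
≡-T {true} _ = refl

-- Executions of the machine: reading processors, concurrent writes, joins

module Execution (w : ℕ) where
  open Machine w

  stepConfig : ((address v : ℕ) (vs : List ℕ) → Fin (suc (length vs))) → Config → Config
  stepConfig ch (config th M k) =
    let (th′ , ws , k′) = stepThread M th
    in  config th′ (commit ch ws M) (k + k′)

  -- `after` recurses on the last step, while a program is consumed from its first one. The resolver
  -- sees the time, so peeling off the first step shifts it.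
  after-suc : ∀ choose t c →
    after choose (suc t) c ≡ after (λ s → choose (suc s)) t (stepConfig (choose 0) c)
  after-suc choose zero    c = refl
  after-suc choose (suc t) c = cong (stepConfig (choose (suc t))) (after-suc choose t c)

  after-+ : ∀ choose t s c →
    after choose (t + s) c ≡ after (λ r → choose (r + s)) t (after choose s c)
  after-+ choose zero    s c = refl
  after-+ choose (suc t) s c = cong (stepConfig (choose (t + s))) (after-+ choose t s c)

  -- t steps of a processor that only reads, at addresses satisfying A.
  data Reads (A : ℕ → Set) (m : Mem) : ℕ → Prog → Regs → Prog → Regs → Set where
    nil : ∀ {p ρ} → Reads A m 0 p ρ p ρ
    op∷ : ∀ {t o r a b p ρ p′ ρ′} →
      Reads A m t p (setReg r (word (⟦ o ⟧ (value ρ a) (value ρ b))) ρ) p′ ρ′ →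
      Reads A m (suc t) (op o r a b ∷ p) ρ p′ ρ′
    load∷ : ∀ {t r a p ρ p′ ρ′} → A (value ρ a) →
      Reads A m t p (setReg r (m (value ρ a)) ρ) p′ ρ′ →
      Reads A m (suc t) (load r a ∷ p) ρ p′ ρ′
    cond∷ : ∀ {t a p₁ p₂ p ρ p′ ρ′} →
      Reads A m t ((if value ρ a ≡ᵇ 0 then p₂ else p₁) ++ p) ρ p′ ρ′ →
      Reads A m (suc t) (cond a p₁ p₂ ∷ p) ρ p′ ρ′
    while∷ : ∀ {t a body p ρ p′ ρ′} →
      Reads A m t (if value ρ a ≡ᵇ 0 then p else body ++ while a body ∷ p) ρ p′ ρ′ →
      Reads A m (suc t) (while a body ∷ p) ρ p′ ρ′

  Reads-++ : ∀ {A m t s p ρ p′ ρ′ p″ ρ″} →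
    Reads A m t p ρ p′ ρ′ → Reads A m s p′ ρ′ p″ ρ″ → Reads A m (t + s) p ρ p″ ρ″
  Reads-++ nil         r′ = r′
  Reads-++ (op∷ r)     r′ = op∷ (Reads-++ r r′)
  Reads-++ (load∷ x r) r′ = load∷ x (Reads-++ r r′)
  Reads-++ (cond∷ r)   r′ = cond∷ (Reads-++ r r′)
  Reads-++ (while∷ r)  r′ = while∷ (Reads-++ r r′)

  Reads-step : ∀ {A m t p ρ p′ ρ′ M} → (∀ a → A a → M a ≡ m a) →
    Reads A m (suc t) p ρ p′ ρ′ →
    ∃[ p₁ ] ∃[ ρ₁ ] (stepThread M (run p ρ) ≡ (run p₁ ρ₁ , [] , 1) × Reads A m t p₁ ρ₁ p′ ρ′)
  Reads-step M≡m (op∷ r) = _ , _ , refl , r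
  Reads-step {ρ = ρ} M≡m (load∷ {r = d} {a} {p} x r) =
    _ , _ , cong (λ v → run p (setReg d v ρ) , [] , 1) (M≡m _ x) , r
  Reads-step M≡m (cond∷ r) = _ , _ , refl , r
  Reads-step M≡m (while∷ r) = _ , _ , refl , r

  Reads-after : ∀ {A m t p ρ p′ ρ′} → Reads A m t p ρ p′ ρ′ → ∀ choose k →
    after choose t (config (run p ρ) m k) ≡ config (run p′ ρ′) m (k + t)
  Reads-after {t = zero} nil choose k = cong (config _ _) (sym (+-identityʳ k))
  Reads-after {m = m} {suc t} {p} {ρ} {p′} {ρ′} rs choose k with Reads-step (λ _ _ → refl) rs
  ... | p₁ , ρ₁ , e≡ , rs′ = begin
    after choose (suc t) (config (run p ρ) m k)
      ≡⟨ after-suc choose t _ ⟩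
    after (λ s → choose (suc s)) t (stepConfig (choose 0) (config (run p ρ) m k))
      ≡⟨ cong (λ (th , ws , j) → after (λ s → choose (suc s)) t
                (config th (commit (choose 0) ws m) (k + j))) e≡ ⟩
    after (λ s → choose (suc s)) t (config (run p₁ ρ₁) m (k + 1))
      ≡⟨ Reads-after rs′ _ (k + 1) ⟩
    config (run p′ ρ′) m (k + 1 + t)
      ≡⟨ cong (config _ _) (+-assoc k 1 t) ⟩
    config (run p′ ρ′) m (k + suc t) ∎
    where open ≡-Reasoning

  written : List Write → ℕ → List ℕ
  written ws a = map proj₂ (filterᵇ (λ (address , _) → address ≡ᵇ a) ws)

  ∈-written : ∀ ws {a v} → v ∈ written ws a → (a , v) ∈ ws
  ∈-written ((x , v) ∷ ws) {a} v∈ with x ≡ᵇ a in e≡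
  ∈-written ((x , v) ∷ ws) {a} (here refl) | true with ≡ᵇ⇒≡ x a (T-≡ e≡)
  ... | refl = here refl
  ∈-written ((x , v) ∷ ws) (there v∈) | true = there (∈-written ws v∈)
  ∈-written ((x , v) ∷ ws) v∈ | false = there (∈-written ws v∈)

  written-∈ : ∀ ws {a v} → (a , v) ∈ ws → v ∈ written ws a
  written-∈ ((x , v) ∷ ws) {a} (here refl) rewrite ≡-T (≡⇒≡ᵇ x x refl) = here refl
  written-∈ ((x , v) ∷ ws) {a} (there p) with x ≡ᵇ a
  ... | true  = there (written-∈ ws p)
  ... | false = written-∈ ws p

  resolve-cases : ∀ ch old vs → (vs ≡ [] × resolve ch old vs ≡ old) ⊎ resolve ch old vs ∈ vs
  resolve-cases ch old []       = inj₁ (refl , refl)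
  resolve-cases ch old (v ∷ vs) = inj₂ (∈-lookup (ch v vs))

  -- This dichotomy is all that is used about steps that attempt writes, which is why the results
  -- hold for every resolver.
  commit-cases : ∀ ch ws M a →
    ((∀ v → ¬ (a , v) ∈ ws) × commit ch ws M a ≡ M a) ⊎ (a , commit ch ws M a) ∈ ws
  commit-cases ch ws M a with resolve-cases (ch a) (M a) (written ws a)
  ... | inj₂ x         = inj₂ (∈-written ws x)
  ... | inj₁ (e≡ , e≡′) = inj₁ ((λ v v∈ → absurd (subst (v ∈_) e≡ (written-∈ ws v∈))) , e≡′)
    where
    absurd : ∀ {v : ℕ} → ¬ v ∈ []
    absurd ()

  -- A child processor that reads for a while and then writes ν to α as its
  -- last operation; x is the number of operations left.
  data Kid (A : ℕ → Set) (m M : Mem) (α ν : ℕ) : Thread → (x : ℕ) → Set where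
    going : ∀ {t p ρ a b ρ′} → Reads A m t p ρ (store a b ∷ []) ρ′ →
      value ρ′ a ≡ α → value ρ′ b ≡ ν → Kid A m M α ν (run p ρ) (suc t)
    fin : ∀ {ρ} → M α ≡ ν → Kid A m M α ν (run [] ρ) 0

  -- The list of pairs is the plan: one write for every child. `r` bounds the operations left to any
  -- single child and hence the time, `U` is their total and hence the work.
  data Kids (A : ℕ → Set) (m M : Mem) : List Write → List Thread → (r U : ℕ) → Set where
    []  : ∀ {r} → Kids A m M [] [] r 0
    _∷_ : ∀ {α ν th x ps ts r U} → Kid A m M α ν th x × x ≤ r →
      Kids A m M ps ts r U → Kids A m M ((α , ν) ∷ ps) (th ∷ ts) r (x + U)

  Written : Mem → List Write → ℕ → ℕ → Set
  Written M ws α ν = M α ≡ ν ⊎ (α , ν) ∈ ws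

  stepKid : ∀ {A m M α ν th x} → (∀ a → A a → M a ≡ m a) → Kid A m M α ν th x →
    ∃[ th′ ] ∃[ ws ] ∃[ k ]
      ( stepThread M th ≡ (th′ , ws , k) × x ≡ k + pred x
      × (∀ {e} → e ∈ ws → e ≡ (α , ν))
      × (∀ M′ → (Written M ws α ν → M′ α ≡ ν) → Kid A m M′ α ν th′ (pred x)))
  stepKid M≡m (going {zero} nil α≡ ν≡) =
    _ , _ , _ , refl , refl
    , (λ { (here refl) → cong₂ _,_ α≡ ν≡ })
    , (λ M′ f → fin (f (inj₂ (here (cong₂ _,_ (sym α≡) (sym ν≡))))))
  stepKid M≡m (going {suc t} rs α≡ ν≡) with Reads-step M≡m rs
  ... | p₁ , ρ₁ , e≡ , rs′ = _ , _ , _ , e≡ , refl , (λ ()) , (λ M′ f → going rs′ α≡ ν≡)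
  stepKid M≡m (fin e≡) = _ , _ , _ , refl , refl , (λ ()) , (λ M′ f → fin (f (inj₁ e≡)))

  Written-⊆ : ∀ {M ws ws′ α ν} → (∀ {e} → e ∈ ws → e ∈ ws′) → Written M ws α ν → Written M ws′ α ν
  Written-⊆ f (inj₁ x) = inj₁ x
  Written-⊆ f (inj₂ y) = inj₂ (f y)

  +-shuffle : ∀ a b c d → (a + b) + (c + d) ≡ (a + c) + (b + d)
  +-shuffle a b c d = begin
    (a + b) + (c + d) ≡⟨ +-assoc a b (c + d) ⟩
    a + (b + (c + d)) ≡⟨ cong (a +_) (sym (+-assoc b c d)) ⟩
    a + (b + c + d)   ≡⟨ cong (λ z → a + (z + d)) (+-comm b c) ⟩
    a + (c + b + d)   ≡⟨ cong (a +_) (+-assoc c b d) ⟩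
    a + (c + (b + d)) ≡⟨ sym (+-assoc a c (b + d)) ⟩
    (a + c) + (b + d) ∎
    where open ≡-Reasoning

  -- The memory after a step depends on the writes of all children together. The new invariant is
  -- therefore a function of any memory `M′` in which a planned write that is already present or is
  -- attempted in this step has taken effect.
  stepKids : ∀ {A m M ps ts r U} → (∀ a → A a → M a ≡ m a) → Kids A m M ps ts r U →
    ∃[ ts′ ] ∃[ ws ] ∃[ k ] ∃[ U′ ]
      ( stepThreads M ts ≡ (ts′ , ws , k) × U ≡ k + U′
      × (∀ {e} → e ∈ ws → e ∈ ps)
      × (∀ M′ → (∀ α ν → (α , ν) ∈ ps → Written M ws α ν → M′ α ≡ ν) →
           Kids A m M′ ps ts′ (pred r) U′))
  stepKids M≡m [] = _ , _ , _ , _ , refl , refl , (λ ()) , (λ _ _ → [])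
  stepKids {M = M} M≡m (_∷_ {ts = ts} (kid , x≤r) kids)
    with stepKid M≡m kid | stepKids M≡m kids
  ... | th′ , ws₁ , k₁ , e≡₁ , x≡ , ⊆ps₁ , next₁
      | ts′ , ws₂ , k₂ , U₂ , e≡₂ , U≡ , ⊆ps₂ , next₂ =
    _ , _ , _ , _
    , cong₂ (λ (a , b , c) (a′ , b′ , c′) → a ∷ a′ , b ++ b′ , c + c′) e≡₁ e≡₂
    , trans (cong₂ _+_ x≡ U≡) (+-shuffle k₁ _ k₂ U₂)
    , ⊆ps
    , (λ M′ f → (next₁ M′ (λ h → f _ _ (here refl) (Written-⊆ {M = M} (λ z → ∈-++⁺ˡ z) h)) , pred-mono-≤ x≤r)
              ∷ next₂ M′ (λ α ν α∈ h → f α ν (there α∈) (Written-⊆ {M = M} (λ z → ∈-++⁺ʳ ws₁ z) h)))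
    where
    ⊆ps : ∀ {e} → e ∈ ws₁ ++ ws₂ → e ∈ _
    ⊆ps e∈ with ∈-++⁻ ws₁ e∈
    ... | inj₁ z = here (⊆ps₁ z)
    ... | inj₂ z = there (⊆ps₂ z)

  Kids-memory : ∀ {A m M ps ts r U} → allDone ts ≡ true → Kids A m M ps ts r U →
    U ≡ 0 × (∀ {α ν} → (α , ν) ∈ ps → M α ≡ ν)
  Kids-memory d [] = refl , λ ()
  Kids-memory {ts = _ ∷ ts} d ((going {zero} nil _ _ , _) ∷ kids) with () ← d
  Kids-memory {ts = _ ∷ ts} d ((going {suc t} (op∷ _) _ _ , _) ∷ kids) with () ← d
  Kids-memory {ts = _ ∷ ts} d ((going {suc t} (load∷ _ _) _ _ , _) ∷ kids) with () ← d
  Kids-memory {ts = _ ∷ ts} d ((going {suc t} (cond∷ _) _ _ , _) ∷ kids) with () ← d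
  Kids-memory {ts = _ ∷ ts} d ((going {suc t} (while∷ _) _ _ , _) ∷ kids) with () ← d
  Kids-memory {ts = _ ∷ ts} d ((fin e≡ , _) ∷ kids) with Kids-memory d kids
  ... | U≡0 , f = U≡0 , λ { (here refl) → e≡ ; (there z) → f z }

  Kids-done : ∀ {A m M ps ts U} → Kids A m M ps ts 0 U → allDone ts ≡ true
  Kids-done []                     = refl
  Kids-done ((fin _ , _) ∷ kids)   = Kids-done kids
  Kids-done ((going _ _ _ , ()) ∷ kids)

  record Joined (A : ℕ → Set) (m : Mem) (ps : List Write) (M′ : Mem) : Set where
    field
      kept    : ∀ a → A a → M′ a ≡ m a
      stored  : ∀ {α ν} → (α , ν) ∈ ps → M′ α ≡ ν
      isWords : IsMemory M′

  -- Planned writes to one address agree, so it does not matter which of them succeeds; and no write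
  -- hits an address in `A`, so all children keep reading the initial memory. The induction is on
  -- the time left to the slowest child, with one more step and operation for leaving the join.
  join-after : ∀ {A m M ps ts U} r → Kids A m M ps ts r U →
    (∀ a → A a → M a ≡ m a) → IsMemory M →
    (∀ {α ν ν′} → (α , ν) ∈ ps → (α , ν′) ∈ ps → ν ≡ ν′) →
    (∀ {α ν} → (α , ν) ∈ ps → ¬ A α) →
    (∀ {α ν} → (α , ν) ∈ ps → ν < 2 ^ w) →
    ∀ choose k p ρ → ∃[ t ] ∃[ M′ ] (t ≤ suc r
      × after choose t (config (join ts p ρ) M k) ≡ config (run p ρ) M′ (k + suc U)
      × Joined A m ps M′)
  join-after {A} {m} {M} {ps} {ts} {U} r kids M≡m isMem cons out words choose k p ρ
    with allDone ts in done?
  ... | true = 1 , M , s≤s z≤n , e≡ , record { kept = M≡m ; stored = proj₂ (Kids-memory done? kids) ; isWords = isMem }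
    where
    e≡ : after choose 1 (config (join ts p ρ) M k) ≡ config (run p ρ) M (k + suc U)
    e≡ rewrite done? | proj₁ (Kids-memory done? kids) = refl
  join-after {ts = ts} zero kids M≡m isMem cons out words choose k p ρ | false
    with () ← trans (sym done?) (Kids-done kids)
  join-after {A} {m} {M} {ps} {ts} {U} (suc r) kids M≡m isMem cons out words choose k p ρ | false
    with stepKids M≡m kids
  ... | ts′ , ws , k₁ , U′ , e≡ , U≡ , ⊆ps , next
    with join-after r (next (commit (choose 0) ws M) stored′) kept′ isMem′ cons out words
           (λ s → choose (suc s)) (k + k₁) p ρ
    where
    M₁ : Mem
    M₁ = commit (choose 0) ws M
    stored′ : ∀ α ν → (α , ν) ∈ ps → Written M ws α ν → M₁ α ≡ ν
    stored′ α ν α∈ h with commit-cases (choose 0) ws M α | h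
    ... | inj₂ z         | _      = cons (⊆ps z) α∈
    ... | inj₁ (_ , e≡)  | inj₁ e = trans e≡ e
    ... | inj₁ (none , _) | inj₂ e = ⊥-elim (none _ e)
    kept′ : ∀ a → A a → M₁ a ≡ m a
    kept′ a Aa with commit-cases (choose 0) ws M a
    ... | inj₁ (_ , e≡) = trans e≡ (M≡m a Aa)
    ... | inj₂ z        = ⊥-elim (out (⊆ps z) Aa)
    isMem′ : IsMemory M₁
    isMem′ a with commit-cases (choose 0) ws M a
    ... | inj₁ (_ , e≡) = subst (_< 2 ^ w) (sym e≡) (isMem a)
    ... | inj₂ z        = words (⊆ps z)
  ... | t , M′ , t≤ , e≡′ , joined = suc t , M′ , s≤s t≤ , (begin
    after choose (suc t) (config (join ts p ρ) M k)
      ≡⟨ after-suc choose t _ ⟩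
    after (λ s → choose (suc s)) t (stepConfig (choose 0) (config (join ts p ρ) M k))
      ≡⟨ cong (after (λ s → choose (suc s)) t) step≡ ⟩
    after (λ s → choose (suc s)) t (config (join ts′ p ρ) (commit (choose 0) ws M) (k + k₁))
      ≡⟨ e≡′ ⟩
    config (run p ρ) M′ (k + k₁ + suc U′)
      ≡⟨ cong (config _ _) (trans (+-assoc k k₁ (suc U′))
           (cong (k +_) (trans (+-suc k₁ U′) (cong suc (sym U≡))))) ⟩
    config (run p ρ) M′ (k + suc U) ∎) , joined
    where
    open ≡-Reasoning
    step≡ : stepConfig (choose 0) (config (join ts p ρ) M k) ≡
            config (join ts′ p ρ) (commit (choose 0) ws M) (k + k₁)
    step≡ rewrite done? | e≡ = refl

-- Total arithmetic, sums, and conjunctions of proof obligations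

infixl 7 _//_ _%%_

-- A divisor 0 gives 0, exactly as on the machine, so expressions can be evaluated without proofs
-- that divisors are nonzero.
_//_ : ℕ → ℕ → ℕ
m // zero  = 0
m // suc n = m / suc n

_%%_ : ℕ → ℕ → ℕ
m %% zero  = 0
m %% suc n = m % suc n

//≡/ : ∀ m n .{{_ : NonZero n}} → m // n ≡ m / n
//≡/ m (suc n) = refl

%%≡% : ∀ m n .{{_ : NonZero n}} → m %% n ≡ m % n
%%≡% m (suc n) = refl

//-≤ : ∀ m n → m // n ≤ m
//-≤ m zero    = z≤n
//-≤ m (suc n) = m/n≤m m (suc n)

%%-≤ : ∀ m n → m %% n ≤ m
%%-≤ m zero    = z≤n
%%-≤ m (suc n) = m%n≤m m (suc n)

%%-≤ʳ : ∀ m n → m %% n ≤ n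
%%-≤ʳ m zero    = z≤n
%%-≤ʳ m (suc n) = m%n≤n m (suc n)

𝟙 : Bool → ℕ
𝟙 b = if b then 1 else 0

𝟙≤1 : ∀ b → 𝟙 b ≤ 1
𝟙≤1 true  = ≤-refl
𝟙≤1 false = z≤n

∑ : (ℕ → ℕ) → ℕ → ℕ
∑ f zero    = 0
∑ f (suc k) = ∑ f k + f k

∑-mono : ∀ f {j k} → j ≤ k → ∑ f j ≤ ∑ f k
∑-mono f {j} {zero}  z≤n = ≤-refl
∑-mono f {j} {suc k} j≤k with m≤n⇒m<n∨m≡n j≤k
... | inj₁ (s≤s j≤k′) = ≤-trans (∑-mono f j≤k′) (m≤m+n _ (f k))
... | inj₂ refl       = ≤-refl

∧-true : ∀ {a b} → a ∧ b ≡ true → a ≡ true × b ≡ true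
∧-true {true} {true} _ = refl , refl

Π : List Set → Set
Π []       = ⊤
Π (X ∷ Xs) = X × Π Xs

Π-++ : ∀ Xs {Ys} → Π (Xs ++ Ys) → Π Xs × Π Ys
Π-++ []       ys       = tt , ys
Π-++ (X ∷ Xs) (x , xs) with Π-++ Xs xs
... | xs′ , ys = (x , xs′) , ys

Π-map : ∀ {C : Set} Xs → C → Π (map (λ X → C → X) Xs) → Π Xs
Π-map []       c xs       = tt
Π-map (X ∷ Xs) c (f , fs) = f c , Π-map Xs c fs

setReg-≡ : ∀ r v ρ → setReg r v ρ r ≡ v
setReg-≡ r v ρ rewrite ≡-T (≡⇒≡ᵇ r r refl) = refl

setReg-≢ : ∀ {r x} v ρ → r ≢ x → setReg r v ρ x ≡ ρ x
setReg-≢ {r} {x} v ρ r≢x with r ≡ᵇ x in e≡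
... | true  = ⊥-elim (r≢x (≡ᵇ⇒≡ r x (T-≡ e≡)))
... | false = refl

setReg-< : ∀ {r x} v ρ → x < r → setReg r v ρ x ≡ ρ x
setReg-< {r} v ρ x<r = setReg-≢ {r} v ρ (λ { refl → <-irrefl refl x<r })

ite-elim : ∀ (P : ℕ → Set) c {x y} Xs Ys → Π (map (λ X → ¬ c ≡ 0 → X) Xs) → Π (map (λ X → c ≡ 0 → X) Ys) →
  (Π Xs → P x) → (Π Ys → P y) → P (if c ≡ᵇ 0 then y else x)
ite-elim P zero    Xs Ys xs ys f g = g (Π-map Ys refl ys)
ite-elim P (suc c) Xs Ys xs ys f g = f (Π-map Xs (λ ()) xs)

-- Expressions, their compilation, and the check against overflow

data Op : Set where
  ADD SUB MUL DIV MOD LT EQ SHR : Op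

toBin : Op → BinOp
toBin ADD = add
toBin SUB = sub
toBin MUL = mul
toBin DIV = div
toBin MOD = mod
toBin LT  = lt
toBin EQ  = eq
toBin SHR = shr

sem : Op → ℕ → ℕ → ℕ
sem ADD a b = a + b
sem SUB a b = a ∸ b
sem MUL a b = a * b
sem DIV a b = a // b
sem MOD a b = a %% b
sem LT  a b = 𝟙 (a <ᵇ b)
sem EQ  a b = 𝟙 (a ≡ᵇ b)
sem SHR a b = a // 2 ^ b

-- The Boolean argument of shl and ld tells whether the result is claimed to
-- be small, that is, below the bound Bd under which products of a few
-- numbers cannot overflow.
data Expr : Set where
  var : Reg → Expr
  con : ℕ → Expr
  bin : Op → Expr → Expr → Expr
  shl : Bool → Expr → Expr → Expr
  ld  : Bool → Expr → Expr
  ite : Expr → Expr → Expr → Expr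

eval : Regs → Mem → Expr → ℕ
eval η m (var x)     = η x
eval η m (con k)     = k
eval η m (bin o a b) = sem o (eval η m a) (eval η m b)
eval η m (shl _ a b) = eval η m a * 2 ^ eval η m b
eval η m (ld _ a)    = m (eval η m a)
eval η m (ite c a b) = if eval η m c ≡ᵇ 0 then eval η m b else eval η m a

-- Registers from `d` on serve as a stack. The code after the expression is passed along as `k`;
-- only the branches of a conditional end in `[]`, because `cond` itself puts the chosen branch in
-- front of the remaining program.
comp : Reg → Expr → Prog → Prog
comp d (var x)     k = op add d (reg x) (lit 0) ∷ k
comp d (con c)     k = op add d (lit c) (lit 0) ∷ k
comp d (bin o a b) k = comp d a (comp (suc d) b (op (toBin o) d (reg d) (reg (suc d)) ∷ k))
comp d (shl _ a b) k = comp d a (comp (suc d) b (op shl d (reg d) (reg (suc d)) ∷ k))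
comp d (ld _ a)    k = comp d a (load d (reg d) ∷ k)
comp d (ite c a b) k = comp d c (cond (reg d) (comp d a []) (comp d b []) ∷ k)

cost : Expr → ℕ
cost (var x)     = 1
cost (con k)     = 1
cost (bin o a b) = cost a + (cost b + 1)
cost (shl _ a b) = cost a + (cost b + 1)
cost (ld _ a)    = cost a + 1
cost (ite c a b) = cost c + suc (cost a + cost b)

comp-++ : ∀ d e k k′ → comp d e k ++ k′ ≡ comp d e (k ++ k′)
comp-++ d (var x)     k k′ = refl
comp-++ d (con c)     k k′ = refl
comp-++ d (bin o a b) k k′ = trans (comp-++ d a _ k′) (cong (comp d a) (comp-++ (suc d) b _ k′))
comp-++ d (shl _ a b) k k′ = trans (comp-++ d a _ k′) (cong (comp d a) (comp-++ (suc d) b _ k′))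
comp-++ d (ld _ a)    k k′ = comp-++ d a _ k′
comp-++ d (ite c a b) k k′ = comp-++ d c _ k′

-- A degree k ≤ 8 stands for the bound Bd ^ k, and 9 for no bound.
deg : Expr → ℕ
deg (var x)         = if x <ᵇ 62 then 1 else 9
deg (con k)         = 1
deg (bin ADD a b)   = suc (deg a ⊔ deg b)
deg (bin SUB a b)   = deg a
deg (bin MUL a b)   = deg a + deg b
deg (bin DIV a b)   = deg a
deg (bin MOD a b)   = deg a ⊓ deg b
deg (bin LT a b)    = 1
deg (bin EQ a b)    = 1
deg (bin SHR a b)   = deg a
deg (shl s a b)     = if s then 1 else 9
deg (ld s a)        = if s then 1 else 9
deg (ite c a b)     = deg a ⊔ deg b

fits : Op → ℕ → Bool
fits ADD d = d ≤ᵇ 8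
fits MUL d = d ≤ᵇ 8
fits _   d = true

chk : Reg → Expr → Bool
chk v (var x)     = x <ᵇ v
chk v (con k)     = k <ᵇ 1000
chk v (bin o a b) = fits o (deg (bin o a b)) ∧ (chk v a ∧ chk v b)
chk v (shl _ a b) = chk v a ∧ chk v b
chk v (ld _ a)    = chk v a
chk v (ite c a b) = chk v c ∧ (chk v a ∧ chk v b)

-- Eight small factors fit into a word. The bound 1000 admits the literals that occur in programs,
-- and `w` is itself small so that it can be used as a number.
record Setting : Set where
  field
    w Bd  : ℕ
    Bd^8≤ : Bd ^ 8 ≤ 2 ^ w
    Bd>   : 1000 ≤ Bd
    w<Bd  : w < Bd

module Compile (S : Setting) where
  open Setting S
  open Machine w
  open Execution w

  -- What the syntactic check cannot decide: addresses read must lie in `A`, shifts must not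
  -- overflow, and results claimed to be small must be so. The obligations of a branch are guarded
  -- by the test. For a concrete expression the list computes, and `Π` of it becomes a plain
  -- product.
  obl : (A : ℕ → Set) → Regs → Mem → Expr → List Set
  obl A η m (var x)     = []
  obl A η m (con k)     = []
  obl A η m (bin o a b) = obl A η m a ++ obl A η m b
  obl A η m (shl s a b) = obl A η m a ++ (obl A η m b ++
    ((eval η m a * 2 ^ eval η m b < (if s then Bd else 2 ^ w)) ∷ []))
  obl A η m (ld s a)    = obl A η m a ++
    (A (eval η m a) ∷ (if s then (m (eval η m a) < Bd) ∷ [] else []))
  obl A η m (ite c a b) = obl A η m c ++
    (map (λ X → ¬ eval η m c ≡ 0 → X) (obl A η m a) ++
     map (λ X → eval η m c ≡ 0 → X) (obl A η m b))

  instance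
    Bd-nonZero : NonZero Bd
    Bd-nonZero = >-nonZero (≤-trans (s≤s z≤n) Bd>)

  2≤Bd : 2 ≤ Bd
  2≤Bd = ≤-trans (s≤s (s≤s z≤n)) Bd>

  Bd≤2^w : Bd ≤ 2 ^ w
  Bd≤2^w = ≤-trans (≤-trans (≤-reflexive (sym (^-identityʳ Bd))) (^-monoʳ-≤ Bd {1} {8} (s≤s z≤n))) Bd^8≤

  -- Register 62 receives the sum of a child processor, which may be a full packed word; the
  -- registers below it hold small numbers.
  record Env (v : Reg) (η : Regs) : Set where
    field
      words : ∀ x → x < v → η x < 2 ^ w
      small : ∀ x → x < v → x < 62 → η x < Bd

  <Bd⇒ : ∀ {a} → a < Bd → a < Bd ^ 1
  <Bd⇒ a< = ≤-trans a< (≤-reflexive (sym (^-identityʳ Bd)))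

  Bd^-mono : ∀ {a i j} → a < Bd ^ i → i ≤ j → a < Bd ^ j
  Bd^-mono a< i≤j = ≤-trans a< (^-monoʳ-≤ Bd i≤j)

  Bd-sum : ∀ {a b} d → a < Bd ^ d → b < Bd ^ d → a + b < Bd ^ suc d
  Bd-sum {a} {b} d a< b< = ≤-trans (+-mono-≤ a< (<⇒≤ b<))
    (≤-trans (≤-reflexive (cong (Bd ^ d +_) (sym (+-identityʳ (Bd ^ d))))) (*-monoˡ-≤ (Bd ^ d) 2≤Bd))

  𝟙<Bd : ∀ b → 𝟙 b < Bd ^ 1
  𝟙<Bd b = <Bd⇒ (≤-trans (s≤s (𝟙≤1 b)) 2≤Bd)

  word-id : ∀ {x} → x < 2 ^ w → word x ≡ x
  word-id x< = m<n⇒m%n≡m {{m^n≢0 2 w}} x<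

  toBin-sem : ∀ o a b → ⟦ toBin o ⟧ a b ≡ sem o a b
  toBin-sem ADD a b       = refl
  toBin-sem SUB a b       = refl
  toBin-sem MUL a b       = refl
  toBin-sem DIV a zero    = refl
  toBin-sem DIV a (suc b) = refl
  toBin-sem MOD a zero    = refl
  toBin-sem MOD a (suc b) = refl
  toBin-sem LT a b        = refl
  toBin-sem EQ a b        = refl
  toBin-sem SHR a b       = sym (//≡/ a (2 ^ b) {{m^n≢0 2 b}})

  module _ {A : ℕ → Set} {m : Mem} (isMem : IsMemory m) {v : Reg} {η : Regs} (env : Env v η) where

    -- Read as a polynomial in `Bd`: a product adds degrees, and a sum costs one degree because `Bd`
    -- is at least 2. Truncated subtraction, division, remainder and right shift never exceed their
    -- first argument, and a remainder never exceeds the divisor either.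
    bound : ∀ e → chk v e ≡ true → Π (obl A η m e) → deg e ≤ 8 → eval η m e < Bd ^ deg e
    bound (var x) c o d≤ with x <ᵇ 62 in e≡
    ... | true  = <Bd⇒ (Env.small env x (<ᵇ⇒< x v (T-≡ c)) (<ᵇ⇒< x 62 (T-≡ e≡)))
    ... | false = ⊥-elim (≤⇒≯ d≤ ≤-refl)
    bound (con k) c o d≤ = <Bd⇒ (≤-trans (<ᵇ⇒< k 1000 (T-≡ c)) Bd>)
    bound (bin ADD a b) c o (s≤s d≤) with ∧-true (proj₂ (∧-true {suc (deg a ⊔ deg b) ≤ᵇ 8} c)) | Π-++ (obl A η m a) o
    ... | ca , cb | oa , ob = Bd-sum (deg a ⊔ deg b)
      (Bd^-mono (bound a ca oa (≤-trans (m≤m⊔n (deg a) (deg b)) (m≤n⇒m≤1+n d≤))) (m≤m⊔n (deg a) (deg b)))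
      (Bd^-mono (bound b cb ob (≤-trans (m≤n⊔m (deg a) (deg b)) (m≤n⇒m≤1+n d≤))) (m≤n⊔m (deg a) (deg b)))
    bound (bin SUB a b) c o d≤ =
      ≤-<-trans (m∸n≤m _ (eval η m b)) (bound a (proj₁ (∧-true c)) (proj₁ (Π-++ (obl A η m a) o)) d≤)
    bound (bin MUL a b) c o d≤ with ∧-true (proj₂ (∧-true {deg a + deg b ≤ᵇ 8} c)) | Π-++ (obl A η m a) o
    ... | ca , cb | oa , ob = subst (eval η m a * eval η m b <_) (sym (^-distribˡ-+-* Bd (deg a) (deg b)))
      (*-mono-< (bound a ca oa (≤-trans (m≤m+n (deg a) (deg b)) d≤))
                (bound b cb ob (≤-trans (m≤n+m (deg b) (deg a)) d≤)))
    bound (bin DIV a b) c o d≤ =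
      ≤-<-trans (//-≤ _ (eval η m b)) (bound a (proj₁ (∧-true c)) (proj₁ (Π-++ (obl A η m a) o)) d≤)
    bound (bin MOD a b) c o d≤ with ∧-true {chk v a} c | Π-++ (obl A η m a) o | ⊓-sel (deg a) (deg b)
    ... | ca , cb | oa , ob | inj₁ e≡ rewrite e≡ = ≤-<-trans (%%-≤ _ (eval η m b)) (bound a ca oa d≤)
    ... | ca , cb | oa , ob | inj₂ e≡ rewrite e≡ = ≤-<-trans (%%-≤ʳ (eval η m a) _) (bound b cb ob d≤)
    bound (bin LT a b) c o d≤ = 𝟙<Bd _
    bound (bin EQ a b) c o d≤ = 𝟙<Bd _
    bound (bin SHR a b) c o d≤ =
      ≤-<-trans (//-≤ _ (2 ^ eval η m b)) (bound a (proj₁ (∧-true c)) (proj₁ (Π-++ (obl A η m a) o)) d≤)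
    bound (shl true a b) c o d≤ =
      <Bd⇒ (proj₁ (proj₂ (Π-++ (obl A η m b) (proj₂ (Π-++ (obl A η m a) o)))))
    bound (shl false a b) c o d≤ = ⊥-elim (≤⇒≯ d≤ ≤-refl)
    bound (ld true a) c o d≤ = <Bd⇒ (proj₁ (proj₂ (proj₂ (Π-++ (obl A η m a) o))))
    bound (ld false a) c o d≤ = ⊥-elim (≤⇒≯ d≤ ≤-refl)
    bound (ite t a b) c o d≤
      with ∧-true (proj₂ (∧-true {chk v t} c))
         | Π-++ (map (λ X → ¬ eval η m t ≡ 0 → X) (obl A η m a)) (proj₂ (Π-++ (obl A η m t) o))
    ... | ca , cb | oa , ob = ite-elim (_< Bd ^ (deg a ⊔ deg b)) (eval η m t) (obl A η m a) (obl A η m b) oa ob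
      (λ oa′ → Bd^-mono (bound a ca oa′ (≤-trans (m≤m⊔n (deg a) (deg b)) d≤)) (m≤m⊔n (deg a) (deg b)))
      (λ ob′ → Bd^-mono (bound b cb ob′ (≤-trans (m≤n⊔m (deg a) (deg b)) d≤)) (m≤n⊔m (deg a) (deg b)))

    fits-word : ∀ e → chk v e ≡ true → Π (obl A η m e) → (deg e ≤ᵇ 8) ≡ true → eval η m e < 2 ^ w
    fits-word e c o d≤ = ≤-trans (Bd^-mono (bound e c o (≤ᵇ⇒≤ (deg e) 8 (T-≡ d≤))) (≤ᵇ⇒≤ (deg e) 8 (T-≡ d≤))) Bd^8≤

    -- Only sums and products can leave the range of words without an obligation, and exactly there
    -- `fits` demands a degree of at most 8. So expressions of degree 9, such as loaded packed
    -- words, may still be divided, shifted to the right or stored.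
    isWord : ∀ e → chk v e ≡ true → Π (obl A η m e) → eval η m e < 2 ^ w
    isWord (var x) c o = Env.words env x (<ᵇ⇒< x v (T-≡ c))
    isWord (con k) c o = ≤-trans (≤-trans (<ᵇ⇒< k 1000 (T-≡ c)) Bd>) Bd≤2^w
    isWord (bin ADD a b) c o = fits-word (bin ADD a b) c o (proj₁ (∧-true c))
    isWord (bin SUB a b) c o = ≤-<-trans (m∸n≤m _ (eval η m b)) (isWord a (proj₁ (∧-true c)) (proj₁ (Π-++ (obl A η m a) o)))
    isWord (bin MUL a b) c o = fits-word (bin MUL a b) c o (proj₁ (∧-true c))
    isWord (bin DIV a b) c o = ≤-<-trans (//-≤ _ (eval η m b)) (isWord a (proj₁ (∧-true c)) (proj₁ (Π-++ (obl A η m a) o)))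
    isWord (bin MOD a b) c o = ≤-<-trans (%%-≤ _ (eval η m b)) (isWord a (proj₁ (∧-true c)) (proj₁ (Π-++ (obl A η m a) o)))
    isWord (bin LT a b) c o = ≤-trans (s≤s (𝟙≤1 (eval η m a <ᵇ eval η m b))) (≤-trans 2≤Bd Bd≤2^w)
    isWord (bin EQ a b) c o = ≤-trans (s≤s (𝟙≤1 (eval η m a ≡ᵇ eval η m b))) (≤-trans 2≤Bd Bd≤2^w)
    isWord (bin SHR a b) c o = ≤-<-trans (//-≤ _ (2 ^ eval η m b)) (isWord a (proj₁ (∧-true c)) (proj₁ (Π-++ (obl A η m a) o)))
    isWord (shl true a b) c o =
      ≤-trans (proj₁ (proj₂ (Π-++ (obl A η m b) (proj₂ (Π-++ (obl A η m a) o))))) Bd≤2^w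
    isWord (shl false a b) c o =
      proj₁ (proj₂ (Π-++ (obl A η m b) (proj₂ (Π-++ (obl A η m a) o))))
    isWord (ld s a) c o = isMem _
    isWord (ite t a b) c o
      with ∧-true (proj₂ (∧-true {chk v t} c))
         | Π-++ (map (λ X → ¬ eval η m t ≡ 0 → X) (obl A η m a)) (proj₂ (Π-++ (obl A η m t) o))
    ... | ca , cb | oa , ob = ite-elim (_< 2 ^ w) (eval η m t) (obl A η m a) (obl A η m b) oa ob
      (isWord a ca) (isWord b cb)

    record Computes (d : Reg) (e : Expr) (ρ : Regs) : Set where
      field
        time   : ℕ
        final  : Regs
        time≤  : time ≤ cost e
        reads  : ∀ k → Reads A m time (comp d e k) ρ k final
        yields : final d ≡ eval η m e
        kept   : ∀ x → x < d → final x ≡ ρ x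

    computes-op : ∀ {d a b ρ} o x (pa : Computes d a ρ) →
      (pb : Computes (suc d) b (Computes.final pa)) →
      word (⟦ o ⟧ (eval η m a) (eval η m b)) ≡ x →
      ∃[ t ] ∃[ ρ′ ] (t ≤ cost a + (cost b + 1)
        × (∀ k → Reads A m t (comp d a (comp (suc d) b (op o d (reg d) (reg (suc d)) ∷ k))) ρ k ρ′)
        × ρ′ d ≡ x × (∀ y → y < d → ρ′ y ≡ ρ y))
    computes-op {d} {a} {b} {ρ} o x pa pb ≡x =
      A.time + (B.time + 1)
      , setReg d (word (⟦ o ⟧ (B.final d) (B.final (suc d)))) B.final
      , +-mono-≤ A.time≤ (+-monoˡ-≤ 1 B.time≤)
      , (λ k → Reads-++ (A.reads _) (Reads-++ (B.reads _) (op∷ nil)))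
      , trans (setReg-≡ d _ B.final) (trans (cong word (cong₂ ⟦ o ⟧ (trans (B.kept d ≤-refl) A.yields) B.yields)) ≡x)
      , (λ y y<d → trans (setReg-< _ B.final y<d) (trans (B.kept y (m≤n⇒m≤1+n y<d)) (A.kept y y<d)))
      where
      module A = Computes pa
      module B = Computes pb

    computes : ∀ d e ρ → v ≤ d → chk v e ≡ true → Π (obl A η m e) →
      (∀ x → x < v → ρ x ≡ η x) → Computes d e ρ
    computes d e@(var x) ρ v≤d c o ρ≡η = record
      { time = 1 ; final = setReg d (word (ρ x + word 0)) ρ ; time≤ = ≤-refl ; reads = λ k → op∷ nil
      ; yields = trans (setReg-≡ d _ ρ) (trans (cong word (trans (cong (ρ x +_) (word-id (m^n>0 2 w))) (trans (+-identityʳ _) (ρ≡η x (<ᵇ⇒< x v (T-≡ c))))))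
                   (word-id (isWord e c o)))
      ; kept = λ y y<d → setReg-< _ ρ y<d }
    computes d e@(con k) ρ v≤d c o ρ≡η = record
      { time = 1 ; final = setReg d (word (word k + word 0)) ρ ; time≤ = ≤-refl ; reads = λ k → op∷ nil
      ; yields = trans (setReg-≡ d _ ρ) (trans (cong word (trans (cong₂ _+_ (word-id (isWord e c o)) (word-id (m^n>0 2 w))) (+-identityʳ _)))
                   (word-id (isWord e c o)))
      ; kept = λ y y<d → setReg-< _ ρ y<d }
    computes d e@(bin f a b) ρ v≤d c o ρ≡η with ∧-true (proj₂ (∧-true {fits f (deg e)} c)) | Π-++ (obl A η m a) o
    ... | ca , cb | oa , ob with computes d a ρ v≤d ca oa ρ≡η
    ... | pa with computes (suc d) b (Computes.final pa) (m≤n⇒m≤1+n v≤d) cb ob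
                    (λ x x<v → trans (Computes.kept pa x (<-≤-trans x<v v≤d)) (ρ≡η x x<v))
    ... | pb with computes-op (toBin f) (sem f (eval η m a) (eval η m b)) pa pb
                    (trans (cong word (toBin-sem f _ _)) (word-id (isWord e c o)))
    ... | t , ρ′ , t≤ , rs , r , kp = record { time = t ; final = ρ′ ; time≤ = t≤ ; reads = rs ; yields = r ; kept = kp }
    computes d e@(shl s a b) ρ v≤d c o ρ≡η with ∧-true {chk v a} c | Π-++ (obl A η m a) o
    ... | ca , cb | oa , ob with computes d a ρ v≤d ca oa ρ≡η
    ... | pa with computes (suc d) b (Computes.final pa) (m≤n⇒m≤1+n v≤d) cb (proj₁ (Π-++ (obl A η m b) ob))
                    (λ x x<v → trans (Computes.kept pa x (<-≤-trans x<v v≤d)) (ρ≡η x x<v))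
    ... | pb with computes-op shl (eval η m a * 2 ^ eval η m b) pa pb (word-id (isWord e c o))
    ... | t , ρ′ , t≤ , rs , r , kp = record { time = t ; final = ρ′ ; time≤ = t≤ ; reads = rs ; yields = r ; kept = kp }
    computes d e@(ld s a) ρ v≤d c o ρ≡η with Π-++ (obl A η m a) o
    ... | oa , acc , _ with computes d a ρ v≤d c oa ρ≡η
    ... | pa = record
      { time = P.time + 1 ; final = setReg d (m (P.final d)) P.final ; time≤ = +-monoˡ-≤ 1 P.time≤
      ; reads = λ k → Reads-++ (P.reads _) (load∷ (subst A (sym P.yields) acc) nil)
      ; yields = trans (setReg-≡ d _ P.final) (cong m P.yields)
      ; kept = λ y y<d → trans (setReg-< _ P.final y<d) (P.kept y y<d) }
      where module P = Computes pa
    computes d (ite t a b) ρ v≤d c o ρ≡η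
      with ∧-true {chk v t} c | Π-++ (obl A η m t) o
    ... | ct , cab | ot , oab with ∧-true {chk v a} cab
      | Π-++ (map (λ X → ¬ eval η m t ≡ 0 → X) (obl A η m a)) oab | computes d t ρ v≤d ct ot ρ≡η
    ... | ca , cb | oa , ob | pt = go (eval η m t ≡ᵇ 0) refl
      where
      module P = Computes pt
      agree : ∀ x → x < v → P.final x ≡ η x
      agree x x<v = trans (P.kept x (<-≤-trans x<v v≤d)) (ρ≡η x x<v)
      select : ∀ {e′} {z : Bool} → (eval η m t ≡ᵇ 0) ≡ z → (if z then b else a) ≡ e′ →
        (pb : Computes d e′ P.final) → Computes d (ite t a b) ρ
      select {z = z} z≡ refl pb = record
        { time = P.time + suc Q.time ; final = Q.final
        ; time≤ = +-mono-≤ P.time≤ (s≤s (≤-trans Q.time≤ (cost≤ z)))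
        ; reads = λ k → Reads-++ (P.reads _) (cond∷ (subst (λ y → Reads A m Q.time y P.final k Q.final) (branch z k z≡) (Q.reads k)))
        ; yields = trans Q.yields (value≡ z z≡)
        ; kept = λ y y<d → trans (Q.kept y y<d) (P.kept y y<d) }
        where
        module Q = Computes pb
        cost≤ : ∀ z → cost (if z then b else a) ≤ cost a + cost b
        cost≤ true  = m≤n+m (cost b) (cost a)
        cost≤ false = m≤m+n (cost a) (cost b)
        branch : ∀ z k → (eval η m t ≡ᵇ 0) ≡ z → comp d (if z then b else a) k ≡ (if P.final d ≡ᵇ 0 then comp d b [] else comp d a []) ++ k
        branch true  k z≡ rewrite P.yields | z≡ = sym (comp-++ d b [] k)
        branch false k z≡ rewrite P.yields | z≡ = sym (comp-++ d a [] k)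
        value≡ : ∀ z → (eval η m t ≡ᵇ 0) ≡ z → eval η m (if z then b else a) ≡ (if eval η m t ≡ᵇ 0 then eval η m b else eval η m a)
        value≡ true  z≡ rewrite z≡ = refl
        value≡ false z≡ rewrite z≡ = refl
      go : ∀ z → (eval η m t ≡ᵇ 0) ≡ z → Computes d (ite t a b) ρ
      go true  z≡ = select z≡ refl (computes d b P.final v≤d cb
        (Π-map (obl A η m b) (≡ᵇ⇒≡ _ 0 (T-≡ z≡)) ob) agree)
      go false z≡ = select z≡ refl (computes d a P.final v≤d ca
        (Π-map (obl A η m a) (λ e≡ → true≢false (trans (sym (≡-T (≡⇒≡ᵇ _ 0 e≡))) z≡)) oa) agree)
        where
        true≢false : ¬ true ≡ false
        true≢false ()

-- Statements: assignments, sums, parallel fills, and their costs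

sumBody : Expr → Prog
sumBody body = comp 65 body
  (op add 62 (reg 62) (reg 65) ∷ op add 61 (reg 61) (lit 1) ∷ op lt 64 (reg 61) (reg 63) ∷ [])

-- Register 61 is the index, 62 the accumulator, 63 the limit, which is evaluated once, and 64 the
-- loop test. Stack registers of the body begin at 65.
sumCode : Expr → Expr → Prog → Prog
sumCode lim body k =
  op add 62 (lit 0) (lit 0) ∷ op add 61 (lit 0) (lit 0) ∷
  comp 63 lim (op lt 64 (reg 61) (reg 63) ∷ while (reg 64) (sumBody body) ∷ k)

sumCode-++ : ∀ lim body k k′ → sumCode lim body k ++ k′ ≡ sumCode lim body (k ++ k′)
sumCode-++ lim body k k′ = cong (λ p → op add 62 (lit 0) (lit 0) ∷ op add 61 (lit 0) (lit 0) ∷ p) (comp-++ 63 lim _ k′)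

opaque
  assign : Reg → Expr → Prog
  assign x e = comp 65 e (op add x (reg 65) (lit 0) ∷ [])

okAssign : Reg → Expr → Bool
okAssign x e = chk 61 e ∧ ((cost e ≤ᵇ 400) ∧ (x <ᵇ 60))

-- Register 61 ranges over the indices of the sum.
opaque
  assignSum : Reg → (lim body : Expr) → Prog
  assignSum x lim body = sumCode lim body (op add x (reg 62) (lit 0) ∷ [])

okAssignSum : Reg → (lim body : Expr) → Bool
okAssignSum x lim body = chk 61 lim ∧ (chk 62 body ∧ ((cost lim + cost body ≤ᵇ 400) ∧ (x <ᵇ 60)))

-- Reserves size cells at the frontier (register 59), whose old content goes to
-- base.  For every k < kids a processor with k in register 60 computes
-- the sum over i < limit (i in register 61) of body into register 62 and
-- then stores content at the given offset in the reserved cells.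
record Fill : Set where
  constructor fill
  field
    base : Reg
    size kids limit body offset content : Expr

kidCode : Fill → Prog
kidCode f = sumCode limit body
  (comp 65 (bin ADD (var 59) offset) (comp 66 content (store (reg 65) (reg 66) ∷ [])))
  where open Fill f

opaque
  alloc : Fill → Prog
  alloc f = comp 65 kids (comp 66 size
    (par 60 (reg 65) (kidCode f) ∷ op add base (reg 59) (lit 0) ∷ op add 59 (reg 59) (reg 66) ∷ []))
    where open Fill f

okFill : Fill → Bool
okFill f = (chk 61 size ∧ chk 61 kids) ∧ ((chk 61 limit ∧ chk 62 body) ∧
  ((chk 63 (bin ADD (var 59) offset) ∧ chk 63 content) ∧
   ((cost size + cost kids + cost limit + cost body + cost offset + cost content ≤ᵇ 400) ∧ (base <ᵇ 59))))
  where open Fill f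

opaque
  loop : Reg → Prog → Prog
  loop f body = while (reg f) (body ++ op sub f (reg f) (lit 1) ∷ []) ∷ []

≤-slack : ∀ {a b} k → b ≡ a + k → a ≤ b
≤-slack {a} k b≡ = subst (a ≤_) (sym b≡) (m≤m+n a k)

slack : ∀ {a b} → a ≤ b → ∃[ k ] b ≡ a + k
slack a≤b = _ , sym (m+[n∸m]≡n a≤b)

pre-cost : ∀ a b c → a + b + c ≤ 400 → b + a ≤ 400
pre-cost a b c h = ≤-trans (≤-reflexive (+-comm b a)) (≤-trans (m≤m+n (a + b) c) h)

regroup : ∀ a b c d e → a + (b + c + d + e) ≡ a + b + c + d + e
regroup = solve-∀

-- Opaque, since otherwise comparing two bounds may unfold the constants.
opaque
  sumTime kidTime allocTime : ℕ → ℕ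
  sumTime ℓ = 405 * suc ℓ
  kidTime ℓ = 410 * suc ℓ
  allocTime ℓ = 900 * suc ℓ

  allocWork : (N ℓ : ℕ) → ℕ
  allocWork N ℓ = 900 * (suc N * suc ℓ)

  sumTime≡ : ∀ ℓ → sumTime ℓ ≡ 405 * suc ℓ
  sumTime≡ ℓ = refl

  allocTime≡ : ∀ ℓ → allocTime ℓ ≡ 900 * suc ℓ
  allocTime≡ ℓ = refl

  allocWork≡ : ∀ N ℓ → allocWork N ℓ ≡ 900 * (suc N * suc ℓ)
  allocWork≡ N ℓ = refl

  kidTime-mono : ∀ {ℓ ℓ′} → ℓ ≤ ℓ′ → kidTime ℓ ≤ kidTime ℓ′
  kidTime-mono p = *-monoʳ-≤ 410 (s≤s p)

  sum-cost : ∀ c₁ c₂ ℓ → c₁ + c₂ ≤ 400 → c₁ + 4 + ℓ * (c₂ + 4) + 1 ≤ sumTime ℓ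
  sum-cost c₁ c₂ ℓ c≤ = begin
    c₁ + 4 + ℓ * (c₂ + 4) + 1     ≤⟨ +-monoˡ-≤ 1 (+-mono-≤ (+-monoˡ-≤ 4 (≤-trans (m≤m+n c₁ c₂) c≤))
                                       (*-monoʳ-≤ ℓ {c₂ + 4} {405} (≤-trans (+-monoˡ-≤ 4 (≤-trans (m≤n+m c₂ c₁) c≤)) (n≤1+n 404)))) ⟩
    404 + ℓ * 405 + 1             ≡⟨ trans (+-comm (404 + ℓ * 405) 1) (*-comm (suc ℓ) 405) ⟩
    405 * suc ℓ                   ∎
    where open ≤-Reasoning

  -- Writing 400 as the total cost plus a slack `d` turns the inequality into a ring identity in
  -- which the difference of the two sides is explicit. The bound for the time of a fill is obtained
  -- in the same way.
  kid-cost : ∀ c₀ c₁ c₂ c₃ c₄ ℓ → c₀ + c₁ + c₂ + c₃ + c₄ ≤ 400 →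
    suc (c₁ + 4 + ℓ * (c₂ + 4) + (1 + (c₃ + 1) + c₄)) ≤ kidTime ℓ
  kid-cost c₀ c₁ c₂ c₃ c₄ ℓ c≤ with slack c≤
  ... | d , e≡ = ≤-slack (c₀ + c₂ + d + 3 + ℓ * (c₀ + c₁ + c₃ + c₄ + d + 6))
    (trans (cong (λ z → (10 + z) * suc ℓ) {400} e≡) (lemma c₀ c₁ c₂ c₃ c₄ ℓ d))
    where
    lemma : ∀ c₀ c₁ c₂ c₃ c₄ ℓ d → (10 + (c₀ + c₁ + c₂ + c₃ + c₄ + d)) * suc ℓ ≡
      suc (c₁ + 4 + ℓ * (c₂ + 4) + (1 + (c₃ + 1) + c₄)) + (c₀ + c₂ + d + 3 + ℓ * (c₀ + c₁ + c₃ + c₄ + d + 6))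
    lemma = solve-∀

  alloc-time : ∀ p ℓ T → p ≤ 400 → p + (1 + (suc (kidTime ℓ) + (2 + T))) ≤ allocTime ℓ + T
  alloc-time p ℓ T p≤ with slack p≤
  ... | d , e≡ = ≤-slack (d + 86 + ℓ * (90 + 400)) (trans (cong (λ z → (500 + z) * suc ℓ + T) {400} e≡) (trans (lemma p ℓ T d)
    (cong (λ z → p + (1 + (suc (410 * suc ℓ) + (2 + T))) + (d + 86 + ℓ * (90 + z))) (sym e≡))))
    where
    lemma : ∀ p ℓ T d → (500 + (p + d)) * suc ℓ + T ≡
      p + (1 + (suc (410 * suc ℓ) + (2 + T))) + (d + 86 + ℓ * (90 + (p + d)))
    lemma = solve-∀

  alloc-work : ∀ p N U ℓ K → p ≤ 400 → U ≤ N * kidTime ℓ → p + (1 + N + (suc U + (2 + K))) ≤ allocWork N ℓ + K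
  alloc-work p N U ℓ K p≤ U≤ = begin
    p + (1 + N + (suc U + (2 + K)))                       ≤⟨ +-mono-≤ p≤ (+-monoʳ-≤ (1 + N) (+-monoˡ-≤ (2 + K) (s≤s U≤))) ⟩
    400 + (1 + N + (suc (N * (410 * suc ℓ)) + (2 + K)))   ≤⟨ ≤-slack (496 + N * 489 + 900 * ℓ + N * ℓ * 490) (lemma N ℓ K) ⟩
    900 * (suc N * suc ℓ) + K                             ∎
    where
    open ≤-Reasoning
    lemma : ∀ N ℓ K → 900 * (suc N * suc ℓ) + K ≡
      400 + (1 + N + (suc (N * (410 * suc ℓ)) + (2 + K))) + (496 + N * 489 + 900 * ℓ + N * ℓ * 490)
    lemma = solve-∀

-- A program logic with bounds on time and work

module Logic (S : Setting) where
  open Setting S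
  open Machine w
  open Execution w
  open Compile S

  record Good (η : Regs) (m : Mem) : Set where
    field
      small : ∀ x → x < 61 → η x < Bd
      words : IsMemory m

  -- `env` is an idealised register state that matches the real one only below 61. The contents of
  -- the scratch registers are thereby forgotten between statements.
  record Ends (choose : Resolver) (c : Config) (rest : Prog) (k T K : ℕ) (Q : Regs → Mem → Set) : Set where
    constructor ends
    field
      {time work} : ℕ
      {regs env}  : Regs
      {mem}       : Mem
      time≤ : time ≤ T
      work≤ : work ≤ K
      runs  : after choose time c ≡ config (run rest regs) mem (k + work)
      good  : Good env mem
      agree : ∀ x → x < 61 → regs x ≡ env x
      post  : Q env mem

  -- T bounds the number of time steps and K that of operations.
  Spec : Prog → Regs → Mem → (T K : ℕ) → (Regs → Mem → Set) → Set
  Spec p η m T K Q = Good η m → ∀ ρ → (∀ x → x < 61 → ρ x ≡ η x) →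
    ∀ choose rest k → Ends choose (config (run (p ++ rest) ρ) m k) rest k T K Q

  Ends-≤ : ∀ {choose c rest k T K T′ K′ Q} → T ≤ T′ → K ≤ K′ →
    Ends choose c rest k T K Q → Ends choose c rest k T′ K′ Q
  Ends-≤ p q (ends t≤ k≤ r g a po) = ends (≤-trans t≤ p) (≤-trans k≤ q) r g a po

  Ends-after : ∀ {choose c th m rest k T K Q} s j →
    after choose s c ≡ config th m (k + j) →
    Ends (λ r → choose (r + s)) (config th m (k + j)) rest (k + j) T K Q →
    Ends choose c rest k (s + T) (j + K) Q
  Ends-after {choose} {c} {k = k} s j e≡ (ends {time} {work} t≤ k≤ r g a po) = ends
    (≤-trans (≤-reflexive (+-comm time s)) (+-monoʳ-≤ s t≤)) (+-monoʳ-≤ j k≤)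
    (trans (after-+ choose time s c) (trans (cong (after _ time) e≡) (trans r (cong (config _ _) (+-assoc k j work)))))
    g a po

  Ends-reads : ∀ {choose A t p ρ p′ ρ′ m rest k T K Q} → Reads A m t p ρ p′ ρ′ →
    (∀ ch → Ends ch (config (run p′ ρ′) m (k + t)) rest (k + t) T K Q) →
    Ends choose (config (run p ρ) m k) rest k (t + T) (t + K) Q
  Ends-reads {choose} {t = t} {k = k} rs e = Ends-after t t (Reads-after rs choose k) (e _)

  Spec-≤ : ∀ {p η m T K T′ K′ Q} → T ≤ T′ → K ≤ K′ → Spec p η m T K Q → Spec p η m T′ K′ Q
  Spec-≤ p q s g ρ a ch rest k = Ends-≤ p q (s g ρ a ch rest k)

  Spec-[] : ∀ {η m Q} → Q η m → Spec [] η m 0 0 Q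
  Spec-[] q g ρ a ch rest k = ends ≤-refl ≤-refl (cong (config _ _) (sym (+-identityʳ k))) g a q

  Spec-++ : ∀ {p p′ η m T K T′ K′ Q Q′} → Spec p η m T K Q →
    (∀ η′ m′ → Q η′ m′ → Spec p′ η′ m′ T′ K′ Q′) →
    Spec (p ++ p′) η m (T + T′) (K + K′) Q′
  Spec-++ {p} {p′} s s′ g ρ a ch rest k with s g ρ a ch (p′ ++ rest) k
  ... | ends {t} {j} t≤ k≤ r g′ a′ po =
    Ends-≤ (+-monoˡ-≤ _ t≤) (+-monoˡ-≤ _ k≤)
      (Ends-after t j (trans (cong (λ q → after ch t (config (run q ρ) _ k)) (++-assoc p p′ rest)) r)
        (s′ _ _ po g′ _ a′ _ rest (k + j)))

  good-env : ∀ {η m} → Good η m → Env 61 η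
  good-env g = record
    { words = λ x x< → <-≤-trans (Good.small g x x<) Bd≤2^w ; small = λ x x< _ → Good.small g x x< }

  below-suc : ∀ {x r} → x < suc r → r ≢ x → x < r
  below-suc (s≤s x≤) r≢x = ≤∧≢⇒< x≤ (r≢x ∘ sym)

  setReg-elim : ∀ {r v : ℕ} {η : Regs} {x} (P : ℕ → Set) → (r ≡ x → P v) → (r ≢ x → P (η x)) → P (setReg r v η x)
  setReg-elim {r} {v} {η} {x} P f g with r ≡ᵇ x in e≡
  ... | true  = f (≡ᵇ⇒≡ r x (T-≡ e≡))
  ... | false = g (λ { refl → false≢true (trans (sym e≡) (≡-T (≡⇒≡ᵇ r r refl))) })
    where
    false≢true : ¬ false ≡ true
    false≢true ()

  env-set : ∀ {r v η} → Env r η → v < Bd → Env (suc r) (setReg r v η)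
  env-set {r} {v} {η} e v< = record
    { words = λ x x< → setReg-elim {r} {v} {η} (_< 2 ^ w) (λ _ → <-≤-trans v< Bd≤2^w) (λ r≢x → Env.words e x (below-suc x< r≢x))
    ; small = λ x x< x<62 → setReg-elim {r} {v} {η} (_< Bd) (λ _ → v<) (λ r≢x → Env.small e x (below-suc x< r≢x) x<62) }

  env-set-word : ∀ {v η} → Env 62 η → v < 2 ^ w → Env 63 (setReg 62 v η)
  env-set-word {v} {η} e v< = record
    { words = λ x x< → setReg-elim {62} {v} {η} (_< 2 ^ w) (λ _ → v<) (λ r≢x → Env.words e x (below-suc x< r≢x))
    ; small = λ x x< x<62 → setReg-elim {62} {v} {η} (_< Bd) (λ { refl → ⊥-elim (<-irrefl refl x<62) })
        (λ r≢x → Env.small e x (below-suc x< r≢x) x<62) }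

  good-set : ∀ {r v η m} → Good η m → v < Bd → Good (setReg r v η) m
  good-set {r} {v} {η} g v< = record
    { small = λ x x< → setReg-elim {r} {v} {η} (_< Bd) (λ _ → v<) (λ _ → Good.small g x x<) ; words = Good.words g }

  agree-set : ∀ {ρ η : Regs} {r v u B} → v ≡ u → (∀ x → x < B → ρ x ≡ η x) →
    ∀ x → x < B → setReg r v ρ x ≡ setReg r u η x
  agree-set {ρ} {η} {r} {v} {u} v≡u a x x< with r ≡ᵇ x
  ... | true  = v≡u
  ... | false = a x x<

  agree-< : ∀ {ρ ρ′ η : Regs} {d B : ℕ} → (∀ x → x < d → ρ′ x ≡ ρ x) → B ≤ d →
    (∀ x → x < B → ρ x ≡ η x) → ∀ x → x < B → ρ′ x ≡ η x
  agree-< kept B≤d a x x< = trans (kept x (<-≤-trans x< B≤d)) (a x x<)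

  word-0 : word 0 ≡ 0
  word-0 = word-id (m^n>0 2 w)

  word-1 : word 1 ≡ 1
  word-1 = word-id (<-≤-trans 2≤Bd Bd≤2^w)

  word-+0 : ∀ {x} → x < 2 ^ w → word (x + word 0) ≡ x
  word-+0 {x} x< = trans (cong word (trans (cong (x +_) word-0) (+-identityʳ x))) (word-id x<)

  word-truth : ∀ b → word (truth b) ≡ 𝟙 b
  word-truth true  = word-1
  word-truth false = word-0

  module Sum {A : ℕ → Set} {m : Mem} (isMem : IsMemory m) {η : Regs} (env : Env 61 η)
    (lim body : Expr) (chkLim : chk 61 lim ≡ true) (chkBody : chk 62 body ≡ true)
    (oblLim : Π (obl A η m lim)) where

    ℓ : ℕ
    ℓ = eval η m lim

    term : ℕ → ℕ
    term i = eval (setReg 61 i η) m body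

    module _ (ℓ<Bd : ℓ < Bd) (oblBody : ∀ i → i < ℓ → Π (obl A (setReg 61 i η) m body)) (∑<2^w : ∑ term ℓ < 2 ^ w) where

      record State (i : ℕ) (ρ : Regs) : Set where
        field
          vars    : ∀ x → x < 61 → ρ x ≡ η x
          index   : ρ 61 ≡ i
          acc     : ρ 62 ≡ ∑ term i
          limit≡  : ρ 63 ≡ ℓ
          flag    : ρ 64 ≡ 𝟙 (i <ᵇ ℓ)

      Loops : (r i : ℕ) → Regs → Set
      Loops r i ρ = ∃[ t ] ∃[ ρ′ ] (t ≤ suc (r * (cost body + 4))
        × (∀ k → Reads A m t (while (reg 64) (sumBody body) ∷ k) ρ k ρ′) × State ℓ ρ′)

      loops : ∀ r i ρ → r + i ≡ ℓ → State i ρ → Loops r i ρ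
      loops zero i ρ refl st = 1 , ρ , s≤s z≤n , (λ k → while∷ (subst (λ p → Reads A m 0 p ρ k ρ) (sym (exit k)) nil)) , st
        where
        exit : ∀ k → (if ρ 64 ≡ᵇ 0 then k else sumBody body ++ while (reg 64) (sumBody body) ∷ k) ≡ k
        exit k rewrite State.flag st with ℓ <ᵇ ℓ in e≡
        ... | true  = ⊥-elim (<-irrefl refl (<ᵇ⇒< ℓ ℓ (T-≡ e≡)))
        ... | false = refl
      loops (suc r) i ρ r≡ st
        with computes isMem (env-set {61} {i} {η} env (<-trans i<ℓ ℓ<Bd)) 65 body ρ (m≤n+m 62 3) chkBody (oblBody i i<ℓ) agree
        where
        i<ℓ : i < ℓ
        i<ℓ = ≤-trans (s≤s (m≤n+m i r)) (≤-reflexive r≡)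
        agree : ∀ x → x < 62 → ρ x ≡ setReg 61 i η x
        agree x x< = setReg-elim {61} {i} {η} (ρ x ≡_) (λ { refl → State.index st }) (λ ne → State.vars st x (below-suc x< ne))
      ... | pc = again (loops r (suc i) ρ₃ (trans (+-suc r i) r≡) st′)
        where
        module C = Computes pc
        i<ℓ : i < ℓ
        i<ℓ = ≤-trans (s≤s (m≤n+m i r)) (≤-reflexive r≡)
        ρ₁ ρ₂ ρ₃ : Regs
        ρ₁ = setReg 62 (word (C.final 62 + C.final 65)) C.final
        ρ₂ = setReg 61 (word (C.final 61 + word 1)) ρ₁
        ρ₃ = setReg 64 (word (truth (ρ₂ 61 <ᵇ C.final 63))) ρ₂
        index≡ : word (C.final 61 + word 1) ≡ suc i
        index≡ = trans (cong word (trans (cong₂ _+_ (trans (C.kept 61 (m≤n+m 62 3)) (State.index st)) word-1) (+-comm i 1)))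
          (word-id (<-≤-trans (≤-<-trans i<ℓ ℓ<Bd) Bd≤2^w))
        vars′ : ∀ x → x < 61 → ρ₃ x ≡ η x
        vars′ x x< = trans (setReg-< {64} _ ρ₂ (<-trans x< (m≤n+m 62 2)))
          (trans (setReg-< {61} _ ρ₁ x<) (trans (setReg-< {62} _ C.final (<-trans x< ≤-refl))
            (trans (C.kept x (<-trans x< (m≤n+m 62 3))) (State.vars st x x<))))
        st′ : State (suc i) ρ₃
        st′ = record
          { vars = vars′
          ; index = index≡
          ; acc = trans (cong word (cong₂ _+_ (trans (C.kept 62 (m≤n+m 63 2)) (State.acc st)) C.yields))
                    (word-id (≤-<-trans (∑-mono term i<ℓ) ∑<2^w))
          ; limit≡ = trans (C.kept 63 (m≤n+m 64 1)) (State.limit≡ st)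
          ; flag = trans (word-truth _) (cong 𝟙 (cong₂ _<ᵇ_ index≡ (trans (C.kept 63 (m≤n+m 64 1)) (State.limit≡ st)))) }
        enter : ∀ k → (if ρ 64 ≡ᵇ 0 then k else sumBody body ++ while (reg 64) (sumBody body) ∷ k)
          ≡ comp 65 body (op add 62 (reg 62) (reg 65) ∷ op add 61 (reg 61) (lit 1) ∷ op lt 64 (reg 61) (reg 63) ∷ while (reg 64) (sumBody body) ∷ k)
        enter k rewrite State.flag st | ≡-T (<⇒<ᵇ i<ℓ) = comp-++ 65 body _ _
        again : Loops r (suc i) ρ₃ → Loops (suc r) i ρ
        again (t , ρ′ , t≤ , rs , st″) = suc (C.time + (3 + t)) , ρ′
          , s≤s (≤-trans (+-mono-≤ C.time≤ (+-monoʳ-≤ 3 t≤)) (≤-reflexive time≡))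
          , (λ k → while∷ (subst (λ p → Reads A m _ p ρ k ρ′) (sym (enter k))
              (Reads-++ (C.reads _) (op∷ (op∷ (op∷ (rs k)))))))
          , st″
          where
          time≡ : cost body + (3 + suc (r * (cost body + 4))) ≡ suc r * (cost body + 4)
          time≡ = sym (+-assoc (cost body) 4 (r * (cost body + 4)))

      record Summed (ρ : Regs) : Set where
        field
          time  : ℕ
          final : Regs
          time≤ : time ≤ cost lim + 4 + ℓ * (cost body + 4)
          reads : ∀ k → Reads A m time (sumCode lim body k) ρ k final
          agree : ∀ x → x < 63 → final x ≡ setReg 62 (∑ term ℓ) (setReg 61 ℓ η) x

      summed : ∀ ρ → (∀ x → x < 61 → ρ x ≡ η x) → Summed ρ
      summed ρ ρ≡η with computes isMem env 63 lim ρ₂ (m≤n+m 61 2) chkLim oblLim agree₂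
        where
        ρ₁ ρ₂ : Regs
        ρ₁ = setReg 62 (word (word 0 + word 0)) ρ
        ρ₂ = setReg 61 (word (word 0 + word 0)) ρ₁
        agree₂ : ∀ x → x < 61 → ρ₂ x ≡ η x
        agree₂ x x< = trans (setReg-< {61} _ ρ₁ x<) (trans (setReg-< {62} _ ρ (<-trans x< ≤-refl)) (ρ≡η x x<))
      ... | pc = finish (loops ℓ 0 ρ₃ (+-identityʳ ℓ) st)
        where
        module C = Computes pc
        ρ₃ : Regs
        ρ₃ = setReg 64 (word (truth (C.final 61 <ᵇ C.final 63))) C.final
        zero≡ : word (word 0 + word 0) ≡ 0
        zero≡ = trans (cong (λ z → word (z + z)) word-0) word-0
        st : State 0 ρ₃
        st = record
          { vars = λ x x< → trans (setReg-< {64} _ C.final (<-trans x< (m≤n+m 62 2)))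
              (trans (C.kept x (<-trans x< (m≤n+m 62 1)))
                (trans (setReg-< {61} _ (setReg 62 (word (word 0 + word 0)) ρ) x<) (trans (setReg-< {62} _ ρ (<-trans x< ≤-refl)) (ρ≡η x x<))))
          ; index = trans (C.kept 61 (m≤n+m 62 1)) zero≡
          ; acc = trans (C.kept 62 ≤-refl) zero≡
          ; limit≡ = C.yields
          ; flag = trans (word-truth _) (cong 𝟙 (cong₂ _<ᵇ_ (trans (C.kept 61 (m≤n+m 62 1)) zero≡) C.yields)) }
        finish : Loops ℓ 0 ρ₃ → Summed ρ
        finish (t , ρ′ , t≤ , rs , st′) = record
          { time = 2 + (C.time + suc t)
          ; final = ρ′
          ; time≤ = ≤-trans (+-monoʳ-≤ 2 (+-mono-≤ C.time≤ (s≤s t≤))) (≤-reflexive time≡)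
          ; reads = λ k → op∷ (op∷ (Reads-++ (C.reads _) (op∷ (rs k))))
          ; agree = λ x x< → setReg-elim {62} {∑ term ℓ} {setReg 61 ℓ η} (ρ′ x ≡_) (λ { refl → State.acc st′ })
              (λ ne → setReg-elim {61} {ℓ} {η} (ρ′ x ≡_) (λ { refl → State.index st′ })
                (λ ne′ → State.vars st′ x (below-suc (below-suc x< ne) ne′))) }
          where
          time≡ : 2 + (cost lim + (2 + ℓ * (cost body + 4))) ≡ cost lim + 4 + ℓ * (cost body + 4)
          time≡ = trans (cong (2 +_) (sym (+-assoc (cost lim) 2 _)))
            (cong (_+ ℓ * (cost body + 4)) (trans (+-comm 2 (cost lim + 2)) (+-assoc (cost lim) 2 2)))

  Any : ℕ → Set
  Any _ = ⊤

  opaque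
    unfolding assign

    Spec-assign : ∀ {x e η m T K Q rest} → okAssign x e ≡ true →
      (Good η m → Π (obl Any η m e)) → (Good η m → eval η m e < Bd) →
      Spec rest (setReg x (eval η m e) η) m T K Q →
      Spec (assign x e ++ rest) η m (401 + T) (401 + K) Q
    Spec-assign {x} {e} {η} {m} {rest = rest} ok o small s g ρ a ch rest′ k
      with ∧-true {chk 61 e} ok
    ... | c , ok′ with ∧-true {cost e ≤ᵇ 400} ok′
    ... | ce , cx = Ends-≤ (+-monoˡ-≤ _ t≤) (+-monoˡ-≤ _ t≤)
      (Ends-reads (subst (λ p → Reads Any m (C.time + 1) p ρ (rest ++ rest′) ρ₁) (sym code≡)
          (Reads-++ (C.reads _) (op∷ nil)))
        (λ ch′ → s (good-set {x} g (small g)) ρ₁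
          (agree-set {C.final} {η} {x} (trans (cong (λ z → word (z + word 0)) C.yields) (word-+0 (isWord (Good.words g) (good-env g) e c (o g))))
            (agree-< {ρ} {C.final} {η} {65} C.kept (m≤n+m 61 4) a)) ch′ rest′ _))
      where
      module C = Computes (computes (Good.words g) (good-env g) 65 e ρ (m≤n+m 61 4) c (o g) a)
      ρ₁ : Regs
      ρ₁ = setReg x (word (C.final 65 + word 0)) C.final
      t≤ : C.time + 1 ≤ 401
      t≤ = +-monoˡ-≤ 1 (≤-trans C.time≤ (≤ᵇ⇒≤ (cost e) 400 (T-≡ ce)))
      code≡ : (assign x e ++ rest) ++ rest′ ≡ comp 65 e (op add x (reg 65) (lit 0) ∷ (rest ++ rest′))
      code≡ = trans (++-assoc (assign x e) rest rest′) (comp-++ 65 e _ _)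

  opaque
    unfolding assignSum

    Spec-assignSum : ∀ {x lim body η m T K Q rest} → okAssignSum x lim body ≡ true →
      (Good η m → Π (obl Any η m lim)) → (Good η m → eval η m lim < Bd) →
      (Good η m → ∀ i → i < eval η m lim → Π (obl Any (setReg 61 i η) m body)) →
      ∑ (λ i → eval (setReg 61 i η) m body) (eval η m lim) < Bd →
      Spec rest (setReg x (∑ (λ i → eval (setReg 61 i η) m body) (eval η m lim)) η) m T K Q →
      Spec (assignSum x lim body ++ rest) η m (sumTime (eval η m lim) + T) (sumTime (eval η m lim) + K) Q
    Spec-assignSum {x} {lim} {body} {η} {m} {rest = rest} ok oℓ ℓ< ob small s g ρ a ch rest′ k
      with ∧-true {chk 61 lim} ok
    ... | cℓ , ok′ with ∧-true {chk 62 body} ok′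
    ... | cb , ok″ with ∧-true {cost lim + cost body ≤ᵇ 400} ok″
    ... | ce , cx = Ends-≤ (+-monoˡ-≤ _ t≤) (+-monoˡ-≤ _ t≤)
      (Ends-reads (subst (λ p → Reads Any m (Z.time + 1) p ρ (rest ++ rest′) ρ₁) (sym code≡)
          (Reads-++ (Z.reads _) (op∷ nil)))
        (λ ch′ → s (good-set {x} g small) ρ₁
          (agree-set {Z.final} {η} {x} (trans (cong (λ z → word (z + word 0)) (Z.agree 62 ≤-refl)) (word-+0 (<-≤-trans small Bd≤2^w)))
            (λ y y< → trans (Z.agree y (<-trans y< (m≤n+m 62 1)))
               (trans (setReg-< {62} _ (setReg 61 (eval η m lim) η) (<-trans y< ≤-refl)) (setReg-< {61} _ η y<)))) ch′ rest′ _))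
      where
      module Σ′ = Sum (Good.words g) (good-env g) lim body cℓ cb (oℓ g)
      module Z = Σ′.Summed (Σ′.summed (ℓ< g) (ob g) (<-≤-trans small Bd≤2^w) ρ a)
      ρ₁ : Regs
      ρ₁ = setReg x (word (Z.final 62 + word 0)) Z.final
      t≤ : Z.time + 1 ≤ sumTime (eval η m lim)
      t≤ = ≤-trans (+-monoˡ-≤ 1 Z.time≤) (sum-cost (cost lim) (cost body) (eval η m lim) (≤ᵇ⇒≤ _ 400 (T-≡ ce)))
      code≡ : (assignSum x lim body ++ rest) ++ rest′ ≡ sumCode lim body (op add x (reg 62) (lit 0) ∷ (rest ++ rest′))
      code≡ = trans (++-assoc (assignSum x lim body) rest rest′) (sumCode-++ lim body _ _)

  kept-at : ∀ {r x v u} (ρ : Regs) → r < 59 → 59 ≤ x → ρ x ≡ u → setReg r v ρ x ≡ u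
  kept-at {r} {x} {v} ρ r< x≥ ρ≡ = trans (setReg-≢ {r} {x} v ρ (λ r≡x → <-irrefl r≡x (<-≤-trans r< x≥))) ρ≡

  word-sum : ∀ {a b c d} → a ≡ c → b ≡ d → c + d < 2 ^ w → word (a + b) ≡ c + d
  word-sum refl refl c+d< = word-id c+d<

  kids-list : ∀ {A m r} (α ν : ℕ → ℕ) (th : ℕ → Thread) is →
    (∀ i → i ∈ is → ∃[ x ] (x ≤ r × Kid A m m (α i) (ν i) (th i) x)) →
    ∃[ U ] (U ≤ length is * r × Kids A m m (map (λ i → α i , ν i) is) (map th is) r U)
  kids-list α ν th []       f = 0 , z≤n , []
  kids-list α ν th (i ∷ is) f with f i (here refl) | kids-list α ν th is (λ j j∈ → f j (there j∈))
  ... | x , x≤ , kid | U , U≤ , kids = x + U , +-mono-≤ x≤ U≤ , (kid , x≤) ∷ kids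

  module Filling (f : Fill) (η : Regs) (m : Mem) where
    open Fill f

    fp #kids #cells : ℕ
    fp     = η 59
    #kids  = eval η m kids
    #cells = eval η m size

    kidEnv : ℕ → Regs
    kidEnv i = setReg 60 i η

    lim : ℕ → ℕ
    lim i = eval (kidEnv i) m limit

    term : ℕ → ℕ → ℕ
    term i j = eval (setReg 61 j (kidEnv i)) m body

    finEnv : ℕ → Regs
    finEnv i = setReg 62 (∑ (term i) (lim i)) (setReg 61 (lim i) (kidEnv i))

    address stored : ℕ → ℕ
    address i = fp + eval (finEnv i) m offset
    stored i  = eval (finEnv i) m content

    -- Children read below the frontier `fp` and write from it on. Two of them may share a target if
    -- they store the same value there, which lets all members of dense groups write into one spare
    -- cell.
    record Safe (ℓ : ℕ) : Set where
      field
        okKids     : Π (obl Any η m kids)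
        okSize     : Π (obl Any η m size)
        kids<      : #kids < Bd
        fp<        : fp + #cells < Bd
        okLimit    : ∀ i → i < #kids → Π (obl (_< fp) (kidEnv i) m limit)
        limit≤     : ∀ i → i < #kids → lim i ≤ ℓ
        ℓ<         : ℓ < Bd
        okBody     : ∀ i → i < #kids → ∀ j → j < lim i → Π (obl (_< fp) (setReg 61 j (kidEnv i)) m body)
        sum<       : ∀ i → i < #kids → ∑ (term i) (lim i) < 2 ^ w
        okOffset   : ∀ i → i < #kids → Π (obl (_< fp) (finEnv i) m offset)
        okValue    : ∀ i → i < #kids → Π (obl (_< fp) (finEnv i) m content)
        consistent : ∀ i j → i < #kids → j < #kids → address i ≡ address j → stored i ≡ stored j

    module _ (ok : okFill f ≡ true) (good : Good η m) {ℓ : ℕ} (safe : Safe ℓ) where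
      open Safe safe

      oks₁ : chk 61 size ≡ true × chk 61 kids ≡ true
      oks₁ = ∧-true (proj₁ (∧-true {chk 61 size ∧ chk 61 kids} ok))

      ok₁ : (chk 61 limit ∧ chk 62 body) ∧
        ((chk 63 (bin ADD (var 59) offset) ∧ chk 63 content) ∧
         ((cost size + cost kids + cost limit + cost body + cost offset + cost content ≤ᵇ 400) ∧ (base <ᵇ 59))) ≡ true
      ok₁ = proj₂ (∧-true {chk 61 size ∧ chk 61 kids} ok)

      oks₂ : chk 61 limit ≡ true × chk 62 body ≡ true
      oks₂ = ∧-true (proj₁ (∧-true {chk 61 limit ∧ chk 62 body} ok₁))

      ok₂ : (chk 63 (bin ADD (var 59) offset) ∧ chk 63 content) ∧
         ((cost size + cost kids + cost limit + cost body + cost offset + cost content ≤ᵇ 400) ∧ (base <ᵇ 59)) ≡ true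
      ok₂ = proj₂ (∧-true {chk 61 limit ∧ chk 62 body} ok₁)

      oks₃ : chk 63 (bin ADD (var 59) offset) ≡ true × chk 63 content ≡ true
      oks₃ = ∧-true (proj₁ (∧-true {chk 63 (bin ADD (var 59) offset) ∧ chk 63 content} ok₂))

      oks₄ : (cost size + cost kids + cost limit + cost body + cost offset + cost content ≤ᵇ 400) ≡ true × (base <ᵇ 59) ≡ true
      oks₄ = ∧-true (proj₂ (∧-true {chk 63 (bin ADD (var 59) offset) ∧ chk 63 content} ok₂))

      costs : cost size + cost kids + cost limit + cost body + cost offset + cost content ≤ 400
      costs = ≤ᵇ⇒≤ _ 400 (T-≡ (proj₁ oks₄))

      kid-runs : ∀ ρ → (∀ x → x < 61 → ρ x ≡ η x) → ∀ i → i < #kids →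
        ∃[ x ] (x ≤ kidTime ℓ × Kid (_< fp) m m (address i) (stored i) (run (kidCode f) (setReg 60 i ρ)) x)
      kid-runs ρ ρ≡η i i< = suc (Z.time + (C.time + D.time)) , time≤
        , going (Reads-++ (Z.reads _) (Reads-++ (C.reads _) (D.reads _)))
            (trans (D.kept 65 ≤-refl) C.yields) D.yields
        where
        isMem : IsMemory m
        isMem = Good.words good
        env : Env 61 (kidEnv i)
        env = record
          { words = λ x x< → setReg-elim {60} {i} {η} (_< 2 ^ w) (λ _ → <-≤-trans (<-trans i< kids<) Bd≤2^w)
                       (λ _ → Env.words (good-env good) x x<)
          ; small = λ x x< x<62 → setReg-elim {60} {i} {η} (_< Bd) (λ _ → <-trans i< kids<)
                       (λ _ → Env.small (good-env good) x x< x<62) }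
        module Σ′ = Sum isMem env limit body (proj₁ oks₂) (proj₂ oks₂) (okLimit i i<)
        lim< : lim i < Bd
        lim< = ≤-<-trans (limit≤ i i<) ℓ<
        module Z = Σ′.Summed (Σ′.summed lim< (okBody i i<) (sum< i i<) (setReg 60 i ρ) (agree-set {ρ} {η} {60} refl ρ≡η))
        envFin : Env 63 (finEnv i)
        envFin = env-set-word (env-set env lim<) (sum< i i<)
        module C = Computes (computes isMem envFin 65 (bin ADD (var 59) offset) Z.final (m≤n+m 63 2) (proj₁ oks₃) (okOffset i i<) Z.agree)
        module D = Computes (computes isMem envFin 66 content C.final (m≤n+m 63 3) (proj₂ oks₃) (okValue i i<)
          (agree-< {Z.final} {C.final} {finEnv i} {65} {63} C.kept (m≤n+m 63 2) Z.agree))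
        time≤ : suc (Z.time + (C.time + D.time)) ≤ kidTime ℓ
        time≤ = ≤-trans (s≤s (+-mono-≤ Z.time≤ (+-mono-≤ C.time≤ D.time≤)))
          (≤-trans (kid-cost (cost size + cost kids) (cost limit) (cost body) (cost offset) (cost content) (lim i) costs)
            (kidTime-mono (limit≤ i i<)))

      opaque
        unfolding alloc

        -- The continuation has to work for every memory with the listed properties, so the order
        -- and the resolution of the writes are forgotten here for good.
        Spec-alloc : ∀ {T K Q rest} →
          (∀ m′ → IsMemory m′ → (∀ a → a < fp → m′ a ≡ m a) → (∀ i → i < #kids → m′ (address i) ≡ stored i) →
            Spec rest (setReg 59 (fp + #cells) (setReg base fp η)) m′ T K Q) →
          Spec (alloc f ++ rest) η m (allocTime ℓ + T) (allocWork #kids ℓ + K) Q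
        Spec-alloc {T} {K} {Q} {rest} s _ ρ ρ≡η ch rest′ k = subst (λ p → Ends ch (config (run p ρ) m k) rest′ k (allocTime ℓ + T) (allocWork #kids ℓ + K) Q) (sym code≡)
          (Ends-≤ time≤ work≤ (Ends-reads evaluated spawned))
          where
          isMem : IsMemory m
          isMem = Good.words good
          more : Prog
          more = op add base (reg 59) (lit 0) ∷ op add 59 (reg 59) (reg 66) ∷ (rest ++ rest′)
          code≡ : (alloc f ++ rest) ++ rest′ ≡ comp 65 kids (comp 66 size (par 60 (reg 65) (kidCode f) ∷ more))
          code≡ = trans (++-assoc (alloc f) rest rest′) (trans (comp-++ 65 kids _ _) (cong (comp 65 kids) (comp-++ 66 size _ _)))
          module C = Computes (computes isMem (good-env good) 65 kids ρ (m≤n+m 61 4) (proj₂ oks₁) okKids ρ≡η)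
          module D = Computes (computes isMem (good-env good) 66 size C.final (m≤n+m 61 5) (proj₁ oks₁) okSize
            (agree-< {ρ} {C.final} {η} {65} C.kept (m≤n+m 61 4) ρ≡η))
          agree : ∀ x → x < 61 → D.final x ≡ η x
          agree = agree-< {C.final} {D.final} {η} {66} D.kept (m≤n+m 61 5) (agree-< {ρ} {C.final} {η} {65} C.kept (m≤n+m 61 4) ρ≡η)
          #kids≡ : D.final 65 ≡ #kids
          #kids≡ = trans (D.kept 65 ≤-refl) C.yields
          ps : List Write
          ps = map (λ i → address i , stored i) (upTo (D.final 65))
          child : ℕ → Thread
          child i = run (kidCode f) (setReg 60 i D.final)
          inRange : ∀ {i} → i ∈ upTo (D.final 65) → i < #kids
          inRange i∈ = subst (_ <_) #kids≡ (∈-upTo⁻ i∈)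
          kidsList : ∃[ U ] (U ≤ length (upTo (D.final 65)) * kidTime ℓ × Kids (_< fp) m m ps (map child (upTo (D.final 65))) (kidTime ℓ) U)
          kidsList = kids-list address stored child (upTo (D.final 65)) (λ i i∈ → kid-runs D.final agree i (inRange i∈))
          U : ℕ
          U = proj₁ kidsList
          fp≤ : ∀ i → fp ≤ address i
          fp≤ i = m≤m+n fp _
          joinedMem : ∀ ch k → ∃[ t ] ∃[ M′ ] (t ≤ suc (kidTime ℓ)
            × after ch t (config (join (map child (upTo (D.final 65))) more D.final) m k) ≡ config (run more D.final) M′ (k + suc U)
            × Joined (_< fp) m ps M′)
          joinedMem ch k = join-after (kidTime ℓ) (proj₂ (proj₂ kidsList)) (λ _ _ → refl) isMem
            (λ p q → cons (∈-map⁻ _ p) (∈-map⁻ _ q)) (λ p → out (∈-map⁻ _ p)) (λ p → words (∈-map⁻ _ p)) ch k more D.final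
            where
            Pair : ℕ → ℕ → Set
            Pair α ν = ∃[ i ] (i ∈ upTo (D.final 65) × (α , ν) ≡ (address i , stored i))
            cons : ∀ {α ν ν′} → Pair α ν → Pair α ν′ → ν ≡ ν′
            cons (i , i∈ , refl) (j , j∈ , e≡) with cong proj₂ e≡
            ... | refl = consistent i j (inRange i∈) (inRange j∈) (cong proj₁ e≡)
            out : ∀ {α ν} → Pair α ν → ¬ α < fp
            out (i , _ , refl) α< = <-irrefl refl (<-≤-trans α< (fp≤ i))
            words : ∀ {α ν} → Pair α ν → ν < 2 ^ w
            words (i , i∈ , refl) = isWord isMem (finEnv-ok i (inRange i∈)) content (proj₂ oks₃) (okValue i (inRange i∈))
              where
              finEnv-ok : ∀ i → i < #kids → Env 63 (finEnv i)
              finEnv-ok i i< = env-set-word (env-set (record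
                { words = λ x x< → setReg-elim {60} {i} {η} (_< 2 ^ w) (λ _ → <-≤-trans (<-trans i< kids<) Bd≤2^w)
                         (λ _ → Env.words (good-env good) x x<)
                ; small = λ x x< x<62 → setReg-elim {60} {i} {η} (_< Bd) (λ _ → <-trans i< kids<)
                         (λ _ → Env.small (good-env good) x x< x<62) }) (≤-<-trans (limit≤ i i<) ℓ<)) (sum< i i<)
          joined : ∀ ch k → Ends ch (config (join (map child (upTo (D.final 65))) more D.final) m k) rest′ k
            (suc (kidTime ℓ) + (2 + T)) (suc U + (2 + K)) Q
          joined ch k = join-continue (joinedMem ch k)
            where
            join-continue : ∃[ t ] ∃[ M′ ] (t ≤ suc (kidTime ℓ)
              × after ch t (config (join (map child (upTo (D.final 65))) more D.final) m k) ≡ config (run more D.final) M′ (k + suc U)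
              × Joined (_< fp) m ps M′) → Ends ch (config (join (map child (upTo (D.final 65))) more D.final) m k) rest′ k
              (suc (kidTime ℓ) + (2 + T)) (suc U + (2 + K)) Q
            join-continue (t , M′ , t≤ , e≡ , J) = Ends-≤ (+-monoˡ-≤ _ t≤) ≤-refl (Ends-after t (suc U) e≡ (Ends-reads moved continue))
              where
              η₁ : Regs
              η₁ = setReg base fp η
              base<59 : base < 59
              base<59 = <ᵇ⇒< base 59 (T-≡ (proj₂ oks₄))
              good′ : Good (setReg 59 (fp + #cells) η₁) M′
              good′ = record
                { small = Good.small (good-set {59} (good-set {base} good (Good.small good 59 (m≤n+m 60 1))) fp<)
                ; words = Joined.isWords J }
              fp≡ : word (D.final 59 + word 0) ≡ fp
              fp≡ = trans (cong (λ z → word (z + word 0)) (agree 59 (m≤n+m 60 1))) (word-+0 (<-≤-trans (Good.small good 59 (m≤n+m 60 1)) Bd≤2^w))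
              regs₁ regs₂ : Regs
              regs₁ = setReg base (word (D.final 59 + word 0)) D.final
              regs₂ = setReg 59 (word (regs₁ 59 + regs₁ 66)) regs₁
              moved : Reads Any M′ 2 more D.final (rest ++ rest′) regs₂
              moved = op∷ (op∷ nil)
              new≡ : word (regs₁ 59 + regs₁ 66) ≡ fp + #cells
              new≡ = word-sum (kept-at D.final base<59 ≤-refl (agree 59 (m≤n+m 60 1)))
                (kept-at D.final base<59 (m≤n+m 59 7) D.yields) (<-≤-trans fp< Bd≤2^w)
              agree′ : ∀ x → x < 61 → regs₂ x ≡ setReg 59 (fp + #cells) η₁ x
              agree′ = agree-set {regs₁} {η₁} {59} new≡ (agree-set {D.final} {η} {base} fp≡ agree)
              stored′ : ∀ i → i < #kids → M′ (address i) ≡ stored i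
              stored′ i i< = Joined.stored J (∈-map⁺ (λ i → address i , stored i) (∈-upTo⁺ (subst (i <_) (sym #kids≡) i<)))
              continue : ∀ ch → Ends ch (config (run (rest ++ rest′) regs₂) M′ (k + suc U + 2)) rest′ (k + suc U + 2) T K Q
              continue ch = s M′ (Joined.isWords J) (Joined.kept J) stored′ good′ regs₂ agree′ ch rest′ _
          parStmt : Stmt
          parStmt = par 60 (reg 65) (kidCode f)
          evaluated : Reads Any m (C.time + D.time) (comp 65 kids (comp 66 size (parStmt ∷ more))) ρ (parStmt ∷ more) D.final
          evaluated = Reads-++ (C.reads (comp 66 size (parStmt ∷ more))) (D.reads (parStmt ∷ more))
          spawn : ∀ ch k → after ch 1 (config (run (parStmt ∷ more) D.final) m k) ≡
            config (join (map child (upTo (D.final 65))) more D.final) m (k + (1 + D.final 65))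
          spawn ch k = refl
          spawned : ∀ ch → Ends ch (config (run (parStmt ∷ more) D.final) m (k + (C.time + D.time))) rest′ (k + (C.time + D.time))
            (1 + (suc (kidTime ℓ) + (2 + T))) (1 + D.final 65 + (suc U + (2 + K))) Q
          spawned ch = Ends-after 1 (1 + D.final 65) (spawn ch _) (joined _ _)
          pre≤ : C.time + D.time ≤ 400
          pre≤ = ≤-trans (+-mono-≤ C.time≤ D.time≤) (pre-cost (cost size) (cost kids) (cost limit + cost body + cost offset + cost content)
            (≤-trans (≤-reflexive (regroup (cost size + cost kids) (cost limit) (cost body) (cost offset) (cost content))) costs))
          time≤ : C.time + D.time + (1 + (suc (kidTime ℓ) + (2 + T))) ≤ allocTime ℓ + T
          time≤ = alloc-time (C.time + D.time) ℓ T pre≤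
          work≤ : C.time + D.time + (1 + D.final 65 + (suc U + (2 + K))) ≤ allocWork #kids ℓ + K
          work≤ = subst (λ z → C.time + D.time + (1 + z + (suc U + (2 + K))) ≤ allocWork #kids ℓ + K) (sym #kids≡) (alloc-work (C.time + D.time) #kids U ℓ K pre≤
            (≤-trans (proj₁ (proj₂ kidsList)) (≤-reflexive (cong (_* kidTime ℓ) (trans (length-upTo (D.final 65)) #kids≡)))))

-- Special kinds of fills, and the rule for counting loops

mapFill : Reg → (size value : Expr) → Fill
mapFill x size v = fill x size size (con 0) (con 0) (var 60) v

sumFill : Reg → (size limit body value : Expr) → Fill
sumFill x size ℓ b v = fill x size size ℓ b (var 60) v

scatterFill : Reg → (size kids offset value : Expr) → Fill
scatterFill x size kids o v = fill x size kids (con 0) (con 0) o v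

module Rules (S : Setting) where
  open Setting S
  open Machine w
  open Execution w
  open Compile S
  open Logic S

  opaque
    unfolding loop

    -- The decrement belongs to `loop`, so the body leaves the counter as it was and establishes the
    -- invariant for the decremented state. The summand 2 pays for the test and the decrement, the
    -- final 1 for the test that ends the loop.
    Spec-loop : ∀ {f body T K} (Inv : ℕ → Regs → Mem → Set) → f < 60 →
      (∀ k η m → η f ≡ suc k → Inv (suc k) η m →
         Spec body η m T K (λ η′ m′ → η′ f ≡ suc k × Inv k (setReg f k η′) m′)) →
      ∀ N η m → η f ≡ N → Inv N η m →
      Spec (loop f body) η m (N * (T + 2) + 1) (N * (K + 2) + 1) (Inv 0)
    Spec-loop {f} {body} {T} {K} Inv f< step = go
      where
      dec : Stmt
      dec = op sub f (reg f) (lit 1)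
      f<61 : f < 61
      f<61 = <-trans f< ≤-refl
      again : Stmt
      again = while (reg f) (body ++ dec ∷ [])
      go : ∀ N η m → η f ≡ N → Inv N η m → Spec (loop f body) η m (N * (T + 2) + 1) (N * (K + 2) + 1) (Inv 0)
      go zero η m f≡ inv g ρ ρ≡η ch rest k = ends ≤-refl ≤-refl
        (Reads-after exited ch k) g ρ≡η inv
        where
        exit : (if ρ f ≡ᵇ 0 then rest else (body ++ dec ∷ []) ++ again ∷ rest) ≡ rest
        exit = cong (λ z → if z ≡ᵇ 0 then rest else (body ++ dec ∷ []) ++ again ∷ rest) (trans (ρ≡η f f<61) f≡)
        exited : Reads Any m 1 (again ∷ rest) ρ rest ρ
        exited = while∷ (subst (λ p → Reads Any m 0 p ρ rest ρ) (sym exit) nil)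
      go (suc N) η m f≡ inv g ρ ρ≡η ch rest k = Ends-≤ (≤-reflexive (time≡ T)) (≤-reflexive (time≡ K))
        (Ends-reads {A = Any} entered (λ ch₁ → continue (step N η m f≡ inv g ρ ρ≡η ch₁ (dec ∷ again ∷ rest) (k + 1))))
        where
        time≡ : ∀ T → 1 + (T + (1 + (N * (T + 2) + 1))) ≡ T + 2 + N * (T + 2) + 1
        time≡ T = begin
          1 + (T + (1 + (N * (T + 2) + 1)))  ≡⟨ +-comm 1 _ ⟩
          T + (1 + (N * (T + 2) + 1)) + 1    ≡⟨ cong (λ z → T + (1 + z) + 1) (+-comm _ 1) ⟩
          T + (2 + N * (T + 2)) + 1          ≡⟨ cong (_+ 1) (sym (+-assoc T 2 _)) ⟩
          T + 2 + N * (T + 2) + 1            ∎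
          where open ≡-Reasoning
        enter : (if ρ f ≡ᵇ 0 then rest else (body ++ dec ∷ []) ++ again ∷ rest) ≡ body ++ dec ∷ again ∷ rest
        enter = trans (cong (λ z → if z ≡ᵇ 0 then rest else (body ++ dec ∷ []) ++ again ∷ rest) (trans (ρ≡η f f<61) f≡))
          (++-assoc body (dec ∷ []) (again ∷ rest))
        entered : Reads Any m 1 (again ∷ rest) ρ (body ++ dec ∷ again ∷ rest) ρ
        entered = while∷ (subst (λ p → Reads Any m 0 p ρ (body ++ dec ∷ again ∷ rest) ρ) (sym enter) nil)
        continue : ∀ {ch₁} → Ends ch₁ (config (run (body ++ dec ∷ again ∷ rest) ρ) m (k + 1)) (dec ∷ again ∷ rest) (k + 1) T K
            (λ η′ m′ → η′ f ≡ suc N × Inv N (setReg f N η′) m′) →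
          Ends ch₁ (config (run (body ++ dec ∷ again ∷ rest) ρ) m (k + 1)) rest (k + 1)
            (T + (1 + (N * (T + 2) + 1))) (K + (1 + (N * (K + 2) + 1))) (Inv 0)
        continue {ch₁} (ends {t} {j} {ρ′} {η′} {m′} t≤ j≤ r g′ a′ (f′≡ , inv′)) =
          Ends-≤ (+-monoˡ-≤ _ t≤) (+-monoˡ-≤ _ j≤) (Ends-after t j r
            (Ends-reads {A = Any} (op∷ nil) (λ ch₂ → go N (setReg f N η′) m′ (setReg-≡ f N η′) inv′
              (good-set {f} g′ (<-trans (≤-reflexive (sym f′≡)) (Good.small g′ f f<61)))
              (setReg f (word (ρ′ f ∸ word 1)) ρ′)
              (agree-set {ρ′} {η′} {f} dec≡ a′) ch₂ rest _)))
          where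
          dec≡ : word (ρ′ f ∸ word 1) ≡ N
          dec≡ = trans (cong₂ (λ x y → word (x ∸ y)) (trans (a′ f f<61) f′≡) word-1)
            (word-id (<-trans (≤-reflexive (sym f′≡)) (<-≤-trans (Good.small g′ f f<61) Bd≤2^w)))

  module _ {η : Regs} {m : Mem} where

    mapSafe : ∀ {x size v} → let open Filling (mapFill x size v) η m in
      Π (obl Any η m size) → fp + #cells < Bd →
      (∀ i → i < #cells → Π (obl (_< fp) (finEnv i) m v)) → Safe 0
    mapSafe {x} {size} {v} oSize fp< oValue = record
      { okKids = oSize ; okSize = oSize ; kids< = ≤-<-trans (m≤n+m _ (η 59)) fp< ; fp< = fp<
      ; okLimit = λ _ _ → tt ; limit≤ = λ _ _ → z≤n ; ℓ< = <-trans z<s 2≤Bd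
      ; okBody = λ { _ _ _ () } ; sum< = λ _ _ → <-≤-trans (<-trans z<s 2≤Bd) Bd≤2^w
      ; okOffset = λ _ _ → tt ; okValue = oValue
      ; consistent = λ i j _ _ e → cong (Filling.stored (mapFill x size v) η m) (+-cancelˡ-≡ (η 59) i j e) }

    sumSafe : ∀ {x size limit body v} ℓ → let open Filling (sumFill x size limit body v) η m in
      Π (obl Any η m size) → fp + #cells < Bd → ℓ < Bd →
      (∀ i → i < #cells → Π (obl (_< fp) (kidEnv i) m limit)) →
      (∀ i → i < #cells → lim i ≤ ℓ) →
      (∀ i → i < #cells → ∀ j → j < lim i → Π (obl (_< fp) (setReg 61 j (kidEnv i)) m body)) →
      (∀ i → i < #cells → ∑ (term i) (lim i) < 2 ^ w) →
      (∀ i → i < #cells → Π (obl (_< fp) (finEnv i) m v)) → Safe ℓ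
    sumSafe {x} {size} {limit} {body} {v} ℓ oSize fp< ℓ< oLimit lim≤ oBody sum< oValue = record
      { okKids = oSize ; okSize = oSize ; kids< = ≤-<-trans (m≤n+m _ (η 59)) fp< ; fp< = fp<
      ; okLimit = oLimit ; limit≤ = lim≤ ; ℓ< = ℓ<
      ; okBody = oBody ; sum< = sum<
      ; okOffset = λ _ _ → tt ; okValue = oValue
      ; consistent = λ i j _ _ e → cong (Filling.stored (sumFill x size limit body v) η m) (+-cancelˡ-≡ (η 59) i j e) }

    scatterSafe : ∀ {x size kids o v} → let open Filling (scatterFill x size kids o v) η m in
      Π (obl Any η m kids) → Π (obl Any η m size) → #kids < Bd → fp + #cells < Bd →
      (∀ i → i < #kids → Π (obl (_< fp) (finEnv i) m o)) →
      (∀ i → i < #kids → Π (obl (_< fp) (finEnv i) m v)) →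
      (∀ i j → i < #kids → j < #kids → eval (finEnv i) m o ≡ eval (finEnv j) m o → stored i ≡ stored j) → Safe 0
    scatterSafe oKids oSize kids< fp< oOffset oValue cons = record
      { okKids = oKids ; okSize = oSize ; kids< = kids< ; fp< = fp<
      ; okLimit = λ _ _ → tt ; limit≤ = λ _ _ → z≤n ; ℓ< = <-trans z<s 2≤Bd
      ; okBody = λ { _ _ _ () } ; sum< = λ _ _ → <-≤-trans (<-trans z<s 2≤Bd) Bd≤2^w
      ; okOffset = oOffset ; okValue = oValue
      ; consistent = λ i j i< j< e → cons i j i< j< (+-cancelˡ-≡ (η 59) _ _ e) }

  Spec-fill : ∀ f {η m ℓ τ Y T K Q rest} → let open Filling f η m in okFill f ≡ true →
    (Good η m → Safe ℓ) → allocTime ℓ ≤ τ → allocWork #kids ℓ ≤ Y →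
    (∀ m′ → IsMemory m′ → (∀ a → a < fp → m′ a ≡ m a) → (∀ i → i < #kids → m′ (address i) ≡ stored i) →
      Spec rest (setReg 59 (fp + #cells) (setReg (Fill.base f) fp η)) m′ T K Q) →
    Spec (alloc f ++ rest) η m (τ + T) (Y + K) Q
  Spec-fill f {η} {m} ok safe τ≤ Y≤ cont g =
    Spec-≤ (+-monoˡ-≤ _ τ≤) (+-monoˡ-≤ _ Y≤) (Filling.Spec-alloc f η m ok g (safe g) cont) g

  Spec-env : ∀ {p η η′ m T K Q} → (∀ x → x < 61 → η x ≡ η′ x) → Spec p η′ m T K Q → Spec p η m T K Q
  Spec-env e s g ρ ρ≡η = s
    (record { small = λ x x< → subst (_< Bd) (e x x<) (Good.small g x x<) ; words = Good.words g })
    ρ (λ x x< → trans (ρ≡η x x<) (e x x<))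

  Spec-assign′ : ∀ x e {v η m T K Q rest} → okAssign x e ≡ true →
    (Good η m → Π (obl Any η m e)) → eval η m e ≡ v → v < Bd →
    Spec rest (setReg x v η) m T K Q →
    Spec (assign x e ++ rest) η m (401 + T) (401 + K) Q
  Spec-assign′ x e ok o refl v< s = Spec-assign {x} {e} ok o (λ _ → v<) s

-- Total division

divMod-split : ∀ m {d} → 0 < d → m ≡ m %% d + m // d * d
divMod-split m {suc d} _ = m≡m%n+[m/n]*n m (suc d)

%%-< : ∀ m {d} → 0 < d → m %% d < d
%%-< m {suc d} _ = m%n<n m (suc d)

//*≤ : ∀ m d → m // d * d ≤ m
//*≤ m zero    = z≤n
//*≤ m (suc d) = m/n*n≤m m (suc d)

//-unique : ∀ q {r d} → r < d → (r + q * d) // d ≡ q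
//-unique q {r} {suc d} r< = begin
  (r + q * suc d) / suc d              ≡⟨ cong (_/ suc d) (+-comm r (q * suc d)) ⟩
  (q * suc d + r) / suc d              ≡⟨ +-distrib-/ (q * suc d) r (subst (_< suc d) (sym rem) r<) ⟩
  q * suc d / suc d + r / suc d        ≡⟨ cong₂ _+_ (m*n/n≡m q (suc d)) (m<n⇒m/n≡0 r<) ⟩
  q + 0                                ≡⟨ +-identityʳ q ⟩
  q                                    ∎
  where
  open ≡-Reasoning
  rem : q * suc d % suc d + r % suc d ≡ r
  rem = cong₂ _+_ (m*n%n≡0 q (suc d)) (m<n⇒m%n≡m r<)

%%-unique : ∀ q {r d} → r < d → (r + q * d) %% d ≡ r
%%-unique q {r} {suc d} r< = trans ([m+kn]%n≡m%n r q (suc d)) (m<n⇒m%n≡m r<)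

//-monoˡ : ∀ d {m n} → m ≤ n → m // d ≤ n // d
//-monoˡ zero    _  = z≤n
//-monoˡ (suc d) m≤ = /-monoˡ-≤ (suc d) m≤

//-< : ∀ {m} n {d} → m < n * d → m // d < n
//-< {m} n {zero}  m< = ⊥-elim (n≮0 (subst (m <_) (*-zeroʳ n) m<))
//-< {m} n {suc d} m< = m<n*o⇒m/o<n m<

%%-id : ∀ {m d} → m < d → m %% d ≡ m
%%-id {m} {suc d} m< = m<n⇒m%n≡m m<

//-small : ∀ {m d} → m < d → m // d ≡ 0
//-small {m} {suc d} m< = m<n⇒m/n≡0 m<

//-// : ∀ m d e → m // d // e ≡ m // (d * e)
//-// m zero    zero    = refl
//-// m zero    (suc e) = 0/n≡0 (suc e)
//-// m (suc d) zero    = cong (m //_) (sym (*-zeroʳ d))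
//-// m (suc d) (suc e) = m/n/o≡m/[n*o] m (suc d) (suc e)

suc//-≤ : ∀ m {d} → 0 < d → m < suc (m // d) * d
suc//-≤ m {d} d> = ≤-trans (s≤s (≤-reflexive (divMod-split m d>)))
  (+-monoˡ-≤ (m // d * d) (%%-< m d>))

2^>0 : ∀ k → 0 < 2 ^ k
2^>0 k = m^n>0 2 k

-- Sums

∑-cong : ∀ {f g} n → (∀ i → i < n → f i ≡ g i) → ∑ f n ≡ ∑ g n
∑-cong zero    _ = refl
∑-cong (suc n) h = cong₂ _+_ (∑-cong n (λ i i< → h i (m≤n⇒m≤1+n i<))) (h n ≤-refl)

∑-+ : ∀ f m n → ∑ f (m + n) ≡ ∑ f m + ∑ (λ i → f (m + i)) n
∑-+ f m zero    = trans (cong (∑ f) (+-identityʳ m)) (sym (+-identityʳ _))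
∑-+ f m (suc n) = trans (cong (∑ f) (+-suc m n)) (trans (cong (_+ f (m + n)) (∑-+ f m n)) (+-assoc (∑ f m) _ _))

∑-0 : ∀ {f} n → (∀ i → i < n → f i ≡ 0) → ∑ f n ≡ 0
∑-0 zero    _ = refl
∑-0 (suc n) h = cong₂ _+_ (∑-0 n (λ i i< → h i (m≤n⇒m≤1+n i<))) (h n ≤-refl)

∑-≤ : ∀ {f} c n → (∀ i → i < n → f i ≤ c) → ∑ f n ≤ n * c
∑-≤ c zero    _ = z≤n
∑-≤ {f} c (suc n) h = ≤-trans (+-mono-≤ (∑-≤ c n (λ i i< → h i (m≤n⇒m≤1+n i<))) (h n ≤-refl)) (≤-reflexive (+-comm (n * c) c))

∑-blocks : ∀ f b k → ∑ (λ i → ∑ (λ j → f (i * b + j)) b) k ≡ ∑ f (k * b)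
∑-blocks f b zero    = refl
∑-blocks f b (suc k) = begin
  ∑ (λ i → ∑ (λ j → f (i * b + j)) b) k + ∑ (λ j → f (k * b + j)) b  ≡⟨ cong (_+ ∑ (λ j → f (k * b + j)) b) (∑-blocks f b k) ⟩
  ∑ f (k * b) + ∑ (λ j → f (k * b + j)) b                            ≡⟨ sym (∑-+ f (k * b) b) ⟩
  ∑ f (k * b + b)                                                    ≡⟨ cong (∑ f) (+-comm (k * b) b) ⟩
  ∑ f (suc k * b)                                                    ∎
  where open ≡-Reasoning

-- Adding up the truth values of a test that holds exactly below `c` finds `c`. Logarithms are
-- computed and windows are searched by this device.
∑-threshold : ∀ f c n → c ≤ n → (∀ i → i < c → f i ≡ 1) → (∀ i → c ≤ i → i < n → f i ≡ 0) → ∑ f n ≡ c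
∑-threshold f c n c≤n one zer with m≤n⇒∃[o]m+o≡n c≤n
... | o , refl = begin
  ∑ f (c + o)                        ≡⟨ ∑-+ f c o ⟩
  ∑ f c + ∑ (λ i → f (c + i)) o      ≡⟨ cong₂ _+_ (∑-cong c one) (∑-0 o (λ i i< → zer (c + i) (m≤m+n c i) (+-monoʳ-< c i<))) ⟩
  ∑ (λ _ → 1) c + 0                  ≡⟨ +-identityʳ _ ⟩
  ∑ (λ _ → 1) c                      ≡⟨ ∑-ones c ⟩
  c                                  ∎
  where
  open ≡-Reasoning
  ∑-ones : ∀ c → ∑ (λ _ → 1) c ≡ c
  ∑-ones zero    = refl
  ∑-ones (suc c) = trans (cong (_+ 1) (∑-ones c)) (+-comm c 1)

𝟙< : ∀ {a b} → a < b → 𝟙 (a <ᵇ b) ≡ 1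
𝟙< a<b = cong 𝟙 (≡-T (<⇒<ᵇ a<b))

𝟙≮ : ∀ {a b} → b ≤ a → 𝟙 (a <ᵇ b) ≡ 0
𝟙≮ {a} {b} b≤a with a <ᵇ b in e≡
... | true  = ⊥-elim (<-irrefl refl (<-≤-trans (<ᵇ⇒< a b (T-≡ e≡)) b≤a))
... | false = refl

𝟙≢0⇒< : ∀ {a b} → ¬ 𝟙 (a <ᵇ b) ≡ 0 → a < b
𝟙≢0⇒< {a} {b} h with a <ᵇ b in e≡
... | true  = <ᵇ⇒< a b (T-≡ e≡)
... | false = ⊥-elim (h refl)

if-< : ∀ {a b} {x y : ℕ} → a < b → (if 𝟙 (a <ᵇ b) ≡ᵇ 0 then y else x) ≡ x
if-< {x = x} {y} a<b = cong (λ z → if z ≡ᵇ 0 then y else x) (𝟙< a<b)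

if-≮ : ∀ {a b} {x y : ℕ} → b ≤ a → (if 𝟙 (a <ᵇ b) ≡ᵇ 0 then y else x) ≡ y
if-≮ {x = x} {y} b≤a = cong (λ z → if z ≡ᵇ 0 then y else x) (𝟙≮ b≤a)

-- Binary logarithms

≤2*⌈/2⌉ : ∀ n → n ≤ 2 * ⌈ n /2⌉
≤2*⌈/2⌉ n = begin
  n                         ≡⟨ sym (⌊n/2⌋+⌈n/2⌉≡n n) ⟩
  ⌊ n /2⌋ + ⌈ n /2⌉         ≤⟨ +-monoˡ-≤ ⌈ n /2⌉ (⌊n/2⌋≤⌈n/2⌉ n) ⟩
  ⌈ n /2⌉ + ⌈ n /2⌉         ≡⟨ cong (⌈ n /2⌉ +_) (sym (+-identityʳ _)) ⟩
  2 * ⌈ n /2⌉               ∎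
  where open ≤-Reasoning

≤2^⌈log₂⌉ : ∀ n → n ≤ 2 ^ ⌈log₂ n ⌉
≤2^⌈log₂⌉ = <-rec (λ n → n ≤ 2 ^ ⌈log₂ n ⌉) go
  where
  go : ∀ n → (∀ {m} → m < n → m ≤ 2 ^ ⌈log₂ m ⌉) → n ≤ 2 ^ ⌈log₂ n ⌉
  go 0 _ = z≤n
  go 1 _ = m^n>0 2 ⌈log₂ 1 ⌉
  go n@(suc (suc k)) ih = begin
    n                               ≤⟨ ≤2*⌈/2⌉ n ⟩
    2 * ⌈ n /2⌉                     ≤⟨ *-monoʳ-≤ 2 (ih (⌈n/2⌉<n k)) ⟩
    2 ^ suc ⌈log₂ ⌈ n /2⌉ ⌉         ≡⟨ cong (λ z → 2 ^ suc z) (⌈log₂⌈n/2⌉⌉≡⌈log₂n⌉∸1 n) ⟩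
    2 ^ suc (⌈log₂ n ⌉ ∸ 1)         ≡⟨ cong (2 ^_) (m+[n∸m]≡n pos) ⟩
    2 ^ ⌈log₂ n ⌉                   ∎
    where
    open ≤-Reasoning
    pos : 1 ≤ ⌈log₂ n ⌉
    pos = ⌈log₂⌉-mono-≤ {2} {n} (s≤s (s≤s z≤n))

≥⌈log₂⌉ : ∀ {i n} → n ≤ 2 ^ i → ⌈log₂ n ⌉ ≤ i
≥⌈log₂⌉ {i} {n} h = ≤-trans (⌈log₂⌉-mono-≤ h) (≤-reflexive (⌈log₂2^n⌉≡n i))

2^<⌈log₂⌉ : ∀ {i n} → i < ⌈log₂ n ⌉ → 2 ^ i < n
2^<⌈log₂⌉ h = ≰⇒> (λ le → <-irrefl refl (<-≤-trans h (≥⌈log₂⌉ le)))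

-- The factor 1 is there because a shifted literal 1 evaluates to `1 * 2 ^ i`; it recurs wherever a
-- power of two is computed by the program.
∑-⌈log₂⌉ : ∀ n w → n ≤ 2 ^ w → ∑ (λ i → 𝟙 (1 * 2 ^ i <ᵇ n)) w ≡ ⌈log₂ n ⌉
∑-⌈log₂⌉ n w h = ∑-threshold _ ⌈log₂ n ⌉ w (≥⌈log₂⌉ h)
  (λ i i< → 𝟙< (subst (_< n) (sym (*-identityˡ (2 ^ i))) (2^<⌈log₂⌉ i<)))
  (λ i i≥ _ → 𝟙≮ (subst (n ≤_) (sym (*-identityˡ (2 ^ i))) (≤-trans (≤2^⌈log₂⌉ n) (^-monoʳ-≤ 2 i≥))))

-- Numbers as sequences of digits

digits : (ℕ → ℕ) → ℕ → ℕ → ℕ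
digits d B q = ∑ (λ i → d i * B ^ i) q

digits-+ : ∀ d B m n → digits d B (m + n) ≡ digits d B m + digits (λ i → d (m + i)) B n * B ^ m
digits-+ d B m zero    = trans (cong (digits d B) (+-identityʳ m)) (sym (+-identityʳ _))
digits-+ d B m (suc n) = begin
  digits d B (m + suc n)                                   ≡⟨ cong (digits d B) (+-suc m n) ⟩
  digits d B (m + n) + d (m + n) * B ^ (m + n)             ≡⟨ cong₂ _+_ (digits-+ d B m n) (cong (d (m + n) *_) (^-distribˡ-+-* B m n)) ⟩
  digits d B m + X * B ^ m + d (m + n) * (B ^ m * B ^ n)   ≡⟨ lemma (digits d B m) X (B ^ m) (d (m + n)) (B ^ n) ⟩
  digits d B m + (X + d (m + n) * B ^ n) * B ^ m           ∎
  where
  open ≡-Reasoning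
  X : ℕ
  X = digits (λ i → d (m + i)) B n
  lemma : ∀ a x p y r → a + x * p + y * (p * r) ≡ a + (x + y * r) * p
  lemma = solve-∀

digits-< : ∀ d B q → 0 < B → (∀ i → i < q → d i < B) → digits d B q < B ^ q
digits-< d B zero    B> h = ≤-refl
digits-< d B (suc q) B> h = begin-strict
  digits d B q + d q * B ^ q   <⟨ +-monoˡ-< (d q * B ^ q) (digits-< d B q B> (λ i i< → h i (m≤n⇒m≤1+n i<))) ⟩
  suc (d q) * B ^ q            ≤⟨ *-monoˡ-≤ (B ^ q) (h q ≤-refl) ⟩
  B * B ^ q                    ∎
  where open ≤-Reasoning

digits-digit : ∀ d B k q → 0 < B → (∀ i → i < q → d i < B) → k < q → digits d B q // B ^ k %% B ≡ d k
digits-digit d B k q B> h k<q with m≤n⇒∃[o]m+o≡n k<q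
... | o , refl = begin
  digits d B (suc k + o) // B ^ k %% B                   ≡⟨ cong (λ z → digits d B z // B ^ k %% B) (sym (+-suc k o)) ⟩
  digits d B (k + suc o) // B ^ k %% B                   ≡⟨ cong (λ z → z // B ^ k %% B) (digits-+ d B k (suc o)) ⟩
  (digits d B k + D′ (1 + o) * B ^ k) // B ^ k %% B      ≡⟨ cong (_%% B) (//-unique (D′ (1 + o)) (digits-< d B k B> (λ i i< → h i (<-trans i< k<q)))) ⟩
  D′ (1 + o) %% B                                        ≡⟨ cong (_%% B) (digits-+ (λ i → d (k + i)) B 1 o) ⟩
  (D′ 1 + digits (λ i → d (k + (1 + i))) B o * B ^ 1) %% B ≡⟨ cong₂ (λ x y → (x + digits (λ i → d (k + (1 + i))) B o * y) %% B)
                                                            (trans (*-identityʳ _) (cong d (+-identityʳ k))) (^-identityʳ B) ⟩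
  (d k + digits (λ i → d (k + (1 + i))) B o * B) %% B    ≡⟨ %%-unique (digits (λ i → d (k + (1 + i))) B o) (h k k<q) ⟩
  d k                                                    ∎
  where
  open ≡-Reasoning
  D′ : ℕ → ℕ
  D′ = digits (λ i → d (k + i)) B

∑-digits : ∀ d e q → ∑ (λ i → d i * 2 ^ (e * i)) q ≡ digits d (2 ^ e) q
∑-digits d e q = ∑-cong q (λ i _ → cong (d i *_) (sym (^-*-assoc 2 e i)))

packed-digit : ∀ d e k q → (∀ i → i < q → d i < 2 ^ e) → k < q →
  ∑ (λ i → d i * 2 ^ (e * i)) q // 2 ^ (e * k) %% 2 ^ e ≡ d k
packed-digit d e k q h k<q = trans
  (cong₂ (λ x y → x // y %% 2 ^ e) (∑-digits d e q) (sym (^-*-assoc 2 e k)))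
  (digits-digit d (2 ^ e) k q (2^>0 e) h k<q)

packed-< : ∀ d e q → (∀ i → i < q → d i < 2 ^ e) → ∑ (λ i → d i * 2 ^ (e * i)) q < 2 ^ (e * q)
packed-< d e q h = subst₂ _<_ (sym (∑-digits d e q)) (^-*-assoc 2 e q) (digits-< d (2 ^ e) q (2^>0 e) h)

-- Bits

bitAt : ℕ → ℕ → ℕ
bitAt x k = x // 2 ^ k %% 2

bitAt<2 : ∀ x k → bitAt x k < 2
bitAt<2 x k = %%-< (x // 2 ^ k) z<s

𝟙-bit : ∀ k x → 𝟙 (bit k x) ≡ bitAt x k
𝟙-bit k x = trans (cong (λ z → 𝟙 (z % 2 ≡ᵇ 1)) (sym (//≡/ x (2 ^ k) {{m^n≢0 2 k}}))) (lemma (bitAt x k) (bitAt<2 x k))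
  where
  lemma : ∀ z → z < 2 → 𝟙 (z ≡ᵇ 1) ≡ z
  lemma 0 _ = refl
  lemma 1 _ = refl
  lemma (suc (suc z)) (s≤s (s≤s ()))

𝟙-injective : ∀ a b → 𝟙 a ≡ 𝟙 b → a ≡ b
𝟙-injective true  true  _ = refl
𝟙-injective false false _ = refl

bitAt-low : ∀ l h c k → k < c → bitAt (l + h * 2 ^ c) k ≡ bitAt l k
bitAt-low l h c k k<c with m≤n⇒∃[o]m+o≡n k<c
... | o , refl = begin
  bitAt (l + h * 2 ^ (suc k + o)) k                             ≡⟨ cong (λ z → bitAt (l + h * z) k) (pow k o) ⟩
  bitAt (l + h * (2 ^ o * 2 * 2 ^ k)) k                         ≡⟨ cong (λ z → bitAt z k) (trans (cong (_+ h * (2 ^ o * 2 * 2 ^ k)) (divMod-split l (2^>0 k))) (lemma (l %% 2 ^ k) (l // 2 ^ k) (2 ^ k) h (2 ^ o))) ⟩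
  (l %% 2 ^ k + (l // 2 ^ k + h * 2 ^ o * 2) * 2 ^ k) // 2 ^ k %% 2 ≡⟨ cong (_%% 2) (//-unique (l // 2 ^ k + h * 2 ^ o * 2) (%%-< l (2^>0 k))) ⟩
  (l // 2 ^ k + h * 2 ^ o * 2) %% 2                             ≡⟨ [m+kn]%n≡m%n (l // 2 ^ k) (h * 2 ^ o) 2 ⟩
  bitAt l k                                                     ∎
  where
  open ≡-Reasoning
  pow : ∀ k o → 2 ^ (suc k + o) ≡ 2 ^ o * 2 * 2 ^ k
  pow k o = trans (cong (2 *_) (^-distribˡ-+-* 2 k o)) (swap (2 ^ k) (2 ^ o))
    where
    swap : ∀ a b → 2 * (a * b) ≡ b * 2 * a
    swap = solve-∀
  lemma : ∀ r q p h x → r + q * p + h * (x * 2 * p) ≡ r + (q + h * x * 2) * p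
  lemma = solve-∀

bitAt-high : ∀ l h c k → l < 2 ^ c → bitAt (l + h * 2 ^ c) (c + k) ≡ bitAt h k
bitAt-high l h c k l< = cong (_%% 2) (begin
  (l + h * 2 ^ c) // 2 ^ (c + k)          ≡⟨ cong ((l + h * 2 ^ c) //_) (^-distribˡ-+-* 2 c k) ⟩
  (l + h * 2 ^ c) // (2 ^ c * 2 ^ k)      ≡⟨ sym (//-// (l + h * 2 ^ c) (2 ^ c) (2 ^ k)) ⟩
  (l + h * 2 ^ c) // 2 ^ c // 2 ^ k       ≡⟨ cong (_// 2 ^ k) (//-unique h l<) ⟩
  h // 2 ^ k                              ∎)
  where open ≡-Reasoning

bitAt-%% : ∀ x c k → k < c → bitAt (x %% 2 ^ c) k ≡ bitAt x k
bitAt-%% x c k k<c = trans (sym (bitAt-low (x %% 2 ^ c) (x // 2 ^ c) c k k<c))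
  (cong (λ z → bitAt z k) (sym (divMod-split x (2^>0 c))))

bitAt-≥ : ∀ x c k → x < 2 ^ c → c ≤ k → bitAt x k ≡ 0
bitAt-≥ x c k x< c≤k = cong (_%% 2) (//-small (<-≤-trans x< (^-monoʳ-≤ 2 c≤k)))

bitAt-// : ∀ x c k → bitAt (x // 2 ^ c) k ≡ bitAt x (c + k)
bitAt-// x c k = cong (_%% 2) (trans (//-// x (2 ^ c) (2 ^ k)) (cong (x //_) (sym (^-distribˡ-+-* 2 c k))))

popCount : ℕ → ℕ → ℕ
popCount b x = ∑ (bitAt x) b

popCount-%% : ∀ b x k → k ≤ b → popCount b (x %% 2 ^ k) ≡ ∑ (bitAt x) k
popCount-%% b x k k≤b with m≤n⇒∃[o]m+o≡n k≤b
... | o , refl = trans (∑-+ (bitAt (x %% 2 ^ k)) k o) (trans (cong₂ _+_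
  (∑-cong k (λ i i< → bitAt-%% x k i i<))
  (∑-0 o (λ i _ → bitAt-≥ (x %% 2 ^ k) k (k + i) (%%-< x (2^>0 k)) (m≤m+n k i)))) (+-identityʳ _))

popCount-≤ : ∀ b x → popCount b x ≤ b
popCount-≤ b x = subst (popCount b x ≤_) (*-identityʳ b) (∑-≤ 1 b (λ i _ → ≤-pred (bitAt<2 x i)))

-- The select table knows only ones, so zeros are sought in the complement. By induction on `b`: x
-- and its complement have an odd sum, which settles bit 0, and half of the complement is the
-- complement of the half.
bitAt-complement : ∀ x b k → x < 2 ^ b → k < b → bitAt (2 ^ b ∸ 1 ∸ x) k + bitAt x k ≡ 1
bitAt-complement x (suc b) zero x< k<b = lemma
  where
  -- x and its complement add up to an odd number.
  y : ℕ
  y = 2 ^ suc b ∸ 1 ∸ x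
  sum≡ : suc (y + x) ≡ 2 ^ suc b
  sum≡ = trans (cong suc (m∸n+n≡m {2 ^ suc b ∸ 1} {x} (≤-pred (≤-trans x< (≤-reflexive (sym (m+[n∸m]≡n (2^>0 (suc b)))))))))
    (m+[n∸m]≡n (2^>0 (suc b)))
  odd-digits : ∀ y₀ x₀ qy qx h → y₀ < 2 → x₀ < 2 → suc ((y₀ + qy * 2) + (x₀ + qx * 2)) ≡ 2 * h → y₀ + x₀ ≡ 1
  odd-digits 0 0 qy qx h _ _ e = ⊥-elim (odd (qy + qx) h (trans (lem qy qx) e))
    where
    lem : ∀ a b → suc (2 * (a + b)) ≡ suc ((0 + a * 2) + (0 + b * 2))
    lem = solve-∀
    odd : ∀ a b → ¬ suc (2 * a) ≡ 2 * b
    odd a b e′ = even≢odd b a (sym e′)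
  odd-digits 0 1 _ _ _ _ _ _ = refl
  odd-digits 1 0 _ _ _ _ _ _ = refl
  odd-digits 1 1 qy qx h _ _ e = ⊥-elim (even≢odd h (suc (qy + qx)) (sym (trans (lem qy qx) e)))
    where
    lem : ∀ a b → suc (2 * suc (a + b)) ≡ suc ((1 + a * 2) + (1 + b * 2))
    lem = solve-∀
  odd-digits (suc (suc _)) _ _ _ _ (s≤s (s≤s ())) _ _
  odd-digits _ (suc (suc _)) _ _ _ _ (s≤s (s≤s ())) _
  one : ∀ z → z // 1 ≡ z
  one = n/1≡n
  lemma : bitAt y 0 + bitAt x 0 ≡ 1
  lemma = trans (cong₂ (λ p q → p %% 2 + q %% 2) (one y) (one x))
    (odd-digits (y %% 2) (x %% 2) (y // 2) (x // 2) (2 ^ b) (%%-< y z<s) (%%-< x z<s)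
      (trans (cong suc (sym (cong₂ _+_ (divMod-split y {2} z<s) (divMod-split x {2} z<s)))) sum≡))
bitAt-complement x (suc b) (suc k) x< (s≤s k<b) = begin
  bitAt (2 ^ suc b ∸ 1 ∸ x) (1 + k) + bitAt x (1 + k)     ≡⟨ cong₂ _+_ (sym (bitAt-// _ 1 k)) (sym (bitAt-// x 1 k)) ⟩
  bitAt ((2 ^ suc b ∸ 1 ∸ x) // 2) k + bitAt (x // 2) k   ≡⟨ cong (λ z → bitAt z k + bitAt (x // 2) k) half ⟩
  bitAt (2 ^ b ∸ 1 ∸ x // 2) k + bitAt (x // 2) k         ≡⟨ bitAt-complement (x // 2) b k (//-< (2 ^ b) (subst (x <_) (*-comm 2 (2 ^ b)) x<)) k<b ⟩
  1                                                       ∎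
  where
  open ≡-Reasoning
  q r : ℕ
  q = x // 2
  r = x %% 2
  q< : q < 2 ^ b
  q< = //-< (2 ^ b) (subst (x <_) (*-comm 2 (2 ^ b)) x<)
  -- 2^(b+1) - 1 - (r + 2q) = (1 - r) + 2 (2^b - 1 - q)
  arith : ∀ r q P → r < 2 → q < P → 2 * P ∸ 1 ∸ (r + q * 2) ≡ (1 ∸ r) + (P ∸ 1 ∸ q) * 2
  arith r q P r<2 q<P with m≤n⇒∃[o]m+o≡n q<P
  ... | o , refl = trans (cong (_∸ (r + q * 2)) (lem₁ q o r)) (trans (cong (_∸ (r + q * 2)) (lem₂ r q o r<2))
        (trans (m+n∸m≡n (r + q * 2) _) (cong (λ z → 1 ∸ r + z * 2) (sym (m+n∸m≡n q o)))))
    where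
    lem₁ : ∀ q o r → 2 * (suc q + o) ∸ 1 ≡ 1 + (q * 2 + o * 2)
    lem₁ q o r = cong (_∸ 1) (l q o)
      where
      l : ∀ q o → 2 * (suc q + o) ≡ 1 + (1 + (q * 2 + o * 2))
      l = solve-∀
    lem₂ : ∀ r q o → r < 2 → 1 + (q * 2 + o * 2) ≡ r + q * 2 + ((1 ∸ r) + o * 2)
    lem₂ 0 q o _ = l q o
      where
      l : ∀ q o → 1 + (q * 2 + o * 2) ≡ 0 + q * 2 + (1 + o * 2)
      l = solve-∀
    lem₂ 1 q o _ = l q o
      where
      l : ∀ q o → 1 + (q * 2 + o * 2) ≡ 1 + q * 2 + (0 + o * 2)
      l = solve-∀
    lem₂ (suc (suc _)) q o (s≤s (s≤s ()))
  half : (2 ^ suc b ∸ 1 ∸ x) // 2 ≡ 2 ^ b ∸ 1 ∸ x // 2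
  half = trans (cong (_// 2) (trans (cong (2 ^ suc b ∸ 1 ∸_) (divMod-split x {2} z<s)) (arith r q (2 ^ b) (%%-< x z<s) q<)))
    (//-unique (2 ^ b ∸ 1 ∸ q) {1 ∸ r} {2} (s≤s (m∸n≤m 1 r)))

-- Positions of the two symbols of a bitmap

is : Bool → Bool → Bool
is true  x = x
is false x = not x

is-refl : ∀ b → is b b ≡ true
is-refl true  = refl
is-refl false = refl

is⇒≡ : ∀ b x → is b x ≡ true → x ≡ b
is⇒≡ true  true  _ = refl
is⇒≡ false false _ = refl

ranks : (ℕ → Bool) → Bool → ℕ → ℕ
ranks β b = ∑ (λ i → 𝟙 (is b (β i)))

ranks-+ : ∀ β i → ranks β false i + ranks β true i ≡ i
ranks-+ β zero    = refl
ranks-+ β (suc i) with β i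
... | true  = trans (cong₂ _+_ (+-identityʳ (ranks β false i)) refl) (trans (sym (+-assoc (ranks β false i) _ 1))
                (trans (cong (_+ 1) (ranks-+ β i)) (+-comm i 1)))
... | false = trans (cong (ranks β false i + 1 +_) (+-identityʳ _)) (trans (swap (ranks β false i) (ranks β true i))
                (trans (cong (_+ 1) (ranks-+ β i)) (+-comm i 1)))
  where
  swap : ∀ a b → a + 1 + b ≡ a + b + 1
  swap = solve-∀

ranks-false : ∀ β i → ranks β false i ≡ i ∸ ranks β true i
ranks-false β i = trans (sym (m+n∸n≡m (ranks β false i) (ranks β true i))) (cong (_∸ ranks β true i) (ranks-+ β i))

ranks-mono : ∀ β b {i j} → i ≤ j → ranks β b i ≤ ranks β b j
ranks-mono β b = ∑-mono (λ i → 𝟙 (is b (β i)))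

ranks-suc : ∀ β b i → is b (β i) ≡ true → ranks β b (suc i) ≡ suc (ranks β b i)
ranks-suc β b i e = trans (cong (λ z → ranks β b i + 𝟙 z) e) (+-comm _ 1)

ranks-< : ∀ β b {i j} → is b (β i) ≡ true → i < j → ranks β b i < ranks β b j
ranks-< β b {i} {j} e i<j = ≤-trans (≤-reflexive (sym (ranks-suc β b i e))) (ranks-mono β b i<j)

ranks-injective : ∀ β b {i j} → is b (β i) ≡ true → is b (β j) ≡ true → ranks β b i ≡ ranks β b j → i ≡ j
ranks-injective β b {i} {j} ei ej r≡ with <-cmp i j
... | tri< i<j _ _ = ⊥-elim (<-irrefl r≡ (ranks-< β b ei i<j))
... | tri≈ _ i≡j _ = i≡j
... | tri> _ _ j<i = ⊥-elim (<-irrefl (sym r≡) (ranks-< β b ej j<i))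

ranks-find : ∀ β b n {j} → j < ranks β b n → ∃[ i ] (i < n × is b (β i) ≡ true × ranks β b i ≡ j)
ranks-find β b (suc n) {j} j< with is b (β n) in e
... | false = let (i , i< , p) = ranks-find β b n (subst (j <_) (+-identityʳ _) j<) in i , m≤n⇒m≤1+n i< , p
... | true with m≤n⇒m<n∨m≡n (≤-pred (subst (j <_) (+-comm (ranks β b n) 1) j<))
...   | inj₁ j<r = let (i , i< , p) = ranks-find β b n j<r in i , m≤n⇒m≤1+n i< , p
...   | inj₂ j≡r = n , ≤-refl , e , sym j≡r

-- The stable partition of the positions by their bits: position i moves to
-- dest i.  F is its inverse, with off added to the positions of the ones.
module Partition (β : ℕ → Bool) (n : ℕ) where

  Z : ℕ
  Z = ranks β false n

  start₀ : Bool → ℕ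
  start₀ true  = Z
  start₀ false = 0

  dest : ℕ → ℕ
  dest i = start₀ (β i) + ranks β (β i) i

  Z+ones : Z + ranks β true n ≡ n
  Z+ones = ranks-+ β n

  dest-of : ∀ {b i} → is b (β i) ≡ true → dest i ≡ start₀ b + ranks β b i
  dest-of {b} {i} e rewrite is⇒≡ b (β i) e = refl

  dest-<Z : ∀ {i} → i < n → β i ≡ false → dest i < Z
  dest-<Z {i} i< e = subst (_< Z) (sym (dest-of {false} (cong not e))) (ranks-< β false (cong not e) i<)

  dest-≥Z : ∀ {i} → β i ≡ true → Z ≤ dest i
  dest-≥Z {i} e = subst (Z ≤_) (sym (dest-of {true} e)) (m≤m+n Z _)

  dest-< : ∀ {i} → i < n → dest i < n
  dest-< {i} i< = go (β i) refl
    where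
    go : ∀ b → β i ≡ b → dest i < n
    go false e = <-≤-trans (dest-<Z i< e) (≤-trans (m≤m+n Z _) (≤-reflexive Z+ones))
    go true  e = subst (_< n) (sym (dest-of {true} e)) (<-≤-trans (+-monoʳ-< Z (ranks-< β true e i<)) (≤-reflexive Z+ones))

  dest-injective : ∀ {i j} → i < n → j < n → dest i ≡ dest j → i ≡ j
  dest-injective {i} {j} i< j< d≡ = go (β i) (β j) refl refl
    where
    go : ∀ b c → β i ≡ b → β j ≡ c → i ≡ j
    go false false ei ej = ranks-injective β false (cong not ei) (cong not ej)
      (trans (sym (dest-of {false} (cong not ei))) (trans d≡ (dest-of {false} (cong not ej))))
    go true true ei ej = ranks-injective β true ei ej (+-cancelˡ-≡ Z _ _
      (trans (sym (dest-of {true} ei)) (trans d≡ (dest-of {true} ej))))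
    go false true ei ej = ⊥-elim (<-irrefl d≡ (<-≤-trans (dest-<Z i< ei) (dest-≥Z ej)))
    go true false ei ej = ⊥-elim (<-irrefl (sym d≡) (<-≤-trans (dest-<Z j< ej) (dest-≥Z ei)))

  dest-surjective : ∀ {J} → J < n → ∃[ i ] (i < n × dest i ≡ J)
  dest-surjective {J} J< with J <? Z
  ... | yes J<Z = let (i , i< , e , r≡) = ranks-find β false n J<Z in i , i< , trans (dest-of {false} e) r≡
  ... | no  J≮Z = let (i , i< , e , r≡) = ranks-find β true n J∸Z< in
      i , i< , trans (dest-of {true} e) (trans (cong (Z +_) r≡) (m+[n∸m]≡n (≮⇒≥ J≮Z)))
    where
    J∸Z< : J ∸ Z < ranks β true n
    J∸Z< = +-cancelˡ-< Z _ _ (subst₂ _<_ (sym (m+[n∸m]≡n (≮⇒≥ J≮Z))) (sym Z+ones) J<)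

  shift : ℕ → Bool → ℕ
  shift off b = if b then off else 0

  module Inverse (off : ℕ) (off≥ : n ≤ off) (F : ℕ → ℕ)
    (F-dest : ∀ i → i < n → F (dest i) ≡ i + shift off (β i)) where

    dest-mono⁻ : ∀ {i j} → i < n → j < n → β i ≡ β j → dest i < dest j → i < j
    dest-mono⁻ {i} {j} i< j< e d< with <-cmp i j
    ... | tri< i<j _ _ = i<j
    ... | tri≈ _ refl _ = ⊥-elim (<-irrefl refl d<)
    ... | tri> _ _ j<i = ⊥-elim (<-asym d< (subst (λ b → start₀ (β j) + ranks β (β j) j < start₀ b + ranks β b i) (sym e)
            (+-monoʳ-< (start₀ (β j)) (ranks-< β (β j) (is-refl (β j)) j<i))))

    -- Within one symbol the partition is stable. Across symbols all values of zeros are below n,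
    -- while those of ones are at least `off`, which is at least n.
    F-mono : ∀ {J J′} → J < J′ → J′ < n → F J < F J′
    F-mono {J} {J′} J<J′ J′< with dest-surjective (<-trans J<J′ J′<) | dest-surjective J′<
    ... | i , i< , refl | j , j< , refl = subst₂ _<_ (sym (F-dest i i<)) (sym (F-dest j j<)) (go (β i) (β j) refl refl)
      where
      go : ∀ b c → β i ≡ b → β j ≡ c → i + shift off (β i) < j + shift off (β j)
      by : ∀ {b c} → β i ≡ b → β j ≡ c → i + shift off b < j + shift off c → i + shift off (β i) < j + shift off (β j)
      by ei ej = subst₂ (λ p q → i + shift off p < j + shift off q) (sym ei) (sym ej)
      go false false ei ej = by ei ej (+-monoˡ-< 0 (dest-mono⁻ i< j< (trans ei (sym ej)) J<J′))
      go true true   ei ej = by ei ej (+-monoˡ-< off (dest-mono⁻ i< j< (trans ei (sym ej)) J<J′))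
      go false true  ei ej = by ei ej (<-≤-trans (subst (_< n) (sym (+-identityʳ i)) i<) (≤-trans off≥ (m≤n+m off j)))
      go true false  ei ej = ⊥-elim (<-asym J<J′ (<-≤-trans (dest-<Z j< ej) (dest-≥Z ei)))

    F-mono-≤ : ∀ {J J′} → J ≤ J′ → J′ < n → F J ≤ F J′
    F-mono-≤ J≤J′ J′< with m≤n⇒m<n∨m≡n J≤J′
    ... | inj₁ J<J′ = <⇒≤ (F-mono J<J′ J′<)
    ... | inj₂ refl = ≤-refl

    F-< : ∀ {J} → J < n → F J < n + off
    F-< {J} J< with dest-surjective J<
    ... | i , i< , refl = subst (_< n + off) (sym (F-dest i i<)) (go (β i))
      where
      go : ∀ b → i + shift off b < n + off
      go true  = +-monoˡ-< off i<
      go false = <-≤-trans (subst (_< n) (sym (+-identityʳ i)) i<) (m≤m+n n off)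

    -- Between the zeros and the ones F jumps by more than off - n.
    F-same : ∀ {b i J} → i < n → is b (β i) ≡ true → J ≤ dest i → F (dest i) ∸ F J ≤ off ∸ n →
      ∃[ p ] (p < n × is b (β p) ≡ true × dest p ≡ J × F J ≡ p + shift off b)
    F-same {b} {i} {J} i< e J≤ span≤ with dest-surjective (≤-<-trans J≤ (dest-< i<))
    ... | p , p< , refl = go b (β p) (is⇒≡ b (β i) e) refl
      where
      Goal : Bool → Set
      Goal b = ∃[ p′ ] (p′ < n × is b (β p′) ≡ true × dest p′ ≡ dest p × F (dest p) ≡ p′ + shift off b)
      go : ∀ b c → β i ≡ b → β p ≡ c → Goal b
      go false false ei ep = p , p< , cong not ep , refl , trans (F-dest p p<) (cong (λ z → p + shift off z) ep)
      go true true   ei ep = p , p< , ep , refl , trans (F-dest p p<) (cong (λ z → p + shift off z) ep)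
      go false true  ei ep = ⊥-elim (<-irrefl refl (<-≤-trans (dest-<Z i< ei) (≤-trans (dest-≥Z ep) J≤)))
      go true false  ei ep = ⊥-elim (<-irrefl refl (begin-strict
        off                                ≡⟨ sym (m∸n+n≡m off≥) ⟩
        (off ∸ n) + n                      ≤⟨ m≤n+m _ i ⟩
        i + ((off ∸ n) + n)                ≡⟨ cong (i +_) (m∸n+n≡m off≥) ⟩
        i + off                            ≡⟨ sym (trans (F-dest i i<) (cong (λ z → i + shift off z) ei)) ⟩
        F (dest i)                         ≤⟨ m≤n+m∸n (F (dest i)) (F (dest p)) ⟩
        F (dest p) + (F (dest i) ∸ F (dest p)) ≤⟨ +-monoʳ-≤ (F (dest p)) span≤ ⟩
        F (dest p) + (off ∸ n)             ≡⟨ cong (_+ (off ∸ n)) (trans (F-dest p p<) (trans (cong (λ z → p + shift off z) ep) (+-identityʳ p))) ⟩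
        p + (off ∸ n)                      <⟨ +-monoˡ-< (off ∸ n) p< ⟩
        n + (off ∸ n)                      ≡⟨ m+[n∸m]≡n off≥ ⟩
        off                                ∎))
        where open ≤-Reasoning

-- Groups of g consecutive values of an increasing F, indexed from 0 to n - 1.
-- A group is sparse if its values spread over at least t numbers; then the
-- quotient of its first value by t identifies it.
module Groups (n g t : ℕ) (g> : 0 < g) (t> : 0 < t) (F : ℕ → ℕ)
  (F-mono : ∀ {J J′} → J < J′ → J′ < n → F J < F J′) where

  -- The end of a group is the start of the following one, so a spread includes the gap between the
  -- two groups; for the last group it is clipped to n - 1. The `if` has the shape of an evaluated
  -- conditional expression.
  next : ℕ → ℕ
  next k = if 𝟙 (suc k * g <ᵇ n) ≡ᵇ 0 then n ∸ 1 else suc k * g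

  first last spread : ℕ → ℕ
  first k  = F (k * g)
  last k   = F (next k)
  spread k = last k ∸ first k

  F-mono′ : ∀ {J J′} → J ≤ J′ → J′ < n → F J ≤ F J′
  F-mono′ J≤J′ J′< with m≤n⇒m<n∨m≡n J≤J′
  ... | inj₁ J<J′ = <⇒≤ (F-mono J<J′ J′<)
  ... | inj₂ refl = ≤-refl

  next-< : ∀ {j k} → j < n → next k < n
  next-< {j} {k} j< with suc k * g <? n
  ... | yes p = subst (_< n) (sym (if-< p)) p
  ... | no ¬p = subst (_< n) (sym (if-≮ (≮⇒≥ ¬p))) (≤-reflexive (m+[n∸m]≡n {1} {n} (≤-trans (s≤s z≤n) j<)))

  ≤-next : ∀ {j k} → j < n → j ≤ suc k * g → j ≤ next k
  ≤-next {j} {k} j< j≤ with suc k * g <? n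
  ... | yes p = subst (j ≤_) (sym (if-< p)) j≤
  ... | no ¬p = subst (j ≤_) (sym (if-≮ (≮⇒≥ ¬p))) (≤-pred (≤-trans j< (≤-reflexive (sym (m+[n∸m]≡n {1} {n} (≤-trans (s≤s z≤n) j<))))))

  first≤ : ∀ {j} → j < n → first (j // g) ≤ F j
  first≤ {j} j< = F-mono′ (//*≤ j g) j<

  ≤last : ∀ {j} → j < n → F j ≤ last (j // g)
  ≤last {j} j< = F-mono′ (≤-next {j} {j // g} j< (<⇒≤ (suc//-≤ j g>))) (next-< {j} {j // g} j<)

  within : ∀ {j} → j < n → F j ∸ first (j // g) ≤ spread (j // g)
  within {j} j< = ∸-monoˡ-≤ (first (j // g)) (≤last j<)

  -- From the start of a sparse group to the start of the next one the values advance by at least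
  -- `t`, so every later group begins in a later range of length `t`.
  slot-< : ∀ {k k′} → t ≤ spread k → k < k′ → k′ * g < n → first k // t < first k′ // t
  slot-< {k} {k′} sp k<k′ k′< = begin-strict
    first k // t              <⟨ ≤-refl ⟩
    suc (first k // t)        ≡⟨ sym (//-unique (suc (first k // t)) (%%-< (first k) t>)) ⟩
    (first k %% t + suc (first k // t) * t) // t ≡⟨ cong (_// t) (trans (lemma (first k %% t) t (first k // t * t)) (cong (_+ t) (sym (divMod-split (first k) t>)))) ⟩
    (first k + t) // t        ≤⟨ //-monoˡ t (≤-trans (+-monoʳ-≤ (first k) sp) (≤-reflexive (m+[n∸m]≡n first≤last))) ⟩
    last k // t               ≤⟨ //-monoˡ t last≤ ⟩
    first k′ // t             ∎
    where
    open ≤-Reasoning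
    lemma : ∀ r t q → r + (t + q) ≡ r + q + t
    lemma = solve-∀
    suc≤ : suc k * g ≤ k′ * g
    suc≤ = *-monoˡ-≤ g k<k′
    next≡ : next k ≡ suc k * g
    next≡ = if-< (≤-<-trans suc≤ k′<)
    first≤last : first k ≤ last k
    first≤last = F-mono′ (subst (k * g ≤_) (sym next≡) (m≤n+m (k * g) g)) (subst (_< n) (sym next≡) (≤-<-trans suc≤ k′<))
    last≤ : last k ≤ first k′
    last≤ = F-mono′ (subst (_≤ k′ * g) (sym next≡) suc≤) k′<

  slot : ℕ → ℕ
  slot j = first (j // g) // t * g + j %% g

  slot-injective : ∀ {i j} → i < n → j < n → t ≤ spread (i // g) → t ≤ spread (j // g) → slot i ≡ slot j → i ≡ j
  slot-injective {i} {j} i< j< si sj s≡ = begin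
    i                          ≡⟨ divMod-split i g> ⟩
    i %% g + i // g * g        ≡⟨ cong₂ (λ r q → r + q * g) rem≡ group≡ ⟩
    j %% g + j // g * g        ≡⟨ sym (divMod-split j g>) ⟩
    j                          ∎
    where
    open ≡-Reasoning
    ordered : ∀ i → slot i ≡ i %% g + first (i // g) // t * g
    ordered i = +-comm (first (i // g) // t * g) (i %% g)
    rem≡ : i %% g ≡ j %% g
    rem≡ = trans (sym (%%-unique (first (i // g) // t) (%%-< i g>)))
      (trans (cong (_%% g) (trans (sym (ordered i)) (trans s≡ (ordered j)))) (%%-unique (first (j // g) // t) (%%-< j g>)))
    quot≡ : first (i // g) // t ≡ first (j // g) // t
    quot≡ = trans (sym (//-unique (first (i // g) // t) (%%-< i g>)))
      (trans (cong (_// g) (trans (sym (ordered i)) (trans s≡ (ordered j)))) (//-unique (first (j // g) // t) (%%-< j g>)))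
    group≡ : i // g ≡ j // g
    group≡ with <-cmp (i // g) (j // g)
    ... | tri< k< _ _ = ⊥-elim (<-irrefl quot≡ (slot-< si k< (≤-<-trans (//*≤ j g) j<)))
    ... | tri≈ _ e _  = e
    ... | tri> _ _ k> = ⊥-elim (<-irrefl (sym quot≡) (slot-< sj k> (≤-<-trans (//*≤ i g) i<)))

  slot-bound : ∀ {j M} → j < n → F j < M → slot j < suc (M // t) * g
  slot-bound {j} {M} j< F< = begin-strict
    first (j // g) // t * g + j %% g  <⟨ +-monoʳ-< (first (j // g) // t * g) (%%-< j g>) ⟩
    first (j // g) // t * g + g       ≡⟨ +-comm _ g ⟩
    suc (first (j // g) // t) * g     ≤⟨ *-monoˡ-≤ g (s≤s (//-monoˡ t (<⇒≤ (≤-<-trans (first≤ j<) F<)))) ⟩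
    suc (M // t) * g                  ∎
    where open ≤-Reasoning

-- Reading b ≤ w bits from position p on out of a bitmap packed in words.
window : (w b : ℕ) (word : ℕ → ℕ) (p : ℕ) → ℕ
window w b word p =
  word (p // w) // 2 ^ (p %% w) %% 2 ^ b +
  word (suc (p // w)) %% (1 * 2 ^ (b ∸ (w ∸ p %% w))) * 2 ^ (w ∸ p %% w)

module Window {w b : ℕ} (w> : 0 < w) (b≤w : b ≤ w) {word : ℕ → ℕ} (word< : ∀ k → word k < 2 ^ w) (p : ℕ) where
  r c x y : ℕ
  r = p %% w
  c = w ∸ r
  x = word (p // w)
  y = word (suc (p // w))

  r<w : r < w
  r<w = %%-< p w>

  r+c : r + c ≡ w
  r+c = m+[n∸m]≡n (<⇒≤ r<w)

  lo hi : ℕ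
  lo = x // 2 ^ r %% 2 ^ b
  hi = y %% (1 * 2 ^ (b ∸ c))

  hi≡ : hi ≡ y %% 2 ^ (b ∸ c)
  hi≡ = cong (y %%_) (*-identityˡ (2 ^ (b ∸ c)))

  x//< : x // 2 ^ r < 2 ^ c
  x//< = //-< (2 ^ c) (<-≤-trans (word< (p // w)) (≤-reflexive (trans (cong (2 ^_) (sym (trans (+-comm c r) r+c))) (^-distribˡ-+-* 2 c r))))

  -- Truncated subtraction turns the modulus into 1 when the window ends within the first word,
  -- which saves the program a case distinction.
  hi-zero : b ≤ c → hi ≡ 0
  hi-zero b≤c = trans hi≡ (trans (cong (λ z → y %% 2 ^ z) (m≤n⇒m∸n≡0 b≤c)) (n≤0⇒n≡0 (≤-pred (%%-< y {1} z<s))))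

  lo-small : c ≤ b → lo ≡ x // 2 ^ r
  lo-small c≤b = %%-id (<-≤-trans x//< (^-monoʳ-≤ 2 c≤b))

  high-< : hi * 2 ^ c < 2 ^ b
  high-< with b ≤? c
  ... | yes b≤c = subst (λ z → z * 2 ^ c < 2 ^ b) (sym (hi-zero b≤c)) (2^>0 b)
  ... | no  b≰c = <-≤-trans (*-monoˡ-< (2 ^ c) {{m^n≢0 2 c}} (subst (_< 2 ^ (b ∸ c)) (sym hi≡) (%%-< y (2^>0 (b ∸ c)))))
      (≤-reflexive (trans (sym (^-distribˡ-+-* 2 (b ∸ c) c)) (cong (2 ^_) (m∸n+n≡m (<⇒≤ (≰⇒> b≰c))))))

  window-< : window w b word p < 2 ^ b
  window-< with b ≤? c
  ... | yes b≤c = subst (_< 2 ^ b) (sym (trans (cong (λ z → lo + z * 2 ^ c) (hi-zero b≤c)) (+-identityʳ lo))) (%%-< _ (2^>0 b))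
  ... | no  b≰c = begin-strict
      lo + hi * 2 ^ c             <⟨ +-monoˡ-< (hi * 2 ^ c) (subst (_< 2 ^ c) (sym (lo-small (<⇒≤ (≰⇒> b≰c)))) x//<) ⟩
      suc hi * 2 ^ c              ≤⟨ *-monoˡ-≤ (2 ^ c) (subst (_< 2 ^ (b ∸ c)) (sym hi≡) (%%-< y (2^>0 (b ∸ c)))) ⟩
      2 ^ (b ∸ c) * 2 ^ c         ≡⟨ trans (sym (^-distribˡ-+-* 2 (b ∸ c) c)) (cong (2 ^_) (m∸n+n≡m (<⇒≤ (≰⇒> b≰c)))) ⟩
      2 ^ b                       ∎
      where open ≤-Reasoning

  position : ∀ k → k < c → (p + k) // w ≡ p // w × (p + k) %% w ≡ r + k
  position k k<c = trans (cong (_// w) e) (//-unique (p // w) r+k<) , trans (cong (_%% w) e) (%%-unique (p // w) r+k<)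
    where
    r+k< : r + k < w
    r+k< = <-≤-trans (+-monoʳ-< r k<c) (≤-reflexive r+c)
    lemma : ∀ r q k → r + q + k ≡ r + k + q
    lemma = solve-∀
    e : p + k ≡ r + k + p // w * w
    e = trans (cong (_+ k) (divMod-split p w>)) (lemma r (p // w * w) k)

  position′ : ∀ k → k < w → (p + (c + k)) // w ≡ suc (p // w) × (p + (c + k)) %% w ≡ k
  position′ k k<w = trans (cong (_// w) e) (//-unique (suc (p // w)) k<w) , trans (cong (_%% w) e) (%%-unique (suc (p // w)) k<w)
    where
    lemma : ∀ r q c k → r + q + (c + k) ≡ k + (r + c + q)
    lemma = solve-∀
    e : p + (c + k) ≡ k + suc (p // w) * w
    e = trans (cong (_+ (c + k)) (divMod-split p w>)) (trans (lemma r (p // w * w) c k) (cong (λ z → k + (z + p // w * w)) r+c))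

  window-bit : ∀ k → k < b → bitAt (window w b word p) k ≡ bitAt (word ((p + k) // w)) ((p + k) %% w)
  window-bit k k<b with k <? c
  ... | yes k<c = begin
      bitAt (lo + hi * 2 ^ c) k       ≡⟨ bitAt-low lo hi c k k<c ⟩
      bitAt lo k                      ≡⟨ bitAt-%% (x // 2 ^ r) b k k<b ⟩
      bitAt (x // 2 ^ r) k            ≡⟨ bitAt-// x r k ⟩
      bitAt x (r + k)                 ≡⟨ sym (cong₂ (λ i j → bitAt (word i) j) (proj₁ (position k k<c)) (proj₂ (position k k<c))) ⟩
      bitAt (word ((p + k) // w)) ((p + k) %% w) ∎
      where open ≡-Reasoning
  ... | no k≮c with m≤n⇒∃[o]m+o≡n (≮⇒≥ k≮c)
  ...   | o , refl = begin
      bitAt (lo + hi * 2 ^ c) (c + o)   ≡⟨ bitAt-high lo hi c o (subst (_< 2 ^ c) (sym (lo-small c≤b)) x//<) ⟩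
      bitAt hi o                        ≡⟨ cong (λ z → bitAt z o) hi≡ ⟩
      bitAt (y %% 2 ^ (b ∸ c)) o        ≡⟨ bitAt-%% y (b ∸ c) o o< ⟩
      bitAt y o                         ≡⟨ sym (cong₂ (λ i j → bitAt (word i) j) (proj₁ pos′) (proj₂ pos′)) ⟩
      bitAt (word ((p + (c + o)) // w)) ((p + (c + o)) %% w) ∎
      where
      open ≡-Reasoning
      c≤b : c ≤ b
      c≤b = <⇒≤ (≤-<-trans (m≤m+n c o) k<b)
      o< : o < b ∸ c
      o< = +-cancelˡ-< c _ _ (subst (c + o <_) (sym (m+[n∸m]≡n c≤b)) k<b)
      o<w : o < w
      o<w = <-≤-trans (≤-<-trans (m≤n+m o c) k<b) b≤w
      pos′ : (p + (c + o)) // w ≡ suc (p // w) × (p + (c + o)) %% w ≡ o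
      pos′ = position′ o o<w

-- Prefix sums by doubling: row d holds sums of 2^d consecutive terms.
module Doubling (f : ℕ → ℕ) (X : ℕ → ℕ → ℕ) (len : ℕ)
  (X-zero : ∀ k → k < len → X 0 k ≡ f k) where

  -- An additive way to say that `X d k` is the sum of the last 2^d terms up to k. For k below 2^d
  -- the truncated subtraction makes it the whole prefix.
  Row : ℕ → Set
  Row d = ∀ k → k < len → X d k + ∑ f (suc k ∸ 2 ^ d) ≡ ∑ f (suc k)

  row-zero : Row 0
  row-zero k k< = trans (cong (_+ ∑ f k) (X-zero k k<)) (+-comm (f k) (∑ f k))

  row-suc : ∀ d → (∀ k → k < len → X (suc d) k ≡ X d k + (if 𝟙 (k <ᵇ 1 * 2 ^ d) ≡ᵇ 0 then X d (k ∸ 1 * 2 ^ d) else 0)) →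
    Row d → Row (suc d)
  row-suc d step row k k< with k <? 2 ^ d
  ... | yes k<p = begin
      X (suc d) k + ∑ f (suc k ∸ 2 ^ suc d)    ≡⟨ cong₂ (λ a b → a + ∑ f b) (trans (step k k<) (trans (cong (X d k +_) (if-< (subst (k <_) (sym (*-identityˡ _)) k<p))) (+-identityʳ _)))
                                                    (m≤n⇒m∸n≡0 (≤-trans k<p (^-monoʳ-≤ 2 (n≤1+n d)))) ⟩
      X d k + ∑ f 0                            ≡⟨ cong (λ z → X d k + ∑ f z) (sym (m≤n⇒m∸n≡0 k<p)) ⟩
      X d k + ∑ f (suc k ∸ 2 ^ d)              ≡⟨ row k k< ⟩
      ∑ f (suc k)                              ∎
      where open ≡-Reasoning
  ... | no k≮p = begin
      X (suc d) k + ∑ f (suc k ∸ 2 ^ suc d)    ≡⟨ cong₂ (λ a b → a + ∑ f b) (trans (step k k<) (cong (X d k +_) (trans (if-≮ (subst (_≤ k) (sym (*-identityˡ _)) p≤k)) (cong (λ z → X d (k ∸ z)) (*-identityˡ (2 ^ d))))))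
                                                    (trans (cong (λ z → suc k ∸ z) (cong (2 ^ d +_) (+-identityʳ (2 ^ d)))) (trans (sym (∸-+-assoc (suc k) (2 ^ d) (2 ^ d))) (cong (_∸ 2 ^ d) (+-∸-assoc 1 p≤k)))) ⟩
      X d k + X d (k ∸ 2 ^ d) + ∑ f (suc (k ∸ 2 ^ d) ∸ 2 ^ d) ≡⟨ +-assoc (X d k) _ _ ⟩
      X d k + (X d (k ∸ 2 ^ d) + ∑ f (suc (k ∸ 2 ^ d) ∸ 2 ^ d)) ≡⟨ cong (X d k +_) (row (k ∸ 2 ^ d) (≤-<-trans (m∸n≤m k (2 ^ d)) k<)) ⟩
      X d k + ∑ f (suc (k ∸ 2 ^ d))            ≡⟨ cong (λ z → X d k + ∑ f z) (sym (+-∸-assoc 1 p≤k)) ⟩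
      X d k + ∑ f (suc k ∸ 2 ^ d)              ≡⟨ row k k< ⟩
      ∑ f (suc k)                              ∎
      where
      open ≡-Reasoning
      p≤k : 2 ^ d ≤ k
      p≤k = ≮⇒≥ k≮p

  row-full : ∀ d → len ≤ 2 ^ d → Row d → ∀ k → k < len → X d k ≡ ∑ f (suc k)
  row-full d len≤ row k k< = trans (sym (+-identityʳ _)) (trans (cong (λ z → X d k + ∑ f z) (sym (m≤n⇒m∸n≡0 (≤-trans k< len≤)))) (row k k<))

-- Rank/select structures: notation, parameters and contents

infixl 6 _⊕_ _⊖_
infixl 7 _⊗_ _⊘_ _⊛_
infix  5 _≺_

_⊕_ _⊖_ _⊗_ _⊘_ _⊛_ _≺_ _≫_ : Expr → Expr → Expr
_⊕_ = bin ADD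
_⊖_ = bin SUB
_⊗_ = bin MUL
_⊘_ = bin DIV
_⊛_ = bin MOD
_≺_ = bin LT
_≫_ = bin SHR

v : Reg → Expr
v = var

# : ℕ → Expr
# = con

-- ld◂ claims a small result, ld▸ does not.
ld◂ ld▸ : Expr → Expr
ld◂ = ld true
ld▸ = ld false

-- The parameters of the rank/select structures for bitmaps of length n.
-- Positions are sampled at every g-th and G-th occurrence, and ranks at every
-- b-th and H-th position; relative values take e bits, q of them per word.
record Params : Set where
  field
    w Bd : ℕ
    n b B q e E H G g T off h nb cap1 cap2 : ℕ
    Bd^8≤ : Bd ^ 8 ≤ 2 ^ w
    Bd>   : 1000 ≤ Bd
    w<Bd  : w < Bd
    n>    : 0 < n
    b>    : 0 < b
    q>    : 0 < q
    g>    : 0 < g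
    h>    : 0 < h
    T>    : 0 < T
    b≤w   : b ≤ w
    eq≤w  : e * q ≤ w
    B≡    : B ≡ 2 ^ b
    E≡    : E ≡ 2 ^ e
    H≡    : H ≡ b * h
    G≡    : G ≡ g * h
    H≤E   : H ≤ E
    2T≤E  : T + T ≤ E
    off≡  : off ≡ n + b
    nb≡   : nb ≡ suc (n // b)
    cap1≡ : cap1 ≡ suc ((n + off) // T) * G
    cap2≡ : cap2 ≡ suc ((n + off) // b) * g

  field
    positions< : n + off + E + E < Bd
    twice< : (n + off) + (n + off) < Bd
    B<Bd : B < Bd
    b<Bd : b < Bd
    q<Bd : q < Bd
    H<Bd : H < Bd
    G<Bd : G < Bd
    g<Bd : g < Bd
    T<Bd : T < Bd

  setting : Setting
  setting = record { w = w ; Bd = Bd ; Bd^8≤ = Bd^8≤ ; Bd> = Bd> ; w<Bd = w<Bd }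

  G> : 0 < G
  G> = subst (0 <_) (sym G≡) (*-mono-≤ g> h>)

  H> : 0 < H
  H> = subst (0 <_) (sym H≡) (*-mono-≤ b> h>)

  w> : 0 < w
  w> = ≤-trans b> b≤w

  o₁ o₂ o₃ o₄ o₅ o₆ o₇ o₈ size : ℕ
  o₁ = 18
  o₂ = o₁ + B
  o₃ = o₂ + B * b
  o₄ = o₃ + (n // H + 1)
  o₅ = o₄ + (nb // q + 1)
  o₆ = o₅ + (n // G + 1)
  o₇ = o₆ + cap1
  o₈ = o₇ + ((n // g + 1) // q + 1)
  size = o₈ + (cap2 // q + 1)

-- The words of a rank/select structure at address R for a bitmap with bits β,
-- with F as in Partition.
module _ (P : Params) where
  open Params P

  module Structure (β : ℕ → Bool) (F : ℕ → ℕ) where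
    open Partition β n using (Z)

    rk : ℕ → ℕ
    rk = ranks β true

    nextOf : ℕ → ℕ → ℕ
    nextOf γ k = if 𝟙 (suc k * γ <ᵇ n) ≡ᵇ 0 then n ∸ 1 else suc k * γ

    spreadOf : ℕ → ℕ → ℕ
    spreadOf γ k = F (nextOf γ k) ∸ F (k * γ)

    slotOf : ℕ → ℕ → ℕ → ℕ
    slotOf γ t j = F (j // γ * γ) // t * γ + j %% γ

    sparseOf : ℕ → ℕ → ℕ → ℕ
    sparseOf γ t k = 1 ∸ 𝟙 (spreadOf γ k <ᵇ t)

    header : ℕ → ℕ → ℕ
    header R 0  = b
    header R 1  = q
    header R 2  = e
    header R 3  = E
    header R 4  = H
    header R 5  = G
    header R 6  = g
    header R 7  = T
    header R 8  = off
    header R 9  = Z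
    header R 10 = R + o₁
    header R 11 = R + o₂
    header R 12 = R + o₃
    header R 13 = R + o₄
    header R 14 = R + o₅
    header R 15 = R + o₆
    header R 16 = R + o₇
    header R 17 = R + o₈
    header R _  = 0

    field′ : ℕ → ℕ → ℕ
    field′ x k = x // 2 ^ (e * (k %% q)) %% E

    -- `a1` and `a2` carry a sparseness flag in their lowest bit. The entries of `a2` and `x2` are
    -- exact modulo `E` only; they are consulted when the enclosing group of length `G` is dense,
    -- and then they are below `E`.
    record Index (M : Mem) (Bm R : ℕ) : Set where
      field
        bits : ∀ i → i < n → bitAt (M (Bm + i // w)) (i %% w) ≡ 𝟙 (β i)
        hdr  : ∀ i → i < 18 → M (R + i) ≡ header R i
        pop  : ∀ x → x < B → M (R + o₁ + x) ≡ popCount b x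
        sel  : ∀ x r → x < B → r < b → M (R + o₂ + (x * b + r)) ≡ ∑ (λ k → 𝟙 (popCount b (x %% (1 * 2 ^ suc k)) <ᵇ suc r)) b
        ra   : ∀ k → k ≤ n // H → M (R + o₃ + k) ≡ rk (k * H)
        rb   : ∀ k → k < nb → field′ (M (R + o₄ + k // q)) k ≡ rk (k * b) ∸ rk (k * b // H * H)
        a1   : ∀ k → k * G < n → M (R + o₅ + k) ≡ 2 * F (k * G) + sparseOf G T k
        x1   : ∀ j → j < n → T ≤ spreadOf G (j // G) → M (R + o₆ + slotOf G T j) ≡ F j ∸ F (j // G * G)
        a2   : ∀ k → k * g < n → field′ (M (R + o₇ + k // q)) k ≡ (2 * (F (k * g) ∸ F (k * g // G * G)) + sparseOf g b k) %% E
        x2   : ∀ j → j < n → b ≤ spreadOf g (j // g) →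
               field′ (M (R + o₈ + slotOf g b j // q)) (slotOf g b j) ≡ (F j ∸ F (j // g * g)) %% E

-- Programs for rank and select queries

-- Registers of the query programs: 0 the argument, 1 n, 2 w, 3 the address of the
-- bitmap, 4 the address of the structure, from 5 on its header.

loadHeader : ℕ → Prog → Prog
loadHeader k p = assign (5 + k) (ld◂ (v 4 ⊕ # k)) ++ p

loadHeaders : Prog → Prog
loadHeaders p =
  loadHeader 0 (loadHeader 1 (loadHeader 2 (loadHeader 3 (loadHeader 4 (loadHeader 5 (
  loadHeader 6 (loadHeader 7 (loadHeader 8 (loadHeader 9 (loadHeader 10 (loadHeader 11 (
  loadHeader 12 (loadHeader 13 (loadHeader 14 (loadHeader 15 (loadHeader 16 (loadHeader 17 p)))))))))))))))))

windowAt : Expr → Expr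
windowAt p = ((ld▸ (v 3 ⊕ p ⊘ v 2)) ≫ (p ⊛ v 2)) ⊛ shl true (# 1) (v 5)
  ⊕ shl true (ld▸ (v 3 ⊕ (# 1 ⊕ p ⊘ v 2)) ⊛ shl true (# 1) (v 5 ⊖ (v 2 ⊖ p ⊛ v 2))) (v 2 ⊖ p ⊛ v 2)

fieldAt : (base k : Expr) → Expr
fieldAt base k = (ld▸ (base ⊕ k ⊘ v 6) ≫ (v 7 ⊗ (k ⊛ v 6))) ⊛ v 8

rankBody : Bool → Prog
rankBody β =
  assign 23 (v 0 ⊘ v 5) ++
  assign 24 (v 23 ⊗ v 5) ++
  assign 25 (windowAt (v 24)) ++
  assign 26 (ld◂ (v 17 ⊕ v 0 ⊘ v 9) ⊕ fieldAt (v 18) (v 23) ⊕ ld◂ (v 15 ⊕ v 25 ⊛ shl true (# 1) (v 0 ⊛ v 5))) ++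
  assign 0 (if β then v 26 else v 0 ⊖ v 26) ++ []

-- Register 23 becomes the destination `J` of the sought occurrence, counted from 0. Registers 24
-- and 25 describe its upper group, 26 and 27 its lower one; 28 to 30 hold the position and contents
-- of the window where that group starts. Register 31 picks `F J` from the upper slots, the lower
-- slots or the table, and undoing the shift yields the answer.
selectBody : Bool → Prog
selectBody β =
  assign 23 ((if β then v 14 else # 0) ⊕ (v 0 ⊖ # 1)) ++
  assign 24 (ld◂ (v 19 ⊕ v 23 ⊘ v 10)) ++
  assign 25 (v 24 ⊘ # 2) ++
  assign 26 (fieldAt (v 21) (v 23 ⊘ v 11)) ++
  assign 27 (v 25 ⊕ v 26 ⊘ # 2) ++
  assign 28 (v 27 ⊖ (if β then v 13 else # 0)) ++
  assign 29 (windowAt (v 28)) ++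
  assign 30 (if β then v 29 else shl true (# 1) (v 5) ⊖ # 1 ⊖ v 29) ++
  assign 31 (ite (v 24 ⊛ # 2)
    (v 25 ⊕ ld◂ (v 20 ⊕ (v 25 ⊘ v 12 ⊗ v 10 ⊕ v 23 ⊛ v 10)))
    (ite (v 26 ⊛ # 2)
      (v 27 ⊕ fieldAt (v 22) (v 27 ⊘ v 5 ⊗ v 11 ⊕ v 23 ⊛ v 11))
      (v 27 ⊕ ld◂ (v 16 ⊕ (v 30 ⊗ v 5 ⊕ v 23 ⊛ v 11))))) ++
  assign 0 (v 31 ⊖ (if β then v 13 else # 0)) ++ []

queries : Queries
queries = record { rankProg = λ b → loadHeaders (rankBody b) ; selectProg = λ b → loadHeaders (selectBody b) }

-- Correctness of the query formulas

module QueryValues (P : Params) (β : ℕ → Bool) (F : ℕ → ℕ)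
  (F-dest : ∀ i → i < Params.n P →
    F (Partition.dest β (Params.n P) i) ≡ i + Partition.shift β (Params.n P) (Params.off P) (β i))
  (M : Mem) (isMem : Machine.IsMemory (Params.w P) M) (Bm R : ℕ) (idx : Structure.Index P β F M Bm R) where
  open Params P
  open Structure P β F
  open Index idx
  open Partition β n
  n≤off : n ≤ off
  n≤off = ≤-trans (m≤m+n n b) (≤-reflexive (sym off≡))
  off∸n : off ∸ n ≡ b
  off∸n = trans (cong (_∸ n) off≡) (m+n∸m≡n n b)
  open Inverse off n≤off F F-dest

  wordOf : ℕ → ℕ
  wordOf k = M (Bm + k)

  winOf : ℕ → ℕ
  winOf p = window w b wordOf p

  module Win (p : ℕ) = Window {w} {b} w> b≤w {wordOf} (λ k → isMem (Bm + k)) p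

  -- A window may reach past the end of the bitmap, where memory is arbitrary, so nothing is claimed
  -- for positions from n on.
  win-bit : ∀ p k → k < b → p + k < n → bitAt (winOf p) k ≡ 𝟙 (β (p + k))
  win-bit p k k<b p+k< = trans (Win.window-bit p k k<b) (bits (p + k) p+k<)

  winFor : Bool → ℕ → ℕ
  winFor true  p = winOf p
  winFor false p = 1 * 2 ^ b ∸ 1 ∸ winOf p

  winFor-< : ∀ c p → winFor c p < 2 ^ b
  winFor-< true  p = Win.window-< p
  winFor-< false p = ≤-<-trans (m∸n≤m _ (winOf p)) (≤-trans (≤-reflexive (trans (cong suc (cong (_∸ 1) (*-identityˡ (2 ^ b)))) (m+[n∸m]≡n (2^>0 b)))) ≤-refl)

  winFor-bit : ∀ c p k → k < b → p + k < n → bitAt (winFor c p) k ≡ 𝟙 (is c (β (p + k)))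
  winFor-bit true  p k k<b p+k< = win-bit p k k<b p+k<
  winFor-bit false p k k<b p+k< = +-cancelʳ-≡ (bitAt (winOf p) k) _ _ (trans
    (trans (cong (λ z → bitAt (z ∸ 1 ∸ winOf p) k + bitAt (winOf p) k) (*-identityˡ (2 ^ b))) (bitAt-complement (winOf p) b k (Win.window-< p) k<b))
    (trans (flip (β (p + k))) (cong (𝟙 (not (β (p + k))) +_) (sym (win-bit p k k<b p+k<)))))
    where
    flip : ∀ x → 1 ≡ 𝟙 (not x) + 𝟙 x
    flip true  = refl
    flip false = refl

  rank-step : ∀ c p m → (∀ k → k < m → p + k < n) → m ≤ b → ∑ (bitAt (winFor c p)) m + ranks β c p ≡ ranks β c (p + m)
  rank-step c p m in-range m≤b = trans (+-comm (∑ (bitAt (winFor c p)) m) (ranks β c p)) (sym (trans (∑-+ (λ i → 𝟙 (is c (β i))) p m)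
    (cong (ranks β c p +_) (∑-cong m (λ k k< → sym (winFor-bit c p k (<-≤-trans k< m≤b) (in-range k k<)))))))

  rankValue : ℕ → ℕ
  rankValue i = M (R + o₃ + i // H) + field′ (M (R + o₄ + i // b // q)) (i // b)
    + M (R + o₁ + winOf (i // b * b) %% (1 * 2 ^ (i %% b)))

  -- `H` is a multiple of `b`, so a whole block of `b` positions lies in one range of the upper
  -- directory, and the program may use the range of i itself.
  block//H : ∀ i → i // b * b // H ≡ i // H
  block//H i = begin
    i // b * b // H         ≡⟨ cong (i // b * b //_) H≡ ⟩
    i // b * b // (b * h)   ≡⟨ sym (//-// (i // b * b) b h) ⟩
    i // b * b // b // h    ≡⟨ cong (_// h) (//-unique (i // b) b>) ⟩
    i // b // h             ≡⟨ //-// i b h ⟩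
    i // (b * h)            ≡⟨ cong (i //_) (sym H≡) ⟩
    i // H                  ∎
    where open ≡-Reasoning

  rankValue≡ : ∀ i → i ≤ n → rankValue i ≡ rk i
  rankValue≡ i i≤n = begin
    rankValue i
      ≡⟨ cong₂ _+_ (cong₂ _+_ (ra (i // H) (//-monoˡ H i≤n)) (rb (i // b) block<)) (pop _ small) ⟩
    rk (i // H * H) + (rk p ∸ rk (p // H * H)) + popCount b (winOf p %% (1 * 2 ^ r))
      ≡⟨ cong₂ (λ x y → rk (i // H * H) + (rk p ∸ rk (x * H)) + popCount b (winOf p %% y)) (block//H i) (*-identityˡ (2 ^ r)) ⟩
    rk (i // H * H) + (rk p ∸ rk (i // H * H)) + popCount b (winOf p %% 2 ^ r)
      ≡⟨ cong₂ _+_ (m+[n∸m]≡n (ranks-mono β true (≤-trans (≤-reflexive (cong (_* H) (sym (block//H i)))) (//*≤ p H)))) (popCount-%% b (winOf p) r (<⇒≤ r<b)) ⟩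
    rk p + ∑ (bitAt (winOf p)) r
      ≡⟨ +-comm (rk p) _ ⟩
    ∑ (bitAt (winOf p)) r + rk p
      ≡⟨ rank-step true p r (λ k k< → <-≤-trans (+-monoʳ-< p k<) (≤-trans (≤-reflexive p+r) i≤n)) (<⇒≤ r<b) ⟩
    rk (p + r)
      ≡⟨ cong rk p+r ⟩
    rk i ∎
    where
    open ≡-Reasoning
    p r : ℕ
    p = i // b * b
    r = i %% b
    r<b : r < b
    r<b = %%-< i b>
    p+r : p + r ≡ i
    p+r = trans (+-comm p r) (sym (divMod-split i b>))
    block< : i // b < nb
    block< = <-≤-trans (s≤s (//-monoˡ b i≤n)) (≤-reflexive (sym nb≡))
    small : winOf p %% (1 * 2 ^ r) < B
    small = <-≤-trans (≤-<-trans (%%-≤ (winOf p) (1 * 2 ^ r)) (Win.window-< p)) (≤-reflexive (sym B≡))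

  module G₁ = Groups n G T G> T> F F-mono
  module G₂ = Groups n g b g> b> F F-mono

  -- The intermediate results of a select query for J = dest i, where β i = c.
  a₁ a c₁ s : ℕ → ℕ
  a₁ J = M (R + o₅ + J // G)
  a J  = a₁ J // 2
  c₁ J = field′ (M (R + o₇ + J // g // q)) (J // g)
  s J  = a J + c₁ J // 2

  startOf : Bool → ℕ → ℕ
  startOf c J = s J ∸ shift off c

  inWindow : Bool → ℕ → ℕ
  inWindow c J = M (R + o₂ + (winFor c (startOf c J) * b + J %% g))

  slot₁ slot₂ : ℕ → ℕ
  slot₁ J = a J // T * G + J %% G
  slot₂ J = s J // b * g + J %% g

  found : Bool → ℕ → ℕ
  found c J = if a₁ J %% 2 ≡ᵇ 0
    then (if c₁ J %% 2 ≡ᵇ 0 then s J + inWindow c J else s J + field′ (M (R + o₈ + slot₂ J // q)) (slot₂ J))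
    else a J + M (R + o₆ + slot₁ J)

  sparse-cases : ∀ γ t k → (t ≤ spreadOf γ k × sparseOf γ t k ≡ 1) ⊎ (spreadOf γ k < t × sparseOf γ t k ≡ 0)
  sparse-cases γ t k with spreadOf γ k <? t
  ... | yes p = inj₂ (p , cong (1 ∸_) (𝟙< p))
  ... | no ¬p = inj₁ (≮⇒≥ ¬p , cong (1 ∸_) (𝟙≮ (≮⇒≥ ¬p)))

  halve : ∀ x y → y < 2 → (2 * x + y) // 2 ≡ x × (2 * x + y) %% 2 ≡ y
  halve x y y< = trans (cong (_// 2) 2x+y) (//-unique x y<) , trans (cong (_%% 2) 2x+y) (%%-unique x y<)
    where
    2x+y : 2 * x + y ≡ y + x * 2
    2x+y = trans (+-comm (2 * x) y) (cong (y +_) (*-comm 2 x))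

  sparse<2 : ∀ γ t k → sparseOf γ t k < 2
  sparse<2 γ t k = s≤s (m∸n≤m 1 (𝟙 (spreadOf γ k <ᵇ t)))

  module Found {J : ℕ} (J< : J < n) where
    first₁ first₂ : ℕ
    first₁ = F (J // G * G)
    first₂ = F (J // g * g)

    group< : ∀ γ → J // γ * γ < n
    group< γ = ≤-<-trans (//*≤ J γ) J<

    a₁≡ : a₁ J ≡ 2 * first₁ + sparseOf G T (J // G)
    a₁≡ = a1 (J // G) (group< G)

    a≡ : a J ≡ first₁
    a≡ = trans (cong (_// 2) a₁≡) (proj₁ (halve first₁ _ (sparse<2 G T (J // G))))

    flag₁ : a₁ J %% 2 ≡ sparseOf G T (J // G)
    flag₁ = trans (cong (_%% 2) a₁≡) (proj₂ (halve first₁ _ (sparse<2 G T (J // G))))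

    subgroup : J // g * g // G ≡ J // G
    subgroup = begin
      J // g * g // G         ≡⟨ cong (J // g * g //_) G≡ ⟩
      J // g * g // (g * h)   ≡⟨ sym (//-// (J // g * g) g h) ⟩
      J // g * g // g // h    ≡⟨ cong (_// h) (//-unique (J // g) g>) ⟩
      J // g // h             ≡⟨ //-// J g h ⟩
      J // (g * h)            ≡⟨ cong (J //_) (sym G≡) ⟩
      J // G                  ∎
      where open ≡-Reasoning

    first₁≤first₂ : first₁ ≤ first₂
    first₁≤first₂ = F-mono-≤ (≤-trans (≤-reflexive (cong (_* G) (sym subgroup))) (//*≤ (J // g * g) G)) (group< g)

    first₂≤ : first₂ ≤ F J
    first₂≤ = F-mono-≤ (//*≤ J g) J<

    module Dense (dense : spreadOf G (J // G) < T) where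
      F∸first₁ : F J ∸ first₁ < T
      F∸first₁ = ≤-<-trans (G₁.within J<) dense

      c : ℕ
      c = first₂ ∸ first₁

      c< : c < T
      c< = ≤-<-trans (∸-monoˡ-≤ first₁ first₂≤) F∸first₁

      sp : ℕ
      sp = sparseOf g b (J // g)

      -- In a dense upper group the offset is below `T`, so twice the offset plus the flag is below
      -- `2T ≤ E`, and the reduction modulo `E` changes nothing.
      c₁≡ : c₁ J ≡ 2 * c + sp
      c₁≡ = trans (a2 (J // g) (group< g)) (trans (cong (λ z → (2 * (first₂ ∸ F (z * G)) + sp) %% E) subgroup) (%%-id (begin-strict
        2 * c + sp      <⟨ +-monoʳ-< (2 * c) (sparse<2 g b (J // g)) ⟩
        2 * c + 2       ≡⟨ trans (+-comm (2 * c) 2) (sym (*-suc 2 c)) ⟩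
        2 * suc c       ≤⟨ *-monoʳ-≤ 2 c< ⟩
        2 * T           ≡⟨ cong (T +_) (+-identityʳ T) ⟩
        T + T           ≤⟨ 2T≤E ⟩
        E               ∎)))
        where open ≤-Reasoning

      s≡ : s J ≡ first₂
      s≡ = trans (cong₂ _+_ a≡ (trans (cong (_// 2) c₁≡) (proj₁ (halve c _ (sparse<2 g b (J // g)))))) (m+[n∸m]≡n first₁≤first₂)

      flag₂ : c₁ J %% 2 ≡ sp
      flag₂ = trans (cong (_%% 2) c₁≡) (proj₂ (halve c _ (sparse<2 g b (J // g))))

      T≤E : T ≤ E
      T≤E = ≤-trans (m≤m+n T T) 2T≤E

      found-sparse : b ≤ spreadOf g (J // g) → s J + field′ (M (R + o₈ + slot₂ J // q)) (slot₂ J) ≡ F J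
      found-sparse sparse = begin
        s J + field′ (M (R + o₈ + slot₂ J // q)) (slot₂ J)
          ≡⟨ cong (λ z → z + field′ (M (R + o₈ + (z // b * g + J %% g) // q)) (z // b * g + J %% g)) s≡ ⟩
        first₂ + field′ (M (R + o₈ + slotOf g b J // q)) (slotOf g b J)
          ≡⟨ cong (first₂ +_) (trans (x2 J J< sparse) (%%-id (≤-<-trans (∸-monoʳ-≤ (F J) first₁≤first₂) (<-≤-trans F∸first₁ T≤E)))) ⟩
        first₂ + (F J ∸ first₂)
          ≡⟨ m+[n∸m]≡n first₂≤ ⟩
        F J ∎
        where open ≡-Reasoning

      module Narrow (narrow : spreadOf g (J // g) < b) {cc : Bool} {i : ℕ} (i< : i < n) (βi : is cc (β i) ≡ true) (J≡ : dest i ≡ J) where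
        F∸first₂ : F J ∸ first₂ < b
        F∸first₂ = ≤-<-trans (G₂.within J<) narrow

        -- The spread of the group is below `b = off ∸ n`, too small for the jump of `F` between the
        -- symbols. So the first member of the group is a position `p` carrying the same symbol as
        -- i.
        same : ∃[ p ] (p < n × is cc (β p) ≡ true × dest p ≡ J // g * g × first₂ ≡ p + shift off cc)
        same = F-same i< βi (≤-trans (//*≤ J g) (≤-reflexive (sym J≡)))
          (≤-trans (<⇒≤ (subst (λ z → F z ∸ first₂ < b) (sym J≡) F∸first₂)) (≤-reflexive (sym off∸n)))

        p : ℕ
        p = proj₁ same
        βp : is cc (β p) ≡ true
        βp = proj₁ (proj₂ (proj₂ same))
        first₂≡ : first₂ ≡ p + shift off cc
        first₂≡ = proj₂ (proj₂ (proj₂ (proj₂ same)))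
        dest-p : dest p ≡ J // g * g
        dest-p = proj₁ (proj₂ (proj₂ (proj₂ same)))

        start≡ : startOf cc J ≡ p
        start≡ = trans (cong (_∸ shift off cc) (trans s≡ first₂≡)) (m+n∸n≡m p (shift off cc))

        FJ≡ : F J ≡ i + shift off cc
        FJ≡ = trans (cong F (sym J≡)) (trans (F-dest i i<) (cong (λ z → i + shift off z) (is⇒≡ cc (β i) βi)))

        p≤i : p ≤ i
        p≤i = +-cancelʳ-≤ (shift off cc) p i (subst₂ _≤_ first₂≡ FJ≡ first₂≤)

        δ : ℕ
        δ = i ∸ p

        p+δ : p + δ ≡ i
        p+δ = m+[n∸m]≡n p≤i

        δ≡ : F J ∸ first₂ ≡ δ
        δ≡ = trans (cong₂ _∸_ FJ≡ first₂≡) ([m+n]∸[o+n]≡m∸o i (shift off cc) p)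
          where
          [m+n]∸[o+n]≡m∸o : ∀ m n o → (m + n) ∸ (o + n) ≡ m ∸ o
          [m+n]∸[o+n]≡m∸o m n o = trans (cong₂ _∸_ (+-comm m n) (+-comm o n)) ([m+n]∸[m+o]≡n∸o n m o)

        δ<b : δ < b
        δ<b = subst (_< b) δ≡ F∸first₂

        r : ℕ
        r = J %% g

        -- Destinations number the occurrences of a symbol consecutively, so the distance `J %% g`
        -- of two destinations is the number of occurrences of the symbol from p up to but excluding
        -- i.
        ranks≡ : ranks β cc i ≡ r + ranks β cc p
        ranks≡ = +-cancelˡ-≡ (start₀ cc) _ _ (begin
          start₀ cc + ranks β cc i        ≡⟨ sym (dest-of {cc} βi) ⟩
          dest i                          ≡⟨ J≡ ⟩
          J                               ≡⟨ divMod-split J g> ⟩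
          r + J // g * g                  ≡⟨ cong (r +_) (trans (sym dest-p) (dest-of {cc} βp)) ⟩
          r + (start₀ cc + ranks β cc p)  ≡⟨ swap r (start₀ cc) (ranks β cc p) ⟩
          start₀ cc + (r + ranks β cc p)  ∎)
          where
          open ≡-Reasoning
          swap : ∀ a b c → a + (b + c) ≡ b + (a + c)
          swap = solve-∀

        r≤δ : r ≤ δ
        r≤δ = +-cancelʳ-≤ (ranks β cc p) r δ (begin
          r + ranks β cc p                              ≡⟨ sym ranks≡ ⟩
          ranks β cc i                                  ≡⟨ cong (ranks β cc) (sym p+δ) ⟩
          ranks β cc (p + δ)                            ≡⟨ ∑-+ (λ i → 𝟙 (is cc (β i))) p δ ⟩
          ranks β cc p + ∑ (λ k → 𝟙 (is cc (β (p + k)))) δ ≤⟨ +-monoʳ-≤ (ranks β cc p) (∑-≤ 1 δ (λ k _ → 𝟙≤1 (is cc (β (p + k))))) ⟩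
          ranks β cc p + δ * 1                          ≡⟨ trans (cong (ranks β cc p +_) (*-identityʳ δ)) (+-comm _ δ) ⟩
          δ + ranks β cc p                              ∎)
          where open ≤-Reasoning

        W : ℕ
        W = winFor cc p

        prefix : ∀ m → m ≤ suc δ → ∑ (bitAt W) m + ranks β cc p ≡ ranks β cc (p + m)
        prefix m m≤ = rank-step cc p m
          (λ k k< → ≤-<-trans (+-monoʳ-≤ p (≤-pred (<-≤-trans k< m≤))) (subst (_< n) (sym p+δ) i<))
          (≤-trans m≤ δ<b)

        before : ∀ k → k < δ → ∑ (bitAt W) (suc k) < suc r
        before k k<δ = s≤s (+-cancelʳ-≤ (ranks β cc p) _ r (begin
          ∑ (bitAt W) (suc k) + ranks β cc p   ≡⟨ prefix (suc k) (≤-trans k<δ (n≤1+n δ)) ⟩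
          ranks β cc (p + suc k)               ≤⟨ ranks-mono β cc (≤-trans (+-monoʳ-≤ p k<δ) (≤-reflexive p+δ)) ⟩
          ranks β cc i                         ≡⟨ ranks≡ ⟩
          r + ranks β cc p                     ∎))
          where open ≤-Reasoning

        -- This covers also those k whose window bits lie past the end of the bitmap: prefix counts
        -- cannot decrease, whatever these bits are.
        after′ : ∀ k → δ ≤ k → suc r ≤ ∑ (bitAt W) (suc k)
        after′ k δ≤k = +-cancelʳ-≤ (ranks β cc p) (suc r) _ (begin
          suc r + ranks β cc p                 ≡⟨ cong suc (sym ranks≡) ⟩
          suc (ranks β cc i)                   ≡⟨ sym (ranks-suc β cc i βi) ⟩
          ranks β cc (suc i)                   ≡⟨ cong (ranks β cc) (trans (cong suc (sym p+δ)) (sym (+-suc p δ))) ⟩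
          ranks β cc (p + suc δ)               ≡⟨ sym (prefix (suc δ) ≤-refl) ⟩
          ∑ (bitAt W) (suc δ) + ranks β cc p   ≤⟨ +-monoˡ-≤ (ranks β cc p) (∑-mono (bitAt W) (s≤s δ≤k)) ⟩
          ∑ (bitAt W) (suc k) + ranks β cc p   ∎)
          where open ≤-Reasoning

        inWindow≡ : inWindow cc J ≡ δ
        inWindow≡ = begin
          M (R + o₂ + (winFor cc (startOf cc J) * b + r))
            ≡⟨ cong (λ z → M (R + o₂ + (winFor cc z * b + r))) start≡ ⟩
          M (R + o₂ + (W * b + r))
            ≡⟨ sel W r (<-≤-trans (winFor-< cc p) (≤-reflexive (sym B≡))) (≤-<-trans r≤δ δ<b) ⟩
          ∑ (λ k → 𝟙 (popCount b (W %% (1 * 2 ^ suc k)) <ᵇ suc r)) b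
            ≡⟨ ∑-cong b (λ k k< → cong (λ z → 𝟙 (z <ᵇ suc r)) (trans (cong (λ z → popCount b (W %% z)) (*-identityˡ (2 ^ suc k))) (popCount-%% b W (suc k) k<))) ⟩
          ∑ (λ k → 𝟙 (∑ (bitAt W) (suc k) <ᵇ suc r)) b
            ≡⟨ ∑-threshold _ δ b (<⇒≤ δ<b) (λ k k< → 𝟙< (before k k<)) (λ k k≥ _ → 𝟙≮ (after′ k k≥)) ⟩
          δ ∎
          where open ≡-Reasoning

        found-narrow : s J + inWindow cc J ≡ F J
        found-narrow = trans (cong₂ _+_ s≡ (trans inWindow≡ (sym δ≡))) (m+[n∸m]≡n first₂≤)

    found-wide : T ≤ spreadOf G (J // G) → a J + M (R + o₆ + slot₁ J) ≡ F J
    found-wide wide = begin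
      a J + M (R + o₆ + slot₁ J)             ≡⟨ cong (λ z → z + M (R + o₆ + (z // T * G + J %% G))) a≡ ⟩
      first₁ + M (R + o₆ + slotOf G T J)     ≡⟨ cong (first₁ +_) (x1 J J< wide) ⟩
      first₁ + (F J ∸ first₁)                ≡⟨ m+[n∸m]≡n (≤-trans first₁≤first₂ first₂≤) ⟩
      F J                                    ∎
      where open ≡-Reasoning

  found≡ : ∀ c {i} → i < n → is c (β i) ≡ true → found c (dest i) ≡ F (dest i)
  found≡ c {i} i< βi = go (sparse-cases G T (J // G))
    where
    J : ℕ
    J = dest i
    J< : J < n
    J< = dest-< i<
    open Found J<
    outer : ∀ {z} → a₁ J %% 2 ≡ z → found c J ≡ (if z ≡ᵇ 0
      then (if c₁ J %% 2 ≡ᵇ 0 then s J + inWindow c J else s J + field′ (M (R + o₈ + slot₂ J // q)) (slot₂ J))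
      else a J + M (R + o₆ + slot₁ J))
    outer refl = refl
    inner : ∀ {z} → c₁ J %% 2 ≡ z → (if c₁ J %% 2 ≡ᵇ 0 then s J + inWindow c J else s J + field′ (M (R + o₈ + slot₂ J // q)) (slot₂ J))
      ≡ (if z ≡ᵇ 0 then s J + inWindow c J else s J + field′ (M (R + o₈ + slot₂ J // q)) (slot₂ J))
    inner refl = refl
    go : (T ≤ spreadOf G (J // G) × sparseOf G T (J // G) ≡ 1) ⊎ (spreadOf G (J // G) < T × sparseOf G T (J // G) ≡ 0) → found c J ≡ F J
    go (inj₁ (wide , e≡)) = trans (outer (trans flag₁ e≡)) (found-wide wide)
    go (inj₂ (dense , e≡)) = trans (outer (trans flag₁ e≡)) (go′ (sparse-cases g b (J // g)))
      where
      open Dense dense hiding (c)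
      go′ : (b ≤ spreadOf g (J // g) × sparseOf g b (J // g) ≡ 1) ⊎ (spreadOf g (J // g) < b × sparseOf g b (J // g) ≡ 0) → _ ≡ F J
      go′ (inj₁ (sparse , e≡′)) = trans (inner (trans flag₂ e≡′)) (found-sparse sparse)
      go′ (inj₂ (narrow , e≡′)) = trans (inner (trans flag₂ e≡′)) (Narrow.found-narrow narrow {c} {i} i< βi refl)

-- Execution of the query programs

module QuerySpecs (P : Params) (β : ℕ → Bool) (F : ℕ → ℕ)
  (F-dest : ∀ i → i < Params.n P →
    F (Partition.dest β (Params.n P) i) ≡ i + Partition.shift β (Params.n P) (Params.off P) (β i))
  (M : Mem) (isMem : Machine.IsMemory (Params.w P) M) (Bm R : ℕ) (idx : Structure.Index P β F M Bm R)
  (R< : R + Params.size P < Params.Bd P) (Bm< : Bm < Params.Bd P) where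
  open Params P
  open Machine w
  open Execution w
  open Compile setting
  open Logic setting
  open Rules setting
  open Structure P β F
  open Index idx
  open Partition β n
  open QueryValues P β F F-dest M isMem Bm R idx
  open Inverse off n≤off F F-dest

  off≤ : ∀ {x} → x ≤ n + off + E + E → x < Bd
  off≤ x≤ = ≤-<-trans x≤ positions<

  n+off≤ : n + off ≤ n + off + E + E
  n+off≤ = ≤-trans (m≤m+n (n + off) E) (m≤m+n (n + off + E) E)

  n<Bd : n < Bd
  n<Bd = off≤ (≤-trans (m≤m+n n off) n+off≤)

  off<Bd : off < Bd
  off<Bd = off≤ (≤-trans (m≤n+m off n) n+off≤)

  E<Bd : E < Bd
  E<Bd = off≤ (m≤n+m E (n + off + E))

  1*2^ : ∀ {k} → 1 * 2 ^ k ≡ 2 ^ k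
  1*2^ {k} = *-identityˡ (2 ^ k)

  2^b< : 1 * 2 ^ b < Bd
  2^b< = subst (_< Bd) (trans B≡ (sym (1*2^ {b}))) B<Bd

  2^≤b : ∀ {k} → k ≤ b → 1 * 2 ^ k < Bd
  2^≤b {k} k≤ = ≤-<-trans (*-monoʳ-≤ 1 (^-monoʳ-≤ 2 k≤)) 2^b<

  e≤w : e ≤ w
  e≤w = ≤-trans (subst (_≤ e * q) (*-identityʳ e) (*-monoʳ-≤ e q>)) eq≤w

  R+ : ∀ {x} → x ≤ size → R + x < Bd
  R+ x≤ = ≤-<-trans (+-monoʳ-≤ R x≤) R<

  o≤₈ : o₈ ≤ size
  o≤₈ = m≤m+n o₈ _
  o≤₇ : o₇ ≤ size
  o≤₇ = ≤-trans (m≤m+n o₇ _) o≤₈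
  o≤₆ : o₆ ≤ size
  o≤₆ = ≤-trans (m≤m+n o₆ _) o≤₇
  o≤₅ : o₅ ≤ size
  o≤₅ = ≤-trans (m≤m+n o₅ _) o≤₆
  o≤₄ : o₄ ≤ size
  o≤₄ = ≤-trans (m≤m+n o₄ _) o≤₅
  o≤₃ : o₃ ≤ size
  o≤₃ = ≤-trans (m≤m+n o₃ _) o≤₄
  o≤₂ : o₂ ≤ size
  o≤₂ = ≤-trans (m≤m+n o₂ _) o≤₃
  o≤₁ : o₁ ≤ size
  o≤₁ = ≤-trans (m≤m+n o₁ _) o≤₂

  header< : ∀ k → header R k < Bd
  header< 0  = b<Bd
  header< 1  = q<Bd
  header< 2  = ≤-<-trans e≤w w<Bd
  header< 3  = E<Bd
  header< 4  = H<Bd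
  header< 5  = G<Bd
  header< 6  = g<Bd
  header< 7  = T<Bd
  header< 8  = off<Bd
  header< 9  = ≤-<-trans (≤-trans (m≤m+n Z _) (≤-reflexive Z+ones)) n<Bd
  header< 10 = R+ o≤₁
  header< 11 = R+ o≤₂
  header< 12 = R+ o≤₃
  header< 13 = R+ o≤₄
  header< 14 = R+ o≤₅
  header< 15 = R+ o≤₆
  header< 16 = R+ o≤₇
  header< 17 = R+ o≤₈
  header< (suc (suc (suc (suc (suc (suc (suc (suc (suc (suc (suc (suc (suc (suc (suc (suc (suc (suc _)))))))))))))))))) = ≤-trans (s≤s z≤n) Bd>

  Post : ℕ → Regs → Mem → Set
  Post x η m = η 0 ≡ x × m ≡ M

  QSpec : Prog → Regs → ℕ → ℕ → Set
  QSpec p η t x = Spec p η M t t (Post x)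

  η₀ : ℕ → Regs
  η₀ i = setReg 0 i (setReg 1 n (setReg 2 w (setReg 3 Bm (setReg 4 R (λ _ → 0)))))

  load-spec : ∀ k {p η t x} → k < 18 → okAssign (5 + k) (ld◂ (v 4 ⊕ # k)) ≡ true → η 4 ≡ R →
    QSpec p (setReg (5 + k) (header R k) η) t x → QSpec (loadHeader k p) η (401 + t) x
  load-spec k {η = η} k< ok η4 s = Spec-assign′ (5 + k) (ld◂ (v 4 ⊕ # k)) ok
    (λ _ → tt , subst (_< Bd) (sym val) (header< k) , tt) val (header< k) s
    where
    val : M (η 4 + k) ≡ header R k
    val = trans (cong (λ z → M (z + k)) η4) (hdr k k<)

  ηₕ : ℕ → Regs
  ηₕ i = setReg 22 (R + o₈) (setReg 21 (R + o₇) (setReg 20 (R + o₆) (setReg 19 (R + o₅) (setReg 18 (R + o₄) (setReg 17 (R + o₃)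
    (setReg 16 (R + o₂) (setReg 15 (R + o₁) (setReg 14 Z (setReg 13 off (setReg 12 T (setReg 11 g (setReg 10 G (setReg 9 H
    (setReg 8 E (setReg 7 e (setReg 6 q (setReg 5 b (η₀ i))))))))))))))))))

  k<18 : ∀ k → {{_ : Bool.T (k <ᵇ 18)}} → k < 18
  k<18 k {{h}} = <ᵇ⇒< k 18 h

  headers-spec : ∀ i {p t x} → QSpec p (ηₕ i) t x → QSpec (loadHeaders p) (η₀ i) (18 * 401 + t) x
  headers-spec i {p} s =
    load-spec 0 (k<18 0) refl refl (load-spec 1 (k<18 1) refl refl (load-spec 2 (k<18 2) refl refl (load-spec 3 (k<18 3) refl refl (
    load-spec 4 (k<18 4) refl refl (load-spec 5 (k<18 5) refl refl (load-spec 6 (k<18 6) refl refl (load-spec 7 (k<18 7) refl refl (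
    load-spec 8 (k<18 8) refl refl (load-spec 9 (k<18 9) refl refl (load-spec 10 (k<18 10) refl refl (load-spec 11 (k<18 11) refl refl (
    load-spec 12 (k<18 12) refl refl (load-spec 13 (k<18 13) refl refl (load-spec 14 (k<18 14) refl refl (load-spec 15 (k<18 15) refl refl (
    load-spec 16 (k<18 16) refl refl (load-spec 17 (k<18 17) refl refl s)))))))))))))))))

  winObl : ∀ p → Π (⊤ ∷ (1 * 2 ^ b < Bd) ∷ ⊤ ∷ (1 * 2 ^ (b ∸ (w ∸ p %% w)) < Bd) ∷
    (Win.hi p * 2 ^ Win.c p < Bd) ∷ [])
  winObl p = tt , 2^b< , tt , 2^≤b {b ∸ (w ∸ p %% w)} (m∸n≤m b (w ∸ p %% w)) , <-trans (Win.high-< p) 2^b<Bd , tt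
    where
    2^b<Bd : 2 ^ b < Bd
    2^b<Bd = subst (_< Bd) (1*2^ {b}) 2^b<

  winEq : ∀ p → wordOf (p // w) // 2 ^ (p %% w) %% (1 * 2 ^ b) + Win.hi p * 2 ^ Win.c p ≡ winOf p
  winEq p = cong (λ z → wordOf (p // w) // 2 ^ (p %% w) %% z + Win.hi p * 2 ^ Win.c p) (1*2^ {b})

  winOf<Bd : ∀ p → winOf p < Bd
  winOf<Bd p = <-trans (Win.window-< p) (subst (_< Bd) (1*2^ {b}) 2^b<)

  ranks≤ : ∀ c i → ranks β c i ≤ i
  ranks≤ c i = subst (ranks β c i ≤_) (*-identityʳ i) (∑-≤ 1 i (λ j _ → 𝟙≤1 (is c (β j))))

  rank-spec : ∀ c i → i ≤ n → QSpec (loadHeaders (rankBody c)) (η₀ i) (18 * 401 + 5 * 401) (ranks β c i)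
  rank-spec c i i≤n = headers-spec i
    (Spec-assign′ 23 (v 0 ⊘ v 5) refl (λ _ → tt) refl (≤-<-trans (//-≤ i b) i<Bd)
    (Spec-assign′ 24 (v 23 ⊗ v 5) refl (λ _ → tt) refl (≤-<-trans (//*≤ i b) i<Bd)
    (Spec-assign′ 25 (windowAt (v 24)) refl (λ _ → winObl (i // b * b)) (winEq (i // b * b)) (winOf<Bd (i // b * b))
    (Spec-assign′ 26 (ld◂ (v 17 ⊕ v 0 ⊘ v 9) ⊕ fieldAt (v 18) (v 23) ⊕ ld◂ (v 15 ⊕ v 25 ⊛ shl true (# 1) (v 0 ⊛ v 5))) refl
      (λ _ → tt , subst (_< Bd) (sym (ra (i // H) (//-monoˡ H i≤n))) (≤-<-trans (ranks≤ true _) (≤-<-trans (//*≤ i H) i<Bd))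
           , tt , 2^≤b (<⇒≤ (%%-< i b>)) , tt , subst (_< Bd) (sym (pop _ win<)) (≤-<-trans (popCount-≤ b _) b<Bd) , tt)
      (rankValue≡ i i≤n) (≤-<-trans (ranks≤ true i) i<Bd)
    (final c)))))
    where
    i<Bd : i < Bd
    i<Bd = ≤-<-trans i≤n n<Bd
    win< : winOf (i // b * b) %% (1 * 2 ^ (i %% b)) < B
    win< = <-≤-trans (≤-<-trans (%%-≤ (winOf (i // b * b)) (1 * 2 ^ (i %% b))) (Win.window-< (i // b * b))) (≤-reflexive (sym B≡))
    η₂₆ : Regs
    η₂₆ = setReg 26 (rk i) (setReg 25 (winOf (i // b * b)) (setReg 24 (i // b * b) (setReg 23 (i // b) (ηₕ i))))
    final : ∀ c → QSpec (assign 0 (if c then v 26 else v 0 ⊖ v 26) ++ []) η₂₆ 401 (ranks β c i)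
    final true  = Spec-assign′ 0 (v 26) refl (λ _ → tt) refl (≤-<-trans (ranks≤ true i) i<Bd) (Spec-[] (refl , refl))
    final false = Spec-assign′ 0 (v 0 ⊖ v 26) refl (λ _ → tt) (sym (ranks-false β i)) (≤-<-trans (ranks≤ false i) i<Bd) (Spec-[] (refl , refl))

  field<E : ∀ x k → field′ x k < E
  field<E x k = %%-< (x // 2 ^ (e * (k %% q))) (subst (0 <_) (sym E≡) (2^>0 e))

  module Select (c : Bool) {i : ℕ} (i< : i < n) (βi : is c (β i) ≡ true) where
    J j : ℕ
    J = dest i
    j = suc (ranks β c i)
    J< : J < n
    J< = dest-< i<
    J<Bd : J < Bd
    J<Bd = <-trans J< n<Bd
    j<Bd : j < Bd
    j<Bd = ≤-<-trans (≤-trans (s≤s (ranks≤ c i)) i<) n<Bd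
    FJ< : F J < n + off
    FJ< = F-< J<
    open Found J< using (a₁≡; a≡; first₁; group<)
    first₁< : first₁ < n + off
    first₁< = F-< (group< G)
    a₁< : a₁ J < Bd
    a₁< = subst (_< Bd) (sym a₁≡) (≤-<-trans (+-monoʳ-≤ (2 * first₁) (≤-pred (sparse<2 G T (J // G)))) (begin-strict
      2 * first₁ + 1            ≤⟨ ≤-reflexive (trans (cong (_+ 1) (cong (first₁ +_) (+-identityʳ first₁))) (trans (+-assoc first₁ first₁ 1) (cong (first₁ +_) (+-comm first₁ 1)))) ⟩
      first₁ + suc first₁       ≤⟨ +-mono-≤ (<⇒≤ first₁<) first₁< ⟩
      (n + off) + (n + off)     <⟨ twice< ⟩
      Bd                        ∎))
      where open ≤-Reasoning
    a<n+off : a J < n + off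
    a<n+off = subst (_< n + off) (sym a≡) first₁<
    a<Bd : a J < Bd
    a<Bd = <-trans a<n+off (off≤ n+off≤)
    c₁<E : c₁ J < E
    c₁<E = field<E _ _
    s≤ : s J ≤ n + off + E
    s≤ = +-mono-≤ (<⇒≤ a<n+off) (≤-trans (//-≤ _ 2) (<⇒≤ c₁<E))
    s<Bd : s J < Bd
    s<Bd = off≤ (≤-trans s≤ (m≤m+n _ E))

    ηJ : Regs
    ηJ = setReg 23 J (ηₕ j)

    J-spec : ∀ {p t x} → QSpec p ηJ t x → QSpec (assign 23 ((if c then v 14 else # 0) ⊕ (v 0 ⊖ # 1)) ++ p) (ηₕ j) (401 + t) x
    J-spec {p} {t} {x} s = go c refl
      where
      go : ∀ c′ → c ≡ c′ → QSpec (assign 23 ((if c′ then v 14 else # 0) ⊕ (v 0 ⊖ # 1)) ++ p) (ηₕ j) (401 + t) x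
      go true  refl = Spec-assign′ 23 (v 14 ⊕ (v 0 ⊖ # 1)) refl (λ _ → tt) (sym (dest-of {true} βi)) J<Bd s
      go false refl = Spec-assign′ 23 (# 0 ⊕ (v 0 ⊖ # 1)) refl (λ _ → tt) (sym (dest-of {false} βi)) J<Bd s

    shift-spec : ∀ x y {p η t r} → okAssign x (v y ⊖ v 13) ≡ true → okAssign x (v y ⊖ # 0) ≡ true → η 13 ≡ off → η y < Bd →
      QSpec p (setReg x (η y ∸ shift off c) η) t r → QSpec (assign x (v y ⊖ (if c then v 13 else # 0)) ++ p) η (401 + t) r
    shift-spec x y {p} {η} {t} {r} ok ok′ η13 y< s = go c s
      where
      go : ∀ c → QSpec p (setReg x (η y ∸ shift off c) η) t r → QSpec (assign x (v y ⊖ (if c then v 13 else # 0)) ++ p) η (401 + t) r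
      go true  = Spec-assign′ x (v y ⊖ v 13) ok (λ _ → tt) (cong (η y ∸_) η13) (≤-<-trans (m∸n≤m _ off) y<)
      go false = Spec-assign′ x (v y ⊖ # 0) ok′ (λ _ → tt) refl (≤-<-trans (m∸n≤m (η y) 0) y<)

    W : ℕ
    W = winFor c (startOf c J)

    W<Bd : W < Bd
    W<Bd = <-trans (winFor-< c _) (subst (_< Bd) (1*2^ {b}) 2^b<)

    flip-spec : ∀ {p η t r} → η 5 ≡ b → η 29 ≡ winOf (startOf c J) →
      QSpec p (setReg 30 W η) t r → QSpec (assign 30 (if c then v 29 else shl true (# 1) (v 5) ⊖ # 1 ⊖ v 29) ++ p) η (401 + t) r
    flip-spec {p} {η} {t} {r} η5 η29 s = go c refl s
      where
      go : ∀ c′ → c ≡ c′ → QSpec p (setReg 30 W η) t r → QSpec (assign 30 (if c′ then v 29 else shl true (# 1) (v 5) ⊖ # 1 ⊖ v 29) ++ p) η (401 + t) r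
      go true refl = Spec-assign′ 30 (v 29) refl (λ _ → tt) η29 W<Bd
      go false refl = Spec-assign′ 30 (shl true (# 1) (v 5) ⊖ # 1 ⊖ v 29) refl (λ _ → subst (λ z → 1 * 2 ^ z < Bd) (sym η5) 2^b< , tt)
        (cong₂ (λ x y → 1 * 2 ^ x ∸ 1 ∸ y) η5 η29) W<Bd

    η₃₀ : Regs
    η₃₀ = setReg 30 W (setReg 29 (winOf (startOf c J)) (setReg 28 (startOf c J) (setReg 27 (s J) (setReg 26 (c₁ J)
      (setReg 25 (a J) (setReg 24 (a₁ J) ηJ))))))

    choice : Expr
    choice = ite (v 24 ⊛ # 2)
      (v 25 ⊕ ld◂ (v 20 ⊕ (v 25 ⊘ v 12 ⊗ v 10 ⊕ v 23 ⊛ v 10)))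
      (ite (v 26 ⊛ # 2)
        (v 27 ⊕ fieldAt (v 22) (v 27 ⊘ v 5 ⊗ v 11 ⊕ v 23 ⊛ v 11))
        (v 27 ⊕ ld◂ (v 16 ⊕ (v 30 ⊗ v 5 ⊕ v 23 ⊛ v 11))))

    module Fd = Found J<

    -- That a loaded entry is small follows from the correctness of the formula: the entry is a
    -- summand of `F J`. Fields need no argument, being remainders modulo a small number.
    choiceObl : Π (obl Any η₃₀ M choice)
    choiceObl = (λ _ → tt) , wide< , (λ _ _ → tt) , (λ _ _ → tt) , narrow< , tt
      where
      wide< : ¬ a₁ J %% 2 ≡ 0 → M (R + o₆ + slot₁ J) < Bd
      wide< ne with sparse-cases G T (J // G)
      ... | inj₂ (_ , e≡) = ⊥-elim (ne (trans Fd.flag₁ e≡))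
      ... | inj₁ (wide , _) = ≤-<-trans (≤-trans (m≤n+m _ (a J)) (≤-reflexive (Fd.found-wide wide))) (<-trans FJ< (off≤ n+off≤))
      narrow< : a₁ J %% 2 ≡ 0 → c₁ J %% 2 ≡ 0 → inWindow c J < Bd
      narrow< z₁ z₂ with sparse-cases G T (J // G)
      ... | inj₁ (_ , e≡) = ⊥-elim (0≢1+n (trans (sym z₁) (trans Fd.flag₁ e≡)))
      ... | inj₂ (dense , _) with sparse-cases g b (J // g)
      ...   | inj₁ (_ , e≡) = ⊥-elim (0≢1+n (trans (sym z₂) (trans (Fd.Dense.flag₂ dense) e≡)))
      ...   | inj₂ (narrow , _) = ≤-<-trans (≤-trans (m≤n+m _ (s J)) (≤-reflexive (Fd.Dense.Narrow.found-narrow dense narrow {c} {i} i< βi refl)))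
                (<-trans FJ< (off≤ n+off≤))

    select-spec : QSpec (loadHeaders (selectBody c)) (η₀ j) (18 * 401 + 10 * 401) i
    select-spec = headers-spec j (J-spec
      (Spec-assign′ 24 (ld◂ (v 19 ⊕ v 23 ⊘ v 10)) refl (λ _ → tt , a₁< , tt) refl a₁<
      (Spec-assign′ 25 (v 24 ⊘ # 2) refl (λ _ → tt) refl a<Bd
      (Spec-assign′ 26 (fieldAt (v 21) (v 23 ⊘ v 11)) refl (λ _ → tt , tt) refl (<-trans c₁<E E<Bd)
      (Spec-assign′ 27 (v 25 ⊕ v 26 ⊘ # 2) refl (λ _ → tt) refl s<Bd
      (shift-spec 28 27 refl refl refl s<Bd
      (Spec-assign′ 29 (windowAt (v 28)) refl (λ _ → winObl (startOf c J)) (winEq (startOf c J)) (winOf<Bd (startOf c J))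
      (flip-spec refl refl
      (Spec-assign′ 31 choice refl (λ _ → choiceObl) (found≡ c i< βi) (<-trans FJ< (off≤ n+off≤))
      (shift-spec 0 31 refl refl refl (<-trans FJ< (off≤ n+off≤)) (Spec-[] (FJ∸ , refl))))))))))))
      where
      FJ∸ : F J ∸ shift off c ≡ i
      FJ∸ = trans (cong (_∸ shift off c) (trans (F-dest i i<) (cong (λ z → i + shift off z) (is⇒≡ c (β i) βi)))) (m+n∸n≡m i (shift off c))

  -- The constant 28 stands for the 18 header words and the ten assignments of a select query, each
  -- taking at most 401 operations.
  answers : ∀ .{{_ : NonZero w}} {p i t x} → i < Bd → t ≤ 28 * 401 → QSpec p (η₀ i) t x →
    Layout.Answers w (28 * 401) n Bm R M p i x
  answers {p} {i} {t} {x} i<Bd t≤ s choose = finish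
    (s good′ (args (i ∷ n ∷ w ∷ Bm ∷ R ∷ [])) (λ x _ → agree₀ x) choose [] 0)
    where
    agree₀ : ∀ y → args (i ∷ n ∷ w ∷ Bm ∷ R ∷ []) y ≡ η₀ i y
    agree₀ 0 = word-id (<-≤-trans i<Bd Bd≤2^w)
    agree₀ 1 = word-id (<-≤-trans n<Bd Bd≤2^w)
    agree₀ 2 = word-id (<-≤-trans w<Bd Bd≤2^w)
    agree₀ 3 = word-id (<-≤-trans Bm< Bd≤2^w)
    agree₀ 4 = word-id (<-≤-trans (≤-<-trans (m≤m+n R size) R<) Bd≤2^w)
    agree₀ (suc (suc (suc (suc (suc y))))) = refl
    small₀ : ∀ y → η₀ i y < Bd
    small₀ 0 = i<Bd
    small₀ 1 = n<Bd
    small₀ 2 = w<Bd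
    small₀ 3 = Bm<
    small₀ 4 = ≤-<-trans (m≤m+n R size) R<
    small₀ (suc (suc (suc (suc (suc y))))) = ≤-trans (s≤s z≤n) Bd>
    good′ : Good (η₀ i) M
    good′ = record { small = λ y _ → small₀ y ; words = isMem }
    finish : Ends choose (config (run (p ++ []) (args (i ∷ n ∷ w ∷ Bm ∷ R ∷ []))) M 0) [] 0 t t (Post x) →
      ∃[ t ] (let c = after choose t (start p (i ∷ n ∷ w ∷ Bm ∷ R ∷ []) M) in
        Returns c x × Config.work c ≤ 28 * 401 × (∀ a → Config.mem c a ≡ M a))
    finish (ends {time} {work} {regs} {env} _ work≤ runs _ agree (x≡ , refl)) = time ,
      subst (λ c → Returns c x × Config.work c ≤ 28 * 401 × (∀ a → Config.mem c a ≡ M a))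
        (sym (trans (cong (λ q → after choose time (config (run q (args (i ∷ n ∷ w ∷ Bm ∷ R ∷ []))) M 0)) (sym (++-identityʳ p))) runs))
        ((regs , refl , trans (agree 0 (s≤s z≤n)) x≡) , ≤-trans work≤ t≤ , (λ a → refl))

  n≤⇒<Bd : ∀ {i} → i ≤ n → i < Bd
  n≤⇒<Bd i≤ = ≤-<-trans i≤ n<Bd

  rank-answers : ∀ .{{_ : NonZero w}} c i → i ≤ n →
    Layout.Answers w (28 * 401) n Bm R M (Queries.rankProg queries c) i (ranks β c i)
  rank-answers c i i≤n = answers (n≤⇒<Bd i≤n) (≤ᵇ⇒≤ (23 * 401) (28 * 401) tt) (rank-spec c i i≤n)

  select-answers : ∀ .{{_ : NonZero w}} c {i} → i < n → is c (β i) ≡ true →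
    Layout.Answers w (28 * 401) n Bm R M (Queries.selectProg queries c) (suc (ranks β c i)) i
  select-answers c {i} i< βi = answers (Select.j<Bd c i< βi) ≤-refl (Select.select-spec c i< βi)

-- Canonical register states, and arrays below the frontier

-- Each phase of the construction is specified from a state of this form. After some assignments
-- `override-same` returns the state to the form required by the next phase, the `Facts` being
-- checked by computation.
override : List (ℕ × ℕ) → Regs → Regs
override []            η = η
override ((r , x) ∷ l) η = setReg r x (override l η)

Facts : List (ℕ × ℕ) → Regs → Set
Facts []            η = ⊤
Facts ((r , x) ∷ l) η = η r ≡ x × Facts l η

setReg-fact : ∀ {r x} (η θ : Regs) → η r ≡ x → (∀ y → η y ≡ θ y) → ∀ y → η y ≡ setReg r x θ y
setReg-fact {r} {x} η θ e h y with r ≡ᵇ y in r≡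
... | true  = trans (cong η (sym (≡ᵇ⇒≡ r y (T-≡ r≡)))) e
... | false = h y

-- The parameters occupy 18 registers, and 21 more hold the state of partC.
pattern refl×18 =
  refl , refl , refl , refl , refl , refl , refl , refl , refl ,
  refl , refl , refl , refl , refl , refl , refl , refl , refl , tt
pattern refl×39 =
  refl , refl , refl , refl , refl , refl , refl ,
  refl , refl , refl , refl , refl , refl , refl ,
  refl , refl , refl , refl , refl , refl , refl , refl×18

override-same : ∀ l η → Facts l η → ∀ y → η y ≡ override l η y
override-same []            η _        y = refl
override-same ((r , x) ∷ l) η (e , es) y = setReg-fact {r} {x} η (override l η) e (override-same l η es) y

record Arr (m : Mem) (fp base N : ℕ) (f : ℕ → ℕ) : Set where
  field
    at    : ∀ i → i < N → m (base + i) ≡ f i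
    below : base + N ≤ fp

  access : ∀ {i} → i < N → base + i < fp
  access i< = <-≤-trans (+-monoʳ-< base i<) below

Agree : ℕ → Mem → Mem → Set
Agree fp m m′ = ∀ a → a < fp → m′ a ≡ m a

Agree-trans : ∀ {fp fp′ m m′ m″} → fp ≤ fp′ → Agree fp m m′ → Agree fp′ m′ m″ → Agree fp m m″
Agree-trans fp≤ ag ag′ a a< = trans (ag′ a (<-≤-trans a< fp≤)) (ag a a<)

Arr-keep : ∀ {m m′ fp fp′ base N f} → Agree fp m m′ → fp ≤ fp′ → Arr m fp base N f → Arr m′ fp′ base N f
Arr-keep {base = base} ag fp≤ A = record
  { at = λ i i< → trans (ag (base + i) (Arr.access A i<)) (Arr.at A i i<) ; below = ≤-trans (Arr.below A) fp≤ }

Arr-new : ∀ {m′ fp N f} → (∀ i → i < N → m′ (fp + i) ≡ f i) → Arr m′ (fp + N) fp N f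
Arr-new h = record { at = h ; below = ≤-refl }

Arr-≗ : ∀ {m fp base N f g} → (∀ i → i < N → f i ≡ g i) → Arr m fp base N f → Arr m fp base N g
Arr-≗ h A = record { at = λ i i< → trans (Arr.at A i i<) (h i i<) ; below = Arr.below A }

-- The program for one level

κ ι : Expr
κ = var 60
ι = var 61

bitOf : Expr → Expr
bitOf i = (ld▸ (v 19 ⊕ i) ≫ v 22) ⊛ # 2

-- The loop counter in register 26 runs downwards, so `v 3 ⊖ v 26` is the number of the scan round
-- and its power of two the stride. The scan is inclusive, hence `rankFill` subtracts the count of
-- the chunk itself before it adds the count of the bits in front of κ.
chunkFill countFill scanFill rankFill : Fill
chunkFill = sumFill 23 (v 15) (v 5)
  (ite (κ ⊗ v 5 ⊕ ι ≺ v 0) (shl false (bitOf (κ ⊗ v 5 ⊕ ι)) ι) (# 0)) (v 62)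
countFill = mapFill 24 (v 15) (ld◂ (v 18 ⊕ ld◂ (v 23 ⊕ κ)))
scanFill = mapFill 44 (v 15) (ld◂ (v 25 ⊕ κ) ⊕
  ite (κ ≺ shl true (# 1) (v 3 ⊖ v 26)) (# 0) (ld◂ (v 25 ⊕ (κ ⊖ shl true (# 1) (v 3 ⊖ v 26)))))
rankFill = mapFill 27 (v 0 ⊕ # 1) (ld◂ (v 25 ⊕ κ ⊘ v 5) ⊖ ld◂ (v 24 ⊕ κ ⊘ v 5) ⊕
  ld◂ (v 18 ⊕ ld◂ (v 23 ⊕ κ ⊘ v 5) ⊛ shl true (# 1) (κ ⊛ v 5)))

scanBody : Prog
scanBody = alloc scanFill ++ (assign 25 (v 44) ++ [])

partA : Prog → Prog
partA rest = assign 22 (v 20 ⊖ # 1) ++ (alloc chunkFill ++ (alloc countFill ++ (assign 25 (v 24) ++ (assign 26 (v 3) ++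
  (loop 26 scanBody ++ (alloc rankFill ++ (assign 28 (v 0 ⊖ ld◂ (v 27 ⊕ v 0)) ++ rest)))))))

-- Quantities of the construction besides those of the structures: lam and L
-- are the numbers of scan rounds and of levels, top bounds the memory, and τ
-- and Y bound the time and work of a phase.
record Build (P : Params) : Set where
  open Params P
  field
    lam L top τ Y V : ℕ
    nb≤2^lam : nb ≤ 2 ^ lam
    2^lam<Bd : 2 ^ lam < Bd
    top<Bd   : top < Bd
    lam<Bd   : lam < Bd
    q≤w      : q ≤ w
    time-ok  : ∀ {ℓ} → ℓ ≤ w → allocTime ℓ ≤ τ
    work-ok  : ∀ {N ℓ} → suc N * suc ℓ ≤ V → allocWork N ℓ ≤ Y
    401≤τ    : 401 ≤ τ
    401≤Y    : 401 ≤ Y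
    scan-τ   : lam * (allocTime 0 + (401 + 0) + 2) + 1 ≤ τ
    scan-Y   : lam * (allocWork nb 0 + (401 + 0) + 2) + 1 ≤ Y
    V-chunk  : suc nb * suc b ≤ V
    V-map    : suc (suc n) * 1 ≤ V
    V-bitmap : suc (n // w + 1) * suc w ≤ V
    V-pop    : suc B * suc b ≤ V
    V-sel    : suc (B * b) * suc b ≤ V
    V-rb     : suc (nb // q + 1) * suc q ≤ V
    V-x1     : suc cap1 * 1 ≤ V
    V-a2     : suc ((n // g + 1) // q + 1) * suc q ≤ V
    V-x2     : suc (cap2 // q + 1) * suc q ≤ V
    V-hdr    : suc (18 + 4 * L) * 1 ≤ V

-- Groups of v 47 positions, with sparseness threshold v 48.
nextE firstE spreadE : Expr → Expr
nextE k   = ite ((# 1 ⊕ k) ⊗ v 47 ≺ v 0) ((# 1 ⊕ k) ⊗ v 47) (v 0 ⊖ # 1)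
firstE k  = ld◂ (v 29 ⊕ k ⊗ v 47)
spreadE k = ld◂ (v 29 ⊕ nextE k) ⊖ firstE k

-- Only `F` is scattered; `permuteFill` gathers along it, since `F` minus the shift is the source of
-- cell κ. In `sparseFill` the positions of groups that are not sparse all write 0 into a spare cell
-- at offset `v 49`.
inverseFill permuteFill bitmapFill sparseFill : Fill
inverseFill = scatterFill 29 (v 0) (v 0)
  (ite (bitOf κ) (v 28 ⊕ ld◂ (v 27 ⊕ κ)) (κ ⊖ ld◂ (v 27 ⊕ κ))) (κ ⊕ bitOf κ ⊗ v 14)
permuteFill = mapFill 30 (v 0) (ld▸ (v 19 ⊕ (ld◂ (v 29 ⊕ κ) ⊖ ite (κ ≺ v 28) (# 0) (v 14))))
bitmapFill = sumFill 31 (v 0 ⊘ v 2 ⊕ # 1) (v 2)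
  (ite (κ ⊗ v 2 ⊕ ι ≺ v 0) (shl false (bitOf (κ ⊗ v 2 ⊕ ι)) ι) (# 0)) (v 62)
sparseFill = scatterFill 50 (v 49 ⊕ # 1) (v 0)
  (ite (spreadE (κ ⊘ v 47) ≺ v 48) (v 49) (firstE (κ ⊘ v 47) ⊘ v 48 ⊗ v 47 ⊕ κ ⊛ v 47))
  (ite (spreadE (κ ⊘ v 47) ≺ v 48) (# 0) (ld◂ (v 29 ⊕ κ) ⊖ firstE (κ ⊘ v 47)))

partB : Prog → Prog
partB rest = alloc inverseFill ++ (alloc permuteFill ++ (alloc bitmapFill ++
  (assign 47 (v 12) ++ (assign 48 (v 10) ++ (assign 49 (v 16) ++ (alloc sparseFill ++ (assign 32 (v 50) ++
  (assign 47 (v 11) ++ (assign 48 (v 5) ++ (assign 49 (v 17) ++ (alloc sparseFill ++ (assign 33 (v 50) ++ rest))))))))))))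

tableE : ℕ → List Expr → Expr
tableE k []       = # 0
tableE k (e ∷ es) = ite (κ ≺ # (suc k)) e (tableE (suc k) es)

-- `subgroupsFill` and `subslotsFill` reduce their entries modulo `E` by `⊛ v 9`: offsets in sparse
-- upper groups may be large and unclaimed slots hold unknown words, and neither may spill into
-- neighbouring fields. Relative block ranks stay below `H ≤ E` by themselves.
headerFill tablePopFill tableSelFill ranksFill blocksFill groupsFill slotsFill subgroupsFill subslotsFill : Fill
headerFill = mapFill 34 (# 18) (tableE 0 (v 5 ∷ v 7 ∷ v 8 ∷ v 9 ∷ v 13 ∷ v 12 ∷ v 11 ∷ v 10 ∷ v 14 ∷ v 28 ∷
  v 35 ∷ v 36 ∷ v 37 ∷ v 38 ∷ v 39 ∷ v 40 ∷ v 41 ∷ v 42 ∷ []))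
tablePopFill = mapFill 35 (v 6) (ld▸ (v 18 ⊕ κ))
tableSelFill = sumFill 36 (v 6 ⊗ v 5) (v 5)
  (ld◂ (v 18 ⊕ κ ⊘ v 5 ⊛ shl true (# 1) (# 1 ⊕ ι)) ≺ # 1 ⊕ κ ⊛ v 5) (v 62)
ranksFill = mapFill 37 (v 0 ⊘ v 13 ⊕ # 1) (ld▸ (v 27 ⊕ κ ⊗ v 13))

-- The index of the entry in field ι of word κ, and its shifted value.
entryE : Expr
entryE = κ ⊗ v 7 ⊕ ι

packE : Expr → Expr
packE x = shl false x (v 8 ⊗ ι)

blocksFill = sumFill 38 (v 15 ⊘ v 7 ⊕ # 1) (v 7)
  (packE (ite (entryE ≺ v 15) (ld◂ (v 27 ⊕ entryE ⊗ v 5) ⊖ ld◂ (v 27 ⊕ entryE ⊗ v 5 ⊘ v 13 ⊗ v 13)) (# 0))) (v 62)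
groupsFill = mapFill 39 (v 0 ⊘ v 12 ⊕ # 1)
  (ite (κ ⊗ v 47 ≺ v 0) (# 2 ⊗ firstE κ ⊕ (# 1 ⊖ (spreadE κ ≺ v 48))) (# 0))
slotsFill = mapFill 40 (v 16) (ld▸ (v 32 ⊕ κ))
subgroupsFill = sumFill 41 ((v 0 ⊘ v 11 ⊕ # 1) ⊘ v 7 ⊕ # 1) (v 7)
  (packE (ite (entryE ⊗ v 47 ≺ v 0)
    ((# 2 ⊗ (firstE entryE ⊖ ld◂ (v 29 ⊕ entryE ⊗ v 47 ⊘ v 12 ⊗ v 12)) ⊕ (# 1 ⊖ (spreadE entryE ≺ v 48))) ⊛ v 9) (# 0))) (v 62)
subslotsFill = sumFill 42 (v 17 ⊘ v 7 ⊕ # 1) (v 7)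
  (packE (ite (entryE ≺ v 17) (ld▸ (v 33 ⊕ entryE) ⊛ v 9) (# 0))) (v 62)

-- The header comes first in the structure and contains the addresses of all other components, so
-- these are computed ahead; each fill then starts exactly at its predicted address.
partC : Prog → Prog
partC rest =
  assign 34 (v 59) ++ (assign 35 (v 59 ⊕ # 18) ++ (assign 36 (v 35 ⊕ v 6) ++ (assign 37 (v 36 ⊕ v 6 ⊗ v 5) ++
  (assign 38 (v 37 ⊕ (v 0 ⊘ v 13 ⊕ # 1)) ++ (assign 39 (v 38 ⊕ (v 15 ⊘ v 7 ⊕ # 1)) ++
  (assign 40 (v 39 ⊕ (v 0 ⊘ v 12 ⊕ # 1)) ++ (assign 41 (v 40 ⊕ v 16) ++
  (assign 42 (v 41 ⊕ ((v 0 ⊘ v 11 ⊕ # 1) ⊘ v 7 ⊕ # 1)) ++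
  (alloc headerFill ++ (alloc tablePopFill ++ (alloc tableSelFill ++ (alloc ranksFill ++ (alloc blocksFill ++
  (assign 47 (v 12) ++ (assign 48 (v 10) ++ (alloc groupsFill ++ (alloc slotsFill ++
  (assign 47 (v 11) ++ (assign 48 (v 5) ++ (alloc subgroupsFill ++ (alloc subslotsFill ++
  (assign 43 (v 59 ⊖ v 34) ++ rest))))))))))))))))))))))

-- Sequences as functions on positions

applyUpTo-cong : ∀ {A : Set} {f g : ℕ → A} n → (∀ i → i < n → f i ≡ g i) → applyUpTo f n ≡ applyUpTo g n
applyUpTo-cong zero    h = refl
applyUpTo-cong (suc n) h = cong₂ _∷_ (h 0 z<s) (applyUpTo-cong n (λ i i< → h (suc i) (s≤s i<)))

applyUpTo-++ : ∀ {A : Set} (f : ℕ → A) m n → applyUpTo f m ++ applyUpTo (λ j → f (m + j)) n ≡ applyUpTo f (m + n)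
applyUpTo-++ f zero    n = refl
applyUpTo-++ f (suc m) n = cong (f 0 ∷_) (applyUpTo-++ (λ i → f (suc i)) m n)

take-applyUpTo : ∀ {A : Set} (f : ℕ → A) {i n} → i ≤ n → take i (applyUpTo f n) ≡ applyUpTo f i
take-applyUpTo f z≤n       = refl
take-applyUpTo f (s≤s i≤n) = cong (f 0 ∷_) (take-applyUpTo (λ j → f (suc j)) i≤n)

filterᵇ-∷ʳ : ∀ {A : Set} (p : A → Bool) xs x → filterᵇ p (xs ∷ʳ x) ≡ (if p x then filterᵇ p xs ∷ʳ x else filterᵇ p xs)
filterᵇ-∷ʳ p [] x with p x
... | true  = refl
... | false = refl
filterᵇ-∷ʳ p (y ∷ xs) x with p y | filterᵇ-∷ʳ p xs x
... | false | ih = ih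
... | true  | ih = trans (cong (y ∷_) ih) (push (p x))
  where
  push : ∀ c → y ∷ (if c then filterᵇ p xs ∷ʳ x else filterᵇ p xs) ≡ (if c then (y ∷ filterᵇ p xs) ∷ʳ x else y ∷ filterᵇ p xs)
  push true  = refl
  push false = refl

-- The induction proceeds at the right end, where `∑` grows. The sequence `out` is prescribed only
-- at the ranks of selected entries, which is the information a scattered or gathered array
-- provides.
filterᵇ-applyUpTo : ∀ (p : ℕ → Bool) (f out : ℕ → ℕ) n →
  (∀ i → i < n → p (f i) ≡ true → out (∑ (λ j → 𝟙 (p (f j))) i) ≡ f i) →
  filterᵇ p (applyUpTo f n) ≡ applyUpTo out (∑ (λ j → 𝟙 (p (f j))) n)
filterᵇ-applyUpTo p f out zero    h = refl
filterᵇ-applyUpTo p f out (suc n) h = begin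
  filterᵇ p (applyUpTo f (suc n))                      ≡⟨ cong (filterᵇ p) (sym (applyUpTo-∷ʳ f n)) ⟩
  filterᵇ p (applyUpTo f n ∷ʳ f n)                     ≡⟨ filterᵇ-∷ʳ p (applyUpTo f n) (f n) ⟩
  (if p (f n) then filterᵇ p (applyUpTo f n) ∷ʳ f n else filterᵇ p (applyUpTo f n))
    ≡⟨ cong (λ ys → if p (f n) then ys ∷ʳ f n else ys) (filterᵇ-applyUpTo p f out n (λ i i< → h i (m≤n⇒m≤1+n i<))) ⟩
  (if p (f n) then applyUpTo out r ∷ʳ f n else applyUpTo out r)
    ≡⟨ go (p (f n)) refl ⟩
  applyUpTo out (r + 𝟙 (p (f n))) ∎
  where
  open ≡-Reasoning
  r : ℕ
  r = ∑ (λ j → 𝟙 (p (f j))) n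
  go : ∀ c → p (f n) ≡ c → (if c then applyUpTo out r ∷ʳ f n else applyUpTo out r) ≡ applyUpTo out (r + 𝟙 c)
  go true  e≡ = trans (cong (applyUpTo out r ∷ʳ_) (sym (h n ≤-refl e≡))) (trans (applyUpTo-∷ʳ out r) (cong (applyUpTo out) (+-comm 1 r)))
  go false e≡ = cong (applyUpTo out) (sym (+-identityʳ r))

count-filterᵇ : ∀ c xs → count c xs ≡ length (filterᵇ (is c) xs)
count-filterᵇ true  xs = refl
count-filterᵇ false xs = refl

count-∷ʳ : ∀ c xs x → count c (xs ∷ʳ x) ≡ count c xs + 𝟙 (is c x)
count-∷ʳ c xs x = begin
  count c (xs ∷ʳ x)                       ≡⟨ count-filterᵇ c (xs ∷ʳ x) ⟩
  length (filterᵇ (is c) (xs ∷ʳ x))       ≡⟨ cong length (filterᵇ-∷ʳ (is c) xs x) ⟩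
  length (if is c x then filterᵇ (is c) xs ∷ʳ x else filterᵇ (is c) xs) ≡⟨ go (is c x) ⟩
  length (filterᵇ (is c) xs) + 𝟙 (is c x) ≡⟨ cong (_+ 𝟙 (is c x)) (sym (count-filterᵇ c xs)) ⟩
  count c xs + 𝟙 (is c x)                 ∎
  where
  open ≡-Reasoning
  go : ∀ t → length (if t then filterᵇ (is c) xs ∷ʳ x else filterᵇ (is c) xs) ≡ length (filterᵇ (is c) xs) + 𝟙 t
  go true  = length-++ (filterᵇ (is c) xs)
  go false = sym (+-identityʳ _)

count-applyUpTo : ∀ c β n → count c (applyUpTo β n) ≡ ranks β c n
count-applyUpTo true  β zero    = refl
count-applyUpTo false β zero    = refl
count-applyUpTo c β (suc n) = trans (cong (count c) (sym (applyUpTo-∷ʳ β n)))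
  (trans (count-∷ʳ c (applyUpTo β n) (β n)) (cong (_+ 𝟙 (is c (β n))) (count-applyUpTo c β n)))

rank-applyUpTo : ∀ c β {i n} → i ≤ n → rank c i (applyUpTo β n) ≡ ranks β c i
rank-applyUpTo c β {i} i≤n = trans (cong (count c) (take-applyUpTo β i≤n)) (count-applyUpTo c β i)

applyUpTo-split : ∀ (β : ℕ → Bool) n ys {c zs} → applyUpTo β n ≡ ys ++ c ∷ zs →
  length ys < n × β (length ys) ≡ c × ys ≡ applyUpTo β (length ys)
applyUpTo-split β (suc n) [] e≡ = z<s , proj₁ (∷-injective e≡) , refl
applyUpTo-split β (suc n) (y ∷ ys) e≡ with applyUpTo-split (λ i → β (suc i)) n ys (proj₂ (∷-injective e≡))
... | l< , β≡ , ys≡ = s≤s l< , β≡ , cong₂ _∷_ (sym (proj₁ (∷-injective e≡))) ys≡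

select-applyUpTo : ∀ c β n {j p} → IsSelect c j (applyUpTo β n) p → p < n × is c (β p) ≡ true × j ≡ suc (ranks β c p)
select-applyUpTo c β n (ys , zs , xs≡ , refl , refl) with applyUpTo-split β n ys xs≡
... | p< , β≡ , ys≡ = p< , trans (cong (is c) β≡) (is-refl c) , cong suc (trans (cong (count c) ys≡) (count-applyUpTo c β (length ys)))

symbols-applyUpTo : ∀ {σ n} (S : Vec (Fin σ) n) (f : ℕ → ℕ) → (∀ (i : Fin n) → f (toℕ i) ≡ toℕ (Vec.lookup S i)) →
  symbols S ≡ applyUpTo f n
symbols-applyUpTo Vec.[]      f h = refl
symbols-applyUpTo (x Vec.∷ S) f h = cong₂ _∷_ (sym (h Fin.zero)) (symbols-applyUpTo S (λ i → f (suc i)) (λ i → h (Fin.suc i)))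

module Levels (L : ℕ) (xs : List ℕ) (l n : ℕ) (sx : ℕ → ℕ) (seq≡ : levelSeq L xs l ≡ applyUpTo sx n)
  (sh : ℕ) (sh≡ : sh ≡ L ∸ suc l) where

  β : ℕ → Bool
  β i = bit sh (sx i)

  open Partition β n

  bitmap≡ : levelBitmap L xs l ≡ applyUpTo β n
  bitmap≡ = trans (cong₂ (λ z → map (bit z)) (sym sh≡) seq≡) (map-applyUpTo sx (bit sh) n)

  -- The destinations of a symbol form a segment, from 0 for zeros and from `Z` for ones, ordered by
  -- rank; so the two filtered lists are two adjacent segments of `sx′`. `sh` is the index, from the
  -- low end, of the bit by which this level is partitioned.
  next-level : ∀ (sx′ : ℕ → ℕ) → (∀ i → i < n → sx′ (dest i) ≡ sx i) → levelSeq L xs (suc l) ≡ applyUpTo sx′ n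
  next-level sx′ h = subst (λ z → filterᵇ (λ x → not (bit z x)) (levelSeq L xs l) ++ filterᵇ (bit z) (levelSeq L xs l) ≡ applyUpTo sx′ n) sh≡
    (trans (cong₂ _++_ (part false) (part true)) (trans (applyUpTo-++ sx′ Z (ranks β true n)) (cong (applyUpTo sx′) Z+ones)))
    where
    part : ∀ c → filterᵇ (λ x → is c (bit sh x)) (levelSeq L xs l) ≡ applyUpTo (λ j → sx′ (start₀ c + j)) (ranks β c n)
    part c = trans (cong (filterᵇ (λ x → is c (bit sh x))) seq≡)
      (filterᵇ-applyUpTo (λ x → is c (bit sh x)) sx (λ j → sx′ (start₀ c + j)) n
        (λ i i< e≡ → trans (cong sx′ (sym (dest-of {c} e≡))) (h i i<)))

-- Copies the descriptions of the previous levels and appends that of the current one.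
descriptionFill : Fill
descriptionFill = mapFill 45 (# 4 ⊗ (v 46 ⊖ v 22))
  (ite (κ ≺ # 4 ⊗ (v 46 ⊖ v 20)) (ld▸ (v 21 ⊕ κ))
    (ite (κ ⊖ # 4 ⊗ (v 46 ⊖ v 20) ≺ # 1) (v 31)
      (ite (κ ⊖ # 4 ⊗ (v 46 ⊖ v 20) ≺ # 2) (v 28)
        (ite (κ ⊖ # 4 ⊗ (v 46 ⊖ v 20) ≺ # 3) (v 34) (v 43)))))

partD : Prog
partD = alloc descriptionFill ++ (assign 21 (v 45) ++ (assign 19 (v 30) ++ []))

levelBody : Prog
levelBody = partA (partB (partC partD))

-- Opaque, since Agda would otherwise unfold the well-founded recursion.
opaque
  clog : ℕ → ℕ
  clog = ⌈log₂_⌉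

  clog≡ : ∀ n → clog n ≡ ⌈log₂ n ⌉
  clog≡ n = refl

  ≤2^clog : ∀ n → n ≤ 2 ^ clog n
  ≤2^clog = ≤2^⌈log₂⌉

  clog-≤ : ∀ {i n} → n ≤ 2 ^ i → clog n ≤ i
  clog-≤ = ≥⌈log₂⌉

  2^<clog : ∀ {i n} → i < clog n → 2 ^ i < n
  2^<clog {i} {n} = 2^<⌈log₂⌉ {i} {n}

-- Concrete sizes as functions of n, and their growth

m<2^m : ∀ m → m < 2 ^ m
m<2^m zero    = ≤-refl
m<2^m (suc m) = begin-strict
  suc m           ≤⟨ m<2^m m ⟩
  2 ^ m           <⟨ ^-monoʳ-< 2 ≤-refl (n<1+n m) ⟩
  2 ^ suc m       ∎
  where open ≤-Reasoning

2^clog≤ : ∀ n → 0 < n → 2 ^ clog n ≤ 2 * n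
2^clog≤ n n> = go (clog n) refl
  where
  go : ∀ k → clog n ≡ k → 2 ^ k ≤ 2 * n
  go zero    _  = ≤-trans n> (m≤m+n n _)
  go (suc k) e≡ = *-monoʳ-≤ 2 (<⇒≤ (2^<clog (≤-reflexive (sym e≡))))

2^clog-suc≤ : ∀ n → 0 < n → 2 ^ clog (suc n) ≤ 2 * n
2^clog-suc≤ n n> = go (clog (suc n)) refl
  where
  go : ∀ k → clog (suc n) ≡ k → 2 ^ k ≤ 2 * n
  go zero    _  = ≤-trans n> (m≤m+n n _)
  go (suc k) e≡ = *-monoʳ-≤ 2 (≤-pred (2^<clog (≤-reflexive (sym e≡))))

clog>0 : ∀ n → 0 < n → 0 < clog (suc n)
clog>0 n n> = n≢0⇒n>0 (λ c≡0 → <-irrefl refl (<-≤-trans (s≤s n>) (subst (λ z → suc n ≤ 2 ^ z) c≡0 (≤2^clog (suc n)))))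

-- `T = 2 ^ (5 * u)` exceeds lam⁵, while u lam G is only (u lam)³, so the slots of sparse upper
-- groups are few. `e = 6 * u` bits hold twice an offset below `T` plus a flag, and also ranks
-- relative to the upper directory, as `H` is at most 2^(3u). With `b` near lam / 4 the tables have
-- about the fourth root of n rows. `lam` is one more than the logarithm, which makes n < 2^lam
-- strict.
module Sizes (n : ℕ) where
  lam u b B q e E T g h G H off nb cap1 cap2 size : ℕ
  lam  = suc (clog n)
  u    = clog (suc lam)
  b    = suc (lam // 4)
  B    = 2 ^ b
  q    = lam // u
  e    = 6 * u
  E    = 2 ^ e
  T    = 2 ^ (5 * u)
  g    = u * u
  h    = lam * lam
  G    = g * h
  H    = b * h
  off  = n + b
  nb   = suc (n // b)
  cap1 = suc ((n + off) // T) * G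
  cap2 = suc ((n + off) // b) * g
  size = 18 + B + B * b + (n // H + 1) + (nb // q + 1) + (n // G + 1) + cap1 + ((n // g + 1) // q + 1) + (cap2 // q + 1)

  -- The cells taken by the fills of one level, listed in their order, so that this is
  -- definitionally the `levelSize` of the correctness proof.
  level : ℕ → ℕ → ℕ
  level w L = nb + nb + lam * nb + (n + 1) + n + n + (n // w + 1) + (cap1 + 1) + (cap2 + 1)
    + 18 + B + B * b + (n // H + 1) + (nb // q + 1) + (n // G + 1) + cap1 + ((n // g + 1) // q + 1) + (cap2 // q + 1) + 4 * L

  n<2^lam : n < 2 ^ lam
  n<2^lam = ≤-<-trans (≤2^clog n) (^-monoʳ-< 2 ≤-refl (n<1+n (clog n)))

  lam<2^u : lam < 2 ^ u
  lam<2^u = ≤2^clog (suc lam)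

  u>0 : 0 < u
  u>0 = clog>0 lam z<s

  2^u≤2lam : 2 ^ u ≤ 2 * lam
  2^u≤2lam = 2^clog-suc≤ lam z<s

  u≤lam : u ≤ lam
  u≤lam = clog-≤ (m<2^m lam)

  q>0 : 0 < q
  q>0 = n≢0⇒n>0 (λ q≡0 → <-irrefl refl (<-≤-trans (suc//-≤ lam u>0)
    (≤-trans (≤-reflexive (trans (cong (λ z → suc z * u) q≡0) (+-identityʳ u))) u≤lam)))

  b≤lam : b ≤ lam
  b≤lam = //-< lam (m<m*n lam 4 (s≤s z<s))

  lam≤4b : lam ≤ b * 4
  lam≤4b = <⇒≤ (suc//-≤ lam {4} z<s)

  off≤ : off ≤ n + lam
  off≤ = +-monoʳ-≤ n b≤lam

  square≥ : ∀ {x} → 0 < x → x ≤ x * x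
  square≥ {suc x} _ = m≤m+n (suc x) (x * suc x)

  u*lam≤h : u * lam ≤ h
  u*lam≤h = *-monoˡ-≤ lam u≤lam

  -- Everything is bounded by a small power of Λ = 2 ^ lam.
  Λ : ℕ
  Λ = 2 ^ lam

  2≤Λ : 2 ≤ Λ
  2≤Λ = *-monoʳ-≤ 2 (m^n>0 2 (clog n))

  instance
    Λ≢0 : NonZero Λ
    Λ≢0 = m^n≢0 2 lam

  -- Wrapped in a record so that exponents can be inferred and computed: a product adds them, and a
  -- sum costs one more because Λ is at least 2.
  record Pow (k x : ℕ) : Set where
    constructor pw
    field unpw : x ≤ Λ ^ k
  open Pow public

  pow : ∀ {i x} → x ≤ Λ → Pow (suc i) x
  pow {i} x≤ = pw (≤-trans x≤ (≤-trans (≤-reflexive (sym (*-identityʳ Λ))) (*-monoʳ-≤ Λ (m^n>0 Λ i))))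

  Pow-< : ∀ {k x z} → Pow k x → suc k * lam ≤ z → x < 2 ^ z
  Pow-< {k} {x} {z} p k< = begin-strict
    x                     ≤⟨ unpw p ⟩
    Λ ^ k                 ≡⟨ ^-*-assoc 2 lam k ⟩
    2 ^ (lam * k)         <⟨ ^-monoʳ-< 2 ≤-refl (m<n+m (lam * k) {lam} z<s) ⟩
    2 ^ (lam + lam * k)   ≡⟨ cong (2 ^_) (trans (sym (*-suc lam k)) (*-comm lam (suc k))) ⟩
    2 ^ (suc k * lam)     ≤⟨ ^-monoʳ-≤ 2 k< ⟩
    2 ^ z                 ∎
    where open ≤-Reasoning

  Pow-≤ : ∀ {i x y} → y ≤ x → Pow i x → Pow i y
  Pow-≤ y≤x (pw x≤) = pw (≤-trans y≤x x≤)

  raise : ∀ {i x} j → i ≤ j → Pow i x → Pow j x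
  raise j i≤j (pw x≤) = pw (≤-trans x≤ (^-monoʳ-≤ Λ i≤j))

  infixl 6 _⊞_
  infixl 7 _⊠_

  _⊠_ : ∀ {i j x y} → Pow i x → Pow j y → Pow (i + j) (x * y)
  _⊠_ {i} {j} (pw p) (pw q) = pw (≤-trans (*-mono-≤ p q) (≤-reflexive (sym (^-distribˡ-+-* Λ i j))))

  _⊞_ : ∀ {i j x y} → Pow i x → Pow j y → Pow (suc (i ⊔ j)) (x + y)
  _⊞_ {i} {j} {x} {y} p q = pw (begin
    x + y                           ≤⟨ +-mono-≤ (unpw (raise (i ⊔ j) (m≤m⊔n i j) p)) (unpw (raise (i ⊔ j) (m≤n⊔m i j) q)) ⟩
    Λ ^ (i ⊔ j) + Λ ^ (i ⊔ j)       ≡⟨ cong (Λ ^ (i ⊔ j) +_) (sym (+-identityʳ _)) ⟩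
    2 * Λ ^ (i ⊔ j)                 ≤⟨ *-monoˡ-≤ (Λ ^ (i ⊔ j)) 2≤Λ ⟩
    Λ ^ suc (i ⊔ j)                 ∎)
    where open ≤-Reasoning

  [lam] : Pow 1 lam
  [lam] = pow (<⇒≤ (m<2^m lam))
  [n] : Pow 1 n
  [n] = pow (<⇒≤ n<2^lam)
  [u] : Pow 1 u
  [u] = Pow-≤ u≤lam [lam]
  [b] : Pow 1 b
  [b] = Pow-≤ b≤lam [lam]
  [1] : Pow 0 1
  [1] = pw ≤-refl
  [2] : Pow 1 2
  [2] = pow 2≤Λ
  [B] : Pow 1 B
  [B] = pow (^-monoʳ-≤ 2 b≤lam)
  [q] : Pow 1 q
  [q] = Pow-≤ (//-≤ lam u) [lam]
  [2^u] : Pow 2 (2 ^ u)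
  [2^u] = Pow-≤ 2^u≤2lam ([2] ⊠ [lam])
  [2^*] : ∀ k → Pow (2 * k) (2 ^ (k * u))
  [2^*] k = pw (begin
    2 ^ (k * u)   ≡⟨ cong (2 ^_) (*-comm k u) ⟩
    2 ^ (u * k)   ≡⟨ sym (^-*-assoc 2 u k) ⟩
    (2 ^ u) ^ k   ≤⟨ ^-monoˡ-≤ k (unpw [2^u]) ⟩
    (Λ ^ 2) ^ k   ≡⟨ ^-*-assoc Λ 2 k ⟩
    Λ ^ (2 * k)   ∎)
    where open ≤-Reasoning
  [E] : Pow 12 E
  [E] = [2^*] 6
  [T] : Pow 10 T
  [T] = [2^*] 5
  [g] : Pow 2 g
  [g] = [u] ⊠ [u]
  [h] : Pow 2 h
  [h] = [lam] ⊠ [lam]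
  [G] : Pow 4 G
  [G] = [g] ⊠ [h]
  [H] : Pow 3 H
  [H] = [b] ⊠ [h]
  [off] : Pow 2 off
  [off] = [n] ⊞ [b]
  [n+off] : Pow 3 (n + off)
  [n+off] = [n] ⊞ [off]
  [nb] : Pow 2 nb
  [nb] = [1] ⊞ Pow-≤ (//-≤ n b) [n]
  [cap1] : Pow 8 cap1
  [cap1] = ([1] ⊞ Pow-≤ (//-≤ (n + off) T) [n+off]) ⊠ [G]
  [cap2] : Pow 6 cap2
  [cap2] = ([1] ⊞ Pow-≤ (//-≤ (n + off) b) [n+off]) ⊠ [g]
  [18] : Pow 5 18
  [18] = pw (≤-trans (≤ᵇ⇒≤ 18 (2 ^ 5) tt) (^-monoˡ-≤ 5 2≤Λ))

  [level] : ∀ {w L} → L ≤ lam → Pow 30 (level w L)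
  [level] {w} {L} L≤ = raise 30 (≤ᵇ⇒≤ _ 30 tt) ([nb] ⊞ [nb] ⊞ [lam] ⊠ [nb] ⊞ ([n] ⊞ [1]) ⊞ [n] ⊞ [n] ⊞ (Pow-≤ (//-≤ n w) [n] ⊞ [1]) ⊞ ([cap1] ⊞ [1]) ⊞ ([cap2] ⊞ [1])
    ⊞ [18] ⊞ [B] ⊞ [B] ⊠ [b] ⊞ (Pow-≤ (//-≤ n H) [n] ⊞ [1]) ⊞ (Pow-≤ (//-≤ nb q) [nb] ⊞ [1]) ⊞ (Pow-≤ (//-≤ n G) [n] ⊞ [1]) ⊞ [cap1]
    ⊞ (Pow-≤ (//-≤ (n // g + 1) q) (Pow-≤ (//-≤ n g) [n] ⊞ [1]) ⊞ [1]) ⊞ (Pow-≤ (//-≤ cap2 q) [cap2] ⊞ [1]) ⊞ 4L)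
    where
    4L : Pow 3 (4 * L)
    4L = [2] ⊠ [2] ⊠ Pow-≤ L≤ [lam]

-- The whole construction program

popFill : Fill
popFill = sumFill 18 (v 6) (v 5) ((κ ≫ ι) ⊛ # 2) (v 62)

-- Adding up the truth values of 2 ^ i < x gives the logarithm of x.
logTerm : Expr → Expr
logTerm x = shl false (# 1) ι ≺ x

constructProg : Prog
constructProg =
  assignSum 46 (v 2) (logTerm (v 1)) ++ (assignSum 3 (v 2) (logTerm (v 0)) ++ (assign 3 (# 1 ⊕ v 3) ++
  (assignSum 4 (v 2) (logTerm (# 1 ⊕ v 3)) ++ (assign 5 (# 1 ⊕ v 3 ⊘ # 4) ++ (assign 6 (shl true (# 1) (v 5)) ++
  (assign 7 (v 3 ⊘ v 4) ++ (assign 8 (# 6 ⊗ v 4) ++ (assign 9 (shl true (# 1) (v 8)) ++ (assign 10 (shl true (# 1) (# 5 ⊗ v 4)) ++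
  (assign 11 (v 4 ⊗ v 4) ++ (assign 12 (v 11 ⊗ (v 3 ⊗ v 3)) ++ (assign 13 (v 5 ⊗ (v 3 ⊗ v 3)) ++ (assign 14 (v 0 ⊕ v 5) ++
  (assign 15 (# 1 ⊕ v 0 ⊘ v 5) ++ (assign 16 ((# 1 ⊕ (v 0 ⊕ v 14) ⊘ v 10) ⊗ v 12) ++ (assign 17 ((# 1 ⊕ (v 0 ⊕ v 14) ⊘ v 5) ⊗ v 11) ++
  -- The input occupies the cells below n, so the frontier starts there. Registers 19 and 21 still
  -- hold 0: the sequence of level 0 is the input at address 0, and there are no descriptions to
  -- copy yet.
  (assign 59 (v 0) ++ (alloc popFill ++ (assign 20 (v 46) ++ (loop 20 levelBody ++ (assign 0 (v 21) ++ [])))))))))))))))))))))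

record ComputedSizes (P : Params) (D : Build P) (σ : ℕ) : Set where
  open Params P
  open Build D
  field
    c u   : ℕ
    σ≤n   : σ ≤ n
    L≡    : ⌈log₂ σ ⌉ ≡ L
    c≡    : ⌈log₂ n ⌉ ≡ c
    lam≡  : suc c ≡ lam
    u≡    : ⌈log₂ suc lam ⌉ ≡ u
    b≡    : suc (lam // 4) ≡ b
    q≡    : lam // u ≡ q
    e≡    : 6 * u ≡ e
    T≡    : 2 ^ (5 * u) ≡ T
    g≡    : u * u ≡ g
    h≡    : lam * lam ≡ h
    L<Bd  : L < Bd
    u<Bd  : u < Bd
    cap1< : cap1 < Bd
    cap2< : cap2 < Bd

-- Correctness of the construction

module Construction (P : Params) (D : Build P) {σ : ℕ} (S : Vec (Fin σ) (Params.n P)) (s : ℕ) .{{w≢0 : NonZero (Params.w P)}} where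
  open Params P
  open Build D
  open Machine w
  open Execution w
  open Compile setting
  open Logic setting
  open Rules setting

  n<Bd : n < Bd
  n<Bd = ≤-<-trans (≤-trans (≤-trans (m≤m+n n off) (m≤m+n (n + off) E)) (m≤m+n (n + off + E) E)) positions<

  digit-word : ∀ x {j} → x < 2 → j < w → x * 2 ^ j < 2 ^ w
  digit-word x {j} x<2 j<w = begin-strict
    x * 2 ^ j       ≤⟨ *-monoˡ-≤ (2 ^ j) (≤-pred x<2) ⟩
    1 * 2 ^ j       ≡⟨ *-identityˡ (2 ^ j) ⟩
    2 ^ j           <⟨ ^-monoʳ-< 2 ≤-refl j<w ⟩
    2 ^ w           ∎
    where open ≤-Reasoning

  phase-assign : ∀ x e {y η m T K Q rest} → okAssign x e ≡ true →
    (Good η m → Π (obl Any η m e)) → eval η m e ≡ y → y < Bd →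
    Spec rest (setReg x y η) m T K Q → Spec (assign x e ++ rest) η m (τ + T) (Y + K) Q
  phase-assign x e {T = T} {K} ok o e≡ y< s = Spec-≤ (+-monoˡ-≤ T 401≤τ) (+-monoˡ-≤ K 401≤Y) (Spec-assign′ x e ok o e≡ y< s)

  consts : ℕ → List (ℕ × ℕ)
  consts pop = (0 , n) ∷ (2 , w) ∷ (3 , lam) ∷ (5 , b) ∷ (6 , B) ∷ (7 , q) ∷ (8 , e) ∷ (9 , E) ∷ (10 , T) ∷ (11 , g) ∷
    (12 , G) ∷ (13 , H) ∷ (14 , off) ∷ (15 , nb) ∷ (16 , cap1) ∷ (17 , cap2) ∷ (18 , pop) ∷ (46 , L) ∷ []

  record LevelOK (m : Mem) (fp a l : ℕ) : Set where
    constructor levelOK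
    field
      bm zs R len : ℕ
      bm≡    : m a ≡ bm
      zs≡    : m (a + 1) ≡ zs
      R≡     : m (a + 2) ≡ R
      len≡   : m (a + 3) ≡ len
      bits   : Layout.packedBits w n m bm ≡ levelBitmap L (symbols S) l
      zeros≡ : zs ≡ count false (levelBitmap L (symbols S) l)
      index  : Layout.IsRankSelect w queries (28 * 401) n (levelBitmap L (symbols S) l) m bm R len
      short  : len * w ≤ s
      bm<fp  : bm + (n // w + 1) ≤ fp
      R<fp   : R + len ≤ fp

  /≤ : ∀ {j} → j < n → j / w < n // w + 1
  /≤ {j} j< = ≤-trans (s≤s (subst (_≤ n // w) (//≡/ j w) (//-monoˡ w (<⇒≤ j<)))) (≤-reflexive (+-comm 1 (n // w)))

  packedBits-cong : ∀ {m m′ : Mem} bm → (∀ i → i < n // w + 1 → m′ (bm + i) ≡ m (bm + i)) →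
    Layout.packedBits w n m′ bm ≡ Layout.packedBits w n m bm
  packedBits-cong bm h = trans (map-upTo _ n) (trans (applyUpTo-cong n (λ j j< → cong (bit (j % w)) (h (j / w) (/≤ j<)))) (sym (map-upTo _ n)))

  -- All that a finished level refers to lies below the frontier, where later phases change nothing.
  -- Only its description of four words moves, to the address `a′`.
  LevelOK-keep : ∀ {m m′ fp fp′ a a′ l} → Agree fp m m′ → fp ≤ fp′ →
    m′ a′ ≡ m a → m′ (a′ + 1) ≡ m (a + 1) → m′ (a′ + 2) ≡ m (a + 2) → m′ (a′ + 3) ≡ m (a + 3) →
    LevelOK m fp a l → LevelOK m′ fp′ a′ l
  LevelOK-keep {m} {m′} ag fp≤ e₀ e₁ e₂ e₃ (levelOK bm zs R len bm≡ zs≡ R≡ len≡ bits zeros≡ index short bm<fp R<fp) =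
    levelOK bm zs R len (trans e₀ bm≡) (trans e₁ zs≡) (trans e₂ R≡) (trans e₃ len≡)
      (trans (packedBits-cong {m} {m′} bm (λ i i< → ag _ (bm+< i<))) bits) zeros≡
      (λ M′ isMem hB hR → index M′ isMem
        (λ i i< → trans (hB i i<) (ag _ (bm+< (≤-trans (s≤s (≤-trans (≤-reflexive (sym (//-unique i w>))) (//-monoˡ w (<⇒≤ i<)))) (≤-reflexive (+-comm 1 (n // w)))))))
        (λ i i< → trans (hR i i<) (ag _ (<-≤-trans (+-monoʳ-< R i<) R<fp))))
      short (≤-trans bm<fp fp≤) (≤-trans R<fp fp≤)
    where
    bm+< : ∀ {i} → i < n // w + 1 → bm + i < _
    bm+< i< = <-≤-trans (+-monoʳ-< bm i<) bm<fp

  after-level : ℕ → ℕ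
  after-level fp = fp + nb + nb + lam * nb + (n + 1) + n + n + (n // w + 1) + (cap1 + 1) + (cap2 + 1)
    + 18 + B + B * b + (n // H + 1) + (nb // q + 1) + (n // G + 1) + cap1 + ((n // g + 1) // q + 1) + (cap2 // q + 1) + 4 * L

  levelSize : ℕ
  levelSize = after-level 0

  ≤-+ʳ : ∀ {a c d} → a ≤ c → a ≤ c + d
  ≤-+ʳ a≤ = ≤-trans a≤ (m≤m+n _ _)

  after-level≡ : ∀ fp → after-level fp ≡ fp + levelSize
  after-level≡ fp = step ((step (step (step (step (step (step (step (step (step (step (step (step (step (step (step (step (step (step
    (sym (+-identityʳ fp)))))))))))))))))))))
    where
    step : ∀ {fp′ t x} → fp′ ≡ fp + t → fp′ + x ≡ fp + (t + x)
    step {t = t} {x} e≡ = trans (cong (_+ x) e≡) (+-assoc fp t x)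

  -- The loop counts down, so `k` levels remain and `L ∸ k` are described from address `hd` on.
  -- `cur` is the address of the sequence of level `L ∸ k`.
  record LevelInv (pop base k : ℕ) (η : Regs) (m : Mem) : Set where
    constructor levelInv
    field
      cur hd fp : ℕ
      sx     : ℕ → ℕ
      k≤     : k ≤ L
      facts  : Facts ((59 , fp) ∷ (19 , cur) ∷ (20 , k) ∷ (21 , hd) ∷ consts pop) η
      symA   : Arr m fp cur n sx
      seq≡   : levelSeq L (symbols S) (L ∸ k) ≡ applyUpTo sx n
      popA   : Arr m fp pop B (popCount b)
      fp≤    : fp ≤ base + (L ∸ k) * levelSize
      hd≤    : hd + 4 * (L ∸ k) ≤ fp
      levels : ∀ l → l < L ∸ k → LevelOK m fp (hd + 4 * l) l

  module Level (sx : ℕ → ℕ) (sh cur pop hd : ℕ) where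

    β : ℕ → Bool
    β i = bit sh (sx i)

    -- The bits of the level, padded with zeros from n on because the last chunk and the last bitmap
    -- word may be incomplete.
    γ : ℕ → ℕ
    γ i = if 𝟙 (i <ᵇ n) ≡ᵇ 0 then 0 else bitAt (sx i) sh

    γ-in : ∀ {i} → i < n → γ i ≡ 𝟙 (β i)
    γ-in {i} i< = trans (if-< i<) (sym (𝟙-bit sh (sx i)))

    γ<2 : ∀ i → γ i < 2
    γ<2 i with i <? n
    ... | yes i< = subst (_< 2) (sym (if-< i<)) (bitAt<2 (sx i) sh)
    ... | no ¬i< = subst (_< 2) (sym (if-≮ (≮⇒≥ ¬i<))) z<s

    ∑γ : ∀ i → i ≤ n → ∑ γ i ≡ ranks β true i
    ∑γ i i≤ = ∑-cong i (λ j j< → γ-in (<-≤-trans j< i≤))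

    chunk : ℕ → ℕ
    chunk k = digits (λ j → γ (k * b + j)) 2 b

    chunk< : ∀ k → chunk k < B
    chunk< k = <-≤-trans (digits-< (λ j → γ (k * b + j)) 2 b z<s (λ j _ → γ<2 (k * b + j))) (≤-reflexive (sym B≡))

    chunk-bit : ∀ k {j} → j < b → bitAt (chunk k) j ≡ γ (k * b + j)
    chunk-bit k {j} j< = digits-digit (λ j → γ (k * b + j)) 2 j b z<s (λ j _ → γ<2 (k * b + j)) j<

    counted : ℕ → ℕ
    counted k = popCount b (chunk k)

    counted≡ : ∀ k → counted k ≡ ∑ (λ j → γ (k * b + j)) b
    counted≡ k = ∑-cong b (λ j j< → chunk-bit k j<)

    ∑counted : ∀ k → ∑ counted k ≡ ∑ γ (k * b)
    ∑counted k = trans (∑-cong k (λ i _ → counted≡ i)) (∑-blocks γ b k)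

    row : ℕ → ℕ → ℕ
    row zero    k = counted k
    row (suc d) k = row d k + (if 𝟙 (k <ᵇ 1 * 2 ^ d) ≡ᵇ 0 then row d (k ∸ 1 * 2 ^ d) else 0)

    module Dbl = Doubling counted row nb (λ k _ → refl)

    row-ok : ∀ d → Dbl.Row d
    row-ok zero    = Dbl.row-zero
    row-ok (suc d) = Dbl.row-suc d (λ k _ → refl) (row-ok d)

    blocks≤ : ∀ {k} → k < nb → suc k * b ≤ off
    blocks≤ {k} k< = begin
      suc k * b           ≤⟨ *-monoˡ-≤ b (≤-trans k< (≤-reflexive nb≡)) ⟩
      b + n // b * b      ≤⟨ +-monoʳ-≤ b (//*≤ n b) ⟩
      b + n               ≡⟨ trans (+-comm b n) (sym off≡) ⟩
      off                 ∎
      where open ≤-Reasoning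

    off<Bd : off < Bd
    off<Bd = ≤-<-trans (≤-trans (≤-trans (m≤n+m off n) (m≤m+n (n + off) E)) (m≤m+n (n + off + E) E)) positions<

    -- An entry of a row is part of a prefix sum of padded bits, and the prefix has at most
    -- `off = n + b` of them.
    row< : ∀ d k → k < nb → row d k < Bd
    row< d k k< = ≤-<-trans (begin
      row d k                                   ≤⟨ m≤m+n (row d k) _ ⟩
      row d k + ∑ counted (suc k ∸ 2 ^ d)       ≡⟨ row-ok d k k< ⟩
      ∑ counted (suc k)                         ≡⟨ ∑counted (suc k) ⟩
      ∑ γ (suc k * b)                           ≤⟨ ∑-≤ 1 (suc k * b) (λ i _ → ≤-pred (γ<2 i)) ⟩
      suc k * b * 1                             ≡⟨ *-identityʳ (suc k * b) ⟩
      suc k * b                                 ≤⟨ blocks≤ k< ⟩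
      off                                       ∎) off<Bd
      where open ≤-Reasoning

    -- Doubling yields sums that include the chunk of i. Its own count is taken off again and
    -- replaced by the count of its lowest `i %% b` bits, again by table lookup.
    rank≡ : ∀ i → i ≤ n → row lam (i // b) ∸ counted (i // b) + popCount b (chunk (i // b) %% (1 * 2 ^ (i %% b))) ≡ ranks β true i
    rank≡ i i≤ = begin
      row lam k ∸ counted k + popCount b (chunk k %% (1 * 2 ^ r))
        ≡⟨ cong₂ (λ x y → x ∸ counted k + popCount b (chunk k %% y)) (Dbl.row-full lam nb≤2^lam (row-ok lam) k k<) (*-identityˡ (2 ^ r)) ⟩
      ∑ counted k + counted k ∸ counted k + popCount b (chunk k %% 2 ^ r)
        ≡⟨ cong₂ _+_ (trans (m+n∸n≡m (∑ counted k) (counted k)) (∑counted k)) (popCount-%% b (chunk k) r (<⇒≤ r<)) ⟩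
      ∑ γ (k * b) + ∑ (bitAt (chunk k)) r
        ≡⟨ cong (∑ γ (k * b) +_) (∑-cong r (λ j j< → chunk-bit k (<-trans j< r<))) ⟩
      ∑ γ (k * b) + ∑ (λ j → γ (k * b + j)) r
        ≡⟨ sym (∑-+ γ (k * b) r) ⟩
      ∑ γ (k * b + r)
        ≡⟨ cong (∑ γ) (trans (+-comm (k * b) r) (sym (divMod-split i b>))) ⟩
      ∑ γ i
        ≡⟨ ∑γ i i≤ ⟩
      ranks β true i ∎
      where
      open ≡-Reasoning
      k r : ℕ
      k = i // b
      r = i %% b
      r< : r < b
      r< = %%-< i b>
      k< : k < nb
      k< = <-≤-trans (s≤s (//-monoˡ b i≤)) (≤-reflexive (sym nb≡))

    block< : ∀ {i} → i < n + 1 → i // b < nb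
    block< {i} i< = <-≤-trans (s≤s (//-monoˡ b (≤-pred (≤-trans i< (≤-reflexive (+-comm n 1)))))) (≤-reflexive (sym nb≡))

    2^%%b< : ∀ i → 1 * 2 ^ (i %% b) < Bd
    2^%%b< i = ≤-<-trans (≤-trans (≤-reflexive (*-identityˡ _)) (≤-trans (^-monoʳ-≤ 2 (<⇒≤ (%%-< i b>))) (≤-reflexive (sym B≡)))) B<Bd

    2^scan< : ∀ k → 1 * 2 ^ (lam ∸ k) < Bd
    2^scan< k = ≤-<-trans (≤-trans (≤-reflexive (*-identityˡ _)) (^-monoʳ-≤ 2 (m∸n≤m lam k))) 2^lam<Bd

    listA : ℕ → List (ℕ × ℕ)
    listA fp = (59 , fp) ∷ (19 , cur) ∷ (20 , suc sh) ∷ (21 , hd) ∷ consts pop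

    listB : (fp rk : ℕ) → List (ℕ × ℕ)
    listB fp rk = (22 , sh) ∷ (27 , rk) ∷ (28 , ranks β false n) ∷ listA fp

    listC : (fp rk fa sx′ bm x₁ x₂ : ℕ) → List (ℕ × ℕ)
    listC fp rk fa sx′ bm x₁ x₂ = (59 , fp) ∷ (22 , sh) ∷ (27 , rk) ∷ (28 , ranks β false n) ∷ (29 , fa) ∷ (30 , sx′) ∷ (31 , bm) ∷ (32 , x₁) ∷ (33 , x₂) ∷
      (19 , cur) ∷ (20 , suc sh) ∷ (21 , hd) ∷ consts pop

    listScan : (k fp ck x0 xs : ℕ) → List (ℕ × ℕ)
    listScan k fp ck x0 xs = (26 , k) ∷ (22 , sh) ∷ (23 , ck) ∷ (24 , x0) ∷ (25 , xs) ∷ listA fp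

    -- Ranks of the ones: chunks, table lookup and prefix sums

    module Specs (m₀ : Mem) (fp₀ : ℕ) (room : fp₀ + nb + nb + lam * nb + (n + 1) ≤ top)
      (symA : Arr m₀ fp₀ cur n sx) (popA : Arr m₀ fp₀ pop B (popCount b)) (cnt<Bd : suc sh < Bd) where

      room< : ∀ {x} → x ≤ fp₀ + nb + nb + lam * nb + (n + 1) → x < Bd
      room< x≤ = ≤-<-trans (≤-trans x≤ room) top<Bd

      fp₁ fp₂ : ℕ
      fp₁ = fp₀ + nb
      fp₂ = fp₁ + nb

      fp₂≤ : fp₂ ≤ fp₀ + nb + nb + lam * nb + (n + 1)
      fp₂≤ = ≤-trans (m≤m+n fp₂ (lam * nb)) (m≤m+n _ (n + 1))

      fp₁≤ : fp₁ ≤ fp₀ + nb + nb + lam * nb + (n + 1)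
      fp₁≤ = ≤-trans (m≤m+n fp₁ nb) fp₂≤

      ηs : Regs → Regs
      ηs η = setReg 22 sh (override (listA fp₀) η)

      chunk-fill : ∀ {η T K Q rest} →
        (∀ m₁ → Agree fp₀ m₀ m₁ → Arr m₁ fp₁ fp₀ nb chunk → Spec rest (setReg 59 fp₁ (setReg 23 fp₀ (ηs η))) m₁ T K Q) →
        Spec (alloc chunkFill ++ rest) (ηs η) m₀ (τ + T) (Y + K) Q
      chunk-fill {η} cont = Spec-fill chunkFill refl
        (λ g → sumSafe {x = 23} b tt (room< fp₁≤) b<Bd (λ _ _ → tt) (λ _ _ → ≤-refl) body-ok sum-ok (λ _ _ → tt))
        (time-ok b≤w) (work-ok V-chunk)
        (λ m₁ _ ag st → cont m₁ ag (Arr-≗ {g = chunk} (λ i _ → sum≡ i) (Arr-new st)))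
        where
        term : ℕ → ℕ → ℕ
        term i j = if 𝟙 (i * b + j <ᵇ n) ≡ᵇ 0 then 0 else m₀ (cur + (i * b + j)) // 2 ^ sh %% 2 * 2 ^ j
        term≡ : ∀ i j → term i j ≡ γ (i * b + j) * 2 ^ j
        term≡ i j with i * b + j <? n
        ... | yes p = trans (if-< p) (trans (cong (λ z → z // 2 ^ sh %% 2 * 2 ^ j) (Arr.at symA _ p)) (cong (_* 2 ^ j) (sym (if-< p))))
        ... | no ¬p = trans (if-≮ (≮⇒≥ ¬p)) (cong (_* 2 ^ j) (sym (if-≮ (≮⇒≥ ¬p))))
        sum≡ : ∀ i → ∑ (term i) b ≡ chunk i
        sum≡ i = ∑-cong b (λ j _ → term≡ i j)
        sum-ok : ∀ i → i < nb → ∑ (term i) b < 2 ^ w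
        sum-ok i _ = subst (_< 2 ^ w) (sym (sum≡ i)) (<-≤-trans (<-trans (chunk< i) B<Bd) Bd≤2^w)
        body-ok : ∀ i → i < nb → ∀ j → j < b →
          (¬ 𝟙 (i * b + j <ᵇ n) ≡ 0 → cur + (i * b + j) < fp₀) ×
          (¬ 𝟙 (i * b + j <ᵇ n) ≡ 0 → m₀ (cur + (i * b + j)) // 2 ^ sh %% 2 * 2 ^ j < 2 ^ w) × ⊤
        body-ok i _ j j< = (λ ne → Arr.access symA (𝟙≢0⇒< ne))
          , (λ _ → digit-word (m₀ (cur + (i * b + j)) // 2 ^ sh %% 2) (%%-< (m₀ (cur + (i * b + j)) // 2 ^ sh) z<s) (<-≤-trans j< b≤w)) , tt

      module _ (m₁ : Mem) (chunkA : Arr m₁ fp₁ fp₀ nb chunk) (popA₁ : Arr m₁ fp₁ pop B (popCount b)) where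

        count-fill : ∀ {η T K Q rest} →
          (∀ m₂ → Agree fp₁ m₁ m₂ → Arr m₂ fp₂ fp₁ nb counted →
            Spec rest (setReg 59 fp₂ (setReg 24 fp₁ (setReg 59 fp₁ (setReg 23 fp₀ (ηs η))))) m₂ T K Q) →
          Spec (alloc countFill ++ rest) (setReg 59 fp₁ (setReg 23 fp₀ (ηs η))) m₁ (τ + T) (Y + K) Q
        count-fill {η} cont = Spec-fill countFill refl
          (λ g → mapSafe {x = 24} tt (room< fp₂≤) value-ok)
          (time-ok z≤n) (work-ok (≤-trans (*-monoʳ-≤ (suc nb) (s≤s z≤n)) V-chunk))
          (λ m₂ _ ag st → cont m₂ ag (Arr-≗ {g = counted} value≡ (Arr-new st)))
          where
          value≡ : ∀ i → i < nb → m₁ (pop + m₁ (fp₀ + i)) ≡ counted i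
          value≡ i i< = trans (cong (λ z → m₁ (pop + z)) (Arr.at chunkA i i<)) (Arr.at popA₁ (chunk i) (chunk< i))
          value-ok : ∀ i → i < nb → (fp₀ + i < fp₁) × (m₁ (fp₀ + i) < Bd) × (pop + m₁ (fp₀ + i) < fp₁) × (m₁ (pop + m₁ (fp₀ + i)) < Bd) × ⊤
          value-ok i i< = Arr.access chunkA i< , subst (_< Bd) (sym (Arr.at chunkA i i<)) (<-trans (chunk< i) B<Bd)
            , subst (λ z → pop + z < fp₁) (sym (Arr.at chunkA i i<)) (Arr.access popA₁ (chunk< i))
            , subst (_< Bd) (sym (value≡ i i<)) (≤-<-trans (popCount-≤ b (chunk i)) b<Bd) , tt

      fpAt : ℕ → ℕ
      fpAt d = fp₂ + d * nb

      fpAt-suc : ∀ d → fpAt (suc d) ≡ fpAt d + nb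
      fpAt-suc d = trans (cong (fp₂ +_) (+-comm nb (d * nb))) (sym (+-assoc fp₂ (d * nb) nb))

      fpAt≤ : ∀ {d} → d ≤ lam → fpAt d ≤ fp₀ + nb + nb + lam * nb + (n + 1)
      fpAt≤ d≤ = ≤-trans (+-monoʳ-≤ fp₂ (*-monoˡ-≤ nb d≤)) (m≤m+n _ (n + 1))

      module _ (m₂ : Mem) where

        ScanState : (D k : ℕ) → Regs → Mem → Set
        ScanState D k η m = ∃[ xs ] (Facts (listScan k (fpAt D) fp₀ fp₁ xs) η × Agree fp₂ m₂ m × Arr m (fpAt D) xs nb (row D))

        Scan : ℕ → Regs → Mem → Set
        Scan k η m = k ≤ lam × ScanState (lam ∸ k) k η m

        scan-step : ∀ k η m → η 26 ≡ suc k → Scan (suc k) η m →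
          Spec scanBody η m (allocTime 0 + (401 + 0)) (allocWork nb 0 + (401 + 0)) (λ η′ m′ → η′ 26 ≡ suc k × Scan k (setReg 26 k η′) m′)
        scan-step k η m _ (k< , xs , facts , ag , rowA) = Spec-env (λ x _ → override-same (listScan (suc k) (fpAt d) fp₀ fp₁ xs) η facts x)
          (Spec-fill scanFill refl (λ g → mapSafe {x = 44} tt new< value-ok) ≤-refl ≤-refl
            (λ m′ _ ag′ st → Spec-assign′ 25 (v 44) refl (λ _ → tt) refl (room< (fpAt≤ d≤))
              (Spec-[] (refl , <⇒≤ k< , subst (λ D → ScanState D k (setReg 26 k (η₂ η)) m′) (sym d+1)
                (fpAt d , facts′ , (λ a a< → trans (ag′ a (<-≤-trans a< (m≤m+n fp₂ (d * nb)))) (ag a a<))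
                , subst (λ z → Arr m′ z (fpAt d) nb (row (suc d))) (sym (fpAt-suc d)) (Arr-≗ {g = row (suc d)} value≡ (Arr-new st)))))))
          where
          d : ℕ
          d = lam ∸ suc k
          d+1 : lam ∸ k ≡ suc d
          d+1 = +-∸-assoc 1 k<
          d≤ : d ≤ lam
          d≤ = m∸n≤m lam (suc k)
          new< : fpAt d + nb < Bd
          new< = subst (_< Bd) (fpAt-suc d) (room< (fpAt≤ (subst (_≤ lam) d+1 (m∸n≤m lam k))))
          η₂ : Regs → Regs
          η₂ η = setReg 25 (fpAt d) (setReg 59 (fpAt d + nb) (setReg 44 (fpAt d) (override (listScan (suc k) (fpAt d) fp₀ fp₁ xs) η)))
          facts′ : Facts (listScan k (fpAt (suc d)) fp₀ fp₁ (fpAt d)) (setReg 26 k (η₂ η))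
          facts′ = refl , refl , refl , refl , refl , sym (fpAt-suc d) , refl , refl , refl , refl×18
          p : ℕ
          p = 1 * 2 ^ d
          back< : ∀ {i} → i < nb → i ∸ p < nb
          back< {i} i< = ≤-<-trans (m∸n≤m i p) i<
          value≡ : ∀ i → i < nb → m (xs + i) + (if 𝟙 (i <ᵇ p) ≡ᵇ 0 then m (xs + (i ∸ p)) else 0) ≡ row (suc d) i
          value≡ i i< = cong₂ (λ x y → x + (if 𝟙 (i <ᵇ p) ≡ᵇ 0 then y else 0)) (Arr.at rowA i i<) (Arr.at rowA (i ∸ p) (back< i<))
          value-ok : ∀ i → i < nb → (xs + i < fpAt d) × (m (xs + i) < Bd) × (p < Bd) ×
            (𝟙 (i <ᵇ p) ≡ 0 → p < Bd) × (𝟙 (i <ᵇ p) ≡ 0 → xs + (i ∸ p) < fpAt d) × (𝟙 (i <ᵇ p) ≡ 0 → m (xs + (i ∸ p)) < Bd) × ⊤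
          value-ok i i< = Arr.access rowA i< , subst (_< Bd) (sym (Arr.at rowA i i<)) (row< d i i<) , 2^scan< (suc k)
            , (λ _ → 2^scan< (suc k)) , (λ _ → Arr.access rowA (back< i<))
            , (λ _ → subst (_< Bd) (sym (Arr.at rowA (i ∸ p) (back< i<))) (row< d (i ∸ p) (back< i<))) , tt

        scan : ∀ {η T K Q rest} → Facts (listScan lam fp₂ fp₀ fp₁ fp₁) η → Arr m₂ fp₂ fp₁ nb counted →
          (∀ η′ m₃ xs → Facts (listScan 0 (fpAt lam) fp₀ fp₁ xs) η′ → Agree fp₂ m₂ m₃ → Arr m₃ (fpAt lam) xs nb (row lam) → Spec rest η′ m₃ T K Q) →
          Spec (loop 26 scanBody ++ rest) η m₂ (τ + T) (Y + K) Q
        scan {η} facts countA cont = Spec-≤ (+-monoˡ-≤ _ scan-τ) (+-monoˡ-≤ _ scan-Y)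
          (Spec-++ (Spec-loop {26} Scan (≤ᵇ⇒≤ 27 60 tt) scan-step lam η m₂ (proj₁ facts)
              (≤-refl , subst (λ D → ScanState D lam η m₂) (sym (n∸n≡0 lam)) (fp₁ , facts₀ , (λ _ _ → refl) , rowA₀)))
            (λ η′ m₃ (_ , xs , facts₃ , ag , rowA) → cont η′ m₃ xs facts₃ ag rowA))
          where
          fp₂≡ : fp₂ ≡ fpAt 0
          fp₂≡ = sym (+-identityʳ fp₂)
          facts₀ : Facts (listScan lam (fpAt 0) fp₀ fp₁ fp₁) η
          facts₀ = subst (λ z → Facts (listScan lam z fp₀ fp₁ fp₁) η) fp₂≡ facts
          rowA₀ : Arr m₂ (fpAt 0) fp₁ nb (row 0)
          rowA₀ = subst (λ z → Arr m₂ z fp₁ nb (row 0)) fp₂≡ countA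

      module _ (m₃ : Mem) (xs : ℕ) (rowA : Arr m₃ (fpAt lam) xs nb (row lam)) (countA : Arr m₃ (fpAt lam) fp₁ nb counted)
        (chunkA : Arr m₃ (fpAt lam) fp₀ nb chunk) (popA₃ : Arr m₃ (fpAt lam) pop B (popCount b)) where

        rk fp₄ : ℕ
        rk  = fpAt lam
        fp₄ = rk + (n + 1)

        fp₄<Bd : fp₄ < Bd
        fp₄<Bd = room< ≤-refl

        η₃ : Regs → Regs
        η₃ = override (listScan 0 (fpAt lam) fp₀ fp₁ xs)

        ranks≤ : ∀ c i → ranks β c i ≤ i
        ranks≤ c i = subst (ranks β c i ≤_) (*-identityʳ i) (∑-≤ 1 i (λ j _ → 𝟙≤1 (is c (β j))))

        rank-fill : ∀ {η T K Q rest} →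
          (∀ m₄ → Agree rk m₃ m₄ → Arr m₄ fp₄ rk (n + 1) (ranks β true) →
            Spec rest (setReg 59 fp₄ (setReg 27 rk (η₃ η))) m₄ T K Q) →
          Spec (alloc rankFill ++ rest) (η₃ η) m₃ (τ + T) (Y + K) Q
        rank-fill {η} cont = Spec-fill rankFill refl
          (λ g → mapSafe {x = 27} tt fp₄<Bd value-ok)
          (time-ok z≤n) (work-ok (≤-trans (≤-reflexive (cong (λ z → suc z * 1) (+-comm n 1))) V-map))
          (λ m₄ _ ag st → cont m₄ ag (Arr-≗ {g = ranks β true} value≡ (Arr-new st)))
          where
          index : ℕ → ℕ
          index i = m₃ (fp₀ + i // b) %% (1 * 2 ^ (i %% b))
          index≡ : ∀ i → i < n + 1 → index i ≡ chunk (i // b) %% (1 * 2 ^ (i %% b))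
          index≡ i i< = cong (_%% (1 * 2 ^ (i %% b))) (Arr.at chunkA (i // b) (block< i<))
          index< : ∀ i → i < n + 1 → index i < B
          index< i i< = subst (_< B) (sym (index≡ i i<)) (≤-<-trans (%%-≤ (chunk (i // b)) (1 * 2 ^ (i %% b))) (chunk< (i // b)))
          value≡ : ∀ i → i < n + 1 → m₃ (xs + i // b) ∸ m₃ (fp₁ + i // b) + m₃ (pop + index i) ≡ ranks β true i
          value≡ i i< = trans (cong₂ _+_ (cong₂ _∸_ (Arr.at rowA (i // b) (block< i<)) (Arr.at countA (i // b) (block< i<)))
              (trans (Arr.at popA₃ (index i) (index< i i<)) (cong (popCount b) (index≡ i i<))))
            (rank≡ i (≤-pred (≤-trans i< (≤-reflexive (+-comm n 1)))))
          value-ok : ∀ i → i < n + 1 → (xs + i // b < rk) × (m₃ (xs + i // b) < Bd) × (fp₁ + i // b < rk) × (m₃ (fp₁ + i // b) < Bd) ×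
            (fp₀ + i // b < rk) × (m₃ (fp₀ + i // b) < Bd) × (1 * 2 ^ (i %% b) < Bd) × (pop + index i < rk) × (m₃ (pop + index i) < Bd) × ⊤
          value-ok i i< = Arr.access rowA k< , subst (_< Bd) (sym (Arr.at rowA k k<)) (row< lam k k<)
            , Arr.access countA k< , subst (_< Bd) (sym (Arr.at countA k k<)) (≤-<-trans (popCount-≤ b (chunk k)) b<Bd)
            , Arr.access chunkA k< , subst (_< Bd) (sym (Arr.at chunkA k k<)) (<-trans (chunk< k) B<Bd)
            , 2^%%b< i , Arr.access popA₃ (index< i i<)
            , subst (_< Bd) (sym (Arr.at popA₃ (index i) (index< i i<))) (≤-<-trans (popCount-≤ b (index i)) b<Bd) , tt
            where
            k : ℕ
            k = i // b
            k< : k < nb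
            k< = block< i<

        zeros : ∀ {η T K Q rest} (m₄ : Mem) → Arr m₄ fp₄ rk (n + 1) (ranks β true) →
          (∀ η′ → Spec rest (override (listB fp₄ rk) η′) m₄ T K Q) →
          Spec (assign 28 (v 0 ⊖ ld◂ (v 27 ⊕ v 0)) ++ rest) (setReg 59 fp₄ (setReg 27 rk (η₃ η))) m₄ (τ + T) (Y + K) Q
        zeros {η} m₄ rankA cont = phase-assign 28 (v 0 ⊖ ld◂ (v 27 ⊕ v 0)) refl
          (λ _ → tt , subst (_< Bd) (sym ones≡) (≤-<-trans (ranks≤ true n) n<Bd) , tt)
          (trans (cong (n ∸_) ones≡) (sym (ranks-false β n))) (≤-<-trans (ranks≤ false n) n<Bd)
          (Spec-env (λ x _ → override-same (listB fp₄ rk) η₄ facts x) (cont η₄))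
          where
          η₄ : Regs
          η₄ = setReg 28 (ranks β false n) (setReg 59 fp₄ (setReg 27 rk (η₃ η)))
          ones≡ : m₄ (rk + n) ≡ ranks β true n
          ones≡ = Arr.at rankA n (≤-reflexive (+-comm 1 n))
          facts : Facts (listB fp₄ rk) η₄
          facts = refl , refl , refl , refl , refl , refl , refl , refl×18

      partA-spec : ∀ {η T K Q rest} →
        (∀ η′ m′ → Agree fp₀ m₀ m′ → Arr m′ (fpAt lam + (n + 1)) (fpAt lam) (n + 1) (ranks β true) →
          Spec rest (override (listB (fpAt lam + (n + 1)) (fpAt lam)) η′) m′ T K Q) →
        Spec (partA rest) (override (listA fp₀) η) m₀ (8 * τ + T) (8 * Y + K) Q
      partA-spec {η} {T} {K} {Q} cont = Spec-≤ (≤-reflexive (eight τ T)) (≤-reflexive (eight Y K))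
        (phase-assign 22 (v 20 ⊖ # 1) refl (λ _ → tt) refl (<-trans ≤-refl cnt<Bd)
        (chunk-fill (λ m₁ ag₁ chunkA → count-fill m₁ chunkA (Arr-keep ag₁ (m≤m+n fp₀ nb) popA) (λ m₂ ag₂ countA →
         phase-assign 25 (v 24) refl (λ _ → tt) refl (room< fp₁≤)
        (phase-assign 26 (v 3) refl (λ _ → tt) refl lam<Bd
        (scan m₂ (refl , refl , refl , refl , refl , refl , refl , refl , refl , refl×18) countA
          (λ η₃ m₃ xs facts ag₃ rowA → Spec-env (λ x _ → override-same (listScan 0 (fpAt lam) fp₀ fp₁ xs) η₃ facts x)
          (let popA₁ = Arr-keep ag₁ (m≤m+n fp₀ nb) popA
               popA₂ = Arr-keep ag₂ (m≤m+n fp₁ nb) popA₁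
               chunkA₂ = Arr-keep ag₂ (m≤m+n fp₁ nb) chunkA
               fp₂≤ = m≤m+n fp₂ (lam * nb)
               countA₃ = Arr-keep ag₃ fp₂≤ countA
               chunkA₃ = Arr-keep ag₃ fp₂≤ chunkA₂
               popA₃ = Arr-keep ag₃ fp₂≤ popA₂
           in rank-fill m₃ xs rowA countA₃ chunkA₃ popA₃ {η₃} (λ m₄ ag₄ rankA →
              zeros m₃ xs rowA countA₃ chunkA₃ popA₃ {η₃} m₄ rankA (λ η′ → cont η′ m₄
                (λ a a< → let a<₁ = <-≤-trans a< (m≤m+n fp₀ nb)
                              a<₂ = <-≤-trans a<₁ (m≤m+n fp₁ nb)
                          in trans (ag₄ a (<-≤-trans a<₂ fp₂≤)) (trans (ag₃ a a<₂) (trans (ag₂ a a<₁) (ag₁ a a<))))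
                rankA))))))))))
        where
        eight : ∀ t u → t + (t + (t + (t + (t + (t + (t + (t + u))))))) ≡ 8 * t + u
        eight = solve-∀

    open Partition β n

    n≤off : n ≤ off
    n≤off = ≤-trans (m≤m+n n b) (≤-reflexive (sym off≡))

    n+off<Bd : n + off < Bd
    n+off<Bd = ≤-<-trans (≤-trans (m≤m+n (n + off) E) (m≤m+n (n + off + E) E)) positions<

    bitmapWord : ℕ → ℕ
    bitmapWord k = digits (λ j → γ (k * w + j)) 2 w

    -- The inverse of the partition, the next sequence, the bitmap and the sparse slots

    module SpecsB (m₀ : Mem) (fp₀ rk : ℕ)
      (room : fp₀ + n + n + (n // w + 1) + (cap1 + 1) + (cap2 + 1) ≤ top)
      (symA : Arr m₀ fp₀ cur n sx) (rankA : Arr m₀ fp₀ rk (n + 1) (ranks β true)) where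

      fp₁ fp₂ fp₃ fp₄ fp₅ : ℕ
      fp₁ = fp₀ + n
      fp₂ = fp₁ + n
      fp₃ = fp₂ + (n // w + 1)
      fp₄ = fp₃ + (cap1 + 1)
      fp₅ = fp₄ + (cap2 + 1)

      fp₅<Bd : fp₅ < Bd
      fp₅<Bd = ≤-<-trans room top<Bd
      fp₄<Bd : fp₄ < Bd
      fp₄<Bd = ≤-<-trans (m≤m+n fp₄ _) fp₅<Bd
      fp₃<Bd : fp₃ < Bd
      fp₃<Bd = ≤-<-trans (m≤m+n fp₃ _) fp₄<Bd
      fp₂<Bd : fp₂ < Bd
      fp₂<Bd = ≤-<-trans (m≤m+n fp₂ _) fp₃<Bd
      fp₁<Bd : fp₁ < Bd
      fp₁<Bd = ≤-<-trans (m≤m+n fp₁ _) fp₂<Bd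

      η₀ : Regs → Regs
      η₀ = override (listB fp₀ rk)

      InverseOf : (ℕ → ℕ) → Set
      InverseOf F = ∀ i → i < n → F (dest i) ≡ i + shift off (β i)

      -- `F` is read off the memory after the fill. As every position below n is a destination,
      -- `InverseOf` determines it on the whole array.
      inverse-fill : ∀ {η T K Q rest} →
        (∀ m₁ F → Agree fp₀ m₀ m₁ → InverseOf F → Arr m₁ fp₁ fp₀ n F →
          Spec rest (setReg 59 fp₁ (setReg 29 fp₀ (η₀ η))) m₁ T K Q) →
        Spec (alloc inverseFill ++ rest) (η₀ η) m₀ (τ + T) (Y + K) Q
      inverse-fill {η} cont = Spec-fill inverseFill refl
        (λ g → scatterSafe {x = 29} tt tt n<Bd fp₁<Bd offset-ok (λ i i< → Arr.access symA i< , tt)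
          (λ i j i< j< e≡ → cong (λ z → z + m₀ (cur + z) // 2 ^ sh %% 2 * off)
            (dest-injective i< j< (trans (sym (offset≡ i i<)) (trans e≡ (offset≡ j j<))))))
        (time-ok z≤n) (work-ok (≤-trans (*-monoˡ-≤ 1 (n≤1+n (suc n))) V-map))
        (λ m₁ _ ag st → cont m₁ (λ J → m₁ (fp₀ + J)) ag
          (λ i i< → trans (cong (λ z → m₁ (fp₀ + z)) (sym (offset≡ i i<))) (trans (st i i<) (stored≡ i i<)))
          (record { at = λ _ _ → refl ; below = ≤-refl }))
        where
        bit≡ : ∀ i → i < n → m₀ (cur + i) // 2 ^ sh %% 2 ≡ 𝟙 (β i)
        bit≡ i i< = trans (cong (λ z → z // 2 ^ sh %% 2) (Arr.at symA i i<)) (sym (𝟙-bit sh (sx i)))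
        i<n+1 : ∀ {i} → i < n → i < n + 1
        i<n+1 i< = ≤-trans i< (m≤m+n n 1)
        offset≡ : ∀ i → i < n → (if m₀ (cur + i) // 2 ^ sh %% 2 ≡ᵇ 0 then i ∸ m₀ (rk + i) else ranks β false n + m₀ (rk + i)) ≡ dest i
        offset≡ i i< = trans (cong₂ (λ x y → if x ≡ᵇ 0 then i ∸ y else ranks β false n + y) (bit≡ i i<) (Arr.at rankA i (i<n+1 i<))) (go (β i))
          where
          go : ∀ c → (if 𝟙 c ≡ᵇ 0 then i ∸ ranks β true i else ranks β false n + ranks β true i) ≡ start₀ c + ranks β c i
          go true  = refl
          go false = sym (ranks-false β i)
        stored≡ : ∀ i → i < n → i + m₀ (cur + i) // 2 ^ sh %% 2 * off ≡ i + shift off (β i)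
        stored≡ i i< = cong (i +_) (trans (cong (_* off) (bit≡ i i<)) (go (β i)))
          where
          go : ∀ c → 𝟙 c * off ≡ shift off c
          go true  = *-identityˡ off
          go false = refl
        rank-ok : ∀ i → i < n → (rk + i < fp₀) × (m₀ (rk + i) < Bd)
        rank-ok i i< = Arr.access rankA (i<n+1 i<) , subst (_< Bd) (sym (Arr.at rankA i (i<n+1 i<)))
          (≤-<-trans (subst (ranks β true i ≤_) (*-identityʳ i) (∑-≤ 1 i (λ j _ → 𝟙≤1 (β j)))) (<-trans i< n<Bd))
        offset-ok : ∀ i → i < n → let c = m₀ (cur + i) // 2 ^ sh %% 2 in
          (cur + i < fp₀) × (¬ c ≡ 0 → rk + i < fp₀) × (¬ c ≡ 0 → m₀ (rk + i) < Bd) ×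
          (c ≡ 0 → rk + i < fp₀) × (c ≡ 0 → m₀ (rk + i) < Bd) × ⊤
        offset-ok i i< = Arr.access symA i< , (λ _ → proj₁ (rank-ok i i<)) , (λ _ → proj₂ (rank-ok i i<))
          , (λ _ → proj₁ (rank-ok i i<)) , (λ _ → proj₂ (rank-ok i i<)) , tt

      module WithInverse (F : ℕ → ℕ) (F-dest : InverseOf F) where
        open Inverse off n≤off F F-dest
        open Structure P β F hiding (rk)

        F<Bd : ∀ {J} → J < n → F J < Bd
        F<Bd J< = <-trans (F-< J<) n+off<Bd

        position : ℕ → ℕ
        position J = F J ∸ (if 𝟙 (J <ᵇ Z) ≡ᵇ 0 then off else 0)

        position-dest : ∀ i → i < n → position (dest i) ≡ i
        position-dest i i< = go (β i) refl
          where
          go : ∀ c → β i ≡ c → position (dest i) ≡ i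
          go false e≡ = trans (cong₂ _∸_ (trans (F-dest i i<) (cong (λ z → i + shift off z) e≡)) (if-< (dest-<Z i< e≡))) (+-identityʳ i)
          go true  e≡ = trans (cong₂ _∸_ (trans (F-dest i i<) (cong (λ z → i + shift off z) e≡)) (if-≮ (dest-≥Z e≡))) (m+n∸n≡m i off)

        position< : ∀ {J} → J < n → position J < n
        position< J< with dest-surjective J<
        ... | i , i< , refl = subst (_< n) (sym (position-dest i i<)) i<

        sx′ : ℕ → ℕ
        sx′ J = sx (position J)

        module _ (m₁ : Mem) (invA : Arr m₁ fp₁ fp₀ n F) (symA₁ : Arr m₁ fp₁ cur n sx) where

          η₁ : Regs → Regs
          η₁ η = setReg 59 fp₁ (setReg 29 fp₀ (η₀ η))

          permute-fill : ∀ {η T K Q rest} →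
            (∀ m₂ → Agree fp₁ m₁ m₂ → Arr m₂ fp₂ fp₁ n sx′ → Spec rest (setReg 59 fp₂ (setReg 30 fp₁ (η₁ η))) m₂ T K Q) →
            Spec (alloc permuteFill ++ rest) (η₁ η) m₁ (τ + T) (Y + K) Q
          permute-fill {η} cont = Spec-fill permuteFill refl
            (λ g → mapSafe {x = 30} tt fp₂<Bd (λ i i< → Arr.access invA i< , subst (_< Bd) (sym (Arr.at invA i i<)) (F<Bd i<)
              , subst (λ z → cur + z < fp₁) (sym (pos≡ i i<)) (Arr.access symA₁ (position< i<)) , tt))
            (time-ok z≤n) (work-ok (≤-trans (*-monoˡ-≤ 1 (n≤1+n (suc n))) V-map))
            (λ m₂ _ ag st → cont m₂ ag (Arr-≗ {g = sx′} (λ i i< → trans (cong (λ z → m₁ (cur + z)) (pos≡ i i<)) (Arr.at symA₁ (position i) (position< i<))) (Arr-new st)))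
            where
            pos≡ : ∀ i → i < n → m₁ (fp₀ + i) ∸ (if 𝟙 (i <ᵇ Z) ≡ᵇ 0 then off else 0) ≡ position i
            pos≡ i i< = cong (_∸ (if 𝟙 (i <ᵇ Z) ≡ᵇ 0 then off else 0)) (Arr.at invA i i<)

        module _ (m₂ : Mem) (symA₂ : Arr m₂ fp₂ cur n sx) where

          η₂ : Regs → Regs
          η₂ η = setReg 59 fp₂ (setReg 30 fp₁ (setReg 59 fp₁ (setReg 29 fp₀ (η₀ η))))

          bitmap-fill : ∀ {η T K Q rest} →
            (∀ m₃ → Agree fp₂ m₂ m₃ → Arr m₃ fp₃ fp₂ (n // w + 1) bitmapWord → Spec rest (setReg 59 fp₃ (setReg 31 fp₂ (η₂ η))) m₃ T K Q) →
            Spec (alloc bitmapFill ++ rest) (η₂ η) m₂ (τ + T) (Y + K) Q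
          bitmap-fill {η} cont = Spec-fill bitmapFill refl
            (λ g → sumSafe {x = 31} w tt fp₃<Bd w<Bd (λ _ _ → tt) (λ _ _ → ≤-refl) body-ok sum-ok (λ _ _ → tt))
            (time-ok ≤-refl) (work-ok V-bitmap)
            (λ m₃ _ ag st → cont m₃ ag (Arr-≗ {g = bitmapWord} (λ i _ → sum≡ i) (Arr-new st)))
            where
            term : ℕ → ℕ → ℕ
            term i j = if 𝟙 (i * w + j <ᵇ n) ≡ᵇ 0 then 0 else m₂ (cur + (i * w + j)) // 2 ^ sh %% 2 * 2 ^ j
            term≡ : ∀ i j → term i j ≡ γ (i * w + j) * 2 ^ j
            term≡ i j with i * w + j <? n
            ... | yes p = trans (if-< p) (trans (cong (λ z → z // 2 ^ sh %% 2 * 2 ^ j) (Arr.at symA₂ _ p)) (cong (_* 2 ^ j) (sym (if-< p))))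
            ... | no ¬p = trans (if-≮ (≮⇒≥ ¬p)) (cong (_* 2 ^ j) (sym (if-≮ (≮⇒≥ ¬p))))
            sum≡ : ∀ i → ∑ (term i) w ≡ bitmapWord i
            sum≡ i = ∑-cong w (λ j _ → term≡ i j)
            sum-ok : ∀ i → i < n // w + 1 → ∑ (term i) w < 2 ^ w
            sum-ok i _ = subst (_< 2 ^ w) (sym (sum≡ i)) (digits-< (λ j → γ (i * w + j)) 2 w z<s (λ j _ → γ<2 (i * w + j)))
            body-ok : ∀ i → i < n // w + 1 → ∀ j → j < w →
              (¬ 𝟙 (i * w + j <ᵇ n) ≡ 0 → cur + (i * w + j) < fp₂) ×
              (¬ 𝟙 (i * w + j <ᵇ n) ≡ 0 → m₂ (cur + (i * w + j)) // 2 ^ sh %% 2 * 2 ^ j < 2 ^ w) × ⊤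
            body-ok i _ j j< = (λ ne → Arr.access symA₂ (𝟙≢0⇒< ne))
              , (λ _ → digit-word (m₂ (cur + (i * w + j)) // 2 ^ sh %% 2) (%%-< (m₂ (cur + (i * w + j)) // 2 ^ sh) z<s) j<) , tt

        listS : (fp z₄₇ z₄₈ z₄₉ : ℕ) → List (ℕ × ℕ)
        listS fp z₄₇ z₄₈ z₄₉ = (59 , fp) ∷ (47 , z₄₇) ∷ (48 , z₄₈) ∷ (49 , z₄₉) ∷ (0 , n) ∷ (29 , fp₀) ∷ []

        Slots : (ℕ → ℕ) → (z t : ℕ) → Set
        Slots X z t = ∀ j → j < n → t ≤ spreadOf z (j // z) → X (slotOf z t j) ≡ F j ∸ F (j // z * z)

        module Sparse (z t cap : ℕ) (z> : 0 < z) (t> : 0 < t) (cap≡ : cap ≡ suc ((n + off) // t) * z)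
          (z<Bd : z < Bd) (m₃ : Mem) (fp : ℕ) (new< : fp + (cap + 1) < Bd) (invA : Arr m₃ fp fp₀ n F) where

          module Gr = Groups n z t z> t> F F-mono

          slot<cap : ∀ {j} → j < n → slotOf z t j < cap
          slot<cap j< = <-≤-trans (Gr.slot-bound j< (F-< j<)) (≤-reflexive (sym cap≡))

          Dense? : ∀ j → (t ≤ spreadOf z (j // z)) ⊎ (spreadOf z (j // z) < t)
          Dense? j with spreadOf z (j // z) <? t
          ... | yes p = inj₂ p
          ... | no ¬p = inj₁ (≮⇒≥ ¬p)

          first< : ∀ {j} → j < n → j // z * z < n
          first< {j} j< = ≤-<-trans (//*≤ j z) j<

          next< : ∀ {j} → j < n → nextOf z (j // z) < n
          next< {j} j< = Gr.next-< {j} {j // z} j<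

          spread≡ : ∀ j → j < n → m₃ (fp₀ + nextOf z (j // z)) ∸ m₃ (fp₀ + j // z * z) ≡ spreadOf z (j // z)
          spread≡ j j< = cong₂ _∸_ (Arr.at invA (nextOf z (j // z)) (next< j<)) (Arr.at invA (j // z * z) (first< j<))

          offsetV valueV : ℕ → ℕ
          offsetV j = if 𝟙 (m₃ (fp₀ + nextOf z (j // z)) ∸ m₃ (fp₀ + j // z * z) <ᵇ t) ≡ᵇ 0
            then m₃ (fp₀ + j // z * z) // t * z + j %% z else cap
          valueV j = if 𝟙 (m₃ (fp₀ + nextOf z (j // z)) ∸ m₃ (fp₀ + j // z * z) <ᵇ t) ≡ᵇ 0
            then m₃ (fp₀ + j) ∸ m₃ (fp₀ + j // z * z) else 0

          sparse-offset : ∀ j → j < n → t ≤ spreadOf z (j // z) → offsetV j ≡ slotOf z t j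
          sparse-offset j j< sp = trans (if-≮ (subst (t ≤_) (sym (spread≡ j j<)) sp))
            (cong (λ x → x // t * z + j %% z) (Arr.at invA (j // z * z) (first< j<)))

          sparse-value : ∀ j → j < n → t ≤ spreadOf z (j // z) → valueV j ≡ F j ∸ F (j // z * z)
          sparse-value j j< sp = trans (if-≮ (subst (t ≤_) (sym (spread≡ j j<)) sp))
            (cong₂ _∸_ (Arr.at invA j j<) (Arr.at invA (j // z * z) (first< j<)))

          dense-offset : ∀ j → j < n → spreadOf z (j // z) < t → offsetV j ≡ cap
          dense-offset j j< d = if-< (subst (_< t) (sym (spread≡ j j<)) d)

          dense-value : ∀ j → j < n → spreadOf z (j // z) < t → valueV j ≡ 0
          dense-value j j< d = if-< (subst (_< t) (sym (spread≡ j j<)) d)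

          -- Positions of sparse groups have distinct slots below `cap`, and all other positions
          -- meet in cell `cap`, where each of them stores 0.
          consistent′ : ∀ i j → i < n → j < n → offsetV i ≡ offsetV j → valueV i ≡ valueV j
          consistent′ i j i< j< e≡ with Dense? i | Dense? j
          ... | inj₂ di | inj₂ dj = trans (dense-value i i< di) (sym (dense-value j j< dj))
          ... | inj₁ si | inj₁ sj = cong valueV (Gr.slot-injective i< j< si sj
                (trans (sym (sparse-offset i i< si)) (trans e≡ (sparse-offset j j< sj))))
          ... | inj₁ si | inj₂ dj = ⊥-elim (<-irrefl (trans (sym (sparse-offset i i< si)) (trans e≡ (dense-offset j j< dj))) (slot<cap i<))
          ... | inj₂ di | inj₁ sj = ⊥-elim (<-irrefl (trans (sym (sparse-offset j j< sj)) (trans (sym e≡) (dense-offset i i< di))) (slot<cap j<))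

          ηS : Regs → Regs
          ηS = override (listS fp z t cap)

          at< : ∀ {j} → j < n → m₃ (fp₀ + j) < Bd
          at< j< = subst (_< Bd) (sym (Arr.at invA _ j<)) (F<Bd j<)

          offset-ok : ∀ j → j < n → let nx = nextOf z (j // z) ; c = 𝟙 (m₃ (fp₀ + nx) ∸ m₃ (fp₀ + j // z * z) <ᵇ t) in
            (fp₀ + nx < fp) × (m₃ (fp₀ + nx) < Bd) × (fp₀ + j // z * z < fp) × (m₃ (fp₀ + j // z * z) < Bd) ×
            (c ≡ 0 → fp₀ + j // z * z < fp) × (c ≡ 0 → m₃ (fp₀ + j // z * z) < Bd) × ⊤
          offset-ok j j< = Arr.access invA (next< j<) , at< (next< j<) , Arr.access invA (first< j<) , at< (first< j<)
            , (λ _ → Arr.access invA (first< j<)) , (λ _ → at< (first< j<)) , tt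

          value-ok : ∀ j → j < n → let nx = nextOf z (j // z) ; c = 𝟙 (m₃ (fp₀ + nx) ∸ m₃ (fp₀ + j // z * z) <ᵇ t) in
            (fp₀ + nx < fp) × (m₃ (fp₀ + nx) < Bd) × (fp₀ + j // z * z < fp) × (m₃ (fp₀ + j // z * z) < Bd) ×
            (c ≡ 0 → fp₀ + j < fp) × (c ≡ 0 → m₃ (fp₀ + j) < Bd) ×
            (c ≡ 0 → fp₀ + j // z * z < fp) × (c ≡ 0 → m₃ (fp₀ + j // z * z) < Bd) × ⊤
          value-ok j j< = Arr.access invA (next< j<) , at< (next< j<) , Arr.access invA (first< j<) , at< (first< j<)
            , (λ _ → Arr.access invA j<) , (λ _ → at< j<)
            , (λ _ → Arr.access invA (first< j<)) , (λ _ → at< (first< j<)) , tt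

          -- `X` is whatever the cells hold afterwards: `Slots` describes those claimed by sparse
          -- groups, and the others keep their unknown contents. The spare cell lies just behind the
          -- array.
          sparse-fill : ∀ {η T K Q rest} →
            (∀ m₄ X → Agree fp m₃ m₄ → Slots X z t → Arr m₄ (fp + (cap + 1)) fp cap X →
              Spec rest (setReg 59 (fp + (cap + 1)) (setReg 50 fp (ηS η))) m₄ T K Q) →
            Spec (alloc sparseFill ++ rest) (ηS η) m₃ (τ + T) (Y + K) Q
          sparse-fill {η} cont = Spec-fill sparseFill refl
            (λ g → scatterSafe {x = 50} tt tt n<Bd new< offset-ok value-ok consistent′)
            (time-ok z≤n) (work-ok (≤-trans (*-monoˡ-≤ 1 (n≤1+n (suc n))) V-map))
            (λ m₄ _ ag st → cont m₄ (λ k → m₄ (fp + k)) ag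
              (λ j j< sp → trans (cong (λ x → m₄ (fp + x)) (sym (sparse-offset j j< sp))) (trans (st j j<) (sparse-value j j< sp)))
              (record { at = λ _ _ → refl ; below = +-monoʳ-≤ fp (m≤m+n cap 1) }))

        record ResultB (m : Mem) (X₁ X₂ : ℕ → ℕ) : Set where
          field
            agree   : Agree fp₀ m₀ m
            invA    : Arr m fp₅ fp₀ n F
            permA   : Arr m fp₅ fp₁ n sx′
            bitmapA : Arr m fp₅ fp₂ (n // w + 1) bitmapWord
            x₁A     : Arr m fp₅ fp₃ cap1 X₁
            x₂A     : Arr m fp₅ fp₄ cap2 X₂
            rkA     : Arr m fp₅ rk (n + 1) (ranks β true)
            slots₁  : Slots X₁ G T
            slots₂  : Slots X₂ g b

      partB-spec : ∀ {η T′ K Q rest} →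
        (∀ η′ m′ F (F-dest : InverseOf F) X₁ X₂ → WithInverse.ResultB F F-dest m′ X₁ X₂ →
          Spec rest (override (listC fp₅ rk fp₀ fp₁ fp₂ fp₃ fp₄) η′) m′ T′ K Q) →
        Spec (partB rest) (override (listB fp₀ rk) η) m₀ (13 * τ + T′) (13 * Y + K) Q
      partB-spec {η} {T′} {K} {Q} {rest} cont = Spec-≤ (≤-reflexive (thirteen τ T′)) (≤-reflexive (thirteen Y K))
        (inverse-fill (λ m₁ F ag₁ F-dest invA₁ →
          let open WithInverse F F-dest
              symA₁ = Arr-keep ag₁ (m≤m+n fp₀ n) symA
              rkA₁ = Arr-keep ag₁ (m≤m+n fp₀ n) rankA
          in permute-fill m₁ invA₁ symA₁ (λ m₂ ag₂ permA₂ →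
          let symA₂ = Arr-keep ag₂ (m≤m+n fp₁ n) symA₁
              rkA₂ = Arr-keep ag₂ (m≤m+n fp₁ n) rkA₁
              invA₂ = Arr-keep ag₂ (m≤m+n fp₁ n) invA₁
          in bitmap-fill m₂ symA₂ (λ m₃ ag₃ bitmapA₃ →
          let ≤₃ = m≤m+n fp₂ (n // w + 1)
          in after-bitmap F F-dest m₃ _ (λ a a< → let a<₁ = <-≤-trans a< (m≤m+n fp₀ n) in
                trans (ag₃ a (<-≤-trans a<₁ (m≤m+n fp₁ n))) (trans (ag₂ a a<₁) (ag₁ a a<)))
              (Arr-keep ag₃ ≤₃ invA₂) (Arr-keep ag₃ ≤₃ permA₂) bitmapA₃ (Arr-keep ag₃ ≤₃ rkA₂) (cont′ F F-dest)))))
        where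
        cont′ : ∀ F (F-dest : InverseOf F) η′ m′ X₁ X₂ → WithInverse.ResultB F F-dest m′ X₁ X₂ → Spec rest (override (listC fp₅ rk fp₀ fp₁ fp₂ fp₃ fp₄) η′) m′ T′ K Q
        cont′ F F-dest η′ m′ X₁ X₂ r = cont η′ m′ F F-dest X₁ X₂ r
        thirteen : ∀ t u → t + (t + (t + (t + (t + (t + (t + (t + (t + (t + (t + (t + (t + u)))))))))))) ≡ 13 * t + u
        thirteen = solve-∀
        after-bitmap : ∀ F (F-dest : InverseOf F) m₃ η → Agree fp₀ m₀ m₃ → Arr m₃ fp₃ fp₀ n F → Arr m₃ fp₃ fp₁ n (WithInverse.sx′ F F-dest) →
          Arr m₃ fp₃ fp₂ (n // w + 1) bitmapWord → Arr m₃ fp₃ rk (n + 1) (ranks β true) →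
          (∀ η′ m′ X₁ X₂ → WithInverse.ResultB F F-dest m′ X₁ X₂ → Spec rest (override (listC fp₅ rk fp₀ fp₁ fp₂ fp₃ fp₄) η′) m′ T′ K Q) →
          Spec (assign 47 (v 12) ++ (assign 48 (v 10) ++ (assign 49 (v 16) ++ (alloc sparseFill ++ (assign 32 (v 50) ++
            (assign 47 (v 11) ++ (assign 48 (v 5) ++ (assign 49 (v 17) ++ (alloc sparseFill ++ (assign 33 (v 50) ++ rest))))))))))
            (setReg 59 fp₃ (setReg 31 fp₂ (setReg 59 fp₂ (setReg 30 fp₁ (setReg 59 fp₁ (setReg 29 fp₀ (η₀ η))))))) m₃
            (τ + (τ + (τ + (τ + (τ + (τ + (τ + (τ + (τ + (τ + T′))))))))))
            (Y + (Y + (Y + (Y + (Y + (Y + (Y + (Y + (Y + (Y + K)))))))))) Q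
        after-bitmap F F-dest m₃ η ag invA permA bitmapA rkA cont =
          phase-assign 47 (v 12) refl (λ _ → tt) refl G<Bd
          (phase-assign 48 (v 10) refl (λ _ → tt) refl T<Bd
          (phase-assign 49 (v 16) refl (λ _ → tt) refl cap1<Bd
          (Spec-env (λ x _ → override-same (listS fp₃ G T cap1) η₃ (refl , refl , refl , refl , refl , refl , tt) x)
          (S₁.sparse-fill {η₃} (λ m₄ X₁ ag₄ slots₁ x₁A →
           let ≤₄ = m≤m+n fp₃ (cap1 + 1)
               invA₄ = Arr-keep ag₄ ≤₄ invA
               η₄ = setReg 49 cap2 (setReg 48 b (setReg 47 g (setReg 32 fp₃ (setReg 59 fp₄ (setReg 50 fp₃ (override (listS fp₃ G T cap1) η₃))))))
               module S₂ = Sparse g b cap2 g> b> cap2≡ g<Bd m₄ fp₄ fp₅<Bd invA₄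
           in phase-assign 32 (v 50) refl (λ _ → tt) refl (≤-<-trans (m≤m+n fp₃ (cap1 + 1)) fp₄<Bd)
          (phase-assign 47 (v 11) refl (λ _ → tt) refl g<Bd
          (phase-assign 48 (v 5) refl (λ _ → tt) refl b<Bd
          (phase-assign 49 (v 17) refl (λ _ → tt) refl cap2<Bd
          (Spec-env (λ x _ → override-same (listS fp₄ g b cap2) η₄ (refl , refl , refl , refl , refl , refl , tt) x)
          (S₂.sparse-fill {η₄} (λ m₅ X₂ ag₅ slots₂ x₂A →
           let ≤₅ = m≤m+n fp₄ (cap2 + 1)
               η₅ = setReg 33 fp₄ (setReg 59 fp₅ (setReg 50 fp₄ (override (listS fp₄ g b cap2) η₄)))
               keep : ∀ {base N f} → Arr m₃ fp₃ base N f → Arr m₅ fp₅ base N f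
               keep A = Arr-keep ag₅ ≤₅ (Arr-keep ag₄ ≤₄ A)
           in phase-assign 33 (v 50) refl (λ _ → tt) refl (≤-<-trans (m≤m+n fp₄ (cap2 + 1)) fp₅<Bd)
          (Spec-env (λ x _ → override-same (listC fp₅ rk fp₀ fp₁ fp₂ fp₃ fp₄) η₅ (refl , refl , refl , refl , refl , refl , refl , refl , refl , refl , refl , refl , refl×18) x)
          (cont η₅ m₅ X₁ X₂ (record
            { agree = λ a a< → let a<₃ = <-≤-trans a< (≤-trans (m≤m+n fp₀ n) (≤-trans (m≤m+n fp₁ n) (m≤m+n fp₂ (n // w + 1)))) in
                trans (ag₅ a (<-≤-trans a<₃ ≤₄)) (trans (ag₄ a a<₃) (ag a a<))
            ; invA = keep invA ; permA = keep permA ; bitmapA = keep bitmapA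
            ; x₁A = Arr-keep ag₅ ≤₅ x₁A ; x₂A = x₂A ; rkA = keep rkA ; slots₁ = slots₁ ; slots₂ = slots₂ }))))))))))))))
          where
          open WithInverse F F-dest
          cap1<Bd : cap1 < Bd
          cap1<Bd = ≤-<-trans (≤-trans (m≤m+n cap1 1) (m≤n+m (cap1 + 1) fp₃)) fp₄<Bd
          cap2<Bd : cap2 < Bd
          cap2<Bd = ≤-<-trans (≤-trans (m≤m+n cap2 1) (m≤n+m (cap2 + 1) fp₄)) fp₅<Bd
          η₃ : Regs
          η₃ = setReg 49 cap1 (setReg 48 T (setReg 47 G (setReg 59 fp₃ (setReg 31 fp₂ (setReg 59 fp₂ (setReg 30 fp₁ (setReg 59 fp₁ (setReg 29 fp₀ (η₀ η)))))))))
          module S₁ = Sparse G T cap1 G> T> cap1≡ G<Bd m₃ fp₃ fp₄<Bd invA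

    bitmap-bit : ∀ i → i < n → bitAt (bitmapWord (i // w)) (i %% w) ≡ 𝟙 (β i)
    bitmap-bit i i< = trans (digits-digit (λ j → γ (i // w * w + j)) 2 (i %% w) w z<s (λ j _ → γ<2 (i // w * w + j)) (%%-< i w>))
      (trans (cong γ (trans (+-comm (i // w * w) (i %% w)) (sym (divMod-split i w>)))) (γ-in i<))

    packedBits≡ : ∀ .{{_ : NonZero w}} (M : Mem) (bm : ℕ) → (∀ i → i < n // w + 1 → M (bm + i) ≡ bitmapWord i) →
      Layout.packedBits w n M bm ≡ applyUpTo β n
    packedBits≡ M bm h = trans (map-upTo _ n) (applyUpTo-cong n (λ j j< → 𝟙-injective _ _ (begin
      𝟙 (bit (j % w) (M (bm + j / w)))     ≡⟨ 𝟙-bit (j % w) (M (bm + j / w)) ⟩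
      bitAt (M (bm + j / w)) (j % w)       ≡⟨ sym (cong₂ (λ x y → bitAt (M (bm + x)) y) (//≡/ j w) (%%≡% j w)) ⟩
      bitAt (M (bm + j // w)) (j %% w)     ≡⟨ cong (λ z → bitAt z (j %% w)) (h (j // w) (≤-trans (s≤s (//-monoˡ w (<⇒≤ j<))) (≤-reflexive (+-comm 1 (n // w))))) ⟩
      bitAt (bitmapWord (j // w)) (j %% w) ≡⟨ bitmap-bit j j< ⟩
      𝟙 (β j)                              ∎)))
      where open ≡-Reasoning

    -- Filling the rank/select structure

    module PartC (F : ℕ → ℕ) (F-dest : ∀ i → i < n → F (dest i) ≡ i + shift off (β i)) (X₁ X₂ : ℕ → ℕ) where
      open Inverse off n≤off F F-dest
      open Structure P β F renaming (rk to rkf)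

      packed : (ℕ → ℕ) → ℕ → ℕ
      packed d k = ∑ (λ j → d (k * q + j) * 2 ^ (e * j)) q

      selV blockD groupV subgroupD subslotD : ℕ → ℕ
      selV k = ∑ (λ j → 𝟙 (popCount b (k // b %% (1 * 2 ^ suc j)) <ᵇ suc (k %% b))) b
      blockD k = if 𝟙 (k <ᵇ nb) ≡ᵇ 0 then 0 else rkf (k * b) ∸ rkf (k * b // H * H)
      groupV k = if 𝟙 (k * G <ᵇ n) ≡ᵇ 0 then 0 else 2 * F (k * G) + sparseOf G T k
      subgroupD k = if 𝟙 (k * g <ᵇ n) ≡ᵇ 0 then 0 else (2 * (F (k * g) ∸ F (k * g // G * G)) + sparseOf g b k) %% E
      subslotD k = if 𝟙 (k <ᵇ cap2) ≡ᵇ 0 then 0 else X₂ k %% E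

      E>0 : 0 < E
      E>0 = subst (0 <_) (sym E≡) (2^>0 e)

      ranks≤ : ∀ c i → ranks β c i ≤ i
      ranks≤ c i = subst (ranks β c i ≤_) (*-identityʳ i) (∑-≤ 1 i (λ j _ → 𝟙≤1 (is c (β j))))

      rank-diff : ∀ i d → 0 < d → rkf i ∸ rkf (i // d * d) < d
      rank-diff i d d> = ≤-<-trans (m≤n+o⇒m∸n≤o (rkf i) (rkf (i // d * d)) (begin
        rkf i                                    ≡⟨ cong rkf (trans (divMod-split i d>) (+-comm (i %% d) (i // d * d))) ⟩
        rkf (i // d * d + i %% d)                ≡⟨ ∑-+ (λ j → 𝟙 (β j)) (i // d * d) (i %% d) ⟩
        rkf (i // d * d) + ∑ (λ j → 𝟙 (β (i // d * d + j))) (i %% d) ≤⟨ +-monoʳ-≤ (rkf (i // d * d)) (∑-≤ 1 (i %% d) (λ j _ → 𝟙≤1 (β (i // d * d + j)))) ⟩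
        rkf (i // d * d) + i %% d * 1            ≡⟨ cong (rkf (i // d * d) +_) (*-identityʳ (i %% d)) ⟩
        rkf (i // d * d) + i %% d                ∎)) (%%-< i d>)
        where open ≤-Reasoning

      if-bound : ∀ {a c x M} → 0 < M → x < M → (if 𝟙 (a <ᵇ c) ≡ᵇ 0 then 0 else x) < M
      if-bound {a} {c} M> x< with a <ᵇ c
      ... | true  = x<
      ... | false = M>

      blockD< : ∀ k → blockD k < 2 ^ e
      blockD< k = <-≤-trans (if-bound {k} {nb} E>0 (<-≤-trans (rank-diff (k * b) H H>) H≤E)) (≤-reflexive E≡)

      subgroupD< : ∀ k → subgroupD k < 2 ^ e
      subgroupD< k = <-≤-trans (if-bound {k * g} {n} E>0 (%%-< (2 * (F (k * g) ∸ F (k * g // G * G)) + sparseOf g b k) E>0)) (≤-reflexive E≡)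

      subslotD< : ∀ k → subslotD k < 2 ^ e
      subslotD< k = <-≤-trans (if-bound {k} {cap2} E>0 (%%-< (X₂ k) E>0)) (≤-reflexive E≡)

      packed< : ∀ d → (∀ k → d k < 2 ^ e) → ∀ k → packed d k < 2 ^ w
      packed< d d< k = <-≤-trans (packed-< (λ j → d (k * q + j)) e q (λ j _ → d< (k * q + j))) (^-monoʳ-≤ 2 eq≤w)

      field-packed : ∀ d → (∀ k → d k < 2 ^ e) → ∀ k → field′ (packed d (k // q)) k ≡ d k
      field-packed d d< k = trans (cong (packed d (k // q) // 2 ^ (e * (k %% q)) %%_) E≡)
        (trans (packed-digit (λ j → d (k // q * q + j)) e (k %% q) q (λ j _ → d< (k // q * q + j)) (%%-< k q>))
          (cong d (trans (+-comm (k // q * q) (k %% q)) (sym (divMod-split k q>)))))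

      field-word : ∀ {x j} → x < 2 ^ e → j < q → x * 2 ^ (e * j) < 2 ^ w
      field-word {x} {j} x< j< = begin-strict
        x * 2 ^ (e * j)        <⟨ *-monoˡ-< (2 ^ (e * j)) {{m^n≢0 2 (e * j)}} x< ⟩
        2 ^ e * 2 ^ (e * j)    ≡⟨ sym (^-distribˡ-+-* 2 e (e * j)) ⟩
        2 ^ (e + e * j)        ≡⟨ cong (2 ^_) (sym (*-suc e j)) ⟩
        2 ^ (e * suc j)        ≤⟨ ^-monoʳ-≤ 2 (≤-trans (*-monoʳ-≤ e j<) eq≤w) ⟩
        2 ^ w                  ∎
        where open ≤-Reasoning

      F<Bd : ∀ {J} → J < n → F J < Bd
      F<Bd J< = <-trans (F-< J<) (≤-<-trans (≤-trans (m≤m+n (n + off) E) (m≤m+n (n + off + E) E)) positions<)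

      rkf<Bd : ∀ {i} → i ≤ n → rkf i < Bd
      rkf<Bd {i} i≤ = ≤-<-trans (ranks≤ true i) (≤-<-trans i≤ n<Bd)

      2^suc< : ∀ {j} → j < b → 1 * 2 ^ suc j < Bd
      2^suc< {j} j< = ≤-<-trans (≤-trans (≤-reflexive (*-identityˡ (2 ^ suc j))) (≤-trans (^-monoʳ-≤ 2 j<) (≤-reflexive (sym B≡)))) B<Bd

      <+1 : ∀ {a c} → a < c + 1 → a ≤ c
      <+1 {a} {c} h = ≤-pred (≤-trans h (≤-reflexive (+-comm c 1)))

      module SpecsC (m₀ : Mem) (R : ℕ) (rk fa sx′ bm x₁ x₂ : ℕ)
        (room : R + 18 + B + B * b + (n // H + 1) + (nb // q + 1) + (n // G + 1) + cap1 + ((n // g + 1) // q + 1) + (cap2 // q + 1) ≤ top)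
        (popA : Arr m₀ R pop B (popCount b)) (rkA : Arr m₀ R rk (n + 1) rkf) (invA : Arr m₀ R fa n F)
        (x₁A : Arr m₀ R x₁ cap1 X₁) (x₂A : Arr m₀ R x₂ cap2 X₂)
        (slots₁ : ∀ j → j < n → T ≤ spreadOf G (j // G) → X₁ (slotOf G T j) ≡ F j ∸ F (j // G * G))
        (slots₂ : ∀ j → j < n → b ≤ spreadOf g (j // g) → X₂ (slotOf g b j) ≡ F j ∸ F (j // g * g)) where

        t₁ t₂ t₃ t₄ t₅ t₆ t₇ t₈ t₉ : ℕ
        t₁ = R + 18
        t₂ = t₁ + B
        t₃ = t₂ + B * b
        t₄ = t₃ + (n // H + 1)
        t₅ = t₄ + (nb // q + 1)
        t₆ = t₅ + (n // G + 1)
        t₇ = t₆ + cap1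
        t₈ = t₇ + ((n // g + 1) // q + 1)
        t₉ = t₈ + (cap2 // q + 1)

        t₉<Bd : t₉ < Bd
        t₉<Bd = ≤-<-trans room top<Bd
        t₈<Bd : t₈ < Bd
        t₈<Bd = ≤-<-trans (m≤m+n t₈ _) t₉<Bd
        t₇<Bd : t₇ < Bd
        t₇<Bd = ≤-<-trans (m≤m+n t₇ _) t₈<Bd
        t₆<Bd : t₆ < Bd
        t₆<Bd = ≤-<-trans (m≤m+n t₆ _) t₇<Bd
        t₅<Bd : t₅ < Bd
        t₅<Bd = ≤-<-trans (m≤m+n t₅ _) t₆<Bd
        t₄<Bd : t₄ < Bd
        t₄<Bd = ≤-<-trans (m≤m+n t₄ _) t₅<Bd
        t₃<Bd : t₃ < Bd
        t₃<Bd = ≤-<-trans (m≤m+n t₃ _) t₄<Bd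
        t₂<Bd : t₂ < Bd
        t₂<Bd = ≤-<-trans (m≤m+n t₂ _) t₃<Bd
        t₁<Bd : t₁ < Bd
        t₁<Bd = ≤-<-trans (m≤m+n t₁ _) t₂<Bd

        headerV : ℕ → ℕ
        headerV 0  = b
        headerV 1  = q
        headerV 2  = e
        headerV 3  = E
        headerV 4  = H
        headerV 5  = G
        headerV 6  = g
        headerV 7  = T
        headerV 8  = off
        headerV 9  = Z
        headerV 10 = t₁
        headerV 11 = t₂
        headerV 12 = t₃
        headerV 13 = t₄
        headerV 14 = t₅
        headerV 15 = t₆
        headerV 16 = t₇
        headerV 17 = t₈
        headerV _  = 0

        record Region (M : Mem) (fp : ℕ) : Set where
          field
            headerA    : Arr M fp R 18 headerV
            tablePopA  : Arr M fp t₁ B (popCount b)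
            tableSelA  : Arr M fp t₂ (B * b) selV
            ranksA     : Arr M fp t₃ (n // H + 1) (λ k → rkf (k * H))
            blocksA    : Arr M fp t₄ (nb // q + 1) (packed blockD)
            groupsA    : Arr M fp t₅ (n // G + 1) groupV
            slotsA     : Arr M fp t₆ cap1 X₁
            subgroupsA : Arr M fp t₇ ((n // g + 1) // q + 1) (packed subgroupD)
            subslotsA  : Arr M fp t₈ (cap2 // q + 1) (packed subslotD)

        module G₁ = Groups n G T G> T> F F-mono
        module G₂ = Groups n g b g> b> F F-mono

        listD : ℕ → List (ℕ × ℕ)
        listD fp = (34 , R) ∷ (35 , t₁) ∷ (36 , t₂) ∷ (37 , t₃) ∷ (38 , t₄) ∷ (39 , t₅) ∷ (40 , t₆) ∷ (41 , t₇) ∷ (42 , t₈) ∷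
          listC fp rk fa sx′ bm x₁ x₂

        -- The same with the group length and the threshold used by groupsFill and subgroupsFill.
        listG : (fp z₄₇ z₄₈ : ℕ) → List (ℕ × ℕ)
        listG fp z₄₇ z₄₈ = (47 , z₄₇) ∷ (48 , z₄₈) ∷ listD fp

        header-fill : ∀ {η T′ K Q rest} (m : Mem) → 
          (∀ η′ m′ → Agree R m m′ → Arr m′ t₁ R (18) headerV → Spec rest (override (listD t₁) η′) m′ T′ K Q) →
          Spec (alloc headerFill ++ rest) (override (listD R) η) m (τ + T′) (Y + K) Q
        header-fill {η} m  cont = Spec-fill headerFill refl
          (λ good → mapSafe {x = 34} tt t₁<Bd (λ _ _ → tt))
          (time-ok z≤n) (work-ok (≤-trans (*-monoˡ-≤ 1 {19} (s≤s (m≤m+n 18 (4 * L)))) V-hdr))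
          (λ m′ _ ag st → Spec-env (λ x _ → override-same (listD t₁) η″ facts x) (cont η″ m′ ag (Arr-≗ {g = headerV} stored≡ (Arr-new st))))
          where
          η″ : Regs
          η″ = setReg 59 t₁ (setReg 34 R (override (listD R) η))
          facts : Facts (listD t₁) η″
          facts = refl×39
          stored≡ : ∀ i → i < 18 → eval (setReg 62 0 (setReg 61 0 (setReg 60 i (override (listD R) η)))) m (Fill.content headerFill) ≡ headerV i
          stored≡ 0 _ = refl
          stored≡ 1 _ = refl
          stored≡ 2 _ = refl
          stored≡ 3 _ = refl
          stored≡ 4 _ = refl
          stored≡ 5 _ = refl
          stored≡ 6 _ = refl
          stored≡ 7 _ = refl
          stored≡ 8 _ = refl
          stored≡ 9 _ = refl
          stored≡ 10 _ = refl
          stored≡ 11 _ = refl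
          stored≡ 12 _ = refl
          stored≡ 13 _ = refl
          stored≡ 14 _ = refl
          stored≡ 15 _ = refl
          stored≡ 16 _ = refl
          stored≡ 17 _ = refl
          stored≡ (suc (suc (suc (suc (suc (suc (suc (suc (suc (suc (suc (suc (suc (suc (suc (suc (suc (suc i)))))))))))))))))) i< =
            ⊥-elim (≤⇒≯ (m≤m+n 18 i) i<)
        pop-fill : ∀ {η T′ K Q rest} (m : Mem) → Arr m t₁ pop B (popCount b) →
          (∀ η′ m′ → Agree t₁ m m′ → Arr m′ t₂ t₁ (B) (popCount b) → Spec rest (override (listD t₂) η′) m′ T′ K Q) →
          Spec (alloc tablePopFill ++ rest) (override (listD t₁) η) m (τ + T′) (Y + K) Q
        pop-fill {η} m popA′ cont = Spec-fill tablePopFill refl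
          (λ good → mapSafe {x = 35} tt t₂<Bd (λ i i< → Arr.access popA′ i< , tt))
          (time-ok z≤n) (work-ok (≤-trans (*-monoʳ-≤ (suc B) (s≤s z≤n)) V-pop))
          (λ m′ _ ag st → Spec-env (λ x _ → override-same (listD t₂) η″ facts x) (cont η″ m′ ag (Arr-≗ {g = (popCount b)} (Arr.at popA′) (Arr-new st))))
          where
          η″ : Regs
          η″ = setReg 59 t₂ (setReg 35 t₁ (override (listD t₁) η))
          facts : Facts (listD t₂) η″
          facts = refl×39

        sel-fill : ∀ {η T′ K Q rest} (m : Mem) → Arr m t₂ pop B (popCount b) →
          (∀ η′ m′ → Agree t₂ m m′ → Arr m′ t₃ t₂ (B * b) selV → Spec rest (override (listD t₃) η′) m′ T′ K Q) →
          Spec (alloc tableSelFill ++ rest) (override (listD t₂) η) m (τ + T′) (Y + K) Q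
        sel-fill {η} m popA′ cont = Spec-fill tableSelFill refl
          (λ good → sumSafe {x = 36} b tt t₃<Bd b<Bd (λ _ _ → tt) (λ _ _ → ≤-refl) body-ok sum-ok (λ _ _ → tt))
          (time-ok b≤w) (work-ok V-sel)
          (λ m′ _ ag st → Spec-env (λ x _ → override-same (listD t₃) η″ facts x) (cont η″ m′ ag (Arr-≗ {g = selV} sum≡ (Arr-new st))))
          where
          η″ : Regs
          η″ = setReg 59 t₃ (setReg 36 t₂ (override (listD t₂) η))
          facts : Facts (listD t₃) η″
          facts = refl×39
          index< : ∀ i j → i < B * b → i // b %% (1 * 2 ^ suc j) < B
          index< i j i< = ≤-<-trans (%%-≤ (i // b) (1 * 2 ^ suc j)) (//-< B i<)
          sum≡ : ∀ i → i < B * b → ∑ (λ j → 𝟙 (m (pop + i // b %% (1 * 2 ^ suc j)) <ᵇ suc (i %% b))) b ≡ selV i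
          sum≡ i i< = ∑-cong b (λ j j< → cong (λ z → 𝟙 (z <ᵇ suc (i %% b))) (Arr.at popA′ _ (index< i j i<)))
          body-ok : ∀ i → i < B * b → ∀ j → j < b →
            (1 * 2 ^ suc j < Bd) × (pop + i // b %% (1 * 2 ^ suc j) < t₂) × (m (pop + i // b %% (1 * 2 ^ suc j)) < Bd) × ⊤
          body-ok i i< j j< = 2^suc< j< , Arr.access popA′ (index< i j i<)
            , subst (_< Bd) (sym (Arr.at popA′ _ (index< i j i<))) (≤-<-trans (popCount-≤ b _) b<Bd) , tt
          sum-ok : ∀ i → i < B * b → ∑ (λ j → 𝟙 (m (pop + i // b %% (1 * 2 ^ suc j)) <ᵇ suc (i %% b))) b < 2 ^ w
          sum-ok i i< = ≤-<-trans (∑-≤ 1 b (λ j _ → 𝟙≤1 (m (pop + i // b %% (1 * 2 ^ suc j)) <ᵇ suc (i %% b))))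
            (<-≤-trans (subst (_< Bd) (sym (*-identityʳ b)) b<Bd) Bd≤2^w)
        ranks-fill : ∀ {η T′ K Q rest} (m : Mem) → Arr m t₃ rk (n + 1) rkf →
          (∀ η′ m′ → Agree t₃ m m′ → Arr m′ t₄ t₃ (n // H + 1) (λ k → rkf (k * H)) → Spec rest (override (listD t₄) η′) m′ T′ K Q) →
          Spec (alloc ranksFill ++ rest) (override (listD t₃) η) m (τ + T′) (Y + K) Q
        ranks-fill {η} m rkA′ cont = Spec-fill ranksFill refl
          (λ good → mapSafe {x = 37} tt t₄<Bd (λ i i< → Arr.access rkA′ (in-range i<) , tt))
          (time-ok z≤n) (work-ok (≤-trans (*-monoˡ-≤ 1 (s≤s (≤-trans (+-monoˡ-≤ 1 (//-≤ n H)) (≤-reflexive (+-comm n 1))))) V-map))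
          (λ m′ _ ag st → Spec-env (λ x _ → override-same (listD t₄) η″ facts x) (cont η″ m′ ag (Arr-≗ {g = (λ k → rkf (k * H))} (λ i i< → Arr.at rkA′ _ (in-range i<)) (Arr-new st))))
          where
          η″ : Regs
          η″ = setReg 59 t₄ (setReg 37 t₃ (override (listD t₃) η))
          facts : Facts (listD t₄) η″
          facts = refl×39
          in-range : ∀ {i} → i < n // H + 1 → i * H < n + 1
          in-range i< = ≤-<-trans (≤-trans (*-monoˡ-≤ H (<+1 i<)) (//*≤ n H)) (≤-reflexive (+-comm 1 n))
        blocks-fill : ∀ {η T′ K Q rest} (m : Mem) → Arr m t₄ rk (n + 1) rkf →
          (∀ η′ m′ → Agree t₄ m m′ → Arr m′ t₅ t₄ (nb // q + 1) (packed blockD) → Spec rest (override (listD t₅) η′) m′ T′ K Q) →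
          Spec (alloc blocksFill ++ rest) (override (listD t₄) η) m (τ + T′) (Y + K) Q
        blocks-fill {η} m rkA′ cont = Spec-fill blocksFill refl
          (λ good → sumSafe {x = 38} q tt t₅<Bd q<Bd (λ _ _ → tt) (λ _ _ → ≤-refl) body-ok (λ i _ → subst (_< 2 ^ w) (sym (sum≡ i)) (packed< blockD blockD< i)) (λ _ _ → tt))
          (time-ok q≤w) (work-ok V-rb)
          (λ m′ _ ag st → Spec-env (λ x _ → override-same (listD t₅) η″ facts x) (cont η″ m′ ag (Arr-≗ {g = (packed blockD)} (λ i _ → sum≡ i) (Arr-new st))))
          where
          η″ : Regs
          η″ = setReg 59 t₅ (setReg 38 t₄ (override (listD t₄) η))
          facts : Facts (listD t₅) η″
          facts = refl×39
          i₁ i₂ : ℕ → ℕ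
          i₁ k = k * b
          i₂ k = k * b // H * H
          ≤₁ : ∀ {k} → k < nb → i₁ k < n + 1
          ≤₁ {k} k< = ≤-<-trans (≤-trans (*-monoˡ-≤ b (≤-pred (≤-trans k< (≤-reflexive nb≡)))) (//*≤ n b)) (≤-reflexive (+-comm 1 n))
          ≤₂ : ∀ {k} → k < nb → i₂ k < n + 1
          ≤₂ {k} k< = ≤-<-trans (//*≤ (k * b) H) (≤₁ k<)
          entry : ℕ → ℕ
          entry k = if 𝟙 (k <ᵇ nb) ≡ᵇ 0 then 0 else m (rk + i₁ k) ∸ m (rk + i₂ k)
          entry≡ : ∀ k → entry k ≡ blockD k
          entry≡ k with k <? nb
          ... | yes p = trans (if-< p) (trans (cong₂ _∸_ (Arr.at rkA′ _ (≤₁ p)) (Arr.at rkA′ _ (≤₂ p))) (sym (if-< p)))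
          ... | no ¬p = trans (if-≮ (≮⇒≥ ¬p)) (sym (if-≮ (≮⇒≥ ¬p)))
          small : ∀ {i} → i < n + 1 → m (rk + i) < Bd
          small i< = subst (_< Bd) (sym (Arr.at rkA′ _ i<)) (rkf<Bd (<+1 i<))
          sum≡ : ∀ i → packed entry i ≡ packed blockD i
          sum≡ i = ∑-cong q (λ j _ → cong (_* 2 ^ (e * j)) (entry≡ (i * q + j)))
          body-ok : ∀ i → i < nb // q + 1 → ∀ j → j < q → let k = i * q + j ; c = 𝟙 (k <ᵇ nb) in
            (¬ c ≡ 0 → rk + i₁ k < t₄) × (¬ c ≡ 0 → m (rk + i₁ k) < Bd) × (¬ c ≡ 0 → rk + i₂ k < t₄) × (¬ c ≡ 0 → m (rk + i₂ k) < Bd) ×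
            (entry k * 2 ^ (e * j) < 2 ^ w) × ⊤
          body-ok i _ j j< = (λ ne → Arr.access rkA′ (≤₁ (𝟙≢0⇒< ne))) , (λ ne → small (≤₁ (𝟙≢0⇒< ne)))
            , (λ ne → Arr.access rkA′ (≤₂ (𝟙≢0⇒< ne))) , (λ ne → small (≤₂ (𝟙≢0⇒< ne)))
            , field-word (subst (_< 2 ^ e) (sym (entry≡ (i * q + j))) (blockD< (i * q + j))) j< , tt
        groups-fill : ∀ {η T′ K Q rest} (m : Mem) → Arr m t₅ fa n F →
          (∀ η′ m′ → Agree t₅ m m′ → Arr m′ t₆ t₅ (n // G + 1) groupV → Spec rest (override (listG t₆ G T) η′) m′ T′ K Q) →
          Spec (alloc groupsFill ++ rest) (override (listG t₅ G T) η) m (τ + T′) (Y + K) Q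
        groups-fill {η} m invA′ cont = Spec-fill groupsFill refl
          (λ good → mapSafe {x = 39} tt t₆<Bd value-ok)
          (time-ok z≤n) (work-ok (≤-trans (*-monoˡ-≤ 1 (s≤s (≤-trans (+-monoˡ-≤ 1 (//-≤ n G)) (≤-reflexive (+-comm n 1))))) V-map))
          (λ m′ _ ag st → Spec-env (λ x _ → override-same (listG t₆ G T) η″ facts x) (cont η″ m′ ag (Arr-≗ {g = groupV} (λ k _ → entry≡ k) (Arr-new st))))
          where
          η″ : Regs
          η″ = setReg 59 t₆ (setReg 39 t₅ (override (listG t₅ G T) η))
          facts : Facts (listG t₆ G T) η″
          facts = (refl , refl , refl×39)
          next< : ∀ {k} → k * G < n → nextOf G k < n
          next< {k} k< = G₁.next-< {k * G} {k} k<
          entry : ℕ → ℕ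
          entry k = if 𝟙 (k * G <ᵇ n) ≡ᵇ 0 then 0 else 2 * m (fa + k * G) + (1 ∸ 𝟙 (m (fa + nextOf G k) ∸ m (fa + k * G) <ᵇ T))
          entry≡ : ∀ k → entry k ≡ groupV k
          entry≡ k with k * G <? n
          ... | yes p = trans (if-< p) (trans (cong₂ (λ x y → 2 * x + (1 ∸ 𝟙 (y ∸ x <ᵇ T))) (Arr.at invA′ _ p) (Arr.at invA′ _ (next< {k} p))) (sym (if-< p)))
          ... | no ¬p = trans (if-≮ (≮⇒≥ ¬p)) (sym (if-≮ (≮⇒≥ ¬p)))
          small : ∀ {i} → i < n → m (fa + i) < Bd
          small i< = subst (_< Bd) (sym (Arr.at invA′ _ i<)) (F<Bd i<)
          value-ok : ∀ k → k < n // G + 1 → let c = 𝟙 (k * G <ᵇ n) ; nx = nextOf G k in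
            (¬ c ≡ 0 → fa + k * G < t₅) × (¬ c ≡ 0 → m (fa + k * G) < Bd) × (¬ c ≡ 0 → fa + nx < t₅) × (¬ c ≡ 0 → m (fa + nx) < Bd) ×
            (¬ c ≡ 0 → fa + k * G < t₅) × (¬ c ≡ 0 → m (fa + k * G) < Bd) × ⊤
          value-ok k _ = (λ ne → Arr.access invA′ (𝟙≢0⇒< ne)) , (λ ne → small (𝟙≢0⇒< ne))
            , (λ ne → Arr.access invA′ (next< {k} (𝟙≢0⇒< ne))) , (λ ne → small (next< {k} (𝟙≢0⇒< ne)))
            , (λ ne → Arr.access invA′ (𝟙≢0⇒< ne)) , (λ ne → small (𝟙≢0⇒< ne)) , tt
        slots-fill : ∀ {η T′ K Q rest} (m : Mem) → Arr m t₆ x₁ cap1 X₁ →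
          (∀ η′ m′ → Agree t₆ m m′ → Arr m′ t₇ t₆ (cap1) X₁ → Spec rest (override (listD t₇) η′) m′ T′ K Q) →
          Spec (alloc slotsFill ++ rest) (override (listG t₆ G T) η) m (τ + T′) (Y + K) Q
        slots-fill {η} m xA cont = Spec-fill slotsFill refl
          (λ good → mapSafe {x = 40} tt t₇<Bd (λ i i< → Arr.access xA i< , tt))
          (time-ok z≤n) (work-ok V-x1)
          (λ m′ _ ag st → Spec-env (λ x _ → override-same (listD t₇) η″ facts x) (cont η″ m′ ag (Arr-≗ {g = X₁} (Arr.at xA) (Arr-new st))))
          where
          η″ : Regs
          η″ = setReg 59 t₇ (setReg 40 t₆ (override (listG t₆ G T) η))
          facts : Facts (listD t₇) η″
          facts = refl×39

        subgroups-fill : ∀ {η T′ K Q rest} (m : Mem) → Arr m t₇ fa n F →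
          (∀ η′ m′ → Agree t₇ m m′ → Arr m′ t₈ t₇ ((n // g + 1) // q + 1) (packed subgroupD) → Spec rest (override (listD t₈) η′) m′ T′ K Q) →
          Spec (alloc subgroupsFill ++ rest) (override (listG t₇ g b) η) m (τ + T′) (Y + K) Q
        subgroups-fill {η} m invA′ cont = Spec-fill subgroupsFill refl
          (λ good → sumSafe {x = 41} q tt t₈<Bd q<Bd (λ _ _ → tt) (λ _ _ → ≤-refl) body-ok (λ i _ → subst (_< 2 ^ w) (sym (sum≡ i)) (packed< subgroupD subgroupD< i)) (λ _ _ → tt))
          (time-ok q≤w) (work-ok V-a2)
          (λ m′ _ ag st → Spec-env (λ x _ → override-same (listD t₈) η″ facts x) (cont η″ m′ ag (Arr-≗ {g = (packed subgroupD)} (λ i _ → sum≡ i) (Arr-new st))))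
          where
          η″ : Regs
          η″ = setReg 59 t₈ (setReg 41 t₇ (override (listG t₇ g b) η))
          facts : Facts (listD t₈) η″
          facts = refl×39
          next< : ∀ {k} → k * g < n → nextOf g k < n
          next< {k} k< = G₂.next-< {k * g} {k} k<
          up : ℕ → ℕ
          up k = k * g // G * G
          up< : ∀ {k} → k * g < n → up k < n
          up< {k} k< = ≤-<-trans (//*≤ (k * g) G) k<
          entry : ℕ → ℕ
          entry k = if 𝟙 (k * g <ᵇ n) ≡ᵇ 0 then 0 else (2 * (m (fa + k * g) ∸ m (fa + up k)) + (1 ∸ 𝟙 (m (fa + nextOf g k) ∸ m (fa + k * g) <ᵇ b))) %% E
          entry≡ : ∀ k → entry k ≡ subgroupD k
          entry≡ k with k * g <? n
          ... | yes p = trans (if-< p) (trans (trans (cong₂ (λ x y → (2 * (x ∸ m (fa + up k)) + (1 ∸ 𝟙 (y ∸ x <ᵇ b))) %% E) (Arr.at invA′ _ p) (Arr.at invA′ _ (next< {k} p)))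
              (cong (λ z → (2 * (F (k * g) ∸ z) + sparseOf g b k) %% E) (Arr.at invA′ _ (up< {k} p)))) (sym (if-< p)))
          ... | no ¬p = trans (if-≮ (≮⇒≥ ¬p)) (sym (if-≮ (≮⇒≥ ¬p)))
          small : ∀ {i} → i < n → m (fa + i) < Bd
          small i< = subst (_< Bd) (sym (Arr.at invA′ _ i<)) (F<Bd i<)
          sum≡ : ∀ i → packed entry i ≡ packed subgroupD i
          sum≡ i = ∑-cong q (λ j _ → cong (_* 2 ^ (e * j)) (entry≡ (i * q + j)))
          body-ok : ∀ i → i < (n // g + 1) // q + 1 → ∀ j → j < q → let k = i * q + j ; c = 𝟙 (k * g <ᵇ n) ; nx = nextOf g k in
            (¬ c ≡ 0 → fa + k * g < t₇) × (¬ c ≡ 0 → m (fa + k * g) < Bd) × (¬ c ≡ 0 → fa + up k < t₇) × (¬ c ≡ 0 → m (fa + up k) < Bd) ×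
            (¬ c ≡ 0 → fa + nx < t₇) × (¬ c ≡ 0 → m (fa + nx) < Bd) × (¬ c ≡ 0 → fa + k * g < t₇) × (¬ c ≡ 0 → m (fa + k * g) < Bd) ×
            (entry k * 2 ^ (e * j) < 2 ^ w) × ⊤
          body-ok i _ j j< = (λ ne → Arr.access invA′ (𝟙≢0⇒< ne)) , (λ ne → small (𝟙≢0⇒< ne))
            , (λ ne → Arr.access invA′ (up< {i * q + j} (𝟙≢0⇒< ne))) , (λ ne → small (up< {i * q + j} (𝟙≢0⇒< ne)))
            , (λ ne → Arr.access invA′ (next< {i * q + j} (𝟙≢0⇒< ne))) , (λ ne → small (next< {i * q + j} (𝟙≢0⇒< ne)))
            , (λ ne → Arr.access invA′ (𝟙≢0⇒< ne)) , (λ ne → small (𝟙≢0⇒< ne))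
            , field-word (subst (_< 2 ^ e) (sym (entry≡ (i * q + j))) (subgroupD< (i * q + j))) j< , tt
        subslots-fill : ∀ {η T′ K Q rest} (m : Mem) → Arr m t₈ x₂ cap2 X₂ →
          (∀ η′ m′ → Agree t₈ m m′ → Arr m′ t₉ t₈ (cap2 // q + 1) (packed subslotD) → Spec rest (override (listD t₉) η′) m′ T′ K Q) →
          Spec (alloc subslotsFill ++ rest) (override (listD t₈) η) m (τ + T′) (Y + K) Q
        subslots-fill {η} m xA cont = Spec-fill subslotsFill refl
          (λ good → sumSafe {x = 42} q tt t₉<Bd q<Bd (λ _ _ → tt) (λ _ _ → ≤-refl) body-ok (λ i _ → subst (_< 2 ^ w) (sym (sum≡ i)) (packed< subslotD subslotD< i)) (λ _ _ → tt))
          (time-ok q≤w) (work-ok V-x2)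
          (λ m′ _ ag st → Spec-env (λ x _ → override-same (listD t₉) η″ facts x) (cont η″ m′ ag (Arr-≗ {g = (packed subslotD)} (λ i _ → sum≡ i) (Arr-new st))))
          where
          η″ : Regs
          η″ = setReg 59 t₉ (setReg 42 t₈ (override (listD t₈) η))
          facts : Facts (listD t₉) η″
          facts = refl×39
          entry : ℕ → ℕ
          entry k = if 𝟙 (k <ᵇ cap2) ≡ᵇ 0 then 0 else m (x₂ + k) %% E
          entry≡ : ∀ k → entry k ≡ subslotD k
          entry≡ k with k <? cap2
          ... | yes p = trans (if-< p) (trans (cong (_%% E) (Arr.at xA _ p)) (sym (if-< p)))
          ... | no ¬p = trans (if-≮ (≮⇒≥ ¬p)) (sym (if-≮ (≮⇒≥ ¬p)))
          sum≡ : ∀ i → packed entry i ≡ packed subslotD i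
          sum≡ i = ∑-cong q (λ j _ → cong (_* 2 ^ (e * j)) (entry≡ (i * q + j)))
          body-ok : ∀ i → i < cap2 // q + 1 → ∀ j → j < q → let k = i * q + j ; c = 𝟙 (k <ᵇ cap2) in
            (¬ c ≡ 0 → x₂ + k < t₈) × (entry k * 2 ^ (e * j) < 2 ^ w) × ⊤
          body-ok i _ j j< = (λ ne → Arr.access xA (𝟙≢0⇒< ne))
            , field-word (subst (_< 2 ^ e) (sym (entry≡ (i * q + j))) (subslotD< (i * q + j))) j< , tt

        ≤₁ : R ≤ t₁
        ≤₁ = m≤m+n R _
        ≤₂ : t₁ ≤ t₂
        ≤₂ = m≤m+n t₁ _
        ≤₃ : t₂ ≤ t₃
        ≤₃ = m≤m+n t₂ _
        ≤₄ : t₃ ≤ t₄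
        ≤₄ = m≤m+n t₃ _
        ≤₅ : t₄ ≤ t₅
        ≤₅ = m≤m+n t₄ _
        ≤₆ : t₅ ≤ t₆
        ≤₆ = m≤m+n t₅ _
        ≤₇ : t₆ ≤ t₇
        ≤₇ = m≤m+n t₆ _
        ≤₈ : t₇ ≤ t₈
        ≤₈ = m≤m+n t₇ _
        ≤₉ : t₈ ≤ t₉
        ≤₉ = m≤m+n t₈ _

        t₂≡ : t₂ ≡ R + o₂
        t₂≡ = +-assoc R o₁ B
        t₃≡ : t₃ ≡ R + o₃
        t₃≡ = trans (cong (_+ B * b) t₂≡) (+-assoc R o₂ (B * b))
        t₄≡ : t₄ ≡ R + o₄
        t₄≡ = trans (cong (_+ (n // H + 1)) t₃≡) (+-assoc R o₃ _)
        t₅≡ : t₅ ≡ R + o₅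
        t₅≡ = trans (cong (_+ (nb // q + 1)) t₄≡) (+-assoc R o₄ _)
        t₆≡ : t₆ ≡ R + o₆
        t₆≡ = trans (cong (_+ (n // G + 1)) t₅≡) (+-assoc R o₅ _)
        t₇≡ : t₇ ≡ R + o₇
        t₇≡ = trans (cong (_+ cap1) t₆≡) (+-assoc R o₆ cap1)
        t₈≡ : t₈ ≡ R + o₈
        t₈≡ = trans (cong (_+ ((n // g + 1) // q + 1)) t₇≡) (+-assoc R o₇ _)
        t₉≡ : t₉ ≡ R + size
        t₉≡ = trans (cong (_+ (cap2 // q + 1)) t₈≡) (+-assoc R o₈ _)

        listE : List (ℕ × ℕ)
        listE = (43 , size) ∷ listD t₉

        partC-spec : ∀ {η T′ K Q rest} →
          (∀ η′ m′ → Agree R m₀ m′ → Region m′ t₉ → Spec rest (override listE η′) m′ T′ K Q) →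
          Spec (partC rest) (override (listC R rk fa sx′ bm x₁ x₂) η) m₀ (23 * τ + T′) (23 * Y + K) Q
        partC-spec {η} {T′} {K} {Q} {rest} cont = Spec-≤ (≤-reflexive (count′ τ T′)) (≤-reflexive (count′ Y K))
          (phase-assign 34 (v 59) refl (λ _ → tt) refl (≤-<-trans ≤₁ t₁<Bd)
          (phase-assign 35 (v 59 ⊕ # 18) refl (λ _ → tt) refl t₁<Bd
          (phase-assign 36 (v 35 ⊕ v 6) refl (λ _ → tt) refl t₂<Bd
          (phase-assign 37 (v 36 ⊕ v 6 ⊗ v 5) refl (λ _ → tt) refl t₃<Bd
          (phase-assign 38 (v 37 ⊕ (v 0 ⊘ v 13 ⊕ # 1)) refl (λ _ → tt) refl t₄<Bd
          (phase-assign 39 (v 38 ⊕ (v 15 ⊘ v 7 ⊕ # 1)) refl (λ _ → tt) refl t₅<Bd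
          (phase-assign 40 (v 39 ⊕ (v 0 ⊘ v 12 ⊕ # 1)) refl (λ _ → tt) refl t₆<Bd
          (phase-assign 41 (v 40 ⊕ v 16) refl (λ _ → tt) refl t₇<Bd
          (phase-assign 42 (v 41 ⊕ ((v 0 ⊘ v 11 ⊕ # 1) ⊘ v 7 ⊕ # 1)) refl (λ _ → tt) refl t₈<Bd
          (Spec-env (λ x _ → override-same (listD R) η₁ refl×39 x)
          (header-fill m₀ (λ _ m₁ a₁ headerA →
           pop-fill m₁ (Arr-keep a₁ ≤₁ popA) (λ _ m₂ a₂ tablePopA →
           let b₂ = Agree-trans ≤₁ a₁ a₂ ; R≤₂ = ≤-trans ≤₁ ≤₂
           in sel-fill m₂ (Arr-keep b₂ R≤₂ popA) (λ _ m₃ a₃ tableSelA →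
           let b₃ = Agree-trans R≤₂ b₂ a₃ ; R≤₃ = ≤-trans R≤₂ ≤₃
           in ranks-fill m₃ (Arr-keep b₃ R≤₃ rkA) (λ _ m₄ a₄ ranksA →
           let b₄ = Agree-trans R≤₃ b₃ a₄ ; R≤₄ = ≤-trans R≤₃ ≤₄
           in blocks-fill m₄ (Arr-keep b₄ R≤₄ rkA) (λ η₅ m₅ a₅ blocksA →
           let b₅ = Agree-trans R≤₄ b₄ a₅ ; R≤₅ = ≤-trans R≤₄ ≤₅
               η₅′ = setReg 48 T (setReg 47 G (override (listD t₅) η₅))
           in phase-assign 47 (v 12) refl (λ _ → tt) refl G<Bd
          (phase-assign 48 (v 10) refl (λ _ → tt) refl T<Bd
          (Spec-env (λ x _ → override-same (listG t₅ G T) η₅′ (refl , refl , refl×39) x)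
          (groups-fill m₅ (Arr-keep b₅ R≤₅ invA) (λ _ m₆ a₆ groupsA →
           let b₆ = Agree-trans R≤₅ b₅ a₆ ; R≤₆ = ≤-trans R≤₅ ≤₆
           in slots-fill m₆ (Arr-keep b₆ R≤₆ x₁A) (λ η₇ m₇ a₇ slotsA →
           let b₇ = Agree-trans R≤₆ b₆ a₇ ; R≤₇ = ≤-trans R≤₆ ≤₇
               η₇′ = setReg 48 b (setReg 47 g (override (listD t₇) η₇))
           in phase-assign 47 (v 11) refl (λ _ → tt) refl g<Bd
          (phase-assign 48 (v 5) refl (λ _ → tt) refl b<Bd
          (Spec-env (λ x _ → override-same (listG t₇ g b) η₇′ (refl , refl , refl×39) x)
          (subgroups-fill m₇ (Arr-keep b₇ R≤₇ invA) (λ _ m₈ a₈ subgroupsA →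
           let b₈ = Agree-trans R≤₇ b₇ a₈ ; R≤₈ = ≤-trans R≤₇ ≤₈
           in subslots-fill m₈ (Arr-keep b₈ R≤₈ x₂A) (λ η₉ m₉ a₉ subslotsA →
           let c₈ = a₉                       ; s₈ = ≤₉
               c₇ = Agree-trans ≤₈ a₈ c₈     ; s₇ = ≤-trans ≤₈ s₈
               c₆ = Agree-trans ≤₇ a₇ c₇     ; s₆ = ≤-trans ≤₇ s₇
               c₅ = Agree-trans ≤₆ a₆ c₆     ; s₅ = ≤-trans ≤₆ s₆
               c₄ = Agree-trans ≤₅ a₅ c₅     ; s₄ = ≤-trans ≤₅ s₅
               c₃ = Agree-trans ≤₄ a₄ c₄     ; s₃ = ≤-trans ≤₄ s₄
               c₂ = Agree-trans ≤₃ a₃ c₃     ; s₂ = ≤-trans ≤₃ s₃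
               c₁ = Agree-trans ≤₂ a₂ c₂     ; s₁ = ≤-trans ≤₂ s₂
               η₉′ = setReg 43 size (override (listD t₉) η₉)
           in phase-assign 43 (v 59 ⊖ v 34) refl (λ _ → tt) (trans (cong (_∸ R) t₉≡) (m+n∸m≡n R size))
                (≤-<-trans (≤-trans (m≤n+m size R) (≤-reflexive (sym t₉≡))) t₉<Bd)
          (Spec-env (λ x _ → override-same listE η₉′ (refl , refl×39) x)
          (cont η₉′ m₉ (Agree-trans R≤₈ b₈ a₉) (record
            { headerA = Arr-keep c₁ s₁ headerA ; tablePopA = Arr-keep c₂ s₂ tablePopA ; tableSelA = Arr-keep c₃ s₃ tableSelA
            ; ranksA = Arr-keep c₄ s₄ ranksA ; blocksA = Arr-keep c₅ s₅ blocksA ; groupsA = Arr-keep c₆ s₆ groupsA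
            ; slotsA = Arr-keep c₇ s₇ slotsA ; subgroupsA = Arr-keep c₈ s₈ subgroupsA ; subslotsA = subslotsA })))))))))))))))))))))))))))))
          where
          count′ : ∀ t u → t + (t + (t + (t + (t + (t + (t + (t + (t + (t + (t + (t + (t + (t + (t + (t + (t + (t + (t + (t + (t + (t + (t + (u))))))))))))))))))))))) ≡ 23 * t + u
          count′ = solve-∀
          η₁ : Regs
          η₁ = setReg 42 t₈ (setReg 41 t₇ (setReg 40 t₆ (setReg 39 t₅ (setReg 38 t₄ (setReg 37 t₃ (setReg 36 t₂ (setReg 35 t₁ (setReg 34 R
            (override (listC R rk fa sx′ bm x₁ x₂) η)))))))))

        -- `Index` speaks only about the bitmap and the `size` words from `R` on, so it passes to
        -- every memory agreeing with `M` there. This gives queries that work with the rest of the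
        -- memory arbitrary.
        index : ∀ {M M′ : Mem} → Region M t₉ → (∀ i → i < n // w + 1 → M (bm + i) ≡ bitmapWord i) →
          (∀ i → i * w < n → M′ (bm + i) ≡ M (bm + i)) → (∀ i → i < size → M′ (R + i) ≡ M (R + i)) →
          Index M′ bm R
        index {M} {M′} region bitmap hB hR = record
          { bits = λ i i< → trans (cong (λ z → bitAt z (i %% w)) (trans (hB (i // w) (≤-<-trans (//*≤ i w) i<))
              (bitmap (i // w) (≤-trans (s≤s (//-monoˡ w (<⇒≤ i<))) (≤-reflexive (+-comm 1 (n // w))))))) (bitmap-bit i i<)
          ; hdr = λ i i< → trans (get headerA ≤-refl i<) (header≡ i i<)
          ; pop = λ x x< → get tablePopA ≤₁ x<
          ; sel = λ x r x< r< → trans (at′ t₂≡ tableSelA R≤₂ (sel< x< r<)) (sel≡ x r r<)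
          ; ra = λ k k≤ → at′ t₃≡ ranksA R≤₃ (≤-trans (s≤s k≤) (≤-reflexive (+-comm 1 _)))
          ; rb = λ k k< → trans (cong (λ z → field′ z k) (at′ t₄≡ blocksA R≤₄ (quot< k (<⇒≤ k<)))) (trans (field-packed blockD blockD< k) (if-< k<))
          ; a1 = λ k k< → trans (at′ t₅≡ groupsA R≤₅ (≤-trans (s≤s (index≤ k G> k<)) (≤-reflexive (+-comm 1 _)))) (if-< k<)
          ; x1 = λ j j< sp → trans (at′ t₆≡ slotsA R≤₆ (<-≤-trans (G₁.slot-bound j< (F-< j<)) (≤-reflexive (sym cap1≡)))) (slots₁ j j< sp)
          ; a2 = λ k k< → trans (cong (λ z → field′ z k) (at′ t₇≡ subgroupsA R≤₇ (quot< k (≤-trans (index≤ k g> k<) (m≤m+n _ 1)))))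
              (trans (field-packed subgroupD subgroupD< k) (if-< k<))
          ; x2 = λ j j< sp → trans (cong (λ z → field′ z (slotOf g b j)) (at′ t₈≡ subslotsA R≤₈ (quot< (slotOf g b j) (<⇒≤ (slot₂< j<)))))
              (trans (field-packed subslotD subslotD< (slotOf g b j)) (trans (if-< (slot₂< j<)) (cong (_%% E) (slots₂ j j< sp))))
          }
          where
          open Region region
          slot₂< : ∀ {j} → j < n → slotOf g b j < cap2
          slot₂< j< = <-≤-trans (G₂.slot-bound j< (F-< j<)) (≤-reflexive (sym cap2≡))
          get : ∀ {base N f i} → Arr M t₉ base N f → R ≤ base → i < N → M′ (base + i) ≡ f i
          get {base} {N} {f} {i} A R≤ i< = trans (cong M′ addr) (trans (hR (base ∸ R + i) (+-cancelˡ-< R _ _ (subst₂ _<_ addr t₉≡ (Arr.access A i<))))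
              (trans (cong M (sym addr)) (Arr.at A i i<)))
            where
            addr : base + i ≡ R + (base ∸ R + i)
            addr = trans (cong (_+ i) (sym (m+[n∸m]≡n R≤))) (+-assoc R (base ∸ R) i)
          at′ : ∀ {t o N f i} → t ≡ R + o → Arr M t₉ t N f → R ≤ t → i < N → M′ (R + o + i) ≡ f i
          at′ refl A R≤ i< = get A R≤ i<
          R≤₂ : R ≤ t₂
          R≤₂ = ≤-trans ≤₁ ≤₂
          R≤₃ : R ≤ t₃
          R≤₃ = ≤-trans R≤₂ ≤₃
          R≤₄ : R ≤ t₄
          R≤₄ = ≤-trans R≤₃ ≤₄
          R≤₅ : R ≤ t₅
          R≤₅ = ≤-trans R≤₄ ≤₅
          R≤₆ : R ≤ t₆
          R≤₆ = ≤-trans R≤₅ ≤₆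
          R≤₇ : R ≤ t₇
          R≤₇ = ≤-trans R≤₆ ≤₇
          R≤₈ : R ≤ t₈
          R≤₈ = ≤-trans R≤₇ ≤₈
          quot< : ∀ k {c} → k ≤ c → k // q < c // q + 1
          quot< k {c} k≤ = ≤-trans (s≤s (//-monoˡ q k≤)) (≤-reflexive (+-comm 1 (c // q)))
          index≤ : ∀ k {d} → 0 < d → k * d < n → k ≤ n // d
          index≤ k {d} d> k< = subst (_≤ n // d) (//-unique k d>) (//-monoˡ d (<⇒≤ k<))
          sel< : ∀ {x r} → x < B → r < b → x * b + r < B * b
          sel< {x} {r} x< r< = <-≤-trans (+-monoʳ-< (x * b) r<) (≤-trans (≤-reflexive (+-comm (x * b) b)) (*-monoˡ-≤ b x<))
          sel≡ : ∀ x r → r < b → selV (x * b + r) ≡ ∑ (λ k → 𝟙 (popCount b (x %% (1 * 2 ^ suc k)) <ᵇ suc r)) b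
          sel≡ x r r< = cong₂ (λ y z → ∑ (λ k → 𝟙 (popCount b (y %% (1 * 2 ^ suc k)) <ᵇ suc z)) b)
            (trans (cong (_// b) (+-comm (x * b) r)) (//-unique x r<)) (trans (cong (_%% b) (+-comm (x * b) r)) (%%-unique x r<))
          header≡ : ∀ i → i < 18 → headerV i ≡ header R i
          header≡ 0  _ = refl
          header≡ 1  _ = refl
          header≡ 2  _ = refl
          header≡ 3  _ = refl
          header≡ 4  _ = refl
          header≡ 5  _ = refl
          header≡ 6  _ = refl
          header≡ 7  _ = refl
          header≡ 8  _ = refl
          header≡ 9  _ = refl
          header≡ 10 _ = refl
          header≡ 11 _ = t₂≡
          header≡ 12 _ = t₃≡
          header≡ 13 _ = t₄≡
          header≡ 14 _ = t₅≡
          header≡ 15 _ = t₆≡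
          header≡ 16 _ = t₇≡
          header≡ 17 _ = t₈≡
          header≡ (suc (suc (suc (suc (suc (suc (suc (suc (suc (suc (suc (suc (suc (suc (suc (suc (suc (suc i)))))))))))))))))) i< =
            ⊥-elim (≤⇒≯ (m≤m+n 18 i) i<)

        isRankSelect : ∀ .{{_ : NonZero w}} {M : Mem} → Region M t₉ → (∀ i → i < n // w + 1 → M (bm + i) ≡ bitmapWord i) → bm < Bd →
          Layout.IsRankSelect w queries (28 * 401) n (applyUpTo β n) M bm R size
        isRankSelect {M} region bitmap bm< M′ isMem hB hR c =
          (λ i i≤ → subst (Layout.Answers w (28 * 401) n bm R M′ (Queries.rankProg queries c) i) (sym (rank-applyUpTo c β i≤)) (QuerySpecs.rank-answers P β F F-dest M′ isMem bm R (idx hB hR) t< bm< c i i≤)) ,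
          (λ j p sel → let (p< , β≡ , j≡) = select-applyUpTo c β n sel in
            subst (λ z → Layout.Answers w (28 * 401) n bm R M′ (Queries.selectProg queries c) z p) (sym j≡) (QuerySpecs.select-answers P β F F-dest M′ isMem bm R (idx hB hR) t< bm< c p< β≡))
          where
          idx = index {M} {M′} region bitmap
          t< : R + size < Bd
          t< = subst (_< Bd) t₉≡ t₉<Bd

        -- Descriptions of the levels, and the invariant of the main loop

        module Conclusion (base fp₀ : ℕ) (m : Mem) (k≤ : suc sh ≤ L) (seq≡ : levelSeq L (symbols S) (L ∸ suc sh) ≡ applyUpTo sx n)
          (popA₀ : Arr m fp₀ pop B (popCount b)) (hd≤ : hd + 4 * (L ∸ suc sh) ≤ fp₀)
          (levels : ∀ l → l < L ∸ suc sh → LevelOK m fp₀ (hd + 4 * l) l) (fp₀≤R : fp₀ ≤ R) (agR : Agree fp₀ m m₀)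
          (after≤ : t₉ + 4 * L ≤ base + (L ∸ sh) * levelSize) (after≤top : t₉ + 4 * L ≤ top) (short : size * w ≤ s)
          (bm≤ : bm + (n // w + 1) ≤ R) (bitmapA : Arr m₀ R bm (n // w + 1) bitmapWord)
          (ys : ℕ → ℕ) (ys-dest : ∀ i → i < n → ys (dest i) ≡ sx i) (permA : Arr m₀ R sx′ n ys) (sx′≤ : sx′ ≤ R) where
          private
            R≤t₉ : R ≤ t₉
            R≤t₉ = ≤-trans ≤₁ (≤-trans ≤₂ (≤-trans ≤₃ (≤-trans ≤₄ (≤-trans ≤₅ (≤-trans ≤₆ (≤-trans ≤₇ (≤-trans ≤₈ ≤₉)))))))
            l : ℕ
            l = L ∸ suc sh
            l+1 : L ∸ sh ≡ suc l
            l+1 = +-∸-assoc 1 k≤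
            sh≡ : sh ≡ L ∸ suc l
            sh≡ = sym (trans (cong (L ∸_) (sym l+1)) (m∸[m∸n]≡n (≤-trans (n≤1+n sh) k≤)))
            module Lv = Levels L (symbols S) l n sx seq≡ sh sh≡
            finish : ℕ
            finish = t₉ + 4 * (L ∸ sh)
            finish≤ : finish ≤ t₉ + 4 * L
            finish≤ = +-monoʳ-≤ t₉ (*-monoʳ-≤ 4 (m∸n≤m L sh))
            finish<Bd : finish < Bd
            finish<Bd = ≤-<-trans (≤-trans finish≤ after≤top) top<Bd
            t₉≤ : t₉ ≤ finish
            t₉≤ = m≤m+n t₉ _
            fp₀≤C : fp₀ ≤ t₉
            fp₀≤C = ≤-trans fp₀≤R R≤t₉
            chain : ℕ → ℕ
            chain j = if 𝟙 (j <ᵇ 1) ≡ᵇ 0 then (if 𝟙 (j <ᵇ 2) ≡ᵇ 0 then (if 𝟙 (j <ᵇ 3) ≡ᵇ 0 then size else R) else ranks β false n) else bm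

          partD-spec : ∀ ηC mC → Agree R m₀ mC → Region mC t₉ →
            Spec partD (override listE ηC) mC (τ + (τ + (τ + 0))) (Y + (Y + (Y + 0)))
              (λ η′ m′ → η′ 20 ≡ suc sh × LevelInv pop base sh (setReg 20 sh η′) m′)
          partD-spec ηC mC agC region = Spec-fill descriptionFill refl
            (λ g → mapSafe {x = 45} tt finish<Bd (λ i _ → (λ ne → <-≤-trans (+-monoʳ-< hd (𝟙≢0⇒< ne)) (≤-trans hd≤ fp₀≤C)) , tt))
            (time-ok z≤n) (work-ok (≤-trans (*-monoˡ-≤ 1 (s≤s (≤-trans (*-monoʳ-≤ 4 (m∸n≤m L sh)) (m≤n+m (4 * L) 18)))) V-hdr))
            (λ mD _ agD st → phase-assign 21 (v 45) refl (λ _ → tt) refl t₉<Bd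
              (phase-assign 19 (v 30) refl (λ _ → tt) refl (≤-<-trans (≤-trans sx′≤ R≤t₉) t₉<Bd)
              (Spec-[] (refl , final mD agD st))))
            where
            agmC : Agree fp₀ m mC
            agmC = Agree-trans fp₀≤R agR agC
            stored : ℕ → ℕ
            stored i = if 𝟙 (i <ᵇ 4 * l) ≡ᵇ 0 then chain (i ∸ 4 * l) else mC (hd + i)
            final : ∀ mD → Agree t₉ mC mD → (∀ i → i < 4 * (L ∸ sh) → mD (t₉ + i) ≡ stored i) →
              LevelInv pop base sh (setReg 20 sh (setReg 19 sx′ (setReg 21 t₉ (setReg 59 finish (setReg 45 t₉ (override listE ηC)))))) mD
            final mD agD st = levelInv sx′ t₉ finish ys (≤-trans (n≤1+n sh) k≤)
              (refl , refl , refl , refl , refl×18)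
              (Arr-keep agD t₉≤ (Arr-keep agC R≤t₉ permA))
              (subst (λ z → levelSeq L (symbols S) z ≡ applyUpTo ys n) (sym l+1) (Lv.next-level ys ys-dest))
              (Arr-keep agmD fp₀≤finish popA₀)
              (≤-trans finish≤ after≤) ≤-refl
              (λ l′ l′< → old-or-new l′ (≤-pred (subst (l′ <_) l+1 l′<)))
              where
              agmD : Agree fp₀ m mD
              agmD = Agree-trans fp₀≤C agmC agD
              fp₀≤finish : fp₀ ≤ finish
              fp₀≤finish = ≤-trans fp₀≤C t₉≤
              cells : ∀ {l′ j} → l′ ≤ l → j < 4 → 4 * l′ + j < 4 * (L ∸ sh)
              cells {l′} {j} l′≤ j< = begin-strict
                4 * l′ + j      <⟨ +-monoʳ-< (4 * l′) j< ⟩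
                4 * l′ + 4      ≤⟨ +-monoˡ-≤ 4 (*-monoʳ-≤ 4 l′≤) ⟩
                4 * l + 4       ≡⟨ trans (+-comm (4 * l) 4) (sym (*-suc 4 l)) ⟩
                4 * suc l       ≡⟨ cong (4 *_) (sym l+1) ⟩
                4 * (L ∸ sh)    ∎
                where open ≤-Reasoning
              cell : ∀ l′ {j} → l′ ≤ l → j < 4 → mD (t₉ + 4 * l′ + j) ≡ stored (4 * l′ + j)
              cell l′ {j} l′≤ j< = trans (cong mD (+-assoc t₉ (4 * l′) j)) (st (4 * l′ + j) (cells l′≤ j<))
              cell₀ : ∀ l′ → l′ ≤ l → mD (t₉ + 4 * l′) ≡ stored (4 * l′ + 0)
              cell₀ l′ l′≤ = trans (cong mD (sym (+-identityʳ _))) (cell l′ l′≤ z<s)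
              old : ∀ l′ {j} → l′ < l → j < 4 → stored (4 * l′ + j) ≡ m (hd + 4 * l′ + j)
              old l′ {j} l′< j< = trans (if-< i<) (trans (agmC (hd + (4 * l′ + j)) (<-≤-trans (+-monoʳ-< hd i<) hd≤)) (cong m (sym (+-assoc hd (4 * l′) j))))
                where
                i< : 4 * l′ + j < 4 * l
                i< = <-≤-trans (+-monoʳ-< (4 * l′) j<) (≤-trans (≤-reflexive (trans (+-comm (4 * l′) 4) (sym (*-suc 4 l′)))) (*-monoʳ-≤ 4 l′<))
              new : ∀ j → stored (4 * l + j) ≡ chain j
              new j = trans (if-≮ (m≤m+n (4 * l) j)) (cong chain (m+n∸m≡n (4 * l) j))
              regionD : Region mD t₉
              regionD = record
                { headerA = kp headerA ; tablePopA = kp tablePopA ; tableSelA = kp tableSelA ; ranksA = kp ranksA ; blocksA = kp blocksA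
                ; groupsA = kp groupsA ; slotsA = kp slotsA ; subgroupsA = kp subgroupsA ; subslotsA = kp subslotsA }
                where
                open Region region
                kp : ∀ {bs N f} → Arr mC t₉ bs N f → Arr mD t₉ bs N f
                kp = Arr-keep agD ≤-refl
              bitmapD : ∀ i → i < n // w + 1 → mD (bm + i) ≡ bitmapWord i
              bitmapD i i< = Arr.at (Arr-keep agD ≤-refl (Arr-keep agC R≤t₉ bitmapA)) i i<
              old-or-new : ∀ l′ → l′ ≤ l → LevelOK mD finish (t₉ + 4 * l′) l′
              old-or-new l′ l′≤ with m≤n⇒m<n∨m≡n l′≤
              ... | inj₁ l′< = LevelOK-keep agmD fp₀≤finish
                    (trans (cell₀ l′ l′≤) (trans (old l′ l′< z<s) (cong m (+-identityʳ _))))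
                    (trans (cell l′ l′≤ (s≤s z<s)) (old l′ l′< (s≤s z<s)))
                    (trans (cell l′ l′≤ (s≤s (s≤s z<s))) (old l′ l′< (s≤s (s≤s z<s))))
                    (trans (cell l′ l′≤ (s≤s (s≤s (s≤s z<s)))) (old l′ l′< (s≤s (s≤s (s≤s z<s))))) (levels l′ l′<)
              ... | inj₂ refl = levelOK bm (ranks β false n) R size
                    (trans (cell₀ l ≤-refl) (new 0)) (trans (cell l ≤-refl (s≤s z<s)) (new 1))
                    (trans (cell l ≤-refl (s≤s (s≤s z<s))) (new 2)) (trans (cell l ≤-refl (s≤s (s≤s (s≤s z<s)))) (new 3))
                    (trans (packedBits≡ mD bm bitmapD) (sym Lv.bitmap≡))
                    (sym (trans (cong (count false) Lv.bitmap≡) (count-applyUpTo false β n)))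
                    (subst (λ bs → Layout.IsRankSelect w queries (28 * 401) n bs mD bm R size) (sym Lv.bitmap≡)
                      (isRankSelect regionD bitmapD (≤-<-trans (≤-trans (m≤m+n bm _) (≤-trans bm≤ R≤t₉)) t₉<Bd)))
                    short (≤-trans bm≤ (≤-trans R≤t₉ t₉≤))
                    (≤-trans (≤-reflexive (sym t₉≡)) t₉≤)

    module _ (base fp₀ : ℕ) (m : Mem) (base≤ : base + L * levelSize ≤ top) (short : size * w ≤ s) (L<Bd : L < Bd) (k≤ : suc sh ≤ L)
      (symA : Arr m fp₀ cur n sx) (seq≡ : levelSeq L (symbols S) (L ∸ suc sh) ≡ applyUpTo sx n) (popA : Arr m fp₀ pop B (popCount b))
      (fp≤ : fp₀ ≤ base + (L ∸ suc sh) * levelSize) (hd≤ : hd + 4 * (L ∸ suc sh) ≤ fp₀)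
      (levels : ∀ l → l < L ∸ suc sh → LevelOK m fp₀ (hd + 4 * l) l) where

      -- The four parts of a level consist of 8, 13, 23 and 3 phases, where the scan loop counts as
      -- one phase.
      level-step : ∀ η → Spec levelBody (override (listA fp₀) η) m (47 * τ) (47 * Y) (λ η′ m′ → η′ 20 ≡ suc sh × LevelInv pop base sh (setReg 20 sh η′) m′)
      level-step η = Spec-≤ (≤-reflexive (total τ)) (≤-reflexive (total Y))
        (Specs.partA-spec m fp₀ roomA symA popA L≤Bd (λ ηA mA agA rankA →
          SpecsB.partB-spec mA fpA rkb roomB (Arr-keep agA fp₀≤A symA) rankA (afterB mA agA rankA)))
        where
        l : ℕ
        l = L ∸ suc sh
        l+1 : L ∸ sh ≡ suc l
        l+1 = +-∸-assoc 1 k≤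
        after≤ : after-level fp₀ ≤ base + (L ∸ sh) * levelSize
        after≤ = begin
          after-level fp₀                       ≡⟨ after-level≡ fp₀ ⟩
          fp₀ + levelSize                       ≤⟨ +-monoˡ-≤ levelSize fp≤ ⟩
          base + l * levelSize + levelSize      ≡⟨ +-assoc base (l * levelSize) levelSize ⟩
          base + (l * levelSize + levelSize)    ≡⟨ cong (base +_) (+-comm (l * levelSize) levelSize) ⟩
          base + suc l * levelSize              ≡⟨ cong (λ z → base + z * levelSize) (sym l+1) ⟩
          base + (L ∸ sh) * levelSize           ∎
          where open ≤-Reasoning
        after≤top : after-level fp₀ ≤ top
        after≤top = ≤-trans after≤ (≤-trans (+-monoʳ-≤ base (*-monoˡ-≤ levelSize (m∸n≤m L sh))) base≤)
        rkb fpA fpB fpC : ℕ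
        rkb = fp₀ + nb + nb + lam * nb
        fpA = rkb + (n + 1)
        fpB = fpA + n + n + (n // w + 1) + (cap1 + 1) + (cap2 + 1)
        fpC = fpB + 18 + B + B * b + (n // H + 1) + (nb // q + 1) + (n // G + 1) + cap1 + ((n // g + 1) // q + 1) + (cap2 // q + 1)
        fpC≤top : fpC ≤ top
        fpC≤top = ≤-trans (m≤m+n fpC (4 * L)) after≤top
        fpB≤C : fpB ≤ fpC
        fpB≤C = ≤-+ʳ (≤-+ʳ (≤-+ʳ (≤-+ʳ (≤-+ʳ (≤-+ʳ (≤-+ʳ (≤-+ʳ (≤-+ʳ ≤-refl))))))))
        fpA≤B : fpA ≤ fpB
        fpA≤B = ≤-+ʳ (≤-+ʳ (≤-+ʳ (≤-+ʳ (≤-+ʳ ≤-refl))))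
        fp₀≤A : fp₀ ≤ fpA
        fp₀≤A = ≤-+ʳ (≤-+ʳ (≤-+ʳ (≤-+ʳ ≤-refl)))
        roomB : fpB ≤ top
        roomB = ≤-trans fpB≤C fpC≤top
        roomA : fpA ≤ top
        roomA = ≤-trans fpA≤B roomB
        L≤Bd : suc sh < Bd
        L≤Bd = ≤-<-trans k≤ L<Bd
        total : ∀ t → 8 * t + (13 * t + (23 * t + (t + (t + (t + 0))))) ≡ 47 * t
        total = solve-∀
        afterB : ∀ mA (agA : Agree fp₀ m mA) rankA ηB mB F F-dest X₁ X₂ →
          SpecsB.WithInverse.ResultB mA fpA rkb roomB (Arr-keep agA fp₀≤A symA) rankA F F-dest mB X₁ X₂ →
          Spec (partC partD) (override (listC fpB rkb fpA (fpA + n) (fpA + n + n) (fpA + n + n + (n // w + 1)) (fpA + n + n + (n // w + 1) + (cap1 + 1))) ηB) mB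
            (23 * τ + (τ + (τ + (τ + 0)))) (23 * Y + (Y + (Y + (Y + 0))))
            (λ η′ m′ → η′ 20 ≡ suc sh × LevelInv pop base sh (setReg 20 sh η′) m′)
        afterB mA agA rankA ηB mB F F-dest X₁ X₂ RB =
          PartC.SpecsC.partC-spec F F-dest X₁ X₂ mB fpB rkb fpA (fpA + n) (fpA + n + n) (fpA + n + n + (n // w + 1))
            (fpA + n + n + (n // w + 1) + (cap1 + 1)) fpC≤top popB rkA invA x₁A x₂A slots₁ slots₂
            (PartC.SpecsC.Conclusion.partD-spec F F-dest X₁ X₂ mB fpB rkb fpA (fpA + n) (fpA + n + n) (fpA + n + n + (n // w + 1))
              (fpA + n + n + (n // w + 1) + (cap1 + 1)) fpC≤top popB rkA invA x₁A x₂A slots₁ slots₂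
              base fp₀ m k≤ seq≡ popA hd≤ levels fp₀≤B agB after≤ after≤top short (≤-+ʳ (≤-+ʳ ≤-refl)) bitmapA sx′ sx′-dest permA (≤-+ʳ (≤-+ʳ (≤-+ʳ (≤-+ʳ ≤-refl)))))
          where
          open SpecsB.WithInverse.ResultB RB
          agB : Agree fp₀ m mB
          agB = Agree-trans fp₀≤A agA agree
          fp₀≤B : fp₀ ≤ fpB
          fp₀≤B = ≤-trans fp₀≤A fpA≤B
          sx′ : ℕ → ℕ
          sx′ = SpecsB.WithInverse.sx′ mA fpA rkb roomB (Arr-keep agA fp₀≤A symA) rankA F F-dest
          sx′-dest : ∀ i → i < n → sx′ (dest i) ≡ sx i
          sx′-dest i i< = cong sx (SpecsB.WithInverse.position-dest mA fpA rkb roomB (Arr-keep agA fp₀≤A symA) rankA F F-dest i i<)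
          popB : Arr mB fpB pop B (popCount b)
          popB = Arr-keep agB fp₀≤B popA

  level-spec : ∀ pop base → base + L * levelSize ≤ top → size * w ≤ s → L < Bd → ∀ sh η m → η 20 ≡ suc sh → LevelInv pop base (suc sh) η m →
    Spec levelBody η m (47 * τ) (47 * Y) (λ η′ m′ → η′ 20 ≡ suc sh × LevelInv pop base sh (setReg 20 sh η′) m′)
  level-spec pop base base≤ short L<Bd sh η m _ (levelInv cur hd fp₀ sx k≤ facts symA seq≡ popA fp≤ hd≤ levels) =
    Spec-env (λ x _ → override-same (Level.listA sx sh cur pop hd fp₀) η facts x)
      (Level.level-step sx sh cur pop hd base fp₀ m base≤ short L<Bd k≤ symA seq≡ popA fp≤ hd≤ levels η)

  -- From the input to the finished wavelet matrix

  module Main (Z : ComputedSizes P D σ) where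
    open ComputedSizes Z

    sum≤τ : sumTime w ≤ τ
    sum≤τ = ≤-trans sum≤alloc (time-ok ≤-refl)
      where
      sum≤alloc : sumTime w ≤ allocTime w
      sum≤alloc = subst₂ _≤_ (sym (sumTime≡ w)) (sym (allocTime≡ w)) (*-monoˡ-≤ (suc w) {405} {900} (≤ᵇ⇒≤ 405 900 tt))

    sum≤Y : sumTime w ≤ Y
    sum≤Y = ≤-trans sum≤alloc (work-ok {n // w + 1} {w} V-bitmap)
      where
      sum≤alloc : sumTime w ≤ allocWork (n // w + 1) w
      sum≤alloc = subst₂ _≤_ (sym (sumTime≡ w)) (sym (allocWork≡ (n // w + 1) w))
        (*-mono-≤ {405} {900} (≤ᵇ⇒≤ 405 900 tt) (m≤m+n (suc w) _))

    n≤2^w : n ≤ 2 ^ w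
    n≤2^w = <⇒≤ (<-≤-trans n<Bd Bd≤2^w)

    log-spec : ∀ x (y : Expr) {η m T K Q rest} (val lg : ℕ) → okAssignSum x (v 2) (logTerm y) ≡ true → η 2 ≡ w →
      (∀ i → eval (setReg 61 i η) m y ≡ val) → (∀ i → Π (obl Any (setReg 61 i η) m y)) →
      val ≤ 2 ^ w → ⌈log₂ val ⌉ ≡ lg → lg < Bd →
      Spec rest (setReg x lg η) m T K Q → Spec (assignSum x (v 2) (logTerm y) ++ rest) η m (τ + T) (Y + K) Q
    log-spec x y {η} {m} {T} {K} {Q} {rest} val lg ok η2 val≡ ob val≤ lg≡ lg< s = Spec-≤
      (+-monoˡ-≤ T (subst (λ t → sumTime t ≤ τ) (sym η2) sum≤τ)) (+-monoˡ-≤ K (subst (λ t → sumTime t ≤ Y) (sym η2) sum≤Y))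
      (Spec-assignSum {x} {v 2} {logTerm y} ok (λ _ → tt) (λ _ → subst (_< Bd) (sym η2) w<Bd)
        (λ _ i i< → 1*2^i< i (subst (i <_) η2 i<) , ob i) (subst (_< Bd) (sym sum≡) lg<)
        (subst (λ t → Spec rest (setReg x t η) m T K Q) (sym sum≡) s))
      where
      1*2^i< : ∀ i → i < w → 1 * 2 ^ i < 2 ^ w
      1*2^i< i i< = subst (_< 2 ^ w) (sym (*-identityˡ (2 ^ i))) (^-monoʳ-< 2 ≤-refl i<)
      sum≡ : ∑ (λ i → 𝟙 (1 * 2 ^ i <ᵇ eval (setReg 61 i η) m y)) (η 2) ≡ lg
      sum≡ = trans (cong (∑ (λ i → 𝟙 (1 * 2 ^ i <ᵇ eval (setReg 61 i η) m y))) η2)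
        (trans (∑-cong w (λ i _ → cong (λ t → 𝟙 (1 * 2 ^ i <ᵇ t)) (val≡ i))) (trans (∑-⌈log₂⌉ val w val≤) lg≡))

    η₀ : Regs
    η₀ = setReg 0 n (setReg 1 σ (setReg 2 w (λ _ → 0)))

    Done : Regs → Mem → Set
    Done η m = ∃[ fp ] (∀ l → l < L → LevelOK m fp (η 0 + 4 * l) l)

    total : ℕ → ℕ
    total t = 20 * t + (L * (47 * t + 2) + 1 + (401 + 0))

    module _ (top≥ : n + B + L * levelSize ≤ top) (short : size * w ≤ s) (M : Mem) (input : Layout.HoldsInput w M S) where

      seq₀ : symbols S ≡ applyUpTo M n
      seq₀ = symbols-applyUpTo S M input

      levels-spec : ∀ η m → Agree n M m → Arr m (n + B) n B (popCount b) →
        Facts ((59 , n + B) ∷ (19 , 0) ∷ (20 , L) ∷ (21 , 0) ∷ consts n) η →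
        Spec (loop 20 levelBody ++ (assign 0 (v 21) ++ [])) η m (L * (47 * τ + 2) + 1 + (401 + 0)) (L * (47 * Y + 2) + 1 + (401 + 0)) Done
      levels-spec η m ag popA facts = Spec-++
        (Spec-loop {20} (LevelInv n (n + B)) (≤ᵇ⇒≤ 21 60 tt) (level-spec n (n + B) top≥ short L<Bd) L η m
          (proj₁ (proj₂ (proj₂ facts))) inv₀)
        (λ η′ m′ inv → Spec-assign {0} {v 21} refl (λ _ → tt) (λ g → Good.small g 21 (≤ᵇ⇒≤ 22 61 tt))
          (Spec-[] (finished η′ m′ inv)))
        where
        inv₀ : LevelInv n (n + B) L η m
        inv₀ = record
          { cur = 0 ; hd = 0 ; fp = n + B ; sx = M ; k≤ = ≤-refl ; facts = facts
          ; symA = record { at = λ i i< → ag i i< ; below = m≤m+n n B }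
          ; seq≡ = subst (λ k → levelSeq L (symbols S) k ≡ applyUpTo M n) (sym (n∸n≡0 L)) seq₀
          ; popA = popA ; fp≤ = m≤m+n (n + B) _
          ; hd≤ = subst (λ k → 4 * k ≤ n + B) (sym (n∸n≡0 L)) z≤n
          ; levels = λ l l< → ⊥-elim (n≮0 (subst (l <_) (n∸n≡0 L) l<)) }
        finished : ∀ η′ m′ → LevelInv n (n + B) 0 η′ m′ → Done (setReg 0 (η′ 21) η′) m′
        finished η′ m′ inv = I.fp , λ l l< → subst (λ a → LevelOK m′ I.fp (a + 4 * l) l) (sym (proj₁ (proj₂ (proj₂ (proj₂ I.facts))))) (I.levels l l<)
          where module I = LevelInv inv

      1*2^ : ∀ k → 1 * 2 ^ k ≡ 2 ^ k
      1*2^ k = *-identityˡ (2 ^ k)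

      shl≡ : ∀ k {x} → 2 ^ k ≡ x → 1 * 2 ^ k ≡ x
      shl≡ k = trans (1*2^ k)

      shl-ok : ∀ k {x} → 2 ^ k ≡ x → x < Bd → 1 * 2 ^ k < Bd
      shl-ok k p x< = subst (_< Bd) (sym (shl≡ k p)) x<

      E<Bd : E < Bd
      E<Bd = ≤-<-trans (m≤n+m E (n + off + E)) positions<

      lam<2^w : suc lam ≤ 2 ^ w
      lam<2^w = ≤-trans lam<Bd Bd≤2^w

      off<Bd : off < Bd
      off<Bd = ≤-<-trans (≤-trans (m≤n+m off n) (m≤m+n (n + off) (n + off))) twice<

      nb<Bd : nb < Bd
      nb<Bd = ≤-<-trans nb≤2^lam 2^lam<Bd

      n+B<Bd : n + B < Bd
      n+B<Bd = ≤-<-trans (≤-trans (m≤m+n (n + B) _) top≥) top<Bd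

      program-spec : Spec constructProg η₀ M (total τ) (total Y) Done
      program-spec = Spec-≤ (≤-reflexive (twenty τ _)) (≤-reflexive (twenty Y _))
        (log-spec 46 (v 1) σ L refl refl (λ _ → refl) (λ _ → tt) (≤-trans σ≤n n≤2^w) L≡ L<Bd
        (log-spec 3 (v 0) n c refl refl (λ _ → refl) (λ _ → tt) n≤2^w c≡ (<-trans (≤-reflexive lam≡) lam<Bd)
        (phase-assign 3 (# 1 ⊕ v 3) refl (λ _ → tt) lam≡ lam<Bd
        (log-spec 4 (# 1 ⊕ v 3) (suc lam) u refl refl (λ _ → refl) (λ _ → tt) lam<2^w u≡ u<Bd
        (phase-assign 5 (# 1 ⊕ v 3 ⊘ # 4) refl (λ _ → tt) b≡ b<Bd
        (phase-assign 6 (shl true (# 1) (v 5)) refl (λ _ → shl-ok b (sym B≡) B<Bd , tt) (shl≡ b (sym B≡)) B<Bd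
        (phase-assign 7 (v 3 ⊘ v 4) refl (λ _ → tt) q≡ q<Bd
        (phase-assign 8 (# 6 ⊗ v 4) refl (λ _ → tt) e≡ (<-trans (<-≤-trans (m<2^m e) (≤-reflexive (sym E≡))) E<Bd)
        (phase-assign 9 (shl true (# 1) (v 8)) refl (λ _ → shl-ok e (sym E≡) E<Bd , tt) (shl≡ e (sym E≡)) E<Bd
        (phase-assign 10 (shl true (# 1) (# 5 ⊗ v 4)) refl (λ _ → shl-ok (5 * u) T≡ T<Bd , tt) (shl≡ (5 * u) T≡) T<Bd
        (phase-assign 11 (v 4 ⊗ v 4) refl (λ _ → tt) g≡ g<Bd
        (phase-assign 12 (v 11 ⊗ (v 3 ⊗ v 3)) refl (λ _ → tt) (trans (cong (g *_) h≡) (sym G≡)) G<Bd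
        (phase-assign 13 (v 5 ⊗ (v 3 ⊗ v 3)) refl (λ _ → tt) (trans (cong (b *_) h≡) (sym H≡)) H<Bd
        (phase-assign 14 (v 0 ⊕ v 5) refl (λ _ → tt) (sym off≡) off<Bd
        (phase-assign 15 (# 1 ⊕ v 0 ⊘ v 5) refl (λ _ → tt) (sym nb≡) nb<Bd
        (phase-assign 16 ((# 1 ⊕ (v 0 ⊕ v 14) ⊘ v 10) ⊗ v 12) refl (λ _ → tt) (sym cap1≡) cap1<
        (phase-assign 17 ((# 1 ⊕ (v 0 ⊕ v 14) ⊘ v 5) ⊗ v 11) refl (λ _ → tt) (sym cap2≡) cap2<
        (phase-assign 59 (v 0) refl (λ _ → tt) refl n<Bd
        (Spec-fill popFill refl
          (λ g → sumSafe {x = 18} b tt n+B<Bd b<Bd (λ _ _ → tt) (λ _ _ → ≤-refl) (λ _ _ _ _ → tt)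
            (λ i _ → ≤-<-trans (popCount-≤ b i) (<-≤-trans b<Bd Bd≤2^w)) (λ _ _ → tt))
          (time-ok b≤w) (work-ok {B} {b} V-pop)
          (λ m₁ _ ag st → phase-assign 20 (v 46) refl (λ _ → tt) refl L<Bd
            (levels-spec _ m₁ ag (Arr-new st) (refl , refl , refl , refl , refl×18))))))))))))))))))))))
        where
        twenty : ∀ t u → t + (t + (t + (t + (t + (t + (t + (t + (t + (t + (t + (t + (t + (t + (t + (t + (t + (t + (t + (t + (u)))))))))))))))))))) ≡ 20 * t + u
        twenty = solve-∀

      small₀ : ∀ x → η₀ x < Bd
      small₀ 0 = n<Bd
      small₀ 1 = ≤-<-trans σ≤n n<Bd
      small₀ 2 = w<Bd
      small₀ (suc (suc (suc x))) = ≤-trans (s≤s z≤n) Bd>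

      args≡ : ∀ x → args (n ∷ σ ∷ w ∷ []) x ≡ η₀ x
      args≡ 0 = word-id (<-≤-trans (small₀ 0) Bd≤2^w)
      args≡ 1 = word-id (<-≤-trans (small₀ 1) Bd≤2^w)
      args≡ 2 = word-id (<-≤-trans (small₀ 2) Bd≤2^w)
      args≡ (suc (suc (suc x))) = refl

    rank-select-mono : ∀ {C C′ m xs B R len} → C ≤ C′ → Layout.IsRankSelect w queries C n xs m B R len → Layout.IsRankSelect w queries C′ n xs m B R len
    rank-select-mono C≤ rs M′ isMem hB hR c =
      (λ i i≤ ch → let (t , r , k≤ , same) = proj₁ (rs M′ isMem hB hR c) i i≤ ch in t , r , ≤-trans k≤ C≤ , same) ,
      (λ j p sel ch → let (t , r , k≤ , same) = proj₂ (rs M′ isMem hB hR c) j p sel ch in t , r , ≤-trans k≤ C≤ , same)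

    constructs : n + B + L * levelSize ≤ top → size * w ≤ s → ∀ {C depth work} → 28 * 401 ≤ C → total τ ≤ depth → total Y ≤ work →
      Layout.Constructs w constructProg queries C s work depth S
    constructs top≥ short {C} {depth} {work} C≥ τ≤ Y≤ M isMem input choose = finish
      (program-spec top≥ short M input (record { small = λ x _ → small₀ top≥ short M input x ; words = isMem }) (args (n ∷ σ ∷ w ∷ [])) (λ x _ → args≡ top≥ short M input x) choose [] 0)
      where
      Result : Config → ℕ → ℕ → Set
      Result c d D = Returns c D × Config.work c ≤ work × d ≤ depth × Layout.IsWaveletMatrix w queries C s S (Config.mem c) D
      start≡ : config (run (constructProg ++ []) (args (n ∷ σ ∷ w ∷ []))) M 0 ≡ start constructProg (n ∷ σ ∷ w ∷ []) M
      start≡ = cong (λ p → config (run p (args (n ∷ σ ∷ w ∷ []))) M 0) (++-identityʳ constructProg)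
      finish : Ends choose (config (run (constructProg ++ []) (args (n ∷ σ ∷ w ∷ []))) M 0) [] 0 (total τ) (total Y) Done →
        ∃[ d ] ∃[ D ] Result (after choose d (start constructProg (n ∷ σ ∷ w ∷ []) M)) d D
      finish (ends {t} {k} {ρ} {η} {m} t≤ k≤ runs _ agree (fp , ok)) = t , η 0 ,
        subst (λ c → Result c t (η 0)) (trans (sym runs) (cong (after choose t) start≡))
          ((ρ , refl , agree 0 z<s) , ≤-trans k≤ Y≤ , ≤-trans t≤ τ≤ , λ l l< → subst (λ k → Described k l) (sym L≡) (described l (ok l (subst (l <_) L≡ l<))))
        where
        Described : ℕ → ℕ → Set
        Described k l =
          let xs = levelBitmap k (symbols S) l
              Bm = m (η 0 + 4 * l)
              Zs = m (η 0 + 4 * l + 1)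
              R  = m (η 0 + 4 * l + 2)
              len = m (η 0 + 4 * l + 3)
          in Layout.packedBits w n m Bm ≡ xs × Zs ≡ count false xs × Layout.IsRankSelect w queries C n xs m Bm R len × len * w ≤ s
        described : ∀ l → LevelOK m fp (η 0 + 4 * l) l → Described L l
        described l (levelOK _ _ _ _ refl refl refl refl bits zeros≡ index shrt _ _) = bits , zeros≡ , rank-select-mono {m = m} C≥ index , shrt
 

-- Linear bounds for the sizes

module Linear where


  Lin : (ℕ → ℕ) → Set
  Lin t = ∃[ c ] (∀ n → 0 < n → t n ≤ c * n)

  lin-≤ : ∀ {s t} → Lin t → (∀ n → 0 < n → s n ≤ t n) → Lin s
  lin-≤ (c , h) s≤t = c , λ n n> → ≤-trans (s≤t n n>) (h n n>)

  lin-+ : ∀ {s t} → Lin s → Lin t → Lin (λ n → s n + t n)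
  lin-+ (c , h) (d , k) = c + d , λ n n> → ≤-trans (+-mono-≤ (h n n>) (k n n>)) (≤-reflexive (sym (*-distribʳ-+ n c d)))

  lin-* : ∀ a {t} → Lin t → Lin (λ n → a * t n)
  lin-* a (c , h) = a * c , λ n n> → ≤-trans (*-monoʳ-≤ a (h n n>)) (≤-reflexive (sym (*-assoc a c n)))

  lin-n : Lin (λ n → n)
  lin-n = 1 , λ n _ → m≤m+n n 0

  lin-const : ∀ k → Lin (λ _ → k)
  lin-const k = k , λ n n> → ≤-trans (≤-reflexive (sym (*-identityʳ k))) (*-monoʳ-≤ k n>)

  ^-distribʳ-* : ∀ a b k → (a * b) ^ k ≡ a ^ k * b ^ k
  ^-distribʳ-* a b zero    = refl
  ^-distribʳ-* a b (suc k) = trans (cong (a * b *_) (^-distribʳ-* a b k)) (swap a b (a ^ k) (b ^ k))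
    where
    swap : ∀ a b x y → a * b * (x * y) ≡ a * x * (b * y)
    swap = solve-∀

  -- With y the quotient of x by k, x is at most (y + 1) k and hence at most 2^y k. Taking k-th
  -- powers gives the claim, since y k is at most x.
  power≤exp : ∀ k x → 0 < k → x ^ k ≤ k ^ k * 2 ^ x
  power≤exp k x k> = begin
    x ^ k                          ≤⟨ ^-monoˡ-≤ k (<⇒≤ (suc//-≤ x k>)) ⟩
    (suc (x // k) * k) ^ k         ≤⟨ ^-monoˡ-≤ k (*-monoˡ-≤ k (m<2^m (x // k))) ⟩
    (2 ^ (x // k) * k) ^ k         ≡⟨ ^-distribʳ-* (2 ^ (x // k)) k k ⟩
    (2 ^ (x // k)) ^ k * k ^ k     ≡⟨ cong (_* k ^ k) (^-*-assoc 2 (x // k) k) ⟩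
    2 ^ (x // k * k) * k ^ k       ≤⟨ *-monoˡ-≤ (k ^ k) (^-monoʳ-≤ 2 (//*≤ x k)) ⟩
    2 ^ x * k ^ k                  ≡⟨ *-comm (2 ^ x) (k ^ k) ⟩
    k ^ k * 2 ^ x                  ∎
    where open ≤-Reasoning

  lam u b B q g h G H cap1 cap2 nb off T size : ℕ → ℕ
  lam n  = Sizes.lam n
  u n    = Sizes.u n
  b n    = Sizes.b n
  B n    = Sizes.B n
  q n    = Sizes.q n
  g n    = Sizes.g n
  h n    = Sizes.h n
  G n    = Sizes.G n
  H n    = Sizes.H n
  cap1 n = Sizes.cap1 n
  cap2 n = Sizes.cap2 n
  nb n   = Sizes.nb n
  off n  = Sizes.off n
  T n    = Sizes.T n
  size n = Sizes.size n

  2^lam≤ : ∀ n → 0 < n → 2 ^ lam n ≤ 4 * n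
  2^lam≤ n n> = ≤-trans (*-monoʳ-≤ 2 (2^clog≤ n n>)) (≤-reflexive (sym (*-assoc 2 2 n)))

  lin-2^lam : Lin (λ n → 2 ^ lam n)
  lin-2^lam = 4 , 2^lam≤

  lin-lam^ : ∀ k → 0 < k → Lin (λ n → lam n ^ k)
  lin-lam^ k k> = lin-≤ (lin-* (k ^ k) lin-2^lam) (λ n _ → power≤exp k (lam n) k>)

  lin-lam : Lin lam
  lin-lam = lin-≤ lin-2^lam (λ n _ → <⇒≤ (m<2^m (lam n)))

  lin-lam² : Lin (λ n → lam n * lam n)
  lin-lam² = lin-≤ (lin-lam^ 2 z<s) (λ n _ → ≤-reflexive (cong (lam n *_) (sym (*-identityʳ (lam n)))))

  u^≤ : ∀ n k → 0 < k → u n ^ k ≤ k ^ k * 2 * lam n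
  u^≤ n k k> = ≤-trans (power≤exp k (u n) k>) (≤-trans (*-monoʳ-≤ (k ^ k) (Sizes.2^u≤2lam n)) (≤-reflexive (sym (*-assoc (k ^ k) 2 (lam n)))))

  -- `u` is logarithmic in `lam`, so each of its powers is linearly bounded in `lam`. The fourth
  -- power is what the packed slots of sparse lower groups require.
  u^4≤ : ∃[ c ] (∀ n → g n * g n ≤ c * lam n)
  u^4≤ = 4 ^ 4 * 2 , λ n → ≤-trans (≤-reflexive (lemma (u n))) (u^≤ n 4 z<s)
    where
    lemma : ∀ u → u * u * (u * u) ≡ u * (u * (u * (u * 1)))
    lemma = solve-∀

  -- The tables: B is about the fourth root of n.
  lin-tables : Lin (λ n → B n * (lam n * lam n * lam n))
  lin-tables = lin-≤ (lin-* (64 * 27 * 4) lin-2^lam) bound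
    where
    bound : ∀ n → 0 < n → B n * (lam n * lam n * lam n) ≤ 64 * 27 * 4 * 2 ^ lam n
    bound n _ = begin
      B n * (lam n * lam n * lam n)          ≤⟨ *-monoʳ-≤ (B n) (*-mono-≤ (*-mono-≤ l≤ l≤) l≤) ⟩
      B n * (x * 4 * (x * 4) * (x * 4))      ≡⟨ lemma₁ (B n) x ⟩
      64 * (B n * (x ^ 3))                   ≤⟨ *-monoʳ-≤ 64 (*-monoʳ-≤ (B n) (power≤exp 3 x z<s)) ⟩
      64 * (B n * (27 * B n))                ≡⟨ lemma₂ (B n) ⟩
      64 * 27 * (B n * B n)                  ≡⟨ cong (64 * 27 *_) square ⟩
      64 * 27 * (4 * (2 ^ (y + y)))          ≤⟨ *-monoʳ-≤ (64 * 27) (*-monoʳ-≤ 4 (^-monoʳ-≤ 2 y+y≤)) ⟩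
      64 * 27 * (4 * 2 ^ lam n)              ≡⟨ sym (*-assoc (64 * 27) 4 (2 ^ lam n)) ⟩
      64 * 27 * 4 * 2 ^ lam n                ∎
      where
      open ≤-Reasoning
      x y : ℕ
      x = b n
      y = lam n // 4
      l≤ : lam n ≤ x * 4
      l≤ = Sizes.lam≤4b n
      lemma₁ : ∀ B x → B * (x * 4 * (x * 4) * (x * 4)) ≡ 64 * (B * (x * (x * (x * 1))))
      lemma₁ = solve-∀
      lemma₂ : ∀ B → 64 * (B * (27 * B)) ≡ 64 * 27 * (B * B)
      lemma₂ = solve-∀
      square : B n * B n ≡ 4 * 2 ^ (y + y)
      square = trans (double (2 ^ y)) (cong (4 *_) (sym (^-distribˡ-+-* 2 y y)))
        where
        double : ∀ p → 2 * p * (2 * p) ≡ 4 * (p * p)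
        double = solve-∀
      y+y≤ : y + y ≤ lam n
      y+y≤ = ≤-trans (≤-trans (m≤m+n (y + y) (y + y)) (≤-reflexive (four y))) (//*≤ (lam n) 4)
        where
        four : ∀ y → y + y + (y + y) ≡ y * 4
        four = solve-∀

  packed-cost : ∀ x d → suc (x // d + 1) * suc d ≤ 2 + 2 * d + 2 * x
  packed-cost x d = begin
    suc (x // d + 1) * suc d        ≡⟨ lemma (x // d) d ⟩
    2 + 2 * d + (x // d + x // d * d) ≤⟨ +-monoʳ-≤ (2 + 2 * d) (+-mono-≤ (//-≤ x d) (//*≤ x d)) ⟩
    2 + 2 * d + (x + x)             ≡⟨ cong (λ z → 2 + 2 * d + (x + z)) (sym (+-identityʳ x)) ⟩
    2 + 2 * d + 2 * x               ∎
    where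
    open ≤-Reasoning
    lemma : ∀ a d → suc (a + 1) * suc d ≡ 2 + 2 * d + (a + a * d)
    lemma = solve-∀

  -- Packing saves a factor of order lam / u.
  packed-words : ∀ n x → u n * lam n * (x // q n) ≤ 2 * g n * x
  packed-words n x = begin
    u n * lam n * (x // q n)                    ≤⟨ *-monoˡ-≤ (x // q n) (*-monoʳ-≤ (u n) lam≤) ⟩
    u n * (2 * (q n * u n)) * (x // q n)        ≡⟨ lemma (u n) (q n) (x // q n) ⟩
    2 * g n * (x // q n * q n)                  ≤⟨ *-monoʳ-≤ (2 * g n) (//*≤ x (q n)) ⟩
    2 * g n * x                                 ∎
    where
    open ≤-Reasoning
    lemma : ∀ u q x → u * (2 * (q * u)) * x ≡ 2 * (u * u) * (x * q)
    lemma = solve-∀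
    lam≤ : lam n ≤ 2 * (q n * u n)
    lam≤ = begin
      lam n               ≤⟨ <⇒≤ (suc//-≤ (lam n) (Sizes.u>0 n)) ⟩
      u n + q n * u n     ≤⟨ +-monoˡ-≤ (q n * u n) (≤-trans (≤-reflexive (sym (*-identityˡ (u n)))) (*-monoˡ-≤ (u n) (Sizes.q>0 n))) ⟩
      q n * u n + q n * u n ≡⟨ cong (q n * u n +_) (sym (+-identityʳ _)) ⟩
      2 * (q n * u n)     ∎

  lin-off : Lin (λ n → n + off n)
  lin-off = lin-≤ (lin-+ lin-n (lin-+ lin-n lin-lam)) (λ n _ → +-monoʳ-≤ n (Sizes.off≤ n))

  -- One cell per b positions leaves room for a factor of order lam.
  per-block : ∀ n x c m → m ≤ c * lam n → m * suc (x // b n) ≤ c * 4 * (x + lam n)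
  per-block n x c m m≤ = begin
    m * suc (x // b n)                   ≤⟨ *-monoˡ-≤ (suc (x // b n)) (≤-trans m≤ (*-monoʳ-≤ c (Sizes.lam≤4b n))) ⟩
    c * (b n * 4) * suc (x // b n)       ≡⟨ lemma c (b n) (x // b n) ⟩
    c * 4 * (x // b n * b n + b n)       ≤⟨ *-monoʳ-≤ (c * 4) (+-mono-≤ (//*≤ x (b n)) (Sizes.b≤lam n)) ⟩
    c * 4 * (x + lam n)                  ∎
    where
    open ≤-Reasoning
    lemma : ∀ c b x → c * (b * 4) * suc x ≡ c * 4 * (x * b + b)
    lemma = solve-∀

  lin-per-block : ∀ (x m : ℕ → ℕ) c → (∀ n → m n ≤ c * lam n) → Lin x → Lin (λ n → m n * suc (x n // b n))
  lin-per-block x m c m≤ lx = lin-≤ (lin-* (c * 4) (lin-+ lx lin-lam)) (λ n _ → per-block n (x n) c (m n) (m≤ n))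

  g≤g² : ∀ n → g n ≤ g n * g n
  g≤g² n = Sizes.square≥ n (*-mono-≤ (Sizes.u>0 n) (Sizes.u>0 n))

  g≤ : ∀ n → g n ≤ proj₁ u^4≤ * lam n
  g≤ n = ≤-trans (g≤g² n) (proj₂ u^4≤ n)

  lin-cap2 : Lin cap2
  lin-cap2 = lin-≤ (lin-per-block (λ n → n + off n) g (proj₁ u^4≤) g≤ lin-off) (λ n _ → ≤-reflexive (*-comm (suc ((n + off n) // b n)) (g n)))

  lin-g²cap2 : Lin (λ n → g n * cap2 n)
  lin-g²cap2 = lin-≤ (lin-per-block (λ n → n + off n) (λ n → g n * g n) (proj₁ u^4≤) (proj₂ u^4≤) lin-off) (λ n _ → ≤-reflexive (lemma (g n) (suc ((n + off n) // b n))))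
    where
    lemma : ∀ g x → g * (x * g) ≡ g * g * x
    lemma = solve-∀

  lin-lam*nb : Lin (λ n → lam n * nb n)
  lin-lam*nb = lin-per-block (λ n → n) lam 1 (λ n → ≤-reflexive (sym (*-identityˡ (lam n)))) lin-n

  lin-g*nb : Lin (λ n → g n * nb n)
  lin-g*nb = lin-per-block (λ n → n) g (proj₁ u^4≤) g≤ lin-n

  1≤u*lam : ∀ n → 1 ≤ u n * lam n
  1≤u*lam n = *-mono-≤ (Sizes.u>0 n) (s≤s z≤n)

  lin-u*lam : Lin (λ n → u n * lam n)
  lin-u*lam = lin-≤ lin-lam² (λ n _ → Sizes.u*lam≤h n)

  -- There are `G` slots for each of X + 1 ranges of length `T`. For X of them, X T is at most n +
  -- off, and u lam G = (u lam)³ is at most a constant times lam⁵, which is at most `T`. The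
  -- remaining range costs a power of lam, which is linear in n.
  lin-cap1 : Lin (λ n → u n * lam n * cap1 n)
  lin-cap1 = lin-≤ (lin-* c (lin-+ (lin-lam^ 5 z<s) lin-off)) bound
    where
    c : ℕ
    c = proj₁ u^4≤
    u*lam*G≤ : ∀ n → u n * lam n * G n ≤ c * lam n ^ 5
    u*lam*G≤ n = begin
      u n * lam n * (g n * h n)                      ≡⟨ lemma₁ (u n) (lam n) ⟩
      u n * (u n * u n) * (lam n * (lam n * lam n))  ≤⟨ *-monoˡ-≤ _ (≤-trans (*-monoˡ-≤ (g n) (Sizes.square≥ n (Sizes.u>0 n))) (proj₂ u^4≤ n)) ⟩
      c * lam n * (lam n * (lam n * lam n))          ≤⟨ ≤-trans (≤-reflexive (lemma₂ c (lam n))) (*-monoʳ-≤ c (^-monoʳ-≤ (lam n) {4} {5} (n≤1+n 4))) ⟩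
      c * lam n ^ 5                                  ∎
      where
      open ≤-Reasoning
      lemma₁ : ∀ u l → u * l * (u * u * (l * l)) ≡ u * (u * u) * (l * (l * l))
      lemma₁ = solve-∀
      lemma₂ : ∀ c l → c * l * (l * (l * l)) ≡ c * (l * (l * (l * (l * 1))))
      lemma₂ = solve-∀
    lam^5≤T : ∀ n → lam n ^ 5 ≤ T n
    lam^5≤T n = ≤-trans (^-monoˡ-≤ 5 (<⇒≤ (Sizes.lam<2^u n))) (≤-reflexive (trans (^-*-assoc 2 (u n) 5) (cong (2 ^_) (*-comm (u n) 5))))
    bound : ∀ n → 0 < n → u n * lam n * cap1 n ≤ c * (lam n ^ 5 + (n + off n))
    bound n _ = begin
      u n * lam n * (suc X * G n)           ≡⟨ lemma (u n * lam n) (suc X) (G n) ⟩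
      suc X * (u n * lam n * G n)           ≤⟨ *-monoʳ-≤ (suc X) (u*lam*G≤ n) ⟩
      c * lam n ^ 5 + X * (c * lam n ^ 5)   ≤⟨ +-monoʳ-≤ (c * lam n ^ 5) (*-monoʳ-≤ X (*-monoʳ-≤ c (lam^5≤T n))) ⟩
      c * lam n ^ 5 + X * (c * T n)         ≡⟨ cong (c * lam n ^ 5 +_) (swap X c (T n)) ⟩
      c * lam n ^ 5 + c * (X * T n)         ≤⟨ +-monoʳ-≤ (c * lam n ^ 5) (*-monoʳ-≤ c (//*≤ (n + off n) (T n))) ⟩
      c * lam n ^ 5 + c * (n + off n)       ≡⟨ sym (*-distribˡ-+ c (lam n ^ 5) (n + off n)) ⟩
      c * (lam n ^ 5 + (n + off n))         ∎
      where
      open ≤-Reasoning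
      X : ℕ
      X = (n + off n) // T n
      lemma : ∀ a x g → a * (x * g) ≡ x * (a * g)
      lemma = solve-∀
      swap : ∀ x c t → x * (c * t) ≡ c * (x * t)
      swap = solve-∀

  lin-directory : ∀ (d : ℕ → ℕ) → (∀ n → u n * lam n ≤ d n) → Lin (λ n → u n * lam n * (n // d n))
  lin-directory d d≥ = lin-≤ lin-n (λ n _ → ≤-trans (*-monoˡ-≤ (n // d n) (d≥ n)) (≤-trans (≤-reflexive (*-comm (d n) (n // d n))) (//*≤ n (d n))))

  u*lam≤H : ∀ n → u n * lam n ≤ H n
  u*lam≤H n = ≤-trans (Sizes.u*lam≤h n) (m≤m+n (h n) _)

  u*lam≤G : ∀ n → u n * lam n ≤ G n
  u*lam≤G n = *-mono-≤ (Sizes.square≥ n (Sizes.u>0 n)) (Sizes.square≥ n z<s)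

  lin-size : Lin (λ n → u n * lam n * size n)
  lin-size = lin-≤
    (lin-+ (lin-+ (lin-+ (lin-+ (lin-+ (lin-+ (lin-+ (lin-+ (lin-* 18 lin-u*lam) tableB) tableBb)
      (lin-+ (lin-directory H u*lam≤H) lin-u*lam)) (lin-+ blocks lin-u*lam)) (lin-+ (lin-directory G u*lam≤G) lin-u*lam))
      lin-cap1) (lin-+ subgroups lin-u*lam)) (lin-+ subslots lin-u*lam))
    (λ n _ → ≤-reflexive (expand (u n * lam n) (B n) (B n * b n) (n // H n) (nb n // q n) (n // G n) (cap1 n) ((n // g n + 1) // q n) (cap2 n // q n)))
    where
    expand : ∀ a x₁ x₂ x₃ x₄ x₅ x₆ x₇ x₈ → a * (18 + x₁ + x₂ + (x₃ + 1) + (x₄ + 1) + (x₅ + 1) + x₆ + (x₇ + 1) + (x₈ + 1)) ≡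
      18 * a + a * x₁ + a * x₂ + (a * x₃ + a) + (a * x₄ + a) + (a * x₅ + a) + a * x₆ + (a * x₇ + a) + (a * x₈ + a)
    expand = solve-∀
    lam≥1 : ∀ n → 1 ≤ lam n
    lam≥1 n = s≤s z≤n
    u*lam≤ : ∀ n → u n * lam n ≤ lam n * lam n * lam n
    u*lam≤ n = ≤-trans (Sizes.u*lam≤h n) (≤-trans (≤-reflexive (sym (*-identityʳ _))) (*-monoʳ-≤ (lam n * lam n) (lam≥1 n)))
    tableB : Lin (λ n → u n * lam n * B n)
    tableB = lin-≤ lin-tables (λ n _ → ≤-trans (≤-reflexive (*-comm (u n * lam n) (B n))) (*-monoʳ-≤ (B n) (u*lam≤ n)))
    tableBb : Lin (λ n → u n * lam n * (B n * b n))
    tableBb = lin-≤ lin-tables (λ n _ → ≤-trans (≤-reflexive (lemma (u n * lam n) (B n) (b n))) (*-monoʳ-≤ (B n) (*-mono-≤ (Sizes.u*lam≤h n) (Sizes.b≤lam n))))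
      where
      lemma : ∀ a x y → a * (x * y) ≡ x * (a * y)
      lemma = solve-∀
    blocks : Lin (λ n → u n * lam n * (nb n // q n))
    blocks = lin-≤ (lin-* 2 lin-g*nb) (λ n _ → ≤-trans (packed-words n (nb n)) (≤-reflexive (*-assoc 2 (g n) (nb n))))
    subgroups : Lin (λ n → u n * lam n * ((n // g n + 1) // q n))
    subgroups = lin-≤ (lin-* 2 (lin-+ lin-n (lin-* (proj₁ u^4≤) lin-lam))) (λ n _ → ≤-trans (packed-words n (n // g n + 1))
      (≤-trans (≤-reflexive (lemma (g n) (n // g n))) (*-monoʳ-≤ 2 (+-mono-≤ (//*≤ n (g n)) (g≤ n)))))
      where
      lemma : ∀ g x → 2 * g * (x + 1) ≡ 2 * (x * g + g)
      lemma = solve-∀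
    subslots : Lin (λ n → u n * lam n * (cap2 n // q n))
    subslots = lin-≤ (lin-* 2 lin-g²cap2) (λ n _ → ≤-trans (packed-words n (cap2 n)) (≤-reflexive (*-assoc 2 (g n) (cap2 n))))

open Linear using (Lin; lin-≤; lin-+; lin-*; lin-n; lin-const; lin-lam; lin-tables; packed-cost; lin-cap1; lin-cap2; lin-lam*nb; 1≤u*lam; lin-size)

-- Common bounds for the time and the work of a phase

module _ (n w L : ℕ) where
  open Sizes n

  opaque
    -- A phase is an assignment, a sum, a fill or the entire scan loop. The units add up the bounds
    -- of all kinds and thus cover every single phase, so that in the end only phases have to be
    -- counted. `volume` adds up children times iterations over the fills.
    v₀ v₁ v₂ v₃ v₄ v₅ v₆ v₇ v₈ v₉ v₁₀ volume timeUnit workUnit : ℕ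
    v₀ = n
    v₁ = v₀ + suc nb * suc b
    v₂ = v₁ + suc (suc n) * 1
    v₃ = v₂ + suc (n // w + 1) * suc w
    v₄ = v₃ + suc B * suc b
    v₅ = v₄ + suc (B * b) * suc b
    v₆ = v₅ + suc (nb // q + 1) * suc q
    v₇ = v₆ + suc cap1 * 1
    v₈ = v₇ + suc ((n // g + 1) // q + 1) * suc q
    v₉ = v₈ + suc (cap2 // q + 1) * suc q
    v₁₀ = v₉ + suc (18 + 4 * L) * 1
    volume = v₁₀
    timeUnit = allocTime w + (401 + (lam * (allocTime 0 + (401 + 0) + 2) + 1))
    workUnit = 900 * volume + (401 + (lam * (allocWork nb 0 + (401 + 0) + 2) + 1))

    v₁₀≤ : v₁₀ ≤ volume
    v₁₀≤ = ≤-refl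
    v₉≤ : v₉ ≤ volume
    v₉≤ = ≤-trans (m≤m+n v₉ (suc (18 + 4 * L) * 1)) v₁₀≤
    v₈≤ : v₈ ≤ volume
    v₈≤ = ≤-trans (m≤m+n v₈ (suc (cap2 // q + 1) * suc q)) v₉≤
    v₇≤ : v₇ ≤ volume
    v₇≤ = ≤-trans (m≤m+n v₇ (suc ((n // g + 1) // q + 1) * suc q)) v₈≤
    v₆≤ : v₆ ≤ volume
    v₆≤ = ≤-trans (m≤m+n v₆ (suc cap1 * 1)) v₇≤
    v₅≤ : v₅ ≤ volume
    v₅≤ = ≤-trans (m≤m+n v₅ (suc (nb // q + 1) * suc q)) v₆≤
    v₄≤ : v₄ ≤ volume
    v₄≤ = ≤-trans (m≤m+n v₄ (suc (B * b) * suc b)) v₅≤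
    v₃≤ : v₃ ≤ volume
    v₃≤ = ≤-trans (m≤m+n v₃ (suc B * suc b)) v₄≤
    v₂≤ : v₂ ≤ volume
    v₂≤ = ≤-trans (m≤m+n v₂ (suc (n // w + 1) * suc w)) v₃≤
    v₁≤ : v₁ ≤ volume
    v₁≤ = ≤-trans (m≤m+n v₁ (suc (suc n) * 1)) v₂≤
    v-chunk : suc nb * suc b ≤ volume
    v-chunk = ≤-trans (m≤n+m (suc nb * suc b) v₀) v₁≤
    v-map : suc (suc n) * 1 ≤ volume
    v-map = ≤-trans (m≤n+m (suc (suc n) * 1) v₁) v₂≤
    v-bitmap : suc (n // w + 1) * suc w ≤ volume
    v-bitmap = ≤-trans (m≤n+m (suc (n // w + 1) * suc w) v₂) v₃≤
    v-pop : suc B * suc b ≤ volume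
    v-pop = ≤-trans (m≤n+m (suc B * suc b) v₃) v₄≤
    v-sel : suc (B * b) * suc b ≤ volume
    v-sel = ≤-trans (m≤n+m (suc (B * b) * suc b) v₄) v₅≤
    v-rb : suc (nb // q + 1) * suc q ≤ volume
    v-rb = ≤-trans (m≤n+m (suc (nb // q + 1) * suc q) v₅) v₆≤
    v-x1 : suc cap1 * 1 ≤ volume
    v-x1 = ≤-trans (m≤n+m (suc cap1 * 1) v₆) v₇≤
    v-a2 : suc ((n // g + 1) // q + 1) * suc q ≤ volume
    v-a2 = ≤-trans (m≤n+m (suc ((n // g + 1) // q + 1) * suc q) v₇) v₈≤
    v-x2 : suc (cap2 // q + 1) * suc q ≤ volume
    v-x2 = ≤-trans (m≤n+m (suc (cap2 // q + 1) * suc q) v₈) v₉≤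
    v-hdr : suc (18 + 4 * L) * 1 ≤ volume
    v-hdr = ≤-trans (m≤n+m (suc (18 + 4 * L) * 1) v₉) v₁₀≤

    time-alloc : ∀ {ℓ} → ℓ ≤ w → allocTime ℓ ≤ timeUnit
    time-alloc {ℓ} ℓ≤ = ≤-trans (subst₂ _≤_ (sym (allocTime≡ ℓ)) (sym (allocTime≡ w)) (*-monoʳ-≤ 900 (s≤s ℓ≤))) (m≤m+n (allocTime w) _)

    work-alloc : ∀ {N ℓ} → suc N * suc ℓ ≤ volume → allocWork N ℓ ≤ workUnit
    work-alloc {N} {ℓ} h = ≤-trans (≤-trans (≤-reflexive (allocWork≡ N ℓ)) (*-monoʳ-≤ 900 h)) (m≤m+n (900 * volume) _)

    401≤time : 401 ≤ timeUnit
    401≤time = ≤-trans (m≤m+n 401 _) (m≤n+m (401 + (lam * (allocTime 0 + (401 + 0) + 2) + 1)) (allocTime w))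
    401≤work : 401 ≤ workUnit
    401≤work = ≤-trans (m≤m+n 401 _) (m≤n+m (401 + (lam * (allocWork nb 0 + (401 + 0) + 2) + 1)) (900 * volume))
    scan-time : lam * (allocTime 0 + (401 + 0) + 2) + 1 ≤ timeUnit
    scan-time = ≤-trans (m≤n+m (lam * (allocTime 0 + (401 + 0) + 2) + 1) 401) (m≤n+m (401 + (lam * (allocTime 0 + (401 + 0) + 2) + 1)) (allocTime w))
    scan-work : lam * (allocWork nb 0 + (401 + 0) + 2) + 1 ≤ workUnit
    scan-work = ≤-trans (m≤n+m (lam * (allocWork nb 0 + (401 + 0) + 2) + 1) 401) (m≤n+m (401 + (lam * (allocWork nb 0 + (401 + 0) + 2) + 1)) (900 * volume))

opaque
  unfolding timeUnit

  -- A child that packs a bitmap word performs `w` iterations one after the other, and there are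
  -- `lam` scan rounds of constant time. So the depth is logarithmic because words have O(log n)
  -- bits.
  timeUnit≤ : ∀ K → ∃[ c ] (∀ n w L → w ≤ K * Sizes.lam n → timeUnit n w L ≤ c * Sizes.lam n)
  timeUnit≤ K = 900 * K + (900 * 1 + 401 + (900 * 1 + (401 + 0) + 2) + 1) , bound
    where
    bound : ∀ n w L → w ≤ K * Sizes.lam n → timeUnit n w L ≤ (900 * K + (900 * 1 + 401 + (900 * 1 + (401 + 0) + 2) + 1)) * Sizes.lam n
    bound n w L w≤ = begin
      allocTime w + (401 + (l * (allocTime 0 + (401 + 0) + 2) + 1))
        ≡⟨ cong₂ (λ x y → x + (401 + (l * (y + (401 + 0) + 2) + 1))) {allocTime w} {900 * suc w} {allocTime 0} {900 * 1} (allocTime≡ w) (allocTime≡ 0) ⟩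
      900 * suc w + (401 + (l * (900 * 1 + (401 + 0) + 2) + 1))
        ≤⟨ +-mono-≤ (*-monoʳ-≤ 900 (+-mono-≤ {1} {l} (s≤s z≤n) w≤)) (+-mono-≤ (one 401) (+-monoʳ-≤ (l * (900 * 1 + (401 + 0) + 2)) (one 1))) ⟩
      900 * (l + K * l) + (401 * l + (l * (900 * 1 + (401 + 0) + 2) + 1 * l))
        ≡⟨ lemma 900 K l 401 (900 * 1 + (401 + 0) + 2) ⟩
      (900 * K + (900 * 1 + 401 + (900 * 1 + (401 + 0) + 2) + 1)) * l ∎
      where
      open ≤-Reasoning
      l : ℕ
      l = Sizes.lam n
      one : ∀ k → k ≤ k * l
      one k = ≤-trans (≤-reflexive (sym (*-identityʳ k))) (*-monoʳ-≤ k (s≤s z≤n))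
      lemma : ∀ a k l d z → a * (l + k * l) + (d * l + (l * z + 1 * l)) ≡ (a * k + (a * 1 + d + z + 1)) * l
      lemma = solve-∀

  -- A fill with about x / d children of d iterations costs O(x + d), so packing is linear whatever
  -- the number of fields per word. The scan costs lam times `nb`, which is linear because a chunk
  -- has at least lam / 4 symbols.
  workUnit≤ : ∀ K → ∃[ c ] (∀ n w L → 0 < n → w ≤ K * Sizes.lam n → L ≤ Sizes.lam n → workUnit n w L ≤ c * n)
  workUnit≤ K = proj₁ total , λ n w L n> w≤ L≤ → ≤-trans (bound n w L w≤ L≤) (proj₂ total n n>)
    where
    lam : ℕ → ℕ
    lam n = Sizes.lam n
    pc : (ℕ → ℕ) → ℕ → ℕ
    pc x n = 2 + 2 * lam n + 2 * x n
    lin-pc : ∀ {x} → Lin x → Lin (pc x)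
    lin-pc lx = lin-+ (lin-+ (lin-const 2) (lin-* 2 lin-lam)) (lin-* 2 lx)
    tables : ℕ → ℕ
    tables n = Sizes.B n * (lam n * lam n * lam n)
    volumeBound : ℕ → ℕ
    volumeBound n = n + pc (λ n → n) n + (2 + n) + (2 + 2 * (K * lam n) + 2 * n) + 4 * tables n + 4 * tables n
      + pc Sizes.nb n + (1 + Sizes.cap1 n) + pc (λ n → n + 1) n + pc Sizes.cap2 n + (19 + 4 * lam n)
    lin-nb : Lin Sizes.nb
    lin-nb = lin-≤ lin-lam*nb (λ n _ → m≤m+n (Sizes.nb n) _)
    lin-c1 : Lin Sizes.cap1
    lin-c1 = lin-≤ lin-cap1 (λ n _ → ≤-trans (≤-reflexive (sym (*-identityˡ (Sizes.cap1 n)))) (*-monoˡ-≤ (Sizes.cap1 n) (1≤u*lam n)))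
    lin-volume : Lin volumeBound
    lin-volume = lin-+ (lin-+ (lin-+ (lin-+ (lin-+ (lin-+ (lin-+ (lin-+ (lin-+ (lin-+ lin-n (lin-pc lin-n)) (lin-+ (lin-const 2) lin-n))
      (lin-+ (lin-+ (lin-const 2) (lin-* 2 (lin-* K lin-lam))) (lin-* 2 lin-n))) (lin-* 4 lin-tables)) (lin-* 4 lin-tables))
      (lin-pc lin-nb)) (lin-+ (lin-const 1) lin-c1)) (lin-pc (lin-+ lin-n (lin-const 1)))) (lin-pc lin-cap2)) (lin-+ (lin-const 19) (lin-* 4 lin-lam))
    scanBound : ℕ → ℕ
    scanBound n = 900 * (lam n + lam n * Sizes.nb n) + 403 * lam n + 1
    total : Lin (λ n → 900 * volumeBound n + (401 + scanBound n))
    total = lin-+ (lin-* 900 lin-volume) (lin-+ (lin-const 401) (lin-+ (lin-+ (lin-* 900 (lin-+ lin-lam lin-lam*nb)) (lin-* 403 lin-lam)) (lin-const 1)))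
    bound : ∀ n w L → w ≤ K * lam n → L ≤ lam n → workUnit n w L ≤ 900 * volumeBound n + (401 + scanBound n)
    bound n w L w≤ L≤ = +-mono-≤ (*-monoʳ-≤ 900 vol) (+-monoʳ-≤ 401 scan≤)
      where
      open Sizes n using (b; B; q; nb; cap1; cap2; g; b≤lam)
      l : ℕ
      l = lam n
      q≤l : q ≤ l
      q≤l = //-≤ l (Sizes.u n)
      pack : ∀ x d → d ≤ l → suc (x // d + 1) * suc d ≤ 2 + 2 * l + 2 * x
      pack x d d≤ = ≤-trans (packed-cost x d) (+-monoˡ-≤ (2 * x) (+-monoʳ-≤ 2 (*-monoʳ-≤ 2 d≤)))
      twice : ∀ x → 0 < x → suc x ≤ 2 * x
      twice x x> = ≤-trans (+-monoˡ-≤ x x>) (≤-reflexive (cong (x +_) (sym (+-identityʳ x))))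
      B>0 : 0 < B
      B>0 = 2^>0 b
      table : ∀ y → 0 < y → y ≤ B * l → suc y * suc b ≤ 4 * tables n
      table y y> y≤ = begin
        suc y * suc b                 ≤⟨ *-mono-≤ (twice y y>) (twice b z<s) ⟩
        2 * y * (2 * b)               ≡⟨ lemma y b ⟩
        4 * (y * b)                   ≤⟨ *-monoʳ-≤ 4 (*-mono-≤ y≤ b≤lam) ⟩
        4 * (B * l * l)               ≤⟨ *-monoʳ-≤ 4 (≤-trans (≤-reflexive (*-assoc B l l)) (*-monoʳ-≤ B (≤-trans (≤-reflexive (sym (*-identityʳ (l * l)))) (*-monoʳ-≤ (l * l) (s≤s z≤n))))) ⟩
        4 * (B * (l * l * l))         ∎
        where
        open ≤-Reasoning
        lemma : ∀ y b → 2 * y * (2 * b) ≡ 4 * (y * b)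
        lemma = solve-∀
      vol : volume n w L ≤ volumeBound n
      vol = +-mono-≤ (+-mono-≤ (+-mono-≤ (+-mono-≤ (+-mono-≤ (+-mono-≤ (+-mono-≤ (+-mono-≤ (+-mono-≤ (+-monoʳ-≤ n
        (≤-trans (≤-reflexive (cong (λ z → suc z * suc b) (+-comm 1 (n // b)))) (pack n b b≤lam)))
        (≤-reflexive (*-identityʳ (suc (suc n)))))
        (≤-trans (packed-cost n w) (+-monoˡ-≤ (2 * n) (+-monoʳ-≤ 2 (*-monoʳ-≤ 2 w≤)))))
        (table B B>0 (≤-trans (≤-reflexive (sym (*-identityʳ B))) (*-monoʳ-≤ B (s≤s z≤n)))))
        (table (B * b) (*-mono-≤ B>0 (s≤s z≤n)) (*-monoʳ-≤ B b≤lam)))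
        (pack nb q q≤l))
        (≤-reflexive (*-identityʳ (suc cap1))))
        (≤-trans (pack (n // g + 1) q q≤l) (+-monoʳ-≤ (2 + 2 * l) (*-monoʳ-≤ 2 (+-monoˡ-≤ 1 (//-≤ n g))))))
        (pack cap2 q q≤l))
        (≤-trans (≤-reflexive (*-identityʳ (19 + 4 * L))) (+-monoʳ-≤ 19 (*-monoʳ-≤ 4 L≤)))
      scan≤ : l * (allocWork nb 0 + (401 + 0) + 2) + 1 ≤ scanBound n
      scan≤ = ≤-reflexive (cong (_+ 1) (trans (cong (λ z → l * (z + (401 + 0) + 2)) {allocWork nb 0} {900 * (suc nb * 1)} (allocWork≡ nb 0)) (lemma 900 l nb 401)))
        where
        lemma : ∀ a l x d → l * (a * (suc x * 1) + (d + 0) + 2) ≡ a * (l + l * x) + (d + 2) * l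
        lemma = solve-∀

-- Instantiation of the parameters, and the final estimates

module Instance (n w L : ℕ) (n> : 0 < n) (wide : 40 * Sizes.lam n ≤ w // 8) (L≤ : L ≤ Sizes.lam n) where
  open Sizes n

  z Bd : ℕ
  z  = w // 8
  Bd = 2 ^ z

  z≥40 : 40 ≤ z
  z≥40 = ≤-trans (*-monoʳ-≤ 40 {1} {lam} (s≤s z≤n)) wide

  w≥ : 40 * lam ≤ w
  w≥ = ≤-trans wide (//-≤ w 8)

  -- `w` is below 8 (z + 1). With z = 7 + y this is 64 + 8 y, at most 128 times 2^y, which is 2^z.
  w<Bd : w < Bd
  w<Bd = go (z ∸ 7) (m+[n∸m]≡n (≤-trans (≤ᵇ⇒≤ 7 40 tt) z≥40))
    where
    go : ∀ y → 7 + y ≡ z → w < Bd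
    go y e≡ = begin-strict
      w                           <⟨ suc//-≤ w {8} z<s ⟩
      suc z * 8                   ≡⟨ cong (λ x → suc x * 8) (sym e≡) ⟩
      suc (7 + y) * 8             ≡⟨ lemma₁ y ⟩
      64 + 8 * y                  ≤⟨ +-mono-≤ (≤-trans (≤-reflexive (sym (*-identityʳ 64))) (*-monoʳ-≤ 64 (m^n>0 2 y))) (*-mono-≤ {8} {64} (≤ᵇ⇒≤ 8 64 tt) (<⇒≤ (m<2^m y))) ⟩
      64 * 2 ^ y + 64 * 2 ^ y     ≡⟨ lemma₂ (2 ^ y) ⟩
      128 * 2 ^ y                 ≡⟨ sym (^-distribˡ-+-* 2 7 y) ⟩
      2 ^ (7 + y)                 ≡⟨ cong (2 ^_) e≡ ⟩
      2 ^ z                       ∎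
      where
      open ≤-Reasoning
      lemma₁ : ∀ y → suc (7 + y) * 8 ≡ 64 + 8 * y
      lemma₁ = solve-∀
      lemma₂ : ∀ p → 64 * p + 64 * p ≡ 128 * p
      lemma₂ = solve-∀

  -- `wide` provides 40 lam bits below `Bd`, so an exponent of at most 39 leaves one factor Λ for
  -- the strict inequality. The exponents are computed from the `Pow` witnesses and compared with 39
  -- by evaluation.
  small : ∀ {k x} → Pow k x → k ≤ 39 → x < Bd
  small {k} {x} p k≤ = Pow-< p (≤-trans (*-monoˡ-≤ lam {suc k} {40} (s≤s k≤)) wide)

  ≤39 : ∀ k → {Bool.T (k ≤ᵇ 39)} → k ≤ 39
  ≤39 k {h} = ≤ᵇ⇒≤ k 39 h

  P : Params
  P = record
    { w = w ; Bd = Bd ; n = n ; b = b ; B = B ; q = q ; e = e ; E = E ; H = H ; G = G ; g = g ; T = T ; off = off ; h = h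
    ; nb = nb ; cap1 = cap1 ; cap2 = cap2
    ; Bd^8≤ = ≤-trans (≤-reflexive (^-*-assoc 2 z 8)) (^-monoʳ-≤ 2 (//*≤ w 8))
    ; Bd> = ≤-trans (≤ᵇ⇒≤ 1000 (2 ^ 40) tt) (^-monoʳ-≤ 2 z≥40)
    ; w<Bd = w<Bd ; n> = n> ; b> = z<s ; q> = q>0 ; g> = *-mono-≤ u>0 u>0 ; h> = z<s ; T> = 2^>0 (5 * u)
    ; b≤w = ≤-trans b≤lam (≤-trans (m≤m+n lam _) w≥)
    ; eq≤w = ≤-trans (≤-trans (≤-reflexive (trans (*-assoc 6 u q) (cong (6 *_) (*-comm u q)))) (*-monoʳ-≤ 6 (//*≤ lam u)))
        (≤-trans (*-monoˡ-≤ lam {6} {40} (≤ᵇ⇒≤ 6 40 tt)) w≥)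
    ; B≡ = refl ; E≡ = refl ; H≡ = refl ; G≡ = refl
    ; H≤E = H≤E
    ; 2T≤E = ≤-trans (≤-reflexive (cong (T +_) (sym (+-identityʳ T)))) (^-monoʳ-≤ 2 {suc (5 * u)} {6 * u} (+-monoˡ-≤ (5 * u) u>0))
    ; off≡ = refl ; nb≡ = refl ; cap1≡ = refl ; cap2≡ = refl
    ; positions< = small ([n] ⊞ [off] ⊞ [E] ⊞ [E]) (≤39 _)
    ; twice< = small (([n] ⊞ [off]) ⊞ ([n] ⊞ [off])) (≤39 _)
    ; B<Bd = small [B] (≤39 _) ; b<Bd = small [b] (≤39 _) ; q<Bd = small [q] (≤39 _) ; H<Bd = small [H] (≤39 _)
    ; G<Bd = small [G] (≤39 _) ; g<Bd = small [g] (≤39 _) ; T<Bd = small [T] (≤39 _) }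
    where
    H≤E : H ≤ E
    H≤E = begin
      b * (lam * lam)                  ≤⟨ *-mono-≤ (≤-trans b≤lam l≤) (*-mono-≤ l≤ l≤) ⟩
      2 ^ u * (2 ^ u * 2 ^ u)          ≡⟨ cong (λ x → 2 ^ u * (2 ^ u * x)) (sym (*-identityʳ (2 ^ u))) ⟩
      (2 ^ u) ^ 3                      ≡⟨ trans (^-*-assoc 2 u 3) (cong (2 ^_) (*-comm u 3)) ⟩
      2 ^ (3 * u)                      ≤⟨ ^-monoʳ-≤ 2 (*-monoˡ-≤ u {3} {6} (≤ᵇ⇒≤ 3 6 tt)) ⟩
      E                                ∎
      where
      open ≤-Reasoning
      l≤ : lam ≤ 2 ^ u
      l≤ = <⇒≤ lam<2^u

  base : ℕ
  base = n + B

  D : Build P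
  D = record
    { lam = lam ; L = L ; top = base + L * level w L ; τ = timeUnit n w L ; Y = workUnit n w L ; V = volume n w L
    ; nb≤2^lam = ≤-trans (s≤s (//-≤ n b)) n<2^lam
    ; 2^lam<Bd = small {1} (pow ≤-refl) (≤39 1)
    ; top<Bd = small ([n] ⊞ [B] ⊞ Pow-≤ L≤ [lam] ⊠ [level] {w} {L} L≤) (≤39 _)
    ; lam<Bd = small [lam] (≤39 _)
    ; q≤w = ≤-trans (//-≤ lam u) (≤-trans (m≤m+n lam _) w≥)
    ; time-ok = time-alloc n w L ; work-ok = λ {N} {ℓ} → work-alloc n w L {N} {ℓ} ; 401≤τ = 401≤time n w L ; 401≤Y = 401≤work n w L
    ; scan-τ = scan-time n w L ; scan-Y = scan-work n w L
    ; V-chunk = v-chunk n w L ; V-map = v-map n w L ; V-bitmap = v-bitmap n w L ; V-pop = v-pop n w L ; V-sel = v-sel n w L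
    ; V-rb = v-rb n w L ; V-x1 = v-x1 n w L ; V-a2 = v-a2 n w L ; V-x2 = v-x2 n w L ; V-hdr = v-hdr n w L }

  sized : ∀ {σ} → σ ≤ n → ⌈log₂ σ ⌉ ≡ L → ComputedSizes P D σ
  sized σ≤n L≡ = record
    { c = clog n ; u = u ; σ≤n = σ≤n ; L≡ = L≡ ; c≡ = sym (clog≡ n) ; lam≡ = refl ; u≡ = sym (clog≡ (suc lam))
    ; b≡ = refl ; q≡ = refl ; e≡ = refl ; T≡ = refl ; g≡ = refl ; h≡ = refl
    ; L<Bd = small (Pow-≤ L≤ [lam]) (≤39 _) ; u<Bd = small [u] (≤39 _) ; cap1< = small [cap1] (≤39 _) ; cap2< = small [cap2] (≤39 _) }

lg≤lam : ∀ n → lg n ≤ Sizes.lam n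
lg≤lam n = ⊔-lub (s≤s z≤n) (≤-trans (≤-reflexive (sym (clog≡ n))) (n≤1+n (clog n)))

lam≤2lg : ∀ n → Sizes.lam n ≤ 2 * lg n
lam≤2lg n = ≤-trans (+-mono-≤ (m≤m⊔n 1 ⌈log₂ n ⌉) (≤-trans (≤-reflexive (clog≡ n)) (m≤n⊔m 1 ⌈log₂ n ⌉)))
  (≤-reflexive (cong (lg n +_) (sym (+-identityʳ (lg n)))))

structureBits : ℕ → ℕ → ℕ
structureBits K n = K * lg n * Sizes.size n

u-unbounded : ∀ X n → 2 ^ (2 ^ X) ≤ n → X ≤ Sizes.u n
u-unbounded X n h = ≮⇒≥ (λ u<X → <-irrefl refl (begin-strict
  n                           <⟨ Sizes.n<2^lam n ⟩
  2 ^ Sizes.lam n             ≤⟨ ^-monoʳ-≤ 2 (<⇒≤ (<-≤-trans (Sizes.lam<2^u n) (^-monoʳ-≤ 2 (<⇒≤ u<X)))) ⟩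
  2 ^ (2 ^ X)                 ≤⟨ h ⟩
  n                           ∎))
  where open ≤-Reasoning

sublinear : ∀ K → Sublinear (structureBits K)
-- From this double exponential on, `u` is at least k K (c + 1), with c the constant of `lin-size`.
-- So the factor u in the weight pays for the demanded ratio k, the word length constant K and c.
sublinear K k = 2 ^ (2 ^ (k * K * suc c)) , λ n N≤n →
  let n> = <-≤-trans (m^n>0 2 (2 ^ (k * K * suc c))) N≤n
      open Sizes n using (lam; u; size)
  in *-cancelʳ-≤ (k * (K * lg n * size)) n (suc c) (begin
    k * (K * lg n * size) * suc c        ≡⟨ lemma k K (lg n) size (suc c) ⟩
    k * K * suc c * lg n * size          ≤⟨ *-monoˡ-≤ size (*-mono-≤ (u-unbounded (k * K * suc c) n N≤n) (lg≤lam n)) ⟩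
    u * lam * size                       ≤⟨ proj₂ lin-size n n> ⟩
    c * n                                ≤⟨ *-monoˡ-≤ n (n≤1+n c) ⟩
    suc c * n                            ≡⟨ *-comm (suc c) n ⟩
    n * suc c                            ∎)
  where
  open ≤-Reasoning
  c : ℕ
  c = proj₁ lin-size
  lemma : ∀ k K l s c → k * (K * l * s) * c ≡ k * K * c * l * s
  lemma = solve-∀

-- 20 phases, then 49 units for each of the L levels.
total≤ : ∀ t L ℓ → 401 ≤ t → L ≤ ℓ → 1 ≤ ℓ → 20 * t + (L * (47 * t + 2) + 1 + (401 + 0)) ≤ 71 * (ℓ * t)
total≤ t L ℓ t≥ L≤ ℓ≥ = begin
  20 * t + (L * (47 * t + 2) + 1 + 401)        ≤⟨ +-monoʳ-≤ (20 * t) (+-mono-≤ (+-mono-≤ (*-monoʳ-≤ L (+-monoʳ-≤ (47 * t) (*-monoʳ-≤ 2 t≥1))) t≥1) t≥) ⟩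
  20 * t + (L * (47 * t + 2 * t) + t + t)      ≡⟨ lemma₁ t L ⟩
  1 * (22 * t) + L * (49 * t)                  ≤⟨ +-mono-≤ (*-monoˡ-≤ (22 * t) ℓ≥) (*-monoˡ-≤ (49 * t) L≤) ⟩
  ℓ * (22 * t) + ℓ * (49 * t)                  ≡⟨ lemma₂ t ℓ ⟩
  71 * (ℓ * t)                                 ∎
  where
  open ≤-Reasoning
  t≥1 : 1 ≤ t
  t≥1 = ≤-trans (s≤s z≤n) t≥
  lemma₁ : ∀ t L → 20 * t + (L * (47 * t + 2 * t) + t + t) ≡ 1 * (22 * t) + L * (49 * t)
  lemma₁ = solve-∀
  lemma₂ : ∀ t ℓ → ℓ * (22 * t) + ℓ * (49 * t) ≡ 71 * (ℓ * t)
  lemma₂ = solve-∀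

-- The origin of 640 = 8 · 40 · 2: `Bd` takes an eighth of a word, has room for the 40th power of
-- 2^lam, and lam is at most twice `lg n`.
wide-words : ∀ l x w → l ≤ 2 * x → 640 * x ≤ w → 40 * l ≤ w // 8
wide-words l x w l≤ w≥ = subst (_≤ w // 8) (//-unique (40 * l) {0} {8} z<s) (//-monoˡ 8 (begin
  40 * l * 8            ≤⟨ *-monoˡ-≤ 8 (*-monoʳ-≤ 40 l≤) ⟩
  40 * (2 * x) * 8      ≡⟨ lemma x ⟩
  640 * x               ≤⟨ w≥ ⟩
  w                     ∎))
  where
  open ≤-Reasoning
  lemma : ∀ x → 40 * (2 * x) * 8 ≡ 640 * x
  lemma = solve-∀

scale : ∀ k {t a m ℓ c C} → t ≤ k * (ℓ * a) → a ≤ c * m → k * c ≤ C → t ≤ C * (m * ℓ)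
scale k {t} {a} {m} {ℓ} {c} {C} t≤ a≤ c≤ = begin
  t                   ≤⟨ t≤ ⟩
  k * (ℓ * a)         ≤⟨ *-monoʳ-≤ k (*-monoʳ-≤ ℓ a≤) ⟩
  k * (ℓ * (c * m))   ≡⟨ lemma k ℓ c m ⟩
  k * c * (m * ℓ)     ≤⟨ *-monoˡ-≤ (m * ℓ) c≤ ⟩
  C * (m * ℓ)         ∎
  where
  open ≤-Reasoning
  lemma : ∀ k ℓ c m → k * (ℓ * (c * m)) ≡ k * c * (m * ℓ)
  lemma = solve-∀

constructs-within : ∀ K C cτ cY → 28 * 401 ≤ C → 71 * (cτ * 2) ≤ C → 71 * cY ≤ C →
  (∀ n w L → w ≤ K * Sizes.lam n → timeUnit n w L ≤ cτ * Sizes.lam n) →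
  (∀ n w L → 0 < n → w ≤ K * Sizes.lam n → L ≤ Sizes.lam n → workUnit n w L ≤ cY * n) →
  ∀ (n σ w : ℕ) .{{_ : NonZero n}} .{{_ : NonZero w}} → σ ≤ n → 640 * lg n ≤ w → w ≤ K * lg n → ∀ (S : Vec (Fin σ) n) →
  Layout.Constructs w constructProg queries C (structureBits K n) (C * (n * lg σ)) (C * (lg n * lg σ)) S
constructs-within K C cτ cY C≥ τ≤C Y≤C τ≤ Y≤ n σ w σ≤n w≥ w≤ S =
  Construction.Main.constructs P D S (structureBits K n) (sized σ≤n (sym (clog≡ σ))) ≤-refl short C≥
    (scale 71 {a = timeUnit n w L} {lg n} {lg σ} {cτ * 2} {C} (total≤ (timeUnit n w L) L (lg σ) (401≤time n w L) L≤lg (m≤m⊔n 1 ⌈log₂ σ ⌉))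
      (≤-trans (τ≤ n w L w≤lam) (≤-trans (*-monoʳ-≤ cτ (lam≤2lg n)) (≤-reflexive (sym (*-assoc cτ 2 (lg n)))))) τ≤C)
    (scale 71 {a = workUnit n w L} {n} {lg σ} {cY} {C} (total≤ (workUnit n w L) L (lg σ) (401≤work n w L) L≤lg (m≤m⊔n 1 ⌈log₂ σ ⌉))
      (Y≤ n w L n> w≤lam L≤lam) Y≤C)
  where
  L : ℕ
  L = clog σ
  L≤lg : L ≤ lg σ
  L≤lg = ≤-trans (≤-reflexive (clog≡ σ)) (m≤n⊔m 1 ⌈log₂ σ ⌉)
  L≤lam : L ≤ Sizes.lam n
  L≤lam = clog-≤ (≤-trans σ≤n (<⇒≤ (Sizes.n<2^lam n)))
  n> : 0 < n
  n> = >-nonZero⁻¹ n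
  w≤lam : w ≤ K * Sizes.lam n
  w≤lam = ≤-trans w≤ (*-monoʳ-≤ K (lg≤lam n))
  short : Sizes.size n * w ≤ structureBits K n
  short = ≤-trans (*-monoʳ-≤ (Sizes.size n) w≤) (≤-reflexive (*-comm (Sizes.size n) (K * lg n)))
  open Instance n w L n> (wide-words (Sizes.lam n) (lg n) w (lam≤2lg n) w≥) L≤lam

≤-sum₁ : ∀ a b c → a ≤ a + b + c
≤-sum₁ a b c = ≤-trans (m≤m+n a b) (m≤m+n (a + b) c)

≤-sum₂ : ∀ a b c → b ≤ a + b + c
≤-sum₂ a b c = ≤-trans (m≤n+m b a) (m≤m+n (a + b) c)

≤-sum₃ : ∀ a b c → c ≤ a + b + c
≤-sum₃ a b c = m≤n+m c (a + b)

mainTheorem8 : ∃[ κ ] ∃[ P ] ∃[ Q ] ∀ (K : ℕ) → ∃[ C ] ∃[ s ]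
    ( Sublinear s
    × ( ∀ (n σ w : ℕ) .{{_ : NonZero n}} .{{_ : NonZero w}} →
    σ ≤ n → κ * lg n ≤ w → w ≤ K * lg n →
    ∀ (S : Vec (Fin σ) n) →
    Layout.Constructs w P Q C (s n) (C * (n * lg σ)) (C * (lg n * lg σ)) S ) )
mainTheorem8 = 640 , constructProg , queries , λ K →
  let (cτ , τ≤) = timeUnit≤ K
      (cY , Y≤) = workUnit≤ K
  in 28 * 401 + 71 * (cτ * 2) + 71 * cY , structureBits K , sublinear K ,
     constructs-within K (28 * 401 + 71 * (cτ * 2) + 71 * cY) cτ cY
       (≤-sum₁ (28 * 401) (71 * (cτ * 2)) (71 * cY)) (≤-sum₂ (28 * 401) (71 * (cτ * 2)) (71 * cY)) (≤-sum₃ (28 * 401) (71 * (cτ * 2)) (71 * cY)) τ≤ Y≤
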